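{- Let $p>3$ be a prime. If $p\equiv1\pmod4$, write $p=x^2+y^2$ with integers $x,y$ and $4\mid x-1$; then $$\sum_{k=0}^{p-1}(8k+1)\binom{ -1/4}k^4\equiv(-1)^{\frac{p-1}4}\Big(2xp-\frac{p^2}{2x}-\frac{p^3}{8x^3}\Big)\pmod{p^4}.$$ If $p\equiv3\pmod4$, then $$\sum_{k=0}^{p-1}(8k+1)\binom{ -1/4}k^4\equiv3(-1)^{\frac{p+1}4}\frac{(2p-1-2^{p-1})p^2}{\binom{(p-1)/2}{(p-3)/4}}\pmod{p^4}.$$
   Context: The general binomial coefficient is $\binom a0=1$, $\binom ak=a(a-1)\cdots(a-k+1)/k!$ for $k\ge1$. Congruences are taken in the ring of rational numbers whose denominators are not divisible by $p$. -}

module Defs where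

open import Data.Nat as ℕ using (ℕ; zero; suc; _!)
open import Data.Nat.Properties using (_!≢0)
open import Data.Nat.Divisibility as ℕD using ()
open import Data.Nat.Primality using (Prime)
open import Data.Integer as ℤ using (ℤ; +_)
open import Data.Rational as ℚ using (ℚ; 0ℚ; 1ℚ; _+_; _*_; _-_; -_; ↧ₙ_)
open import Data.Rational.Properties using (_≟_)
open import Data.Product using (∃; _×_)
open import Relation.Nullary using (¬_; yes; no)

ℕ→ℚ : ℕ → ℚ
ℕ→ℚ n = (+ n) ℚ./ 1

ℤ→ℚ : ℤ → ℚ
ℤ→ℚ z = z ℚ./ 1

_^ℚ_ : ℚ → ℕ → ℚ
q ^ℚ zero = 1ℚ
q ^ℚ suc n = q * (q ^ℚ n)

-- total inverse (inv 0 = 0); only applied to provably nonzero values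
inv : ℚ → ℚ
inv q with q ≟ 0ℚ
... | yes _ = 0ℚ
... | no q≢0 = ℚ.1/_ q {{ℚ.≢-nonZero q≢0}}

falling : ℚ → ℕ → ℚ
falling a zero = 1ℚ
falling a (suc k) = falling a k * (a - ℕ→ℚ k)

binomℚ : ℚ → ℕ → ℚ
binomℚ a k = falling a k * ((+ 1) ℚ./ (k !)) {{k !≢0}}

PIntegral : ℕ → ℚ → Set
PIntegral p q = ¬ (p ℕD.∣ ↧ₙ q)

Congr : (p : ℕ) → ℚ → ℚ → ℚ → Set
Congr p a b m = ∃ λ t → PIntegral p t × (a - b ≡ m * t)
  where open import Relation.Binary.PropositionalEquality using (_≡_)

Σ< : ℕ → (ℕ → ℚ) → ℚ
Σ< zero f = 0ℚ
Σ< (suc n) f = Σ< n f + f n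

S : ℕ → ℚ
S p = Σ< p (λ k → ℕ→ℚ (8 ℕ.* k ℕ.+ 1) * (binomℚ (- ((+ 1) ℚ./ 4)) k ^ℚ 4))

{-# OPTIONS --safe #-}
module Submission where

-- Clearing denominators turns the sum into an integer one. If Q is the cube of 4n + 1, where n < p and
-- p ∣ 4n + 1, the terms for k ≤ n deform to those of a terminating very well poised ₅F₄, which Dougall's
-- formula sums in closed form; the deformation does not change the sum modulo p⁴, because its
-- first-order effect agrees modulo p with that on a sum that is antisymmetric under k ↦ n − k. What
-- remains is to evaluate that closed form.
--
-- If p ≡ 3 (mod 4) the closed form carries the factor p², and the half-factorials modulo p² are
-- determined by 2^((p−1)/2) alone.
--
-- If p ≡ 1 (mod 4), n = (p − 1)/4, the value C(2n, n) is needed modulo p³. With the Teichmüller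
-- character ζ, the Jacobi sum J of a quartic and the quadratic character φ is expanded modulo p³ after
-- replacing φ(a) by (15c − 10c³ + 3c⁵)/8 with c = a^(2n), an expression in which only four binomial
-- coefficients survive; these are multiples of C(2n, n) by units written in terms of harmonic sums. On the
-- other hand 2J = X + ιY, where X and Y are Jacobsthal sums with X² + Y² = 4p, and X modulo 8 identifies
-- X with ±2x; so J is up to sign the unit root of W (2x − W) = p.

open import Defs
open import Data.Empty using (⊥; ⊥-elim)
open import Data.Integer as ℤ using (ℤ; +_; -[1+_]; ∣_∣)
open import Data.Integer.Divisibility as ℤD using ()
import Data.Integer.Divisibility.Signed as ℤDˢ
import Data.Integer.DivMod as ℤDM
import Data.Integer.Properties as ℤₚ
open import Data.Integer.Tactic.RingSolver using (solve; solve-∀)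
open import Data.List.Base using (_∷_; [])
open import Data.Maybe.Base using (nothing)
open import Data.Nat as ℕ using (ℕ; zero; suc; s≤s; z≤n; _!; _>_; _%_; _∸_; _/_)
open import Data.Nat.Combinatorics
  using (_C_; nCn≡1; nC1≡n; nCk≡nC[n∸k]; nCk+nC[k+1]≡[n+1]C[k+1]; nCk≡n!/k![n-k]!; k![n∸k]!∣n!; k>n⇒nCk≡0)
import Data.Nat.Coprimality as Coprimality
import Data.Nat.Divisibility as ℕD
import Data.Nat.DivMod as ℕDM
open import Data.Nat.Primality using (Prime; euclidsLemma; prime⇒nonTrivial; prime⇒nonZero)
import Data.Nat.Properties as ℕₚ
open import Data.Product using (∃; _×_; _,_; proj₁; proj₂)
open import Data.Rational as ℚ using (ℚ; mkℚ; 0ℚ; 1ℚ; toℚᵘ)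
import Data.Rational.Properties as ℚₚ
open import Data.Rational.Unnormalised as ℚᵘ using (mkℚᵘ; *≡*)
import Data.Rational.Unnormalised.Properties as ℚᵘₚ
open import Data.Sum using (_⊎_; inj₁; inj₂)
open import Function using (_∘_)
open import Level using (0ℓ)
open import Relation.Binary.Bundles using (Setoid)
open import Relation.Binary.Definitions using (tri<; tri≈; tri>)
open import Relation.Binary.PropositionalEquality
import Relation.Binary.Reasoning.Setoid as SetoidReasoning
open import Relation.Nullary using (¬_; Dec; yes; no; contradiction)
import Tactic.RingSolver as RingSolver
import Tactic.RingSolver.Core.AlmostCommutativeRing as ACR

-- The exponent 3 in the deformation is dictated by the target p⁴. With R = 4n + 1, the factors z³ -
-- R³ and y³ + R³ are products over the cube roots of unity, so the perturbation has no part of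
-- degree 1 or 2 in R and costs only p³; its coefficient then matters modulo p alone, where z_j ≡
-- -y_(n-1-j). The factor z - R, zero at j = n, makes the sum terminate; the other two stay together
-- as an integer quadratic, so no roots of unity are adjoined.
--
-- If p ≡ 1 (mod 4), the closed form carries a single p and its cofactor is needed modulo p³.
-- Reflection of factorials leaves two unknowns: a harmonic sum `λ′` over half the range and a sum
-- of inverse squares `ω` over a quarter of it. Neither is ever evaluated: `λ′` cancels, and the
-- unit 1 + p²ω that accompanies C(2n, n) in the closed form is the very one that the Jacobi sum
-- produces.
--
-- The power c alone gives φ only modulo p. The quintic touches the signs ±1 to third order, hence
-- precision p³, and it is still a polynomial, so the binomial theorem expands it into finitely many
-- power sums of ζ.

module IntegerCongruences where

  open import Data.Integer using (_+_; _*_; _-_; -_; _^_)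

  -- Congruences of integers, finite sums and products, binomial coefficients

  infix 4 _≈_[_]

  record _≈_[_] (a b m : ℤ) : Set where
    constructor mod-by
    field
      quotient : ℤ
      equation : a ≡ b + m * quotient

  module _ {m : ℤ} where

    ≡⇒≈ : ∀ {a b} → a ≡ b → a ≈ b [ m ]
    ≡⇒≈ {a} refl = mod-by (+ 0) (solve (a ∷ m ∷ []))

    ≈-refl : ∀ {a} → a ≈ a [ m ]
    ≈-refl = ≡⇒≈ refl

    ≈-sym : ∀ {a b} → a ≈ b [ m ] → b ≈ a [ m ]
    ≈-sym {_} {b} (mod-by q refl) = mod-by (- q) (solve (b ∷ q ∷ m ∷ []))

    ≈-trans : ∀ {a b c} → a ≈ b [ m ] → b ≈ c [ m ] → a ≈ c [ m ]
    ≈-trans {c = c} (mod-by q refl) (mod-by r refl) = mod-by (q + r) (solve (c ∷ q ∷ r ∷ m ∷ []))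

    +-≈ : ∀ {a b c d} → a ≈ b [ m ] → c ≈ d [ m ] → a + c ≈ b + d [ m ]
    +-≈ {b = b} {d = d} (mod-by q refl) (mod-by r refl) = mod-by (q + r) (solve (b ∷ d ∷ q ∷ r ∷ m ∷ []))

    *-≈ : ∀ {a b c d} → a ≈ b [ m ] → c ≈ d [ m ] → a * c ≈ b * d [ m ]
    *-≈ {b = b} {d = d} (mod-by q refl) (mod-by r refl) =
      mod-by (b * r + q * d + m * q * r) (solve (b ∷ d ∷ q ∷ r ∷ m ∷ []))

    neg-≈ : ∀ {a b} → a ≈ b [ m ] → - a ≈ - b [ m ]
    neg-≈ {b = b} (mod-by q refl) = mod-by (- q) (solve (b ∷ q ∷ m ∷ []))

    -‿≈ : ∀ {a b c d} → a ≈ b [ m ] → c ≈ d [ m ] → a - c ≈ b - d [ m ]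
    -‿≈ p q = +-≈ p (neg-≈ q)

    *-≈ˡ : ∀ c {a b} → a ≈ b [ m ] → c * a ≈ c * b [ m ]
    *-≈ˡ c = *-≈ (≈-refl {c})

    *-≈ʳ : ∀ c {a b} → a ≈ b [ m ] → a * c ≈ b * c [ m ]
    *-≈ʳ c p = *-≈ p (≈-refl {c})

    ^-≈ : ∀ k {a b} → a ≈ b [ m ] → a ^ k ≈ b ^ k [ m ]
    ^-≈ zero    _ = ≈-refl
    ^-≈ (suc k) p = *-≈ p (^-≈ k p)

    difference-≈0 : ∀ {a b} → a ≈ b [ m ] → a - b ≈ + 0 [ m ]
    difference-≈0 {b = b} (mod-by q refl) = mod-by q (solve (b ∷ q ∷ m ∷ []))

    ≈-from-difference : ∀ {a b} → a - b ≈ + 0 [ m ] → a ≈ b [ m ]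
    ≈-from-difference {a} {b} (mod-by q e) = mod-by q (trans a≡ (trans (cong (_+ b) e) (solve (b ∷ q ∷ m ∷ []))))
      where
      a≡ : a ≡ a - b + b
      a≡ = solve (a ∷ b ∷ [])

    multiple-≈0 : ∀ a → m * a ≈ + 0 [ m ]
    multiple-≈0 a = mod-by a (solve (a ∷ m ∷ []))

  ≈-setoid : ℤ → Setoid 0ℓ 0ℓ
  ≈-setoid m = record
    { Carrier = ℤ
    ; _≈_ = λ a b → a ≈ b [ m ]
    ; isEquivalence = record { refl = ≈-refl ; sym = ≈-sym ; trans = ≈-trans }
    }

  module ≈-Reasoning (m : ℤ) = SetoidReasoning (≈-setoid m)

  module _ {m c : ℤ} where

    ≈-lower : ∀ {a b} → a ≈ b [ m * c ] → a ≈ b [ m ]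
    ≈-lower {b = b} (mod-by q refl) = mod-by (c * q) (solve (b ∷ q ∷ m ∷ c ∷ []))

    ≈-raise : ∀ {a b} → a ≈ b [ m ] → a * c ≈ b * c [ m * c ]
    ≈-raise {b = b} (mod-by q refl) = mod-by q (solve (b ∷ q ∷ m ∷ c ∷ []))

  ≈-zero-* : ∀ {m n a b} → a ≈ + 0 [ m ] → b ≈ + 0 [ n ] → a * b ≈ + 0 [ m * n ]
  ≈-zero-* {m} {n} (mod-by q refl) (mod-by r refl) = mod-by (q * r) (solve (q ∷ r ∷ m ∷ n ∷ []))

  ≈-exact : ∀ {a b} → a ≈ b [ + 0 ] → a ≡ b
  ≈-exact {b = b} (mod-by q refl) = solve (b ∷ q ∷ [])

  ∑ : ℕ → (ℕ → ℤ) → ℤ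
  ∑ zero    f = + 0
  ∑ (suc n) f = ∑ n f + f n

  ∏ : ℕ → (ℕ → ℤ) → ℤ
  ∏ zero    f = + 1
  ∏ (suc n) f = ∏ n f * f n

  ∑-≈ : ∀ {m} n {f g} → (∀ i → i ℕ.< n → f i ≈ g i [ m ]) → ∑ n f ≈ ∑ n g [ m ]
  ∑-≈ zero    h = ≈-refl
  ∑-≈ (suc n) h = +-≈ (∑-≈ n (λ i i<n → h i (ℕₚ.m<n⇒m<1+n i<n))) (h n ℕₚ.≤-refl)

  ∏-≈ : ∀ {m} n {f g} → (∀ i → i ℕ.< n → f i ≈ g i [ m ]) → ∏ n f ≈ ∏ n g [ m ]
  ∏-≈ zero    h = ≈-refl
  ∏-≈ (suc n) h = *-≈ (∏-≈ n (λ i i<n → h i (ℕₚ.m<n⇒m<1+n i<n))) (h n ℕₚ.≤-refl)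

  ∑-cong : ∀ n {f g} → (∀ i → i ℕ.< n → f i ≡ g i) → ∑ n f ≡ ∑ n g
  ∑-cong n h = ≈-exact (∑-≈ n (λ i i<n → ≡⇒≈ (h i i<n)))

  ∏-cong : ∀ n {f g} → (∀ i → i ℕ.< n → f i ≡ g i) → ∏ n f ≡ ∏ n g
  ∏-cong n h = ≈-exact (∏-≈ n (λ i i<n → ≡⇒≈ (h i i<n)))

  ∑-+ : ∀ n f g → ∑ n (λ i → f i + g i) ≡ ∑ n f + ∑ n g
  ∑-+ zero    f g = refl
  ∑-+ (suc n) f g = trans (cong (_+ (f n + g n)) (∑-+ n f g)) (lemma (∑ n f) (∑ n g) (f n) (g n))
    where
    lemma : ∀ a b c d → a + b + (c + d) ≡ a + c + (b + d)
    lemma = solve-∀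

  ∏-* : ∀ n f g → ∏ n (λ i → f i * g i) ≡ ∏ n f * ∏ n g
  ∏-* zero    f g = refl
  ∏-* (suc n) f g = trans (cong (_* (f n * g n)) (∏-* n f g)) (lemma (∏ n f) (∏ n g) (f n) (g n))
    where
    lemma : ∀ a b c d → a * b * (c * d) ≡ a * c * (b * d)
    lemma = solve-∀

  ∑-*ˡ : ∀ n c f → ∑ n (λ i → c * f i) ≡ c * ∑ n f
  ∑-*ˡ zero    c f = sym (ℤₚ.*-zeroʳ c)
  ∑-*ˡ (suc n) c f = trans (cong (_+ c * f n) (∑-*ˡ n c f)) (sym (ℤₚ.*-distribˡ-+ c (∑ n f) (f n)))

  ∑-*ʳ : ∀ n c f → ∑ n (λ i → f i * c) ≡ ∑ n f * c
  ∑-*ʳ n c f = trans (∑-cong n (λ i _ → ℤₚ.*-comm (f i) c)) (trans (∑-*ˡ n c f) (ℤₚ.*-comm c _))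

  ∑-neg : ∀ n f → ∑ n (λ i → - f i) ≡ - ∑ n f
  ∑-neg zero    f = refl
  ∑-neg (suc n) f = trans (cong (_+ - f n) (∑-neg n f)) (sym (ℤₚ.neg-distrib-+ (∑ n f) (f n)))

  ∑-const : ∀ n c → ∑ n (λ _ → c) ≡ + n * c
  ∑-const zero    c = sym (ℤₚ.*-zeroˡ c)
  ∑-const (suc n) c = trans (cong (_+ c) (∑-const n c)) (lemma (+ n) c)
    where
    lemma : ∀ n c → n * c + c ≡ (+ 1 + n) * c
    lemma = solve-∀

  ∏-const : ∀ n c → ∏ n (λ _ → c) ≡ c ^ n
  ∏-const zero    c = refl
  ∏-const (suc n) c = trans (cong (_* c) (∏-const n c)) (ℤₚ.*-comm (c ^ n) c)

  ∑-head : ∀ n f → ∑ (suc n) f ≡ f 0 + ∑ n (f ∘ suc)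
  ∑-head zero    f = ℤₚ.+-comm (+ 0) (f 0)
  ∑-head (suc n) f = trans (cong (_+ f (suc n)) (∑-head n f)) (ℤₚ.+-assoc (f 0) _ _)

  ∏-head : ∀ n f → ∏ (suc n) f ≡ f 0 * ∏ n (f ∘ suc)
  ∏-head zero    f = ℤₚ.*-comm (+ 1) (f 0)
  ∏-head (suc n) f = trans (cong (_* f (suc n)) (∏-head n f)) (ℤₚ.*-assoc (f 0) _ _)

  ∑-split : ∀ m n f → ∑ (m ℕ.+ n) f ≡ ∑ m f + ∑ n (λ i → f (m ℕ.+ i))
  ∑-split m zero    f rewrite ℕₚ.+-identityʳ m = sym (ℤₚ.+-identityʳ _)
  ∑-split m (suc n) f rewrite ℕₚ.+-suc m n =
    trans (cong (_+ f (m ℕ.+ n)) (∑-split m n f)) (ℤₚ.+-assoc (∑ m f) _ _)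

  ∏-split : ∀ m n f → ∏ (m ℕ.+ n) f ≡ ∏ m f * ∏ n (λ i → f (m ℕ.+ i))
  ∏-split m zero    f rewrite ℕₚ.+-identityʳ m = sym (ℤₚ.*-identityʳ _)
  ∏-split m (suc n) f rewrite ℕₚ.+-suc m n =
    trans (cong (_* f (m ℕ.+ n)) (∏-split m n f)) (ℤₚ.*-assoc (∏ m f) _ _)

  ∑-swap : ∀ m n (f : ℕ → ℕ → ℤ) → ∑ m (λ i → ∑ n (f i)) ≡ ∑ n (λ j → ∑ m (λ i → f i j))
  ∑-swap zero    n f = sym (trans (∑-const n (+ 0)) (ℤₚ.*-zeroʳ (+ n)))
  ∑-swap (suc m) n f = trans (cong (_+ ∑ n (f m)) (∑-swap m n f)) (sym (∑-+ n _ _))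

  private
    reflect-suc : ∀ n i → i ℕ.< n → suc (n ℕ.∸ suc i) ≡ n ℕ.∸ i
    reflect-suc n i i<n = sym (ℕₚ.+-∸-assoc 1 i<n)

  ∑-reverse : ∀ n f → ∑ n f ≡ ∑ n (λ i → f (n ℕ.∸ suc i))
  ∑-reverse zero    f = refl
  ∑-reverse (suc n) f =
    trans (∑-head n f)
    (trans (cong (λ z → f 0 + z) (trans (∑-reverse n (f ∘ suc)) (∑-cong n (λ i i<n → cong f (reflect-suc n i i<n)))))
    (trans (ℤₚ.+-comm (f 0) _) (cong (λ z → ∑ n (λ i → f (n ℕ.∸ i)) + f z) (sym (ℕₚ.n∸n≡0 n)))))

  ∏-reverse : ∀ n f → ∏ n f ≡ ∏ n (λ i → f (n ℕ.∸ suc i))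
  ∏-reverse zero    f = refl
  ∏-reverse (suc n) f =
    trans (∏-head n f)
    (trans (cong (λ z → f 0 * z) (trans (∏-reverse n (f ∘ suc)) (∏-cong n (λ i i<n → cong f (reflect-suc n i i<n)))))
    (trans (ℤₚ.*-comm (f 0) _) (cong (λ z → ∏ n (λ i → f (n ℕ.∸ i)) * f z) (sym (ℕₚ.n∸n≡0 n)))))

  ∑-zero : ∀ {m} n {f} → (∀ i → i ℕ.< n → f i ≈ + 0 [ m ]) → ∑ n f ≈ + 0 [ m ]
  ∑-zero n h = ≈-trans (∑-≈ n h) (≡⇒≈ (trans (∑-const n (+ 0)) (ℤₚ.*-zeroʳ (+ n))))

  ∑-single : ∀ {m} n {f} r → r ℕ.< n → (∀ i → i ℕ.< n → i ≢ r → f i ≈ + 0 [ m ]) → ∑ n f ≈ f r [ m ]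
  ∑-single {m} (suc n) {f} r r<1+n h with r ℕ.≟ n
  ... | yes refl = ≈-trans (+-≈ (∑-zero n (λ i i<n → h i (ℕₚ.m<n⇒m<1+n i<n) (ℕₚ.<⇒≢ i<n))) ≈-refl)
                           (≡⇒≈ (ℤₚ.+-identityˡ (f n)))
  ... | no r≢n = ≈-trans (+-≈ (∑-single n r (ℕₚ.≤∧≢⇒< (ℕ.s≤s⁻¹ r<1+n) r≢n) (λ i i<n → h i (ℕₚ.m<n⇒m<1+n i<n)))
                              (h n ℕₚ.≤-refl (r≢n ∘ sym)))
                         (≡⇒≈ (ℤₚ.+-identityʳ (f r)))

  ∑-mono : ∀ n {f g} → (∀ i → i ℕ.< n → f i ℤ.≤ g i) → ∑ n f ℤ.≤ ∑ n g
  ∑-mono zero    h = ℤₚ.≤-refl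
  ∑-mono (suc n) h = ℤₚ.+-mono-≤ (∑-mono n (λ i i<n → h i (ℕₚ.m<n⇒m<1+n i<n))) (h n ℕₚ.≤-refl)

  nC0≡1 : ∀ n → n C 0 ≡ 1
  nC0≡1 n = trans (nCk≡nC[n∸k] {0} {n} z≤n) (nCn≡1 n)

  [1+n]Cn≡1+n : ∀ n → suc n C n ≡ suc n
  [1+n]Cn≡1+n n = trans (nCk≡nC[n∸k] (ℕₚ.n≤1+n n))
    (trans (cong (suc n C_) (trans (ℕₚ.+-∸-assoc 1 (ℕₚ.≤-refl {n})) (cong suc (ℕₚ.n∸n≡0 n)))) (nC1≡n (suc n)))

  C-factorial : ∀ {n k} → k ℕ.≤ n → (n C k) ℕ.* (k ! ℕ.* (n ℕ.∸ k) !) ≡ n !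
  C-factorial {n} {k} k≤n =
    trans (cong (ℕ._* (k ! ℕ.* (n ℕ.∸ k) !)) (nCk≡n!/k![n-k]! k≤n))
          (ℕDM.m/n*n≡m (k![n∸k]!∣n! k≤n))
    where instance _ = k ℕₚ.!* (n ℕ.∸ k) !≢0

  binomial-theorem : ∀ x b → (+ 1 + x) ^ b ≡ ∑ (suc b) (λ j → + (b C j) * x ^ j)
  binomial-theorem x zero    = refl
  binomial-theorem x (suc b) = sym (begin
    ∑ (suc (suc b)) (λ j → + (suc b C j) * x ^ j)
      ≡⟨ ∑-head (suc b) _ ⟩
    + (suc b C 0) * + 1 + ∑ (suc b) (λ j → + (suc b C suc j) * (x * x ^ j))
      ≡⟨ cong₂ _+_ (cong (λ c → + c * + 1) (trans (nC0≡1 (suc b)) (sym (nC0≡1 b)))) (∑-cong (suc b) (λ j _ → pascal j)) ⟩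
    + (b C 0) * + 1 + ∑ (suc b) (λ j → x * (+ (b C j) * x ^ j) + + (b C suc j) * (x * x ^ j))
      ≡⟨ cong (λ z → + (b C 0) * + 1 + z) (trans (∑-+ (suc b) _ _) (cong (_+ top) (∑-*ˡ (suc b) x _))) ⟩
    + (b C 0) * + 1 + (x * s + top)
      ≡⟨ regroup (+ (b C 0) * + 1) (x * s) top ⟩
    (+ (b C 0) * + 1 + top) + x * s
      ≡⟨ cong (_+ x * s) (sym (∑-head (suc b) (λ j → + (b C j) * x ^ j))) ⟩
    (s + + (b C suc b) * x ^ suc b) + x * s
      ≡⟨ cong (λ c → (s + + c * x ^ suc b) + x * s) (k>n⇒nCk≡0 (ℕₚ.n<1+n b)) ⟩
    (s + + 0 * x ^ suc b) + x * s
      ≡⟨ collect s x (x ^ suc b) ⟩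
    (+ 1 + x) * s
      ≡⟨ cong ((+ 1 + x) *_) (sym (binomial-theorem x b)) ⟩
    (+ 1 + x) ^ suc b ∎)
    where
    open ≡-Reasoning
    s = ∑ (suc b) (λ j → + (b C j) * x ^ j)
    top = ∑ (suc b) (λ j → + (b C suc j) * (x * x ^ j))
    pascal : ∀ j → + (suc b C suc j) * (x * x ^ j) ≡ x * (+ (b C j) * x ^ j) + + (b C suc j) * (x * x ^ j)
    pascal j = trans (cong (λ c → + c * (x * x ^ j)) (sym (nCk+nC[k+1]≡[n+1]C[k+1] b j)))
                     (expand (+ (b C j)) (+ (b C suc j)) x (x ^ j))
      where
      expand : ∀ a c x y → (a + c) * (x * y) ≡ x * (a * y) + c * (x * y)
      expand = solve-∀
    regroup : ∀ a b c → a + (b + c) ≡ (a + c) + b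
    regroup = solve-∀
    collect : ∀ s x y → (s + + 0 * y) + x * s ≡ (+ 1 + x) * s
    collect = solve-∀

  ^-distrib-* : ∀ a b k → (a * b) ^ k ≡ a ^ k * b ^ k
  ^-distrib-* a b zero    = refl
  ^-distrib-* a b (suc k) = trans (cong (a * b *_) (^-distrib-* a b k)) (lemma a b (a ^ k) (b ^ k))
    where
    lemma : ∀ a b x y → a * b * (x * y) ≡ a * x * (b * y)
    lemma = solve-∀

  sign-square : ∀ k → (- + 1) ^ k * (- + 1) ^ k ≡ + 1
  sign-square k = trans (sym (^-distrib-* (- + 1) (- + 1) k)) (ℤₚ.^-zeroˡ k)

  -- The cofactor of a - b in aⁿ - bⁿ. Modulo a - b it is n bⁿ⁻¹, and for n = p this supplies the
  -- extra factor p in `^p-lift`.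
  geometric : ℕ → ℤ → ℤ → ℤ
  geometric zero    a b = + 0
  geometric (suc n) a b = a * geometric n a b + b ^ n

  ^-difference : ∀ n a b → a ^ n - b ^ n ≡ (a - b) * geometric n a b
  ^-difference zero    a b = sym (ℤₚ.*-zeroʳ (a - b))
  ^-difference (suc n) a b = trans (step a b (a ^ n) (b ^ n))
    (trans (cong (λ z → a * z + (a - b) * b ^ n) (^-difference n a b)) (collect a b (geometric n a b) (b ^ n)))
    where
    step : ∀ a b u v → a * u - b * v ≡ a * (u - v) + (a - b) * v
    step = solve-∀
    collect : ∀ a b g v → a * ((a - b) * g) + (a - b) * v ≡ (a - b) * (a * g + v)
    collect = solve-∀

  geometric-≈ : ∀ {m} n {a b} → a ≈ b [ m ] → geometric (suc n) a b ≈ + suc n * b ^ n [ m ]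
  geometric-≈ zero    {a} {b} _ = ≡⇒≈ (lemma a b)
    where
    lemma : ∀ a b → a * + 0 + + 1 ≡ + 1 * + 1
    lemma = solve-∀
  geometric-≈ (suc n) {a} {b} h = ≈-trans (+-≈ (*-≈ h (geometric-≈ n h)) ≈-refl) (≡⇒≈ (lemma (+ suc n) b (b ^ n)))
    where
    lemma : ∀ k b y → b * (k * y) + b * y ≡ (+ 1 + k) * (b * y)
    lemma = solve-∀

  ^-telescope : ∀ n k → ∑ n (λ t → (+ 1 + + t) ^ suc k - (+ t) ^ suc k) ≡ (+ n) ^ suc k
  ^-telescope zero    k = sym (ℤₚ.*-zeroˡ ((+ 0) ^ k))
  ^-telescope (suc n) k = trans (cong (_+ ((+ 1 + + n) ^ suc k - (+ n) ^ suc k)) (^-telescope n k)) (lemma ((+ n) ^ suc k) ((+ suc n) ^ suc k))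
    where
    lemma : ∀ a b → a + (b - a) ≡ b
    lemma = solve-∀

  -- Arithmetic modulo a prime and its first four powers

  module ModPrime {p : ℕ} (pr : Prime p) where

    P : ℤ
    P = + p

    private instance
      p≢0 : ℕ.NonZero p
      p≢0 = prime⇒nonZero pr

    1<p : 1 ℕ.< p
    1<p = ℕ.nonTrivial⇒n>1 p {{prime⇒nonTrivial pr}}

    ≈0⇒∣ : ∀ {a} → a ≈ + 0 [ P ] → p ℕD.∣ ∣ a ∣
    ≈0⇒∣ (mod-by q refl) =
      ℕD.divides ∣ q ∣ (trans (cong ∣_∣ (ℤₚ.+-identityˡ (P * q))) (trans (ℤₚ.abs-* P q) (ℕₚ.*-comm p ∣ q ∣)))

    ∣⇒≈0 : ∀ {a} → p ℕD.∣ ∣ a ∣ → a ≈ + 0 [ P ]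
    ∣⇒≈0 {a} d with ℤDˢ.∣ᵤ⇒∣ {P} {a} d
    ... | ℤDˢ.divides q e = mod-by q (trans e (trans (ℤₚ.*-comm q P) (sym (ℤₚ.+-identityˡ (P * q)))))

    P≈0 : P ≈ + 0 [ P ]
    P≈0 = mod-by (+ 1) (trans (sym (ℤₚ.*-identityʳ P)) (sym (ℤₚ.+-identityˡ _)))

    Nz : ℤ → Set
    Nz a = ¬ (a ≈ + 0 [ P ])

    ≈0? : ∀ a → Dec (a ≈ + 0 [ P ])
    ≈0? a with p ℕD.∣? ∣ a ∣
    ... | yes d = yes (∣⇒≈0 d)
    ... | no ¬d = no (¬d ∘ ≈0⇒∣)

    euclid : ∀ {a b} → a * b ≈ + 0 [ P ] → a ≈ + 0 [ P ] ⊎ b ≈ + 0 [ P ]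
    euclid {a} {b} h with euclidsLemma ∣ a ∣ ∣ b ∣ pr (subst (p ℕD.∣_) (ℤₚ.abs-* a b) (≈0⇒∣ h))
    ... | inj₁ d = inj₁ (∣⇒≈0 d)
    ... | inj₂ d = inj₂ (∣⇒≈0 d)

    nz-* : ∀ {a b} → Nz a → Nz b → Nz (a * b)
    nz-* na nb h with euclid h
    ... | inj₁ x = na x
    ... | inj₂ x = nb x

    nz-≈ : ∀ {a b} → a ≈ b [ P ] → Nz a → Nz b
    nz-≈ e na h = na (≈-trans e h)

    nz-small : ∀ {i} → 0 ℕ.< i → i ℕ.< p → Nz (+ i)
    nz-small {suc i} _ i<p h = ℕₚ.<⇒≱ i<p (ℕD.∣⇒≤ (≈0⇒∣ h))

    nz-1 : Nz (+ 1)
    nz-1 = nz-small (s≤s z≤n) 1<p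

    nz-neg : ∀ {a} → Nz a → Nz (- a)
    nz-neg {a} na h = na (≈-trans (≡⇒≈ (sym (ℤₚ.neg-involutive a))) (neg-≈ h))

    nz-^ : ∀ {a} k → Nz a → Nz (a ^ k)
    nz-^ zero    na = nz-1
    nz-^ (suc k) na = nz-* na (nz-^ k na)

    nz-∏ : ∀ n {f} → (∀ i → i ℕ.< n → Nz (f i)) → Nz (∏ n f)
    nz-∏ zero    h = nz-1
    nz-∏ (suc n) h = nz-* (nz-∏ n (λ i i<n → h i (ℕₚ.m<n⇒m<1+n i<n))) (h n ℕₚ.≤-refl)

    nz-factorˡ : ∀ {a b} → Nz (a * b) → Nz a
    nz-factorˡ {a} {b} nab h = nab (≈-trans (*-≈ʳ b h) (≡⇒≈ (ℤₚ.*-zeroˡ b)))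

    nz-! : ∀ {n} → n ℕ.< p → Nz (+ (n !))
    nz-! {zero}  _ = nz-1
    nz-! {suc n} h = subst Nz (sym (ℤₚ.pos-* (suc n) (n !))) (nz-* (nz-small (s≤s z≤n) h) (nz-! (ℕₚ.<⇒≤ h)))

    p∣pCk : ∀ {k} → 0 ℕ.< k → k ℕ.< p → + (p C k) ≈ + 0 [ P ]
    p∣pCk {k} 0<k k<p with euclid {+ (p C k)} {+ (k ! ℕ.* (p ℕ.∸ k) !)} (∣⇒≈0 p∣)
      where
      p∣ : p ℕD.∣ ∣ + (p C k) * + (k ! ℕ.* (p ℕ.∸ k) !) ∣
      p∣ = subst (p ℕD.∣_) (sym (trans (ℤₚ.abs-* (+ (p C k)) (+ (k ! ℕ.* (p ℕ.∸ k) !))) (C-factorial (ℕₚ.<⇒≤ k<p)))) (p∣p! p≢0)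
        where
        p∣p! : ∀ {n} → ℕ.NonZero n → n ℕD.∣ n !
        p∣p! {suc n} _ = ℕD.m∣m*n (n !)
    ... | inj₁ x = x
    ... | inj₂ x = ⊥-elim (nz-* (nz-! k<p) (nz-! (ℕₚ.∸-monoʳ-< {p} {k} {0} 0<k (ℕₚ.<⇒≤ k<p)))
                                (≈-trans (≡⇒≈ (sym (ℤₚ.pos-* (k !) ((p ℕ.∸ k) !)))) x))

    private
      freshman : ∀ {q} → q ≡ p → ∀ x → (+ 1 + x) ^ q ≈ + 1 + x ^ q [ P ]
      freshman {zero}   e x = ⊥-elim (ℕₚ.n≮0 (subst (1 ℕ.<_) (sym e) 1<p))
      freshman {suc q} refl x = begin
        (+ 1 + x) ^ suc q
          ≡⟨ binomial-theorem x (suc q) ⟩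
        ∑ (suc q) f + f (suc q)
          ≡⟨ cong (_+ f (suc q)) (∑-head q f) ⟩
        f 0 + ∑ q (f ∘ suc) + f (suc q)
          ≈⟨ +-≈ (+-≈ (≡⇒≈ (cong (λ c → + c * + 1) (nC0≡1 (suc q)))) (∑-zero q vanish)) (≡⇒≈ (cong (λ c → + c * x ^ suc q) (nCn≡1 (suc q)))) ⟩
        + 1 * + 1 + + 0 + + 1 * x ^ suc q
          ≡⟨ tidy (x ^ suc q) ⟩
        + 1 + x ^ suc q ∎
        where
        open ≈-Reasoning P
        f : ℕ → ℤ
        f j = + (suc q C j) * x ^ j
        vanish : ∀ i → i ℕ.< q → f (suc i) ≈ + 0 [ P ]
        vanish i i<q = ≈-trans (*-≈ʳ (x ^ suc i) (p∣pCk (s≤s z≤n) (s≤s i<q))) (≡⇒≈ (ℤₚ.*-zeroˡ (x ^ suc i)))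
        tidy : ∀ y → + 1 * + 1 + + 0 + + 1 * y ≡ + 1 + y
        tidy = solve-∀

      fermat-ℕ : ∀ a → (+ a) ^ p ≈ + a [ P ]
      fermat-ℕ zero    = ≡⇒≈ (0^p p≢0)
        where
        0^p : ∀ {q} → ℕ.NonZero q → (+ 0) ^ q ≡ + 0
        0^p {suc q} _ = ℤₚ.*-zeroˡ ((+ 0) ^ q)
      fermat-ℕ (suc a) = ≈-trans (freshman refl (+ a)) (+-≈ (≈-refl {a = + 1}) (fermat-ℕ a))

    residue : ∀ a → ∃ λ r → r ℕ.< p × a ≈ + r [ P ]
    residue a = a ℤDM.%ℕ p , ℤDM.n%ℕd<d a p , mod-by (a ℤDM./ℕ p)
      (trans (ℤDM.a≡a%ℕn+[a/ℕn]*n a p) (cong (λ z → + (a ℤDM.%ℕ p) + z) (ℤₚ.*-comm (a ℤDM./ℕ p) P)))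

    fermat : ∀ a → a ^ p ≈ a [ P ]
    fermat a with residue a
    ... | r , _ , a≈r = ≈-trans (^-≈ p a≈r) (≈-trans (fermat-ℕ r) (≈-sym a≈r))

    private
      p≡2+ : p ≡ suc (suc (p ℕ.∸ 2))
      p≡2+ = sym (trans (cong suc (sym (ℕₚ.+-∸-assoc 1 1<p))) (trans (sym (ℕₚ.+-∸-assoc 1 {p} {1} (ℕₚ.<⇒≤ 1<p))) refl))

    ≈0-cancel : ∀ {u a} → Nz u → u * a ≈ + 0 [ P ] → a ≈ + 0 [ P ]
    ≈0-cancel nu h with euclid h
    ... | inj₁ x = ⊥-elim (nu x)
    ... | inj₂ x = x

    ≈-cancel₁ : ∀ {u a b} → Nz u → u * a ≈ u * b [ P ] → a ≈ b [ P ]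
    ≈-cancel₁ {u} {a} {b} nu h = ≈-from-difference (≈0-cancel nu (≈-trans (≡⇒≈ (lemma u a b)) (difference-≈0 h)))
      where
      lemma : ∀ u a b → u * (a - b) ≡ u * a - u * b
      lemma = solve-∀

    fermat-1 : ∀ {u} → Nz u → u ^ (p ℕ.∸ 1) ≈ + 1 [ P ]
    fermat-1 {u} nu = ≈-cancel₁ nu (begin
      u * u ^ (p ℕ.∸ 1)  ≡⟨ cong (u ^_) (sym (ℕₚ.+-∸-assoc 1 {p} {1} (ℕₚ.<⇒≤ 1<p))) ⟩
      u ^ p              ≈⟨ fermat u ⟩
      u                  ≡⟨ sym (ℤₚ.*-identityʳ u) ⟩
      u * + 1            ∎)
      where open ≈-Reasoning P

    inverse₁ : ∀ {u} → Nz u → ∃ λ v → u * v ≈ + 1 [ P ]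
    inverse₁ {u} nu = u ^ (p ℕ.∸ 2) , ≈-trans (≡⇒≈ (cong (u ^_) (cong ℕ.pred (sym p≡2+)))) (fermat-1 nu)

    private
      -- One Newton step for 1/u squares the error 1 - uv, so two steps turn a Fermat inverse modulo
      -- P into an inverse modulo P⁴.
      newton : ∀ {m u} → (∃ λ v → u * v ≈ + 1 [ m ]) → ∃ λ v → u * v ≈ + 1 [ m * m ]
      newton {m} {u} (v , mod-by q e) = v * (+ 2 - u * v) , mod-by (- (q * q))
        (trans (sym (ℤₚ.*-assoc u v _)) (trans (cong (λ z → z * (+ 2 - z)) e) (lemma m q)))
        where
        lemma : ∀ m q → (+ 1 + m * q) * (+ 2 - (+ 1 + m * q)) ≡ + 1 + m * m * - (q * q)
        lemma = solve-∀

    P² P³ P⁴ : ℤ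
    P² = P * P
    P³ = P * P * P
    P⁴ = P * P * P * P

    inverse : ∀ {u} → Nz u → ∃ λ v → u * v ≈ + 1 [ P⁴ ]
    inverse {u} nu = proj₁ n₄ , subst (λ m → u * proj₁ n₄ ≈ + 1 [ m ]) (sym (ℤₚ.*-assoc (P * P) P P)) (proj₂ n₄)
      where
      n₄ : ∃ λ v → u * v ≈ + 1 [ P * P * (P * P) ]
      n₄ = newton {u = u} (newton {u = u} (inverse₁ nu))

    ≈-cancel : ∀ {m u v a b} → u * v ≈ + 1 [ m ] → u * a ≈ u * b [ m ] → a ≈ b [ m ]
    ≈-cancel {m} {u} {v} {a} {b} uv h = begin
      a            ≡⟨ sym (ℤₚ.*-identityˡ a) ⟩
      + 1 * a      ≈⟨ *-≈ʳ a uv ⟨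
      u * v * a    ≡⟨ lemma u v a ⟩
      v * (u * a)  ≈⟨ *-≈ˡ v h ⟩
      v * (u * b)  ≡⟨ lemma u v b ⟨
      u * v * b    ≈⟨ *-≈ʳ b uv ⟩
      + 1 * b      ≡⟨ ℤₚ.*-identityˡ b ⟩
      b            ∎
      where
      open ≈-Reasoning m
      lemma : ∀ u v a → u * v * a ≡ v * (u * a)
      lemma = solve-∀

    ≈-cancel₄ : ∀ {u a b} → Nz u → u * a ≈ u * b [ P⁴ ] → a ≈ b [ P⁴ ]
    ≈-cancel₄ {u} {a} {b} nu = ≈-cancel {u = u} {proj₁ (inverse nu)} {a} {b} (proj₂ (inverse nu))

    ≈-cancel₃ : ∀ {u a b} → Nz u → u * a ≈ u * b [ P³ ] → a ≈ b [ P³ ]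
    ≈-cancel₃ {u} {a} {b} nu = ≈-cancel {u = u} {proj₁ (inverse nu)} {a} {b} (≈-lower (proj₂ (inverse nu)))

    ≈-cancel₂ : ∀ {u a b} → Nz u → u * a ≈ u * b [ P² ] → a ≈ b [ P² ]
    ≈-cancel₂ {u} {a} {b} nu = ≈-cancel {u = u} {proj₁ (inverse nu)} {a} {b} (≈-lower (≈-lower (proj₂ (inverse nu))))

    ≈-unraise : ∀ {m a b} → a * P ≈ b * P [ m * P ] → a ≈ b [ m ]
    ≈-unraise {m} {a} {b} (mod-by q e) = mod-by q (ℤₚ.*-cancelʳ-≡ a (b + m * q) P (trans e (lemma b m q P)))
      where
      lemma : ∀ b m q p → b * p + m * p * q ≡ (b + m * q) * p
      lemma = solve-∀

    -- In aᵖ - bᵖ = (a - b) · `geometric p a b` the second factor is congruent to p bᵖ⁻¹, so every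
    -- p-th power gains one factor p.
    ^p-lift : ∀ {m a b} → a ≈ b [ P ] → a ≈ b [ m ] → a ^ p ≈ b ^ p [ m * P ]
    ^p-lift {m} {a} {b} h₁ h = ≈-from-difference (≈-trans (≡⇒≈ (^-difference p a b))
      (≈-zero-* (difference-≈0 h) (geometric≈0 p≡2+)))
      where
      geometric≈0 : ∀ {r} → p ≡ suc r → geometric p a b ≈ + 0 [ P ]
      geometric≈0 {r} e = ≈-trans (subst (λ q → geometric q a b ≈ + q * b ^ r [ P ]) (sym e) (geometric-≈ r h₁))
        (≈-trans (*-≈ʳ (b ^ r) P≈0) (≡⇒≈ (ℤₚ.*-zeroˡ (b ^ r))))

    power-sum : ℕ → ℤ
    power-sum k = ∑ p (λ t → (+ t) ^ k)

    private
      -- Summed over a full period, (t + 1)^(k+1) - t^(k+1) telescopes to p^(k+1), while the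
      -- binomial theorem expresses it through the lower power sums.
      power-sum-recursion : ∀ k → ∑ k (λ j → + (suc k C j) * power-sum j) + + suc k * power-sum k ≈ + 0 [ P ]
      power-sum-recursion k = begin
        ∑ k (λ j → + (suc k C j) * power-sum j) + + suc k * power-sum k
          ≡⟨ cong₂ _+_ (trans (∑-cong k (λ j _ → sym (∑-*ˡ p (+ (suc k C j)) _))) (∑-swap k p _)) (sym (∑-*ˡ p (+ suc k) _)) ⟩
        ∑ p (λ t → ∑ k (λ j → + (suc k C j) * (+ t) ^ j)) + ∑ p (λ t → + suc k * (+ t) ^ k)
          ≡⟨ sym (∑-+ p _ _) ⟩
        ∑ p (λ t → ∑ k (λ j → + (suc k C j) * (+ t) ^ j) + + suc k * (+ t) ^ k)
          ≡⟨ ∑-cong p (λ t _ → difference t) ⟩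
        ∑ p (λ t → (+ 1 + + t) ^ suc k - (+ t) ^ suc k)
          ≡⟨ ^-telescope p k ⟩
        P * P ^ k
          ≈⟨ multiple-≈0 (P ^ k) ⟩
        + 0 ∎
        where
        open ≈-Reasoning P
        difference : ∀ t → ∑ k (λ j → + (suc k C j) * (+ t) ^ j) + + suc k * (+ t) ^ k ≡ (+ 1 + + t) ^ suc k - (+ t) ^ suc k
        difference t = trans (tidy (∑ k (λ j → + (suc k C j) * (+ t) ^ j)) (+ suc k * (+ t) ^ k) ((+ t) ^ suc k))
          (cong (_- (+ t) ^ suc k) (sym (trans (binomial-theorem (+ t) (suc k))
            (cong₂ (λ c d → ∑ k (λ j → + (suc k C j) * (+ t) ^ j) + + c * (+ t) ^ k + + d * (+ t) ^ suc k) ([1+n]Cn≡1+n k) (nCn≡1 (suc k))))))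
          where
          tidy : ∀ a b c → a + b ≡ a + b + + 1 * c - c
          tidy = solve-∀

    -- Strong induction on the recursion; its top coefficient k + 1 has to be a unit, which is where
    -- the bound comes from.
    power-sum≈0 : ∀ k → suc k ℕ.< p → power-sum k ≈ + 0 [ P ]
    power-sum≈0 k k<p = below (suc k) k (ℕₚ.n<1+n k) k<p
      where
      below : ∀ b k → k ℕ.< b → suc k ℕ.< p → power-sum k ≈ + 0 [ P ]
      below (suc b) k (s≤s k≤b) k<p = ≈0-cancel (nz-small (s≤s z≤n) k<p) (begin
        + suc k * power-sum k
          ≡⟨ sym (ℤₚ.+-identityˡ _) ⟩
        + 0 + + suc k * power-sum k
          ≈⟨ +-≈ (∑-zero k (λ j j<k → ≈-trans (*-≈ˡ (+ (suc k C j)) (below b j (ℕₚ.<-≤-trans j<k k≤b) (ℕₚ.<-trans (s≤s j<k) k<p)))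
                                     (≡⇒≈ (ℤₚ.*-zeroʳ (+ (suc k C j)))))) ≈-refl ⟨
        ∑ k (λ j → + (suc k C j) * power-sum j) + + suc k * power-sum k
          ≈⟨ power-sum-recursion k ⟩
        + 0 ∎)
        where open ≈-Reasoning P

    -- Multiplying a product by P shifts the modulus, so congruences with different precisions combine.
    P*-≈ : ∀ {m a b} → a ≈ b [ m ] → P * a ≈ P * b [ m * P ]
    P*-≈ {a = a} {b} h = ≈-trans (≡⇒≈ (ℤₚ.*-comm P a)) (≈-trans (≈-raise h) (≡⇒≈ (ℤₚ.*-comm b P)))

  -- The product of f j over k ≤ j < L: the part of a common denominator ∏ L f that survives when a
  -- term with denominator ∏ k f is cleared.
  tail : ℕ → (ℕ → ℤ) → ℕ → ℤ
  tail L f k = ∏ (L ℕ.∸ k) (λ i → f (L ℕ.∸ suc i))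

  tail-step : ∀ {L k} f → k ℕ.< L → tail L f k ≡ f k * tail L f (suc k)
  tail-step {L} {k} f k<L = begin
    ∏ (L ℕ.∸ k) g
      ≡⟨ cong (λ r → ∏ r g) (ℕₚ.+-∸-assoc 1 k<L) ⟩
    ∏ (L ℕ.∸ suc k) g * f (L ℕ.∸ suc (L ℕ.∸ suc k))
      ≡⟨ cong (λ r → ∏ (L ℕ.∸ suc k) g * f r) (trans (cong (L ℕ.∸_) (sym (ℕₚ.+-∸-assoc 1 k<L))) (ℕₚ.m∸[m∸n]≡n (ℕₚ.<⇒≤ k<L))) ⟩
    ∏ (L ℕ.∸ suc k) g * f k
      ≡⟨ ℤₚ.*-comm (∏ (L ℕ.∸ suc k) g) (f k) ⟩
    f k * ∏ (L ℕ.∸ suc k) g ∎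
    where
    open ≡-Reasoning
    g : ℕ → ℤ
    g i = f (L ℕ.∸ suc i)

  tail-full : ∀ L f → tail L f 0 ≡ ∏ L f
  tail-full L f = sym (∏-reverse L f)

  tail-split : ∀ {L k} n f → k ℕ.≤ n → n ℕ.≤ L → tail L f k ≡ tail n f k * tail L f n
  tail-split {L} {k} n f k≤n n≤L = begin
    ∏ (L ℕ.∸ k) g
      ≡⟨ cong (λ r → ∏ r g) (trans (cong (ℕ._∸ k) (sym (ℕₚ.m∸n+n≡m n≤L))) (ℕₚ.+-∸-assoc (L ℕ.∸ n) k≤n)) ⟩
    ∏ (L ℕ.∸ n ℕ.+ (n ℕ.∸ k)) g
      ≡⟨ ∏-split (L ℕ.∸ n) (n ℕ.∸ k) g ⟩
    tail L f n * ∏ (n ℕ.∸ k) (λ i → f (L ℕ.∸ suc (L ℕ.∸ n ℕ.+ i)))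
      ≡⟨ cong (tail L f n *_) (∏-cong (n ℕ.∸ k) (λ i _ → cong f (index i))) ⟩
    tail L f n * tail n f k
      ≡⟨ ℤₚ.*-comm (tail L f n) (tail n f k) ⟩
    tail n f k * tail L f n ∎
    where
    open ≡-Reasoning
    g : ℕ → ℤ
    g i = f (L ℕ.∸ suc i)
    index : ∀ i → L ℕ.∸ suc (L ℕ.∸ n ℕ.+ i) ≡ n ℕ.∸ suc i
    index i = trans (cong (L ℕ.∸_) (sym (ℕₚ.+-suc (L ℕ.∸ n) i)))
      (trans (sym (ℕₚ.∸-+-assoc L (L ℕ.∸ n) (suc i))) (cong (ℕ._∸ suc i) (ℕₚ.m∸[m∸n]≡n n≤L)))

  -- Dougall's terminating ₅F₄ summation, denominators cleared

  module Dougall (P : ℤ) (L : ℕ) where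

    4× : ℕ → ℤ
    4× n = + 4 * + n

    -- In hypergeometric terms a = 1/4, one upper parameter is -n, and the other two are (1 - ρP)/4
    -- for the primitive cube roots of unity ρ; multiplying the conjugate pair gives the quadratics
    -- in `Z` and `Y`. Here P is any integer, independent of n, because the induction varies n
    -- alone.
    Z Y α : ℕ → ℤ
    Z j = (4× j + + 1) * ((4× j + + 1) * (4× j + + 1) + P * (4× j + + 1) + P * P)
    Y j = (4× j + + 4) * α j
    α n = (4× n + + 4) * (4× n + + 4) - (4× n + + 4) * P + P * P

    -- Passing from n to n + 1 shifts every factor of `D` by one place; this is the new factor that
    -- enters at the top of the fixed range L.
    λ′ : ℕ → ℤ
    λ′ n = 4× L + + 5 + 4× n

    A B : ℕ → ℤ
    A k = ∏ k Z
    B k = tail L Y k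

    d U D : ℕ → ℕ → ℤ
    d n j = 4× j + + 5 + 4× n
    U n k = ∏ k (λ j → 4× j - 4× n)
    D n k = tail L (d n) k

    -- `t` is the cleared summand and `G` its telescoping companion, set to 0 at k = 0 so that no
    -- lower boundary term remains.
    t G : ℕ → ℕ → ℤ
    t n k = (+ 2 * 4× k + + 1) * (A k * U n k) * (B k * D n k)
    G n zero    = + 0
    G n (suc k) = A (suc k) * B k * (U n k * D n (suc k))

    4×-suc : ∀ n → 4× (suc n) ≡ 4× n + + 4
    4×-suc n = lemma (+ n)
      where
      lemma : ∀ n → + 4 * (+ 1 + n) ≡ + 4 * n + + 4
      lemma = solve-∀

    U-suc-suc : ∀ n k → U (suc n) (suc k) ≡ - (4× n + + 4) * U n k
    U-suc-suc n k = trans (∏-head k _)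
      (cong₂ _*_ (trans (cong (λ z → 4× 0 - z) (4×-suc n)) (lemma₀ (4× n)))
                 (∏-cong k (λ j _ → trans (cong₂ _-_ (4×-suc j) (4×-suc n)) (lemma (4× j) (4× n)))))
      where
      lemma₀ : ∀ n → + 4 * + 0 - (n + + 4) ≡ - (n + + 4)
      lemma₀ = solve-∀
      lemma : ∀ j n → j + + 4 - (n + + 4) ≡ j - n
      lemma = solve-∀

    D-suc : ∀ n k → k ℕ.< L → D (suc n) k ≡ λ′ n * D n (suc k)
    D-suc n k k<L = begin
      ∏ (L ℕ.∸ k) g
        ≡⟨ cong (λ r → ∏ r g) (ℕₚ.+-∸-assoc 1 k<L) ⟩
      ∏ (suc r) g
        ≡⟨ ∏-head r g ⟩
      g 0 * ∏ r (g ∘ suc)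
        ≡⟨ cong₂ _*_ (first (ℕₚ.≤-<-trans z≤n k<L)) (∏-cong r (λ i i<r → shift i (ℕₚ.<-≤-trans i<r (ℕₚ.∸-monoʳ-≤ L (s≤s (z≤n {k})))))) ⟩
      λ′ n * D n (suc k) ∎
      where
      open ≡-Reasoning
      r = L ℕ.∸ suc k
      g : ℕ → ℤ
      g i = 4× (L ℕ.∸ suc i) + + 5 + 4× (suc n)
      raise : ∀ a b → a ≡ suc b → 4× b + + 5 + 4× (suc n) ≡ 4× a + + 5 + 4× n
      raise _ b refl = trans (cong (λ z → 4× b + + 5 + z) (4×-suc n))
        (trans (lemma (4× b) (4× n)) (cong (λ z → z + + 5 + 4× n) (sym (4×-suc b))))
        where
        lemma : ∀ b n → b + + 5 + (n + + 4) ≡ b + + 4 + + 5 + n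
        lemma = solve-∀
      first : 0 ℕ.< L → g 0 ≡ λ′ n
      first 0<L = raise L (L ℕ.∸ 1) (ℕₚ.+-∸-assoc 1 0<L)
      shift : ∀ i → i ℕ.< L ℕ.∸ 1 → g (suc i) ≡ 4× (L ℕ.∸ suc i) + + 5 + 4× n
      shift i i<L-1 = raise (L ℕ.∸ suc i) (L ℕ.∸ suc (suc i))
        (ℕₚ.+-∸-assoc 1 (subst (suc (suc i) ℕ.≤_) (ℕₚ.m+[n∸m]≡n (ℕₚ.≤-<-trans z≤n k<L)) (s≤s i<L-1)))

    -- Wilf–Zeilberger: up to a difference of G in k, t satisfies a first-order recurrence in n.
    certificate : ∀ n k → k ℕ.< L →
      α n * t (suc n) k ≡ λ′ n * (4× n + + 3 - P) * t n k + λ′ n * (G n (suc k) - G n k)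
    certificate n zero 0<L = begin
      α n * t (suc n) 0
        ≡⟨ cong (λ d → α n * ((+ 2 * 4× 0 + + 1) * (+ 1 * + 1) * (B 0 * d))) (D-suc n 0 0<L) ⟩
      α n * ((+ 2 * 4× 0 + + 1) * (+ 1 * + 1) * (B 0 * (λ′ n * D n 1)))
        ≡⟨ identity P (4× n) (λ′ n) (B 0) (D n 1) ⟩
      λ′ n * (4× n + + 3 - P) * ((+ 2 * 4× 0 + + 1) * (+ 1 * + 1) * (B 0 * ((4× 0 + + 5 + 4× n) * D n 1))) + λ′ n * (+ 1 * Z 0 * B 0 * (+ 1 * D n 1) - + 0)
        ≡⟨ cong (λ d → λ′ n * (4× n + + 3 - P) * ((+ 2 * 4× 0 + + 1) * (+ 1 * + 1) * (B 0 * d)) + λ′ n * (G n 1 - + 0)) (sym (tail-step (d n) 0<L)) ⟩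
      λ′ n * (4× n + + 3 - P) * t n 0 + λ′ n * (G n 1 - G n 0) ∎
      where
      open ≡-Reasoning
      identity : ∀ P N l b d →
        ((N + + 4) * (N + + 4) - (N + + 4) * P + P * P) * ((+ 2 * + 0 + + 1) * (+ 1 * + 1) * (b * (l * d)))
        ≡ l * (N + + 3 - P) * ((+ 2 * + 0 + + 1) * (+ 1 * + 1) * (b * ((+ 0 + + 5 + N) * d)))
          + l * (+ 1 * ((+ 0 + + 1) * ((+ 0 + + 1) * (+ 0 + + 1) + P * (+ 0 + + 1) + P * P)) * b * (+ 1 * d) - + 0)
      identity = solve-∀
    certificate n (suc k) k<L = begin
      α n * t (suc n) (suc k)
        ≡⟨ cong₂ (λ u d′ → α n * ((+ 2 * 4× (suc k) + + 1) * (a * u) * (b * d′))) (U-suc-suc n k) (D-suc n (suc k) k<L) ⟩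
      α n * ((+ 2 * 4× (suc k) + + 1) * (a * (- (4× n + + 4) * u)) * (b * (λ′ n * e)))
        ≡⟨ cong (λ K → α n * ((+ 2 * K + + 1) * (a * (- (4× n + + 4) * u)) * (b * (λ′ n * e)))) (4×-suc k) ⟩
      _ ≡⟨ identity P (4× n) (4× k) (λ′ n) a u b e ⟩
      _ ≡⟨ cong (λ K → λ′ n * (4× n + + 3 - P) * ((+ 2 * K + + 1) * (a * (u * (4× k - 4× n))) * (b * ((K + + 5 + 4× n) * e)))
                   + λ′ n * (a * ((K + + 1) * ((K + + 1) * (K + + 1) + P * (K + + 1) + P * P)) * b * (u * (4× k - 4× n) * e) - a * (Y k * b) * (u * ((K + + 5 + 4× n) * e)))) (sym (4×-suc k)) ⟩
      λ′ n * (4× n + + 3 - P) * ((+ 2 * 4× (suc k) + + 1) * (a * U n (suc k)) * (b * ((4× (suc k) + + 5 + 4× n) * e)))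
        + λ′ n * (G n (suc (suc k)) - a * (Y k * b) * (u * ((4× (suc k) + + 5 + 4× n) * e)))
        ≡⟨ cong₂ (λ bk dk → λ′ n * (4× n + + 3 - P) * ((+ 2 * 4× (suc k) + + 1) * (a * U n (suc k)) * (b * dk)) + λ′ n * (G n (suc (suc k)) - a * bk * (u * dk)))
                 (sym (tail-step Y (ℕₚ.<⇒≤ k<L))) (sym (tail-step (d n) k<L)) ⟩
      λ′ n * (4× n + + 3 - P) * t n (suc k) + λ′ n * (G n (suc (suc k)) - G n (suc k)) ∎
      where
      open ≡-Reasoning
      a = A (suc k)
      u = U n k
      b = B (suc k)
      e = D n (suc (suc k))
      identity : ∀ P N k l a u b d →
        ((N + + 4) * (N + + 4) - (N + + 4) * P + P * P) * ((+ 2 * (k + + 4) + + 1) * (a * (- (N + + 4) * u)) * (b * (l * d)))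
        ≡ l * (N + + 3 - P) * ((+ 2 * (k + + 4) + + 1) * (a * (u * (k - N))) * (b * ((k + + 4 + + 5 + N) * d)))
          + l * (a * ((k + + 4 + + 1) * ((k + + 4 + + 1) * (k + + 4 + + 1) + P * (k + + 4 + + 1) + P * P)) * b * (u * (k - N) * d)
                 - a * (((k + + 4) * ((k + + 4) * (k + + 4) - (k + + 4) * P + P * P)) * b) * (u * ((k + + 4 + + 5 + N) * d)))
      identity = solve-∀

    -- This is the certificate at k = n + 1, where `t n` and the upper `G` vanish through the factor
    -- 4n - 4n of `U`. It is separate because n + 1 may equal L, where `certificate` does not apply.
    certificate-top : ∀ n → n ℕ.< L → α n * t (suc n) (suc n) ≡ - (λ′ n * G n (suc n))
    certificate-top n n<L = begin
      α n * t (suc n) (suc n)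
        ≡⟨ cong (λ u → α n * ((+ 2 * 4× (suc n) + + 1) * (a * u) * (b * D (suc n) (suc n)))) (U-suc-suc n n) ⟩
      α n * ((+ 2 * 4× (suc n) + + 1) * (a * (- (4× n + + 4) * u)) * (b * D (suc n) (suc n)))
        ≡⟨ cong (λ K → α n * ((+ 2 * K + + 1) * (a * (- (4× n + + 4) * u)) * (b * D (suc n) (suc n)))) (4×-suc n) ⟩
      α n * ((+ 2 * (4× n + + 4) + + 1) * (a * (- (4× n + + 4) * u)) * (b * D (suc n) (suc n)))
        ≡⟨ identity P (4× n) a u b (D (suc n) (suc n)) ⟩
      - (a * (Y n * b) * (u * ((4× n + + 5 + (4× n + + 4)) * D (suc n) (suc n))))
        ≡⟨ cong₂ (λ bn K → - (a * bn * (u * ((4× n + + 5 + K) * D (suc n) (suc n))))) (sym (tail-step Y n<L)) (sym (4×-suc n)) ⟩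
      - (a * B n * (u * ((4× n + + 5 + 4× (suc n)) * D (suc n) (suc n))))
        ≡⟨ cong (λ d → - (a * B n * (u * d))) (trans (sym (tail-step (d (suc n)) n<L)) (D-suc n n n<L)) ⟩
      - (a * B n * (u * (λ′ n * D n (suc n))))
        ≡⟨ collect (a * B n) u (λ′ n) (D n (suc n)) ⟩
      - (λ′ n * G n (suc n)) ∎
      where
      open ≡-Reasoning
      a = A (suc n)
      u = U n n
      b = B (suc n)
      identity : ∀ P N a u b d →
        ((N + + 4) * (N + + 4) - (N + + 4) * P + P * P) * ((+ 2 * (N + + 4) + + 1) * (a * (- (N + + 4) * u)) * (b * d))
        ≡ - (a * (((N + + 4) * ((N + + 4) * (N + + 4) - (N + + 4) * P + P * P)) * b) * (u * ((N + + 5 + (N + + 4)) * d)))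
      identity = solve-∀
      collect : ∀ x u l d → - (x * (u * (l * d))) ≡ - (l * (x * (u * d)))
      collect = solve-∀

    recurrence : ∀ n → n ℕ.< L →
      α n * ∑ (suc (suc n)) (t (suc n)) ≡ λ′ n * (4× n + + 3 - P) * ∑ (suc n) (t n)
    recurrence n n<L = begin
      α n * (∑ (suc n) (t (suc n)) + t (suc n) (suc n))
        ≡⟨ ℤₚ.*-distribˡ-+ (α n) _ _ ⟩
      α n * ∑ (suc n) (t (suc n)) + α n * t (suc n) (suc n)
        ≡⟨ cong₂ _+_ (partial (suc n) n<L) (certificate-top n n<L) ⟩
      (λ′ n * (4× n + + 3 - P) * ∑ (suc n) (t n) + λ′ n * G n (suc n)) + - (λ′ n * G n (suc n))
        ≡⟨ cancel _ (λ′ n * G n (suc n)) ⟩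
      λ′ n * (4× n + + 3 - P) * ∑ (suc n) (t n) ∎
      where
      open ≡-Reasoning
      cancel : ∀ x y → x + y + - y ≡ x
      cancel = solve-∀
      combine : ∀ c l s t g g′ → c * s + l * g + (c * t + l * (g′ - g)) ≡ c * (s + t) + l * g′
      combine = solve-∀
      partial : ∀ k → k ℕ.≤ L → α n * ∑ k (t (suc n)) ≡ λ′ n * (4× n + + 3 - P) * ∑ k (t n) + λ′ n * G n k
      partial zero    _   = lemma (α n) (λ′ n * (4× n + + 3 - P)) (λ′ n)
        where
        lemma : ∀ a c l → a * + 0 ≡ c * + 0 + l * + 0
        lemma = solve-∀
      partial (suc k) k<L = trans (ℤₚ.*-distribˡ-+ (α n) _ _)
        (trans (cong₂ _+_ (partial k (ℕₚ.<⇒≤ k<L)) (certificate n k k<L))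
               (combine (λ′ n * (4× n + + 3 - P)) (λ′ n) (∑ k (t n)) (t n k) (G n k) (G n (suc k))))

    -- Induction by `recurrence` from the one-term sum at n = 0. The product of the α stays on the
    -- left, so nothing is divided; P and L are specialised only afterwards.
    closed-form : ∀ n → n ℕ.≤ L →
      ∏ n α * ∑ (suc n) (t n) ≡ ∏ n (λ m → λ′ m * (4× m + + 3 - P)) * (∏ L Y * ∏ L (λ j → 4× j + + 5))
    closed-form zero    _   = trans (lemma (B 0) (D 0 0)) (cong (+ 1 *_) (cong₂ _*_ (tail-full L Y)
      (trans (tail-full L (d 0)) (∏-cong L (λ j _ → ℤₚ.+-identityʳ (4× j + + 5))))))
      where
      lemma : ∀ b d → + 1 * (+ 0 + (+ 2 * + 0 + + 1) * (+ 1 * + 1) * (b * d)) ≡ + 1 * (b * d)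
      lemma = solve-∀
    closed-form (suc n) n<L = begin
      ∏ n α * α n * ∑ (suc (suc n)) (t (suc n))
        ≡⟨ ℤₚ.*-assoc (∏ n α) (α n) _ ⟩
      ∏ n α * (α n * ∑ (suc (suc n)) (t (suc n)))
        ≡⟨ cong (∏ n α *_) (recurrence n n<L) ⟩
      ∏ n α * (c * ∑ (suc n) (t n))
        ≡⟨ swap (∏ n α) c (∑ (suc n) (t n)) ⟩
      c * (∏ n α * ∑ (suc n) (t n))
        ≡⟨ cong (c *_) (closed-form n (ℕₚ.<⇒≤ n<L)) ⟩
      c * (∏ n (λ m → λ′ m * (4× m + + 3 - P)) * rest)
        ≡⟨ regroup c (∏ n (λ m → λ′ m * (4× m + + 3 - P))) rest ⟩
      ∏ n (λ m → λ′ m * (4× m + + 3 - P)) * c * rest ∎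
      where
      open ≡-Reasoning
      c = λ′ n * (4× n + + 3 - P)
      rest = ∏ L Y * ∏ L (λ j → 4× j + + 5)
      swap : ∀ a c s → a * (c * s) ≡ c * (a * s)
      swap = solve-∀
      regroup : ∀ c x r → c * (x * r) ≡ x * c * r
      regroup = solve-∀

  -- The double factorial (2m - 1)!!.
  O : ℕ → ℤ
  O m = ∏ m (λ i → + 2 * + i + + 1)

  double-factorial : ∀ m → + ((2 ℕ.* m) !) ≡ (+ 2) ^ m * + (m !) * O m
  double-factorial zero    = refl
  double-factorial (suc m) = begin
    + ((2 ℕ.* suc m) !)
      ≡⟨ cong (λ k → + (k !)) (cong suc (ℕₚ.+-suc m (m ℕ.+ 0))) ⟩
    + (suc (suc (2 ℕ.* m)) ℕ.* (suc (2 ℕ.* m) ℕ.* (2 ℕ.* m) !))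
      ≡⟨ trans (ℤₚ.pos-* (2 ℕ.+ 2 ℕ.* m) ((1 ℕ.+ 2 ℕ.* m) ℕ.* (2 ℕ.* m) !)) (cong (+ (2 ℕ.+ 2 ℕ.* m) *_) (ℤₚ.pos-* (1 ℕ.+ 2 ℕ.* m) ((2 ℕ.* m) !))) ⟩
    (+ 2 + + (2 ℕ.* m)) * ((+ 1 + + (2 ℕ.* m)) * + ((2 ℕ.* m) !))
      ≡⟨ cong₂ (λ a b → (+ 2 + a) * ((+ 1 + a) * b)) (ℤₚ.pos-* 2 m) (double-factorial m) ⟩
    (+ 2 + + 2 * + m) * ((+ 1 + + 2 * + m) * ((+ 2) ^ m * + (m !) * O m))
      ≡⟨ lemma (+ m) ((+ 2) ^ m) (+ (m !)) (O m) ⟩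
    (+ 2 * (+ 2) ^ m) * ((+ 1 + + m) * + (m !)) * (O m * (+ 2 * + m + + 1))
      ≡⟨ cong (λ f → (+ 2 * (+ 2) ^ m) * f * O (suc m)) (sym (ℤₚ.pos-* (suc m) (m !))) ⟩
    (+ 2) ^ suc m * + (suc m !) * O (suc m) ∎
    where
    open ≡-Reasoning
    lemma : ∀ m t f o → (+ 2 + + 2 * m) * ((+ 1 + + 2 * m) * (t * f * o)) ≡ (+ 2 * t) * ((+ 1 + m) * f) * (o * (+ 2 * m + + 1))
    lemma = solve-∀

  !-as-∏ : ∀ n → ∏ n (λ i → + suc i) ≡ + (n !)
  !-as-∏ zero    = refl
  !-as-∏ (suc n) = trans (cong (_* + suc n) (!-as-∏ n))
    (trans (ℤₚ.*-comm (+ (n !)) (+ suc n)) (sym (ℤₚ.pos-* (suc n) (n !))))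

  ∏-scale : ∀ n c f → ∏ n (λ i → c * f i) ≡ c ^ n * ∏ n f
  ∏-scale n c f = trans (∏-* n (λ _ → c) f) (cong (_* ∏ n f) (∏-const n c))

  pos-∸ : ∀ {m n} → n ℕ.≤ m → + (m ℕ.∸ n) ≡ + m - + n
  pos-∸ {m} {n} n≤m = sym (trans (cong (λ k → + k - + n) (sym (ℕₚ.m∸n+n≡m n≤m))) (lemma (+ (m ℕ.∸ n)) (+ n)))
    where
    lemma : ∀ a b → a + b - b ≡ a
    lemma = solve-∀

  ∑-antisymmetric : ∀ n h → (∀ k → k ℕ.≤ n → h (n ℕ.∸ k) ≡ - h k) → ∑ (suc n) h ≡ + 0
  ∑-antisymmetric n h anti = ℤₚ.*-cancelˡ-≡ (+ 2) s (+ 0) (begin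
    + 2 * s
      ≡⟨ double s ⟩
    s + s
      ≡⟨ cong (_+ s) (trans (∑-reverse (suc n) h) (trans (∑-cong (suc n) (λ k k≤n → anti k (ℕ.s≤s⁻¹ k≤n))) (∑-neg (suc n) h))) ⟩
    - s + s
      ≡⟨ ℤₚ.+-inverseˡ s ⟩
    + 0 ∎)
    where
    open ≡-Reasoning
    s = ∑ (suc n) h
    double : ∀ s → + 2 * s ≡ s + s
    double = solve-∀

  ∏-zero : ∀ {m} k {f} j → j ℕ.< k → f j ≈ + 0 [ m ] → ∏ k f ≈ + 0 [ m ]
  ∏-zero (suc k) {f} j j<1+k h with j ℕ.≟ k
  ... | yes refl = ≈-trans (*-≈ˡ (∏ k f) h) (≡⇒≈ (ℤₚ.*-zeroʳ (∏ k f)))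
  ... | no j≢k = ≈-trans (*-≈ʳ (f k) (∏-zero k j (ℕₚ.≤∧≢⇒< (ℕ.s≤s⁻¹ j<1+k) j≢k) h)) (≡⇒≈ (ℤₚ.*-zeroˡ (f k)))

  -- The sum modulo p⁴ in closed form

  module TruncatedSum {p : ℕ} (pr : Prime p) (3<p : 3 ℕ.< p) (n : ℕ) (n<p : n ℕ.< p)
                      (R≈0 : + 4 * + n + + 1 ≈ + 0 [ + p ]) where
    open ModPrime pr

    R : ℤ
    R = + 4 * + n + + 1

    y z : ℕ → ℤ
    y j = + 4 * + j + + 4
    z j = + 4 * + j + + 1

    y≡4* : ∀ j → y j ≡ + 4 * + suc j
    y≡4* j = lemma (+ j)
      where
      lemma : ∀ j → + 4 * j + + 4 ≡ + 4 * (+ 1 + j)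
      lemma = solve-∀

    ∏y : ∀ k → ∏ k y ≡ (+ 4) ^ k * + (k !)
    ∏y k = trans (∏-cong k (λ j _ → y≡4* j)) (trans (∏-scale k (+ 4) (λ j → + suc j)) (cong ((+ 4) ^ k *_) (!-as-∏ k)))

    nz-2 : Nz (+ 2)
    nz-2 = nz-small (s≤s z≤n) (ℕₚ.<-trans (s≤s (s≤s (s≤s z≤n))) 3<p)

    nz-4 : Nz (+ 4)
    nz-4 = nz-* nz-2 nz-2

    nz-y : ∀ {j} → suc j ℕ.< p → Nz (y j)
    nz-y {j} j<p = subst Nz (sym (y≡4* j)) (nz-* nz-4 (nz-small (s≤s z≤n) j<p))

    -- Q = 0 gives the fourth powers of the original sum, Q = R³ the summable deformation.
    numerator denominator : ℤ → ℕ → ℤ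
    numerator   Q j = z j * (z j * z j * z j - Q)
    denominator Q j = y j * (y j * y j * y j + Q)

    term : ℤ → ℕ → ℤ
    term Q k = (+ 8 * + k + + 1) * (∏ k (numerator Q) * tail n (denominator Q) k)

    R³ : ℤ
    R³ = R * R * R

    open Dougall R n using (t; α; Y; λ′; 4×; A; U; B; D; d; closed-form) renaming (Z to Z′)

    -- At Q = R³ the difference and the sum of cubes split off z - R = 4j - 4n and y + R = 4j + 5 +
    -- 4n, the factors of `U` and `D`, once P and L of the summation are set to R and n.
    term≡t : ∀ k → term R³ k ≡ t n k
    term≡t k = trans (cong₂ _*_ (lemma (+ k)) (cong₂ _*_
      (trans (∏-cong k (λ j _ → split-numerator (+ j) (+ n))) (∏-* k Z′ (λ j → 4× j - 4× n)))
      (trans (∏-cong (n ℕ.∸ k) (λ i _ → split-denominator (+ (n ℕ.∸ suc i)) (+ n))) (∏-* (n ℕ.∸ k) (λ i → Y (n ℕ.∸ suc i)) (λ i → d n (n ℕ.∸ suc i))))))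
      (sym (ℤₚ.*-assoc (+ 2 * 4× k + + 1) (A k * U n k) (B k * D n k)))
      where
      lemma : ∀ k → + 8 * k + + 1 ≡ + 2 * (+ 4 * k) + + 1
      lemma = solve-∀
      split-numerator : ∀ j n → (+ 4 * j + + 1) * ((+ 4 * j + + 1) * (+ 4 * j + + 1) * (+ 4 * j + + 1) - (+ 4 * n + + 1) * (+ 4 * n + + 1) * (+ 4 * n + + 1))
        ≡ (+ 4 * j + + 1) * ((+ 4 * j + + 1) * (+ 4 * j + + 1) + (+ 4 * n + + 1) * (+ 4 * j + + 1) + (+ 4 * n + + 1) * (+ 4 * n + + 1)) * (+ 4 * j - + 4 * n)
      split-numerator = solve-∀
      split-denominator : ∀ j n → (+ 4 * j + + 4) * ((+ 4 * j + + 4) * (+ 4 * j + + 4) * (+ 4 * j + + 4) + (+ 4 * n + + 1) * (+ 4 * n + + 1) * (+ 4 * n + + 1))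
        ≡ (+ 4 * j + + 4) * ((+ 4 * j + + 4) * (+ 4 * j + + 4) - (+ 4 * j + + 4) * (+ 4 * n + + 1) + (+ 4 * n + + 1) * (+ 4 * n + + 1)) * (+ 4 * j + + 5 + + 4 * n)
      split-denominator = solve-∀

    nz-α : ∀ m → m ℕ.< n → Nz (α m)
    nz-α m m<n = nz-≈ (≈-sym (≈-trans (+-≈ (-‿≈ (≈-refl {a = y m * y m}) (*-≈ˡ (y m) R≈0)) (*-≈ R≈0 R≈0)) (≡⇒≈ (lemma (y m)))))
                      (nz-* (nz-y m+1<p) (nz-y m+1<p))
      where
      m+1<p = ℕₚ.≤-<-trans m<n n<p
      lemma : ∀ y → y * y - y * + 0 + + 0 * + 0 ≡ y * y
      lemma = solve-∀

    ∏[16i²-R²] : ℤ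
    ∏[16i²-R²] = ∏ n (λ i → + 16 * (+ suc i * + suc i) - R * R)

    -- The factors R + 4i come from `λ′`, and R together with the R - 4i from ∏ (4j + 5) read
    -- backwards. The 4m + 3 - R are -2 times odd numbers: with n! they form (2n)!, and their signs
    -- turn the (R + 4i)(R - 4i) into 16i² - R².
    closed : ℤ
    closed = (+ 4) ^ n * (R * ∏[16i²-R²] * + ((2 ℕ.* n) !))

    private
      ∏[R-4i] : ∏ n (λ j → + 4 * + j + + 5) ≡ R * ∏ n (λ i → R - + 4 * + suc i)
      ∏[R-4i] = begin
        ∏ n (λ j → + 4 * + j + + 5)
          ≡⟨ ∏-reverse n _ ⟩
        ∏ n (λ i → + 4 * + (n ℕ.∸ suc i) + + 5)
          ≡⟨ ∏-cong n (λ i i<n → trans (cong (λ k → + 4 * k + + 5) (pos-∸ i<n)) (lemma (+ n) (+ i))) ⟩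
        ∏ n (λ i → R - + 4 * + i)
          ≡⟨ sym (ℤₚ.*-identityʳ _) ⟩
        ∏ n (λ i → R - + 4 * + i) * + 1
          ≡⟨ cong (∏ n (λ i → R - + 4 * + i) *_) (last (+ n)) ⟩
        ∏ (suc n) (λ i → R - + 4 * + i)
          ≡⟨ ∏-head n _ ⟩
        (R - + 4 * + 0) * ∏ n (λ i → R - + 4 * + suc i)
          ≡⟨ cong (_* ∏ n (λ i → R - + 4 * + suc i)) (ℤₚ.+-identityʳ R) ⟩
        R * ∏ n (λ i → R - + 4 * + suc i) ∎
        where
        open ≡-Reasoning
        lemma : ∀ n i → + 4 * (n - (+ 1 + i)) + + 5 ≡ + 4 * n + + 1 - + 4 * i
        lemma = solve-∀
        last : ∀ n → + 1 ≡ + 4 * n + + 1 - + 4 * n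
        last = solve-∀

      ∏[4m+3-R] : ∏ n (λ m → + 4 * + m + + 3 - R) ≡ (- + 1) ^ n * ((+ 2) ^ n * O n)
      ∏[4m+3-R] = begin
        ∏ n (λ m → + 4 * + m + + 3 - R)
          ≡⟨ ∏-reverse n _ ⟩
        ∏ n (λ i → + 4 * + (n ℕ.∸ suc i) + + 3 - R)
          ≡⟨ ∏-cong n (λ i i<n → trans (cong (λ k → + 4 * k + + 3 - R) (pos-∸ i<n)) (lemma (+ n) (+ i))) ⟩
        ∏ n (λ i → - + 1 * (+ 2 * (+ 2 * + i + + 1)))
          ≡⟨ trans (∏-scale n (- + 1) _) (cong ((- + 1) ^ n *_) (∏-scale n (+ 2) _)) ⟩
        (- + 1) ^ n * ((+ 2) ^ n * O n) ∎
        where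
        open ≡-Reasoning
        lemma : ∀ n i → + 4 * (n - (+ 1 + i)) + + 3 - (+ 4 * n + + 1) ≡ - + 1 * (+ 2 * (+ 2 * i + + 1))
        lemma = solve-∀

      closed≡ : ∏ n (λ m → λ′ m * (4× m + + 3 - R)) * (∏ n Y * ∏ n (λ j → 4× j + + 5)) ≡ ∏ n α * closed
      closed≡ = begin
        ∏ n (λ m → λ′ m * (4× m + + 3 - R)) * (∏ n Y * ∏ n (λ j → 4× j + + 5))
          ≡⟨ cong₂ _*_ (trans (∏-* n λ′ (λ m → 4× m + + 3 - R)) (cong₂ _*_ (∏-cong n (λ m _ → lemma (+ n) (+ m))) ∏[4m+3-R]))
                       (cong₂ _*_ (trans (∏-* n y α) (cong (_* ∏ n α) (∏y n))) ∏[R-4i]) ⟩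
        f * (s * (w * O n)) * ((v * + (n !)) * ∏ n α * (R * g))
          ≡⟨ regroup f s w (O n) v (+ (n !)) (∏ n α) R g ⟩
        ∏ n α * (v * (R * (s * (f * g)) * (w * + (n !) * O n)))
          ≡⟨ cong₂ (λ x q → ∏ n α * (v * (R * x * q))) signs (sym (double-factorial n)) ⟩
        ∏ n α * closed ∎
        where
        open ≡-Reasoning
        f = ∏ n (λ m → R + + 4 * + suc m)
        g = ∏ n (λ i → R - + 4 * + suc i)
        s = (- + 1) ^ n
        w = (+ 2) ^ n
        v = (+ 4) ^ n
        lemma : ∀ n m → + 4 * n + + 5 + + 4 * m ≡ + 4 * n + + 1 + + 4 * (+ 1 + m)
        lemma = solve-∀
        regroup : ∀ f s w o v k a r g → f * (s * (w * o)) * ((v * k) * a * (r * g)) ≡ a * (v * (r * (s * (f * g)) * (w * k * o)))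
        regroup = solve-∀
        signs : s * (f * g) ≡ ∏[16i²-R²]
        signs = trans (cong (s *_) (sym (∏-* n _ _))) (trans (sym (∏-scale n (- + 1) _)) (∏-cong n (λ i _ → square R (+ suc i))))
          where
          square : ∀ r x → - + 1 * ((r + + 4 * x) * (r - + 4 * x)) ≡ + 16 * (x * x) - r * r
          square = solve-∀

    ∑term-R³ : ∑ (suc n) (term R³) ≈ closed [ P⁴ ]
    ∑term-R³ = ≈-cancel₄ (nz-∏ n nz-α) (≡⇒≈ (trans (cong (∏ n α *_) (∑-cong (suc n) (λ k _ → term≡t k))) (trans (closed-form n ℕₚ.≤-refl) closed≡)))

    -- A and A* are two deformations of A₀ and A*₀ by multiples of P³; as A₀ ≈ A*₀ modulo P, the two
    -- first-order deformations agree modulo P, hence A − A₀ and A* − A*₀ agree modulo P⁴.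
    record Deformations (A A₀ A* A*₀ : ℤ) : Set where
      constructor deformations
      field
        first  : A ≈ A₀ [ P³ ]
        second : A* ≈ A*₀ [ P³ ]
        bases  : A₀ ≈ A*₀ [ P ]
        match  : A - A₀ ≈ A* - A*₀ [ P⁴ ]

    private
      small-* : ∀ {a a* b b*} → a ≈ + 0 [ P³ ] → a ≈ a* [ P⁴ ] → b ≈ b* [ P ] → a * b ≈ a* * b* [ P⁴ ]
      small-* {a} {a*} {b} {b*} a0 aa bb = ≈-trans
        (≈-from-difference (≈-trans (≡⇒≈ (lemma a b b*)) (≈-zero-* a0 (difference-≈0 bb)))) (*-≈ʳ b* aa)
        where
        lemma : ∀ a b c → a * b - a * c ≡ a * (b - c)
        lemma = solve-∀

      lower-P³ : ∀ {a b} → a ≈ b [ P³ ] → a ≈ b [ P ]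
      lower-P³ h = ≈-lower (≈-lower h)

    -- Product rule AB - A₀B₀ = (A - A₀)B + (B - B₀)A₀: each difference already carries P³, so its
    -- cofactor may be exchanged for anything congruent to it modulo P.
    deformations-* : ∀ {A A₀ A* A*₀ B B₀ B* B*₀} → Deformations A A₀ A* A*₀ → Deformations B B₀ B* B*₀ →
      Deformations (A * B) (A₀ * B₀) (A* * B*) (A*₀ * B*₀)
    deformations-* {A} {A₀} {A*} {A*₀} {B} {B₀} {B*} {B*₀} (deformations f s b m) (deformations f′ s′ b′ m′) = deformations
      (*-≈ f f′) (*-≈ s s′) (*-≈ b b′)
      (≈-trans (≡⇒≈ (lemma A A₀ B B₀)) (≈-trans
        (+-≈ (small-* (difference-≈0 f) m (≈-trans (lower-P³ f′) (≈-trans b′ (≈-sym (lower-P³ s′)))))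
             (small-* (difference-≈0 f′) m′ b))
        (≡⇒≈ (sym (lemma A* A*₀ B* B*₀)))))
      where
      lemma : ∀ a a₀ b b₀ → a * b - a₀ * b₀ ≡ (a - a₀) * b + (b - b₀) * a₀
      lemma = solve-∀

    deformations-∏ : ∀ k {f f₀ f* f*₀} → (∀ j → j ℕ.< k → Deformations (f j) (f₀ j) (f* j) (f*₀ j)) →
      Deformations (∏ k f) (∏ k f₀) (∏ k f*) (∏ k f*₀)
    deformations-∏ zero    h = deformations ≈-refl ≈-refl ≈-refl ≈-refl
    deformations-∏ (suc k) h = deformations-* (deformations-∏ k (λ j j<k → h j (ℕₚ.m<n⇒m<1+n j<k))) (h k ℕₚ.≤-refl)

    private
      v : ℤ → ℕ → ℤ
      v Q i = denominator Q (n ℕ.∸ suc i)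

      -- The comparison term. Modulo P, the numerator at j equals the denominator at n - 1 - j when
      -- Q = 0, and 8k + 1 equals 8k - 4n; after these replacements the term is exactly odd under k
      -- ↦ n - k, whatever Q is.
      term* : ℤ → ℕ → ℤ
      term* Q k = (+ 8 * + k - + 4 * + n) * (∏ k (v Q) * ∏ (n ℕ.∸ k) (v Q))

      R³≈0 : R³ ≈ + 0 [ P³ ]
      R³≈0 = ≈-zero-* (≈-zero-* R≈0 R≈0) R≈0

      deformations-numerator : ∀ j → j ℕ.< n → Deformations (numerator R³ j) (numerator (+ 0) j) (v R³ j) (v (+ 0) j)
      deformations-numerator j j<n = deformations
        (zeroed₁ (z j)) (zeroed₂ w) bases
        (≈-trans (≡⇒≈ (lemma₁ (z j) R³)) (≈-trans (small-* R³≈0 ≈-refl (≈-trans (neg-≈ z≈-w) (≡⇒≈ (ℤₚ.neg-involutive w)))) (≡⇒≈ (sym (lemma₂ w R³)))))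
        where
        w = y (n ℕ.∸ suc j)
        z≈-w : z j ≈ - w [ P ]
        z≈-w = ≈-trans (≈-trans (≡⇒≈ (split (+ n) (+ j))) (+-≈ R≈0 ≈-refl))
          (≡⇒≈ (trans (ℤₚ.+-identityˡ _) (cong (λ k → - (+ 4 * k + + 4)) (sym (pos-∸ j<n)))))
          where
          split : ∀ n j → + 4 * j + + 1 ≡ + 4 * n + + 1 + - (+ 4 * (n - (+ 1 + j)) + + 4)
          split = solve-∀
        bases : numerator (+ 0) j ≈ v (+ 0) j [ P ]
        bases = ≈-trans (*-≈ z≈-w (-‿≈ (*-≈ (*-≈ z≈-w z≈-w) z≈-w) (≈-refl {a = + 0}))) (≡⇒≈ (sign w))
          where
          sign : ∀ w → - w * (- w * - w * - w - + 0) ≡ w * (w * w * w + + 0)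
          sign = solve-∀
        lemma₁ : ∀ x r → x * (x * x * x - r) - x * (x * x * x - + 0) ≡ r * - x
        lemma₁ = solve-∀
        lemma₂ : ∀ x r → x * (x * x * x + r) - x * (x * x * x + + 0) ≡ r * x
        lemma₂ = solve-∀
        zeroed₁ : ∀ x → x * (x * x * x - R³) ≈ x * (x * x * x - + 0) [ P³ ]
        zeroed₁ x = *-≈ˡ x (-‿≈ (≈-refl {a = x * x * x}) R³≈0)
        zeroed₂ : ∀ x → x * (x * x * x + R³) ≈ x * (x * x * x + + 0) [ P³ ]
        zeroed₂ x = *-≈ˡ x (+-≈ (≈-refl {a = x * x * x}) R³≈0)

      deformations-denominator : ∀ i → Deformations (v R³ i) (v (+ 0) i) (v R³ i) (v (+ 0) i)
      deformations-denominator i = deformations z₂ z₂ ≈-refl ≈-refl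
        where
        w = y (n ℕ.∸ suc i)
        z₂ : v R³ i ≈ v (+ 0) i [ P³ ]
        z₂ = *-≈ˡ w (+-≈ (≈-refl {a = w * w * w}) R³≈0)

      deformations-term : ∀ k → k ℕ.≤ n → Deformations (term R³ k) (term (+ 0) k) (term* R³ k) (term* (+ 0) k)
      deformations-term k k≤n = deformations-* coefficient (deformations-*
        (deformations-∏ k (λ j j<k → deformations-numerator j (ℕₚ.<-≤-trans j<k k≤n)))
        (deformations-∏ (n ℕ.∸ k) (λ i _ → deformations-denominator i)))
        where
        coefficient : Deformations (+ 8 * + k + + 1) (+ 8 * + k + + 1) (+ 8 * + k - + 4 * + n) (+ 8 * + k - + 4 * + n)
        coefficient = deformations ≈-refl ≈-refl
          (≈-trans (≡⇒≈ (lemma (+ k) (+ n))) (≈-trans (+-≈ R≈0 ≈-refl) (≡⇒≈ (ℤₚ.+-identityˡ _))))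
          (≡⇒≈ (trans (ℤₚ.+-inverseʳ (+ 8 * + k + + 1)) (sym (ℤₚ.+-inverseʳ (+ 8 * + k - + 4 * + n)))))
          where
          lemma : ∀ k n → + 8 * k + + 1 ≡ + 4 * n + + 1 + (+ 8 * k - + 4 * n)
          lemma = solve-∀

      ∑term*≡0 : ∀ Q → ∑ (suc n) (term* Q) ≡ + 0
      ∑term*≡0 Q = ∑-antisymmetric n (term* Q) anti
        where
        anti : ∀ k → k ℕ.≤ n → term* Q (n ℕ.∸ k) ≡ - term* Q k
        anti k k≤n = trans (cong₂ (λ a b → (+ 8 * a - + 4 * + n) * (∏ (n ℕ.∸ k) (v Q) * ∏ b (v Q))) (pos-∸ k≤n) (ℕₚ.m∸[m∸n]≡n k≤n))
          (lemma (+ k) (+ n) (∏ (n ℕ.∸ k) (v Q)) (∏ k (v Q)))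
          where
          lemma : ∀ k n a b → (+ 8 * (n - k) - + 4 * n) * (a * b) ≡ - ((+ 8 * k - + 4 * n) * (b * a))
          lemma = solve-∀

      ∑-difference : ∀ m f g → ∑ m (λ k → f k - g k) ≡ ∑ m f - ∑ m g
      ∑-difference m f g = trans (∑-+ m f (λ k → - g k)) (cong (λ z → ∑ m f + z) (∑-neg m g))

    ∑term-0 : ∑ (suc n) (term (+ 0)) ≈ closed [ P⁴ ]
    ∑term-0 = ≈-trans (≈-sym (≈-from-difference (begin
      ∑ (suc n) (term R³) - ∑ (suc n) (term (+ 0))
        ≡⟨ sym (∑-difference (suc n) (term R³) (term (+ 0))) ⟩
      ∑ (suc n) (λ k → term R³ k - term (+ 0) k)
        ≈⟨ ∑-≈ (suc n) (λ k k≤n → Deformations.match (deformations-term k (ℕ.s≤s⁻¹ k≤n))) ⟩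
      ∑ (suc n) (λ k → term* R³ k - term* (+ 0) k)
        ≡⟨ ∑-difference (suc n) (term* R³) (term* (+ 0)) ⟩
      ∑ (suc n) (term* R³) - ∑ (suc n) (term* (+ 0))
        ≡⟨ cong₂ _-_ (∑term*≡0 R³) (∑term*≡0 (+ 0)) ⟩
      + 0 ∎))) ∑term-R³
      where open ≈-Reasoning P⁴

    fourth : ℤ → ℤ
    fourth a = a * a * a * a

    full-sum : ℤ
    full-sum = ∑ p (λ k → (+ 8 * + k + + 1) * (∏ k (fourth ∘ z) * tail (p ℕ.∸ 1) (fourth ∘ y) k))

    -- Terms with k > n contain the factor z_n⁴ = R⁴ and vanish; for k ≤ n the denominators beyond n
    -- are a common factor.
    full-sum≈ : full-sum ≈ closed * tail (p ℕ.∸ 1) (fourth ∘ y) n [ P⁴ ]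
    full-sum≈ = begin
      ∑ p f
        ≡⟨ cong (λ m → ∑ m f) (sym (ℕₚ.m+[n∸m]≡n n<p)) ⟩
      ∑ (suc n ℕ.+ (p ℕ.∸ suc n)) f
        ≡⟨ ∑-split (suc n) (p ℕ.∸ suc n) f ⟩
      ∑ (suc n) f + ∑ (p ℕ.∸ suc n) (λ i → f (suc n ℕ.+ i))
        ≈⟨ +-≈ (≡⇒≈ (trans (∑-cong (suc n) (λ k k≤n → head k (ℕ.s≤s⁻¹ k≤n))) (∑-*ʳ (suc n) rest (term (+ 0)))))
               (∑-zero (p ℕ.∸ suc n) (λ i _ → vanish i)) ⟩
      ∑ (suc n) (term (+ 0)) * rest + + 0
        ≈⟨ +-≈ (*-≈ʳ rest ∑term-0) ≈-refl ⟩
      closed * rest + + 0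
        ≡⟨ ℤₚ.+-identityʳ _ ⟩
      closed * rest ∎
      where
      open ≈-Reasoning P⁴
      rest = tail (p ℕ.∸ 1) (fourth ∘ y) n
      f : ℕ → ℤ
      f k = (+ 8 * + k + + 1) * (∏ k (fourth ∘ z) * tail (p ℕ.∸ 1) (fourth ∘ y) k)
      n≤p-1 : n ℕ.≤ p ℕ.∸ 1
      n≤p-1 = ℕₚ.∸-monoˡ-≤ 1 n<p
      head : ∀ k → k ℕ.≤ n → f k ≡ term (+ 0) k * rest
      head k k≤n = trans (cong₂ (λ a b → (+ 8 * + k + + 1) * (a * b)) (∏-cong k (λ j _ → lemma₁ (z j)))
          (trans (tail-split n (fourth ∘ y) k≤n n≤p-1) (cong (_* rest) (∏-cong (n ℕ.∸ k) (λ i _ → lemma₂ (y (n ℕ.∸ suc i)))))))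
        (regroup (+ 8 * + k + + 1) (∏ k (numerator (+ 0))) (tail n (denominator (+ 0)) k) rest)
        where
        lemma₁ : ∀ x → x * x * x * x ≡ x * (x * x * x - + 0)
        lemma₁ = solve-∀
        lemma₂ : ∀ x → x * x * x * x ≡ x * (x * x * x + + 0)
        lemma₂ = solve-∀
        regroup : ∀ c a b r → c * (a * (b * r)) ≡ c * (a * b) * r
        regroup = solve-∀
      vanish : ∀ i → f (suc n ℕ.+ i) ≈ + 0 [ P⁴ ]
      vanish i = ≈-trans (*-≈ˡ c (*-≈ʳ b (∏-zero (suc n ℕ.+ i) n (s≤s (ℕₚ.m≤m+n n i)) (≈-zero-* (≈-zero-* (≈-zero-* R≈0 R≈0) R≈0) R≈0))))
                         (≡⇒≈ (lemma c b))
        where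
        c = + 8 * + (suc n ℕ.+ i) + + 1
        b = tail (p ℕ.∸ 1) (fourth ∘ y) (suc n ℕ.+ i)
        lemma : ∀ c b → c * (+ 0 * b) ≡ + 0
        lemma = solve-∀

    full-denominator : ∏ (p ℕ.∸ 1) (fourth ∘ y) ≡ ∏ n (fourth ∘ y) * tail (p ℕ.∸ 1) (fourth ∘ y) n
    full-denominator = trans (sym (tail-full (p ℕ.∸ 1) (fourth ∘ y)))
      (trans (tail-split n (fourth ∘ y) z≤n (ℕₚ.∸-monoˡ-≤ 1 n<p)) (cong (_* tail (p ℕ.∸ 1) (fourth ∘ y) n) (tail-full n (fourth ∘ y))))

-- Shifted factorials and their reflections

module ShiftedProducts where

  open IntegerCongruences
  open import Data.Integer using (_+_; _*_; _-_; -_; _^_)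

  half-shifted : ℤ → ℕ → ℤ
  half-shifted P k = ∏ k (λ i → + 2 * + suc i - P)

  -- With P = 2(a + b) + 1, the last b factors 2i - P are the negatives of 1, 3, ..., 2b - 1.
  half-shifted-split : ∀ a b {P} → P ≡ + 2 * (+ a + + b) + + 1 →
    half-shifted P (a ℕ.+ b) ≡ half-shifted P a * ((- + 1) ^ b * O b)
  half-shifted-split a b {P} refl = trans (∏-split a b _) (cong (half-shifted P a *_) (begin
    ∏ b (λ i → + 2 * + suc (a ℕ.+ i) - P)
      ≡⟨ ∏-reverse b _ ⟩
    ∏ b (λ i → + 2 * + suc (a ℕ.+ (b ℕ.∸ suc i)) - P)
      ≡⟨ ∏-cong b (λ i i<b → trans (cong (λ k → + 2 * (+ 1 + (+ a + k)) - P) (pos-∸ i<b)) (lemma (+ a) (+ b) (+ i))) ⟩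
    ∏ b (λ i → - + 1 * (+ 2 * + i + + 1))
      ≡⟨ ∏-scale b (- + 1) _ ⟩
    (- + 1) ^ b * O b ∎))
    where
    open ≡-Reasoning
    lemma : ∀ a b i → + 2 * (+ 1 + (a + (b - (+ 1 + i)))) - (+ 2 * (a + b) + + 1) ≡ - + 1 * (+ 2 * i + + 1)
    lemma = solve-∀

  factorial-nonzero : ∀ n → ℤ.NonZero (+ (n !))
  factorial-nonzero n = ℤ.≢-nonZero (λ e → ℕ.≢-nonZero⁻¹ (n !) {{n ℕₚ.!≢0}} (ℤₚ.+-injective e))

  upper-half : ∀ M → ∏ M (λ i → + suc (M ℕ.+ i)) ≡ (+ 2) ^ M * O M
  upper-half M = ℤₚ.*-cancelˡ-≡ (+ (M !)) _ _ {{factorial-nonzero M}} (begin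
    + (M !) * ∏ M (λ i → + suc (M ℕ.+ i))
      ≡⟨ cong (_* ∏ M (λ i → + suc (M ℕ.+ i))) (sym (!-as-∏ M)) ⟩
    ∏ M (λ i → + suc i) * ∏ M (λ i → + suc (M ℕ.+ i))
      ≡⟨ sym (∏-split M M (λ i → + suc i)) ⟩
    ∏ (M ℕ.+ M) (λ i → + suc i)
      ≡⟨ !-as-∏ (M ℕ.+ M) ⟩
    + ((M ℕ.+ M) !)
      ≡⟨ cong (λ k → + ((M ℕ.+ k) !)) (sym (ℕₚ.+-identityʳ M)) ⟩
    + ((2 ℕ.* M) !)
      ≡⟨ double-factorial M ⟩
    (+ 2) ^ M * + (M !) * O M
      ≡⟨ lemma ((+ 2) ^ M) (+ (M !)) (O M) ⟩
    + (M !) * ((+ 2) ^ M * O M) ∎)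
    where
    open ≡-Reasoning
    lemma : ∀ a b c → a * b * c ≡ b * (a * c)
    lemma = solve-∀

  shifted : ℤ → ℕ → ℤ
  shifted P k = ∏ k (λ i → + suc i + P)

  shifted-reflect : ∀ a b {P} → P ≡ + a + + b + + 1 → shifted (- P) b ≡ (- + 1) ^ b * ∏ b (λ i → + suc (a ℕ.+ i))
  shifted-reflect a b {P} refl = begin
    ∏ b (λ i → + suc i + - P)
      ≡⟨ ∏-reverse b _ ⟩
    ∏ b (λ i → + suc (b ℕ.∸ suc i) + - P)
      ≡⟨ ∏-cong b (λ i i<b → trans (cong (λ k → + 1 + k + - P) (pos-∸ i<b)) (lemma (+ a) (+ b) (+ i))) ⟩
    ∏ b (λ i → - + 1 * + suc (a ℕ.+ i))
      ≡⟨ ∏-scale b (- + 1) _ ⟩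
    (- + 1) ^ b * ∏ b (λ i → + suc (a ℕ.+ i)) ∎
    where
    open ≡-Reasoning
    lemma : ∀ a b i → + 1 + (b - (+ 1 + i)) + - (a + b + + 1) ≡ - + 1 * (+ 1 + (a + i))
    lemma = solve-∀

  -- Both sides are (-1)^M (2M)!/M!: the 2i - P are the negated odd numbers below P, the i - P the
  -- negated upper half of 1, ..., 2M. Expanding the two sides p-adically is what pins down powers
  -- of 2.
  half-shifted≡shifted : ∀ M {P} → P ≡ + 2 * + M + + 1 → (+ 2) ^ M * half-shifted P M ≡ shifted (- P) M
  half-shifted≡shifted M {P} refl = begin
    (+ 2) ^ M * half-shifted P M
      ≡⟨ cong ((+ 2) ^ M *_) (half-shifted-split 0 M (cong (λ k → + 2 * k + + 1) (sym (ℤₚ.+-identityˡ (+ M))))) ⟩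
    (+ 2) ^ M * (+ 1 * ((- + 1) ^ M * O M))
      ≡⟨ lemma ((+ 2) ^ M) ((- + 1) ^ M) (O M) ⟩
    (- + 1) ^ M * ((+ 2) ^ M * O M)
      ≡⟨ cong ((- + 1) ^ M *_) (sym (upper-half M)) ⟩
    (- + 1) ^ M * ∏ M (λ i → + suc (M ℕ.+ i))
      ≡⟨ sym (shifted-reflect M M (double (+ M))) ⟩
    shifted (- P) M ∎
    where
    open ≡-Reasoning
    lemma : ∀ a b c → a * (+ 1 * (b * c)) ≡ b * (a * c)
    lemma = solve-∀
    double : ∀ M → + 2 * M + + 1 ≡ M + M + + 1
    double = solve-∀

  shifted-! : ∀ a b → + ((a ℕ.+ b) !) ≡ + (a !) * shifted (+ a) b
  shifted-! a b = trans (sym (!-as-∏ (a ℕ.+ b))) (trans (∏-split a b (λ i → + suc i))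
    (cong₂ _*_ (!-as-∏ a) (∏-cong b (λ i _ → lemma (+ a) (+ i)))))
    where
    lemma : ∀ a i → + 1 + (a + i) ≡ + 1 + i + a
    lemma = solve-∀

  !-reflect : ∀ a b {P} → P ≡ + a + + b + + 1 → + (a !) * ((- + 1) ^ b * shifted (- P) b) ≡ + ((a ℕ.+ b) !)
  !-reflect a b {P} e = begin
    + (a !) * ((- + 1) ^ b * shifted (- P) b)
      ≡⟨ cong (λ x → + (a !) * ((- + 1) ^ b * x)) (shifted-reflect a b e) ⟩
    + (a !) * ((- + 1) ^ b * ((- + 1) ^ b * g))
      ≡⟨ cong (+ (a !) *_) (trans (sym (ℤₚ.*-assoc ((- + 1) ^ b) _ g)) (trans (cong (_* g) (sign-square b)) (ℤₚ.*-identityˡ g))) ⟩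
    + (a !) * g
      ≡⟨ cong (_* g) (sym (!-as-∏ a)) ⟩
    ∏ a (λ i → + suc i) * g
      ≡⟨ sym (∏-split a b (λ i → + suc i)) ⟩
    ∏ (a ℕ.+ b) (λ i → + suc i)
      ≡⟨ !-as-∏ (a ℕ.+ b) ⟩
    + ((a ℕ.+ b) !) ∎
    where
    open ≡-Reasoning
    g = ∏ b (λ i → + suc (a ℕ.+ i))

-- Primes congruent to 3 modulo 4

module SecondCase where

  open IntegerCongruences
  open ShiftedProducts
  open import Data.Integer using (_+_; _*_; _-_; -_; _^_)

  module _ (P : ℤ) where

    -- (2i - P)² differs from 4i(i - P) by exactly P². Squaring therefore removes the first-order
    -- harmonic term that would otherwise be unknown.
    half-shifted² : ∀ k → half-shifted P k * half-shifted P k ≈ (+ 4) ^ k * (+ (k !) * shifted (- P) k) [ P * P ]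
    half-shifted² k = begin
      half-shifted P k * half-shifted P k
        ≡⟨ sym (∏-* k _ _) ⟩
      ∏ k (λ i → (+ 2 * + suc i - P) * (+ 2 * + suc i - P))
        ≈⟨ ∏-≈ k (λ i _ → mod-by (+ 1) (lemma (+ suc i) P)) ⟩
      ∏ k (λ i → + 4 * (+ suc i * (+ suc i + - P)))
        ≡⟨ trans (∏-scale k (+ 4) _) (cong ((+ 4) ^ k *_) (trans (∏-* k _ _) (cong (_* shifted (- P) k) (!-as-∏ k)))) ⟩
      (+ 4) ^ k * (+ (k !) * shifted (- P) k) ∎
      where
      open ≈-Reasoning (P * P)
      lemma : ∀ i p → (+ 2 * i - p) * (+ 2 * i - p) ≡ + 4 * (i * (i + - p)) + p * p * + 1
      lemma = solve-∀

    shifted-± : ∀ k → shifted P k * shifted (- P) k ≈ + (k !) * + (k !) [ P * P ]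
    shifted-± k = begin
      shifted P k * shifted (- P) k
        ≡⟨ sym (∏-* k _ _) ⟩
      ∏ k (λ i → (+ suc i + P) * (+ suc i + - P))
        ≈⟨ ∏-≈ k (λ i _ → mod-by (- + 1) (lemma (+ suc i) P)) ⟩
      ∏ k (λ i → + suc i * + suc i)
        ≡⟨ trans (∏-* k _ _) (cong₂ _*_ (!-as-∏ k) (!-as-∏ k)) ⟩
      + (k !) * + (k !) ∎
      where
      open ≈-Reasoning (P * P)
      lemma : ∀ i p → (i + p) * (i + - p) ≡ i * i + p * p * (- + 1)
      lemma = solve-∀

    half-shifted≈ : ∀ k → half-shifted P k ≈ (+ 2) ^ k * + (k !) [ P ]
    half-shifted≈ k = ≈-trans (∏-≈ k (λ i _ → mod-by (- + 1) (lemma (+ suc i) P)))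
      (≡⇒≈ (trans (∏-scale k (+ 2) _) (cong ((+ 2) ^ k *_) (!-as-∏ k))))
      where
      lemma : ∀ i p → + 2 * i - p ≡ + 2 * i + p * (- + 1)
      lemma = solve-∀

    shifted≈ : ∀ k c → shifted (P * c) k ≈ + (k !) [ P ]
    shifted≈ k c = ≈-trans (∏-≈ k (λ i _ → mod-by c refl)) (≡⇒≈ (!-as-∏ k))

  module Prime≡3 {p : ℕ} (pr : Prime p) (3<p : 3 ℕ.< p) (m : ℕ)
                 (p≡ : p ≡ suc ((m ℕ.+ suc m) ℕ.+ (m ℕ.+ suc m))) where
    open ModPrime pr

    -- Since (p - 1)/4 is not an integer here, n is (3p - 1)/4, for which 4n + 1 = 3p; M is (p -
    -- 1)/2.
    M n : ℕ
    M = m ℕ.+ suc m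
    n = suc m ℕ.+ M

    P≡M : P ≡ + M + + M + + 1
    P≡M = trans (cong +_ p≡) (ℤₚ.+-comm (+ 1) (+ M + + M))

    P≡m : P ≡ + 4 * + m + + 3
    P≡m = trans P≡M (lemma (+ m))
      where
      lemma : ∀ m → (m + (+ 1 + m)) + (m + (+ 1 + m)) + + 1 ≡ + 4 * m + + 3
      lemma = solve-∀

    n+m : n ℕ.+ m ≡ M ℕ.+ M
    n+m = ℤₚ.+-injective (lemma (+ m))
      where
      lemma : ∀ m → (+ 1 + m) + (m + (+ 1 + m)) + m ≡ (m + (+ 1 + m)) + (m + (+ 1 + m))
      lemma = solve-∀

    R≡3P : + 4 * + n + + 1 ≡ + 3 * P
    R≡3P = trans (lemma (+ m)) (cong (+ 3 *_) (sym P≡m))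
      where
      lemma : ∀ m → + 4 * ((+ 1 + m) + (m + (+ 1 + m))) + + 1 ≡ + 3 * (+ 4 * m + + 3)
      lemma = solve-∀

    n<p : n ℕ.< p
    n<p = subst (n ℕ.<_) (sym p≡) (s≤s (subst (n ℕ.≤_) n+m (ℕₚ.m≤m+n n m)))

    open TruncatedSum pr 3<p n n<p
      (≈-trans (≡⇒≈ (trans R≡3P (ℤₚ.*-comm (+ 3) P))) (multiple-≈0 (+ 3))) public

    -- ε is the sign (-1)^((p+1)/4), and as w = 2^((p-1)/2), X is the factor 2p - 1 - 2^(p-1) of the
    -- claimed value.
    ε w u X o a₀ b₀ A₋ B₋ B₊ H h f N : ℤ
    ε = (- + 1) ^ suc m
    w = (+ 2) ^ M
    u = (+ 2) ^ m
    X = + 2 * P - + 1 - w * w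
    o = O (suc m)
    a₀ = + (m !)
    b₀ = + (M !)
    A₋ = shifted (- P) m
    B₋ = shifted (- P) M
    B₊ = shifted P M
    H = half-shifted P M
    h = half-shifted P m
    f = + ((p ℕ.∸ 1) !)
    N = + (n !)

    M<p : M ℕ.< p
    M<p = subst (M ℕ.<_) (sym p≡) (s≤s (ℕₚ.m≤m+n M M))

    m<p : m ℕ.< p
    m<p = ℕₚ.≤-<-trans (ℕₚ.m≤m+n m (suc m)) M<p

    f≡ : f ≡ + ((M ℕ.+ M) !)
    f≡ = cong (λ k → + ((k ℕ.∸ 1) !)) p≡

    b₀≡ : b₀ ≡ o * u * a₀
    b₀≡ = begin
      + ((m ℕ.+ suc m) !)
        ≡⟨ cong (λ k → + (k !)) (trans (ℕₚ.+-suc m m) (cong (λ k → suc (m ℕ.+ k)) (sym (ℕₚ.+-identityʳ m)))) ⟩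
      + (suc (2 ℕ.* m) ℕ.* (2 ℕ.* m) !)
        ≡⟨ trans (ℤₚ.pos-* (suc (2 ℕ.* m)) _) (cong₂ _*_ (cong (λ k → + 1 + k) (ℤₚ.pos-* 2 m)) (double-factorial m)) ⟩
      (+ 1 + + 2 * + m) * (u * a₀ * O m)
        ≡⟨ lemma (+ m) u a₀ (O m) ⟩
      o * u * a₀ ∎
      where
      open ≡-Reasoning
      lemma : ∀ m u a o → (+ 1 + + 2 * m) * (u * a * o) ≡ o * (+ 2 * m + + 1) * u * a
      lemma = solve-∀

    H≡ : H ≡ h * (ε * o)
    H≡ = half-shifted-split m (suc m) (trans P≡M (lemma (+ M)))
      where
      lemma : ∀ M → M + M + + 1 ≡ + 2 * M + + 1
      lemma = solve-∀

    wH≡ : w * H ≡ B₋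
    wH≡ = half-shifted≡shifted M (trans P≡M (lemma (+ M)))
      where
      lemma : ∀ M → M + M + + 1 ≡ + 2 * M + + 1
      lemma = solve-∀

    f≡b₀B₋ : f * f ≡ b₀ * B₋ * (b₀ * B₋)
    f≡b₀B₋ = trans (cong₂ _*_ e e) (trans (lemma b₀ ((- + 1) ^ M) B₋) (trans (cong (_* (b₀ * B₋ * (b₀ * B₋))) (sign-square M)) (ℤₚ.*-identityˡ _)))
      where
      e = trans f≡ (sym (!-reflect M M P≡M))
      lemma : ∀ b s x → b * (s * x) * (b * (s * x)) ≡ s * s * (b * x * (b * x))
      lemma = solve-∀

    f≡-b₀B₋ : f ≡ - (b₀ * B₋)
    f≡-b₀B₋ = trans (trans f≡ (sym (!-reflect M M P≡M))) (trans (cong (λ s → b₀ * (s * B₋)) odd) (lemma b₀ B₋))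
      where
      odd : (- + 1) ^ (m ℕ.+ suc m) ≡ - + 1
      odd = trans (ℤₚ.^-distribˡ-+-* (- + 1) m (suc m)) (trans (shuffle ((- + 1) ^ m)) (cong -_ (sign-square m)))
        where
        shuffle : ∀ x → x * (- + 1 * x) ≡ - (x * x)
        shuffle = solve-∀
      lemma : ∀ b x → b * (- + 1 * x) ≡ - (b * x)
      lemma = solve-∀

    NA₋ : N * A₋ * (N * A₋) ≡ f * f
    NA₋ = trans (sym (trans (lemma N ((- + 1) ^ m) A₋) (trans (cong (_* (N * A₋ * (N * A₋))) (sign-square m)) (ℤₚ.*-identityˡ _)))) (sym (cong₂ _*_ e e))
      where
      P≡ : P ≡ + n + + m + + 1
      P≡ = trans P≡M (cong (λ k → + k + + 1) (sym n+m))
      e : f ≡ N * ((- + 1) ^ m * A₋)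
      e = trans f≡ (trans (cong (λ k → + (k !)) (sym n+m)) (sym (!-reflect n m P≡)))
      lemma : ∀ b s x → b * (s * x) * (b * (s * x)) ≡ s * s * (b * x * (b * x))
      lemma = solve-∀

    nz-b₀ : Nz b₀
    nz-b₀ = nz-! M<p

    nz-a₀ : Nz a₀
    nz-a₀ = nz-! m<p

    nz-shifted : ∀ k → k ℕ.< p → Nz (shifted (- P) k)
    nz-shifted k k<p = nz-≈ (≈-sym (subst (λ c → shifted c k ≈ + (k !) [ P ]) (lemma P) (shifted≈ P k (- + 1)))) (nz-! k<p)
      where
      lemma : ∀ p → p * (- + 1) ≡ - p
      lemma = solve-∀

    4^≡ : ∀ k → (+ 4) ^ k ≡ (+ 2) ^ k * (+ 2) ^ k
    4^≡ = ^-distrib-* (+ 2) (+ 2)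

    -- Square the exact equation wH = B₋, replace H² by `half-shifted²`, and cancel the unit B₋ that
    -- reappears.
    B₋≈ : B₋ ≈ w * w * w * w * b₀ [ P² ]
    B₋≈ = ≈-cancel₂ (nz-shifted M M<p) (begin
      B₋ * B₋
        ≡⟨ sym (cong₂ _*_ wH≡ wH≡) ⟩
      w * H * (w * H)
        ≡⟨ lemma₁ w H ⟩
      w * w * (H * H)
        ≈⟨ *-≈ˡ (w * w) (half-shifted² P M) ⟩
      w * w * ((+ 4) ^ M * (b₀ * B₋))
        ≡⟨ cong (λ x → w * w * (x * (b₀ * B₋))) (4^≡ M) ⟩
      w * w * (w * w * (b₀ * B₋))
        ≡⟨ lemma₂ w b₀ B₋ ⟩
      B₋ * (w * w * w * w * b₀) ∎)
      where
      open ≈-Reasoning P²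
      lemma₁ : ∀ w h → w * h * (w * h) ≡ w * w * (h * h)
      lemma₁ = solve-∀
      lemma₂ : ∀ w b x → w * w * (w * w * (b * x)) ≡ x * (w * w * w * w * b)
      lemma₂ = solve-∀

    -- Squaring `H≡` drops ε and allows `half-shifted²` at both m and M; `B₋≈` then removes B₋.
    A₋≈ : A₋ ≈ w * w * w * w * w * w * a₀ [ P² ]
    A₋≈ = ≈-cancel₂ (nz-* nz-b₀ nz-b₀) (begin
      b₀ * b₀ * A₋
        ≡⟨ cong (λ b → b * b * A₋) b₀≡ ⟩
      o * u * a₀ * (o * u * a₀) * A₋
        ≡⟨ lemma₁ o u a₀ A₋ ⟩
      o * o * a₀ * (u * u * (a₀ * A₋))
        ≡⟨ cong (λ x → o * o * a₀ * (x * (a₀ * A₋))) (sym (4^≡ m)) ⟩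
      o * o * a₀ * ((+ 4) ^ m * (a₀ * A₋))
        ≈⟨ *-≈ˡ (o * o * a₀) (half-shifted² P m) ⟨
      o * o * a₀ * (h * h)
        ≡⟨ sym (trans (cong (λ s → s * (o * o * a₀ * (h * h))) (sign-square (suc m))) (ℤₚ.*-identityˡ _)) ⟩
      ε * ε * (o * o * a₀ * (h * h))
        ≡⟨ lemma₂ ε o a₀ h ⟩
      a₀ * (h * (ε * o) * (h * (ε * o)))
        ≡⟨ cong (λ x → a₀ * (x * x)) (sym H≡) ⟩
      a₀ * (H * H)
        ≈⟨ *-≈ˡ a₀ (half-shifted² P M) ⟩
      a₀ * ((+ 4) ^ M * (b₀ * B₋))
        ≡⟨ cong (λ x → a₀ * (x * (b₀ * B₋))) (4^≡ M) ⟩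
      a₀ * (w * w * (b₀ * B₋))
        ≈⟨ *-≈ˡ a₀ (*-≈ˡ (w * w) (*-≈ˡ b₀ B₋≈)) ⟩
      a₀ * (w * w * (b₀ * (w * w * w * w * b₀)))
        ≡⟨ lemma₃ a₀ w b₀ ⟩
      b₀ * b₀ * (w * w * w * w * w * w * a₀) ∎)
      where
      open ≈-Reasoning P²
      lemma₁ : ∀ o u a x → o * u * a * (o * u * a) * x ≡ o * o * a * (u * u * (a * x))
      lemma₁ = solve-∀
      lemma₂ : ∀ e o a h → e * e * (o * o * a * (h * h)) ≡ a * (h * (e * o) * (h * (e * o)))
      lemma₂ = solve-∀
      lemma₃ : ∀ a w b → a * (w * w * (b * (w * w * w * w * b))) ≡ b * b * (w * w * w * w * w * w * a)
      lemma₃ = solve-∀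

    -- The quadratic character of 2, obtained by reading `H≡` modulo P.
    w≈ε : w ≈ ε [ P ]
    w≈ε = ≈-cancel₁ nz-b₀ (begin
      b₀ * w
        ≡⟨ ℤₚ.*-comm b₀ w ⟩
      w * b₀
        ≈⟨ half-shifted≈ P M ⟨
      H
        ≡⟨ H≡ ⟩
      h * (ε * o)
        ≈⟨ *-≈ʳ (ε * o) (half-shifted≈ P m) ⟩
      u * a₀ * (ε * o)
        ≡⟨ lemma u a₀ ε o ⟩
      o * u * a₀ * ε
        ≡⟨ cong (_* ε) (sym b₀≡) ⟩
      b₀ * ε ∎)
      where
      open ≈-Reasoning P
      lemma : ∀ u a e o → u * a * (e * o) ≡ o * u * a * e
      lemma = solve-∀

    -- As (w - ε)² ≈ 0 and ε² = 1, w² may be replaced by 2εw - 1; beyond -2w there remains 2P(ε -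
    -- w), which is 0 modulo P² again by `w≈ε`.
    -2w≈ : ε * X * (P + + 1) ≈ - + 2 * w [ P² ]
    -2w≈ = begin
      ε * (+ 2 * P - + 1 - w * w) * (P + + 1)
        ≡⟨ expand ε P w ⟩
      ε * (P + + 1) * (- ((w - ε) * (w - ε)) - + 1 + ε * ε) + (ε * ε) * (- + 2 * w) + (+ 2 * ε * (P * P) + + 2 * (P * ((+ 1 - ε * ε) * w)) - + 2 * (P * (w - ε)))
        ≈⟨ +-≈ (+-≈ (*-≈ˡ (ε * (P + + 1)) (+-≈ (-‿≈ (neg-≈ (≈-zero-* w-ε w-ε)) ≈-refl) ε²)) (*-≈ʳ (- + 2 * w) ε²))
               (-‿≈ (+-≈ (*-≈ˡ (+ 2 * ε) (≈-zero-* P≈0 P≈0)) (*-≈ˡ (+ 2) (*-≈ˡ P (*-≈ʳ w (-‿≈ (≈-refl {a = + 1}) ε²))))) (*-≈ˡ (+ 2) (≈-zero-* P≈0 w-ε))) ⟩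
      ε * (P + + 1) * (- + 0 - + 1 + + 1) + + 1 * (- + 2 * w) + (+ 2 * ε * + 0 + + 2 * (P * ((+ 1 - + 1) * w)) - + 2 * + 0)
        ≡⟨ collapse ε P w ⟩
      - + 2 * w ∎
      where
      open ≈-Reasoning P²
      w-ε : w - ε ≈ + 0 [ P ]
      w-ε = difference-≈0 w≈ε
      ε² : ε * ε ≈ + 1 [ P² ]
      ε² = ≡⇒≈ (sign-square (suc m))
      expand : ∀ e p w → e * (+ 2 * p - + 1 - w * w) * (p + + 1)
        ≡ e * (p + + 1) * (- ((w - e) * (w - e)) - + 1 + e * e) + (e * e) * (- + 2 * w) + (+ 2 * e * (p * p) + + 2 * (p * ((+ 1 - e * e) * w)) - + 2 * (p * (w - e)))
      expand = solve-∀
      collapse : ∀ e p w → e * (p + + 1) * (- + 0 - + 1 + + 1) + + 1 * (- + 2 * w) + (+ 2 * e * + 0 + + 2 * (p * ((+ 1 - + 1) * w)) - + 2 * + 0) ≡ - + 2 * w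
      collapse = solve-∀

    s v Γ : ℤ
    s = + suc m
    v = (+ 4) ^ n
    Γ = + (M C m)

    Γ-relation : Γ * (a₀ * (s * a₀)) ≡ b₀
    Γ-relation = begin
      + (M C m) * (a₀ * (s * a₀))
        ≡⟨ cong (λ x → + (M C m) * (a₀ * x)) (sym (ℤₚ.pos-* (suc m) (m !))) ⟩
      + (M C m) * (+ (m !) * + (suc m !))
        ≡⟨ trans (cong (+ (M C m) *_) (sym (ℤₚ.pos-* (m !) (suc m !)))) (sym (ℤₚ.pos-* (M C m) _)) ⟩
      + ((M C m) ℕ.* (m ! ℕ.* suc m !))
        ≡⟨ cong (λ k → + ((M C m) ℕ.* (m ! ℕ.* k !))) (sym (ℕₚ.m+n∸m≡n m (suc m))) ⟩
      + ((M C m) ℕ.* (m ! ℕ.* (M ℕ.∸ m) !))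
        ≡⟨ cong +_ (C-factorial (ℕₚ.m≤m+n m (suc m))) ⟩
      b₀ ∎
      where open ≡-Reasoning

    v-relation : + 2 * (v * s) ≡ w * w * w * (P + + 1)
    v-relation = begin
      + 2 * ((+ 4) ^ n * s)
        ≡⟨ cong (λ x → + 2 * (x * s)) (trans (4^≡ n) (cong₂ _*_ 2^n 2^n)) ⟩
      + 2 * ((+ 2 * u * w) * (+ 2 * u * w) * s)
        ≡⟨ lemma₁ u w (+ m) ⟩
      (u * (+ 2 * u)) * w * w * (+ 4 * + m + + 3 + + 1)
        ≡⟨ cong₂ (λ x y → x * w * w * (y + + 1)) (sym w≡) (sym P≡m) ⟩
      w * w * w * (P + + 1) ∎
      where
      open ≡-Reasoning
      2^n : (+ 2) ^ n ≡ + 2 * u * w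
      2^n = ℤₚ.^-distribˡ-+-* (+ 2) (suc m) M
      w≡ : w ≡ u * (+ 2 * u)
      w≡ = ℤₚ.^-distribˡ-+-* (+ 2) m (suc m)
      lemma₁ : ∀ u w m → + 2 * ((+ 2 * u * w) * (+ 2 * u * w) * (+ 1 + m)) ≡ (u * (+ 2 * u)) * w * w * (+ 4 * m + + 3 + + 1)
      lemma₁ = solve-∀

    key : + 3 * (v * v * v * (N * N) * f * B₊) * Γ ≈ + 3 * (ε * X) * fourth (v * N) [ P² ]
    key = ≈-cancel₂ nz-U (≈-trans left (≈-sym right))
      where
      open ≈-Reasoning P²
      -- The powers of A₋ turn N into f up to sign, and the remaining factors feed `Γ-relation` and
      -- `v-relation`; both sides then collapse to one monomial in v, f, a₀, b₀ and w.
      U mid : ℤ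
      U = + 2 * (a₀ * (s * a₀)) * (A₋ * A₋ * (A₋ * A₋))
      mid = - + 6 * (v * v * v * (f * f)) * (fourth b₀ * (w * w * w * w * w * w * a₀ * (w * w * w * w * w * w * a₀)))
      nz-A₋ : Nz A₋
      nz-A₋ = nz-shifted m m<p
      nz-U : Nz U
      nz-U = nz-* (nz-* nz-2 (nz-* nz-a₀ (nz-* (nz-small (s≤s z≤n) m+1<p) nz-a₀))) (nz-* (nz-* nz-A₋ nz-A₋) (nz-* nz-A₋ nz-A₋))
        where
        m+1<p : suc m ℕ.< p
        m+1<p = ℕₚ.≤-<-trans (ℕₚ.m≤n+m (suc m) m) M<p
      left : U * (+ 3 * (v * v * v * (N * N) * f * B₊) * Γ) ≈ mid [ P² ]
      left = begin
        U * (+ 3 * (v * v * v * (N * N) * f * B₊) * Γ)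
          ≡⟨ lemma₁ (a₀ * (s * a₀)) A₋ (v * v * v) N f B₊ Γ ⟩
        + 6 * (v * v * v) * (N * A₋ * (N * A₋)) * (f * B₊ * (Γ * (a₀ * (s * a₀)))) * (A₋ * A₋)
          ≡⟨ cong₂ (λ x y → + 6 * (v * v * v) * x * (f * B₊ * y) * (A₋ * A₋)) NA₋ Γ-relation ⟩
        + 6 * (v * v * v) * (f * f) * (f * B₊ * b₀) * (A₋ * A₋)
          ≡⟨ cong (λ x → + 6 * (v * v * v) * (f * f) * (x * B₊ * b₀) * (A₋ * A₋)) f≡-b₀B₋ ⟩
        + 6 * (v * v * v) * (f * f) * (- (b₀ * B₋) * B₊ * b₀) * (A₋ * A₋)
          ≡⟨ lemma₂ (v * v * v) (f * f) b₀ B₋ B₊ (A₋ * A₋) ⟩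
        - + 6 * (v * v * v * (f * f)) * ((b₀ * b₀ * (B₊ * B₋)) * (A₋ * A₋))
          ≈⟨ *-≈ˡ (- + 6 * (v * v * v * (f * f))) (*-≈ (*-≈ˡ (b₀ * b₀) (shifted-± P M)) (*-≈ A₋≈ A₋≈)) ⟩
        - + 6 * (v * v * v * (f * f)) * ((b₀ * b₀ * (b₀ * b₀)) * (w * w * w * w * w * w * a₀ * (w * w * w * w * w * w * a₀)))
          ≡⟨ lemma₃ (- + 6 * (v * v * v * (f * f))) b₀ _ ⟩
        mid ∎
        where
        lemma₁ : ∀ a x v n f b c → + 2 * a * (x * x * (x * x)) * (+ 3 * (v * (n * n) * f * b) * c) ≡ + 6 * v * (n * x * (n * x)) * (f * b * (c * a)) * (x * x)
        lemma₁ = solve-∀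
        lemma₂ : ∀ v f b x y a → + 6 * v * f * (- (b * x) * y * b) * a ≡ - + 6 * (v * f) * ((b * b * (y * x)) * a)
        lemma₂ = solve-∀
        lemma₃ : ∀ k b a → k * (b * b * (b * b) * a) ≡ k * (b * b * b * b * a)
        lemma₃ = solve-∀
      right : U * (+ 3 * (ε * X) * fourth (v * N)) ≈ mid [ P² ]
      right = begin
        U * (+ 3 * (ε * X) * fourth (v * N))
          ≡⟨ lemma₁ a₀ s A₋ (ε * X) v N ⟩
        + 3 * (ε * X) * (v * v * v) * (N * A₋ * (N * A₋)) * (N * A₋ * (N * A₋)) * (a₀ * a₀) * (+ 2 * (v * s))
          ≡⟨ cong₂ (λ x y → + 3 * (ε * X) * (v * v * v) * x * x * (a₀ * a₀) * y) NA₋ v-relation ⟩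
        + 3 * (ε * X) * (v * v * v) * (f * f) * (f * f) * (a₀ * a₀) * (w * w * w * (P + + 1))
          ≡⟨ lemma₂ ε X (v * v * v) (f * f) a₀ w P ⟩
        + 3 * (v * v * v) * (f * f) * (a₀ * a₀) * (w * w * w) * (f * f) * (ε * X * (P + + 1))
          ≈⟨ *-≈ (*-≈ˡ (+ 3 * (v * v * v) * (f * f) * (a₀ * a₀) * (w * w * w)) ff) -2w≈ ⟩
        + 3 * (v * v * v) * (f * f) * (a₀ * a₀) * (w * w * w) * (b₀ * (w * w * w * w * b₀) * (b₀ * (w * w * w * w * b₀))) * (- + 2 * w)
          ≡⟨ lemma₃ (v * v * v) (f * f) a₀ w b₀ ⟩
        mid ∎
        where
        ff : f * f ≈ b₀ * (w * w * w * w * b₀) * (b₀ * (w * w * w * w * b₀)) [ P² ]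
        ff = ≈-trans (≡⇒≈ f≡b₀B₋) (*-≈ (*-≈ˡ b₀ B₋≈) (*-≈ˡ b₀ B₋≈))
        lemma₁ : ∀ a s x e v n → + 2 * (a * (s * a)) * (x * x * (x * x)) * (+ 3 * e * (v * n * (v * n) * (v * n) * (v * n)))
          ≡ + 3 * e * (v * v * v) * (n * x * (n * x)) * (n * x * (n * x)) * (a * a) * (+ 2 * (v * s))
        lemma₁ = solve-∀
        lemma₂ : ∀ e x v f a w p → + 3 * (e * x) * v * f * f * (a * a) * (w * w * w * (p + + 1)) ≡ + 3 * v * f * (a * a) * (w * w * w) * f * (e * x * (p + + 1))
        lemma₂ = solve-∀
        lemma₃ : ∀ v f a w b → + 3 * v * f * (a * a) * (w * w * w) * (b * (w * w * w * w * b) * (b * (w * w * w * w * b))) * (- + 2 * w)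
          ≡ - + 6 * (v * f) * (b * b * b * b * (w * w * w * w * w * w * a * (w * w * w * w * w * w * a)))
        lemma₃ = solve-∀

    -- One P comes from R = 3P, the other from (2n)! because 2n = p + M. The cofactor is therefore
    -- needed modulo P² only.
    closed≡ : closed ≡ P * (P * (+ 3 * (v * ∏[16i²-R²] * f * B₊)))
    closed≡ = begin
      v * (R * ∏[16i²-R²] * + ((2 ℕ.* n) !))
        ≡⟨ cong₂ (λ x y → v * (x * ∏[16i²-R²] * y)) R≡3P 2n! ⟩
      v * (+ 3 * P * ∏[16i²-R²] * (P * f * B₊))
        ≡⟨ lemma v P ∏[16i²-R²] f B₊ ⟩
      P * (P * (+ 3 * (v * ∏[16i²-R²] * f * B₊))) ∎
      where
      open ≡-Reasoning
      lemma : ∀ v p g f b → v * (+ 3 * p * g * (p * f * b)) ≡ p * (p * (+ 3 * (v * g * f * b)))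
      lemma = solve-∀
      2n≡ : 2 ℕ.* n ≡ p ℕ.+ M
      2n≡ = ℤₚ.+-injective (trans (ℤₚ.pos-* 2 n) (trans (double (+ m)) (cong (_+ + M) (sym P≡m))))
        where
        double : ∀ m → + 2 * ((+ 1 + m) + (m + (+ 1 + m))) ≡ + 4 * m + + 3 + (m + (+ 1 + m))
        double = solve-∀
      2n! : + ((2 ℕ.* n) !) ≡ P * f * B₊
      2n! = trans (cong (λ k → + (k !)) 2n≡) (trans (shifted-! p M) (cong (_* B₊) p!))
        where
        p! : + (p !) ≡ P * f
        p! = trans (cong (λ k → + (k !)) (sym (ℕₚ.suc-pred p {{prime⇒nonZero pr}})))
          (trans (ℤₚ.pos-* (suc (ℕ.pred p)) (ℕ.pred p !)) (cong (λ k → + k * f) (ℕₚ.suc-pred p {{prime⇒nonZero pr}})))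

    ∏≈ : ∏[16i²-R²] ≈ v * v * (N * N) [ P² ]
    ∏≈ = begin
      ∏ n (λ i → + 16 * (+ suc i * + suc i) - R * R)
        ≈⟨ ∏-≈ n (λ i _ → ≈-trans (-‿≈ (≈-refl {a = + 16 * (+ suc i * + suc i)}) (≈-zero-* R≈ R≈)) (≡⇒≈ (lemma (+ suc i)))) ⟩
      ∏ n (λ i → + 4 * (+ 4) * (+ suc i * + suc i))
        ≡⟨ trans (∏-scale n (+ 4 * + 4) _) (cong₂ _*_ (^-distrib-* (+ 4) (+ 4) n) (trans (∏-* n _ _) (cong₂ _*_ (!-as-∏ n) (!-as-∏ n)))) ⟩
      v * v * (N * N) ∎
      where
      open ≈-Reasoning P²
      R≈ : R ≈ + 0 [ P ]
      R≈ = ≈-trans (≡⇒≈ (trans R≡3P (ℤₚ.*-comm (+ 3) P))) (multiple-≈0 (+ 3))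
      lemma : ∀ x → + 16 * (x * x) - + 0 ≡ + 4 * + 4 * (x * x)
      lemma = solve-∀

    ∏fourth : ∏ n (fourth ∘ y) ≡ fourth (v * N)
    ∏fourth = trans (∏-* n _ y) (cong₂ _*_ (trans (∏-* n _ y) (cong₂ _*_ (trans (∏-* n y y) (cong₂ _*_ (∏y n) (∏y n))) (∏y n))) (∏y n))

    full-sum-≈ : full-sum * Γ ≈ + 3 * (ε * X) * (P * P) * ∏ (p ℕ.∸ 1) (fourth ∘ y) [ P⁴ ]
    full-sum-≈ = begin
      full-sum * Γ
        ≈⟨ *-≈ʳ Γ full-sum≈ ⟩
      closed * rest * Γ
        ≡⟨ cong (λ x → x * rest * Γ) closed≡ ⟩
      P * (P * (+ 3 * (v * ∏[16i²-R²] * f * B₊))) * rest * Γ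
        ≈⟨ *-≈ʳ Γ (*-≈ʳ rest (P*-≈ (P*-≈ (*-≈ˡ (+ 3) (*-≈ʳ B₊ (*-≈ʳ f (*-≈ˡ v ∏≈))))))) ⟩
      P * (P * (+ 3 * (v * (v * v * (N * N)) * f * B₊))) * rest * Γ
        ≡⟨ lemma₁ P v N f B₊ rest Γ ⟩
      P * (P * (+ 3 * (v * v * v * (N * N) * f * B₊) * Γ)) * rest
        ≈⟨ *-≈ʳ rest (P*-≈ (P*-≈ key)) ⟩
      P * (P * (+ 3 * (ε * X) * fourth (v * N))) * rest
        ≡⟨ lemma₂ P (+ 3 * (ε * X)) (fourth (v * N)) rest ⟩
      + 3 * (ε * X) * (P * P) * (fourth (v * N) * rest)
        ≡⟨ cong (+ 3 * (ε * X) * (P * P) *_) (trans (cong (_* rest) (sym ∏fourth)) (sym full-denominator)) ⟩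
      + 3 * (ε * X) * (P * P) * ∏ (p ℕ.∸ 1) (fourth ∘ y) ∎
      where
      open ≈-Reasoning P⁴
      rest = tail (p ℕ.∸ 1) (fourth ∘ y) n
      lemma₁ : ∀ p v n f b r c → p * (p * (+ 3 * (v * (v * v * (n * n)) * f * b))) * r * c ≡ p * (p * (+ 3 * (v * v * v * (n * n) * f * b) * c)) * r
      lemma₁ = solve-∀
      lemma₂ : ∀ p k f r → p * (p * (k * f)) * r ≡ k * (p * p) * (f * r)
      lemma₂ = solve-∀

-- Passage from rationals to integers

module RationalTransfer where

  open IntegerCongruences
  open import Data.Rational using (_+_; _*_; _-_; -_)

  ℚ-ring : ACR.AlmostCommutativeRing 0ℓ 0ℓ
  ℚ-ring = ACR.fromCommutativeRing ℚₚ.+-*-commutativeRing λ _ → nothing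

  private
    toℚᵘ-ℤ→ℚ : ∀ a → toℚᵘ (ℤ→ℚ a) ℚᵘ.≃ mkℚᵘ a 0
    toℚᵘ-ℤ→ℚ a = ℚₚ.toℚᵘ-fromℚᵘ (mkℚᵘ a 0)

  ℤ→ℚ-+ : ∀ a b → ℤ→ℚ (a ℤ.+ b) ≡ ℤ→ℚ a + ℤ→ℚ b
  ℤ→ℚ-+ a b = ℚₚ.toℚᵘ-injective (ℚᵘₚ.≃-trans (toℚᵘ-ℤ→ℚ (a ℤ.+ b)) (ℚᵘₚ.≃-trans (*≡* (lemma a b))
    (ℚᵘₚ.≃-sym (ℚᵘₚ.≃-trans (ℚₚ.toℚᵘ-homo-+ (ℤ→ℚ a) (ℤ→ℚ b)) (ℚᵘₚ.+-cong (toℚᵘ-ℤ→ℚ a) (toℚᵘ-ℤ→ℚ b))))))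
    where
    lemma : ∀ a b → (a ℤ.+ b) ℤ.* + 1 ≡ (a ℤ.* + 1 ℤ.+ b ℤ.* + 1) ℤ.* + 1
    lemma = solve-∀

  ℤ→ℚ-* : ∀ a b → ℤ→ℚ (a ℤ.* b) ≡ ℤ→ℚ a * ℤ→ℚ b
  ℤ→ℚ-* a b = ℚₚ.toℚᵘ-injective (ℚᵘₚ.≃-trans (toℚᵘ-ℤ→ℚ (a ℤ.* b)) (ℚᵘₚ.≃-trans (*≡* refl)
    (ℚᵘₚ.≃-sym (ℚᵘₚ.≃-trans (ℚₚ.toℚᵘ-homo-* (ℤ→ℚ a) (ℤ→ℚ b)) (ℚᵘₚ.*-cong (toℚᵘ-ℤ→ℚ a) (toℚᵘ-ℤ→ℚ b))))))

  ℤ→ℚ-neg : ∀ a → ℤ→ℚ (ℤ.- a) ≡ - ℤ→ℚ a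
  ℤ→ℚ-neg a = ℚₚ.toℚᵘ-injective (ℚᵘₚ.≃-trans (toℚᵘ-ℤ→ℚ (ℤ.- a)) (ℚᵘₚ.≃-trans (*≡* refl)
    (ℚᵘₚ.≃-sym (ℚᵘₚ.≃-trans (ℚₚ.toℚᵘ-homo‿- (ℤ→ℚ a)) (ℚᵘₚ.-‿cong (toℚᵘ-ℤ→ℚ a))))))

  ℤ→ℚ-- : ∀ a b → ℤ→ℚ (a ℤ.- b) ≡ ℤ→ℚ a - ℤ→ℚ b
  ℤ→ℚ-- a b = trans (ℤ→ℚ-+ a (ℤ.- b)) (cong (λ x → ℤ→ℚ a + x) (ℤ→ℚ-neg b))

  ℤ→ℚ-injective : ∀ {a b} → ℤ→ℚ a ≡ ℤ→ℚ b → a ≡ b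
  ℤ→ℚ-injective {a} {b} e with ℚᵘₚ.≃-trans (ℚᵘₚ.≃-sym (toℚᵘ-ℤ→ℚ a)) (ℚᵘₚ.≃-trans (ℚₚ.toℚᵘ-cong e) (toℚᵘ-ℤ→ℚ b))
  ... | *≡* h = trans (sym (ℤₚ.*-identityʳ a)) (trans h (ℤₚ.*-identityʳ b))

  ℤ→ℚ-^ : ∀ a k → ℤ→ℚ (a ℤ.^ k) ≡ ℤ→ℚ a ^ℚ k
  ℤ→ℚ-^ a zero    = refl
  ℤ→ℚ-^ a (suc k) = trans (ℤ→ℚ-* a (a ℤ.^ k)) (cong (ℤ→ℚ a *_) (ℤ→ℚ-^ a k))

  /-cancel : ∀ i n .{{_ : ℕ.NonZero n}} → (i ℚ./ n) * ℤ→ℚ (+ n) ≡ ℤ→ℚ i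
  /-cancel i (suc n) = ℚₚ.toℚᵘ-injective (ℚᵘₚ.≃-trans (ℚₚ.toℚᵘ-homo-* (i ℚ./ suc n) (ℤ→ℚ (+ suc n)))
    (ℚᵘₚ.≃-trans (ℚᵘₚ.*-cong (ℚₚ.toℚᵘ-fromℚᵘ (mkℚᵘ i n)) (toℚᵘ-ℤ→ℚ (+ suc n)))
    (ℚᵘₚ.≃-trans (*≡* (lemma i (+ suc n))) (ℚᵘₚ.≃-sym (toℚᵘ-ℤ→ℚ i)))))
    where
    lemma : ∀ i n → (i ℤ.* n) ℤ.* + 1 ≡ i ℤ.* (n ℤ.* + 1)
    lemma = solve-∀

  inv-inverse : ∀ {q} → q ≢ 0ℚ → inv q * q ≡ 1ℚ
  inv-inverse {q} q≢0 with q ℚₚ.≟ 0ℚ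
  ... | yes e = contradiction e q≢0
  ... | no n = ℚₚ.*-inverseˡ q {{ℚ.≢-nonZero n}}

  -- For the reduced fraction n/d the hypothesis reads n b = a d, so p ∣ d would force p ∣ n,
  -- against coprimality.
  p-integral : ∀ {p} (pr : Prime p) {q a b} → ModPrime.Nz pr b → q * ℤ→ℚ b ≡ ℤ→ℚ a → PIntegral p q
  p-integral {p} pr {mkℚ n d-1 c} {a} {b} nb e p∣d = ℕₚ.<⇒≢ 1<p (sym (Coprimality.recompute c (p∣n , p∣d)))
    where
    open ModPrime pr
    cross : n ℤ.* b ≡ a ℤ.* + suc d-1
    cross with ℚᵘₚ.≃-trans (ℚᵘₚ.≃-sym (ℚᵘₚ.*-cong (ℚᵘₚ.≃-refl {mkℚᵘ n d-1}) (toℚᵘ-ℤ→ℚ b)))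
         (ℚᵘₚ.≃-trans (ℚᵘₚ.≃-sym (ℚₚ.toℚᵘ-homo-* (mkℚ n d-1 c) (ℤ→ℚ b))) (ℚᵘₚ.≃-trans (ℚₚ.toℚᵘ-cong e) (toℚᵘ-ℤ→ℚ a)))
    ... | *≡* h = trans (lemma₁ (n ℤ.* b)) (trans h (cong (λ x → a ℤ.* + suc x) (ℕₚ.*-identityʳ d-1)))
      where
      lemma₁ : ∀ x → x ≡ x ℤ.* + 1
      lemma₁ = solve-∀
    p∣n : p ℕD.∣ ∣ n ∣
    p∣n = ≈0⇒∣ (≈0-cancel nb (≈-trans (≡⇒≈ (trans (ℤₚ.*-comm b n) cross))
      (≈-trans (*-≈ˡ a (∣⇒≈0 {+ suc d-1} p∣d)) (≡⇒≈ (ℤₚ.*-zeroʳ a)))))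

  module _ {p : ℕ} (pr : Prime p) where
    open ModPrime pr

    nz⇒≢0 : ∀ {a} → Nz a → ℤ→ℚ a ≢ 0ℚ
    nz⇒≢0 {a} na e = na (≡⇒≈ (ℤ→ℚ-injective {a} {+ 0} e))

    congruence-of-quotients : ∀ {q r D Z E Y} → Nz D → Nz E → q * ℤ→ℚ D ≡ ℤ→ℚ Z → r * ℤ→ℚ E ≡ ℤ→ℚ Y →
      Z ℤ.* E ≈ Y ℤ.* D [ P⁴ ] → Congr p q r (ℕ→ℚ p ^ℚ 4)
    congruence-of-quotients {q} {r} {D} {Z} {E} {Y} nD nE qD rE (mod-by k e) =
      t , p-integral pr {t} {k} {F} nF tF , cancel (begin
        (q - r) * ℤ→ℚ F
          ≡⟨ cong ((q - r) *_) (ℤ→ℚ-* D E) ⟩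
        (q - r) * (ℤ→ℚ D * ℤ→ℚ E)
          ≡⟨ lemma₁ q r (ℤ→ℚ D) (ℤ→ℚ E) ⟩
        q * ℤ→ℚ D * ℤ→ℚ E - r * ℤ→ℚ E * ℤ→ℚ D
          ≡⟨ cong₂ (λ x y → x * ℤ→ℚ E - y * ℤ→ℚ D) qD rE ⟩
        ℤ→ℚ Z * ℤ→ℚ E - ℤ→ℚ Y * ℤ→ℚ D
          ≡⟨ cong₂ _-_ (sym (ℤ→ℚ-* Z E)) (sym (ℤ→ℚ-* Y D)) ⟩
        ℤ→ℚ (Z ℤ.* E) - ℤ→ℚ (Y ℤ.* D)
          ≡⟨ sym (ℤ→ℚ-- (Z ℤ.* E) (Y ℤ.* D)) ⟩
        ℤ→ℚ (Z ℤ.* E ℤ.- Y ℤ.* D)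
          ≡⟨ cong ℤ→ℚ (trans (cong (ℤ._- Y ℤ.* D) e) (lemma₂ (Y ℤ.* D) P k)) ⟩
        ℤ→ℚ (P ℤ.^ 4 ℤ.* k)
          ≡⟨ trans (ℤ→ℚ-* (P ℤ.^ 4) k) (cong₂ _*_ (ℤ→ℚ-^ P 4) (sym tF)) ⟩
        (ℕ→ℚ p ^ℚ 4) * (t * ℤ→ℚ F)
          ≡⟨ sym (ℚₚ.*-assoc (ℕ→ℚ p ^ℚ 4) t (ℤ→ℚ F)) ⟩
        (ℕ→ℚ p ^ℚ 4) * t * ℤ→ℚ F ∎)
      where
      open ≡-Reasoning
      F : ℤ
      F = D ℤ.* E
      nF : Nz F
      nF = nz-* nD nE
      t : ℚ
      t = ℤ→ℚ k * inv (ℤ→ℚ F)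
      tF : t * ℤ→ℚ F ≡ ℤ→ℚ k
      tF = trans (ℚₚ.*-assoc (ℤ→ℚ k) _ _) (trans (cong (ℤ→ℚ k *_) (inv-inverse (nz⇒≢0 nF))) (ℚₚ.*-identityʳ (ℤ→ℚ k)))
      lemma₁ : ∀ q r d e → (q - r) * (d * e) ≡ q * d * e - r * e * d
      lemma₁ = RingSolver.solve-∀ ℚ-ring
      lemma₂ : ∀ y p k → y ℤ.+ p ℤ.* p ℤ.* p ℤ.* p ℤ.* k ℤ.- y ≡ p ℤ.* (p ℤ.* (p ℤ.* (p ℤ.* + 1))) ℤ.* k
      lemma₂ = solve-∀
      cancel : ∀ {a b} → a * ℤ→ℚ F ≡ b * ℤ→ℚ F → a ≡ b
      cancel {a} {b} h = trans (expand a) (trans (cong (_* inv (ℤ→ℚ F)) h) (sym (expand b)))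
        where
        expand : ∀ a → a ≡ a * ℤ→ℚ F * inv (ℤ→ℚ F)
        expand a = sym (trans (ℚₚ.*-assoc a (ℤ→ℚ F) (inv (ℤ→ℚ F))) (trans (cong (a *_) (trans (ℚₚ.*-comm (ℤ→ℚ F) (inv (ℤ→ℚ F))) (inv-inverse (nz⇒≢0 nF)))) (ℚₚ.*-identityʳ a)))

  fourthℤ : ℤ → ℤ
  fourthℤ a = a ℤ.* a ℤ.* a ℤ.* a

  zs ys : ℕ → ℤ
  zs j = + 4 ℤ.* + j ℤ.+ + 1
  ys j = + 4 ℤ.* + j ℤ.+ + 4

  ¼ : ℚ
  ¼ = - ((+ 1) ℚ./ 4)

  falling-¼ : ∀ k → falling ¼ k * ℤ→ℚ ((ℤ.- + 4) ℤ.^ k) ≡ ℤ→ℚ (∏ k zs)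
  falling-¼ zero    = refl
  falling-¼ (suc k) = begin
    falling ¼ k * (¼ - ℕ→ℚ k) * ℤ→ℚ (ℤ.- + 4 ℤ.* (ℤ.- + 4) ℤ.^ k)
      ≡⟨ cong (falling ¼ k * (¼ - ℕ→ℚ k) *_) (ℤ→ℚ-* (ℤ.- + 4) ((ℤ.- + 4) ℤ.^ k)) ⟩
    falling ¼ k * (¼ - ℕ→ℚ k) * (ℤ→ℚ (ℤ.- + 4) * ℤ→ℚ ((ℤ.- + 4) ℤ.^ k))
      ≡⟨ lemma (falling ¼ k) ¼ (ℕ→ℚ k) (ℤ→ℚ (ℤ.- + 4)) (ℤ→ℚ ((ℤ.- + 4) ℤ.^ k)) ⟩
    falling ¼ k * ℤ→ℚ ((ℤ.- + 4) ℤ.^ k) * (¼ * ℤ→ℚ (ℤ.- + 4) + - ℤ→ℚ (ℤ.- + 4) * ℕ→ℚ k)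
      ≡⟨ cong₂ _*_ (falling-¼ k) (trans (cong (λ x → 1ℚ + x) (sym (ℤ→ℚ-* (+ 4) (+ k))))
           (trans (sym (ℤ→ℚ-+ (+ 1) (+ 4 ℤ.* + k))) (cong ℤ→ℚ (ℤₚ.+-comm (+ 1) (+ 4 ℤ.* + k))))) ⟩
    ℤ→ℚ (∏ k zs) * ℤ→ℚ (zs k)
      ≡⟨ sym (ℤ→ℚ-* (∏ k zs) (zs k)) ⟩
    ℤ→ℚ (∏ (suc k) zs) ∎
    where
    open ≡-Reasoning
    lemma : ∀ f a k c d → f * (a - k) * (c * d) ≡ f * d * (a * c + - c * k)
    lemma = RingSolver.solve-∀ ℚ-ring

  binom-¼ : ∀ k → binomℚ ¼ k * ℤ→ℚ ((ℤ.- + 4) ℤ.^ k ℤ.* + (k !)) ≡ ℤ→ℚ (∏ k zs)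
  binom-¼ k = begin
    falling ¼ k * g * ℤ→ℚ ((ℤ.- + 4) ℤ.^ k ℤ.* + (k !))
      ≡⟨ cong (falling ¼ k * g *_) (ℤ→ℚ-* ((ℤ.- + 4) ℤ.^ k) (+ (k !))) ⟩
    falling ¼ k * g * (ℤ→ℚ ((ℤ.- + 4) ℤ.^ k) * ℤ→ℚ (+ (k !)))
      ≡⟨ lemma (falling ¼ k) g (ℤ→ℚ ((ℤ.- + 4) ℤ.^ k)) (ℤ→ℚ (+ (k !))) ⟩
    falling ¼ k * ℤ→ℚ ((ℤ.- + 4) ℤ.^ k) * (g * ℤ→ℚ (+ (k !)))
      ≡⟨ cong₂ _*_ (falling-¼ k) (/-cancel (+ 1) (k !) {{k ℕₚ.!≢0}}) ⟩
    ℤ→ℚ (∏ k zs) * 1ℚ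
      ≡⟨ ℚₚ.*-identityʳ _ ⟩
    ℤ→ℚ (∏ k zs) ∎
    where
    open ≡-Reasoning
    g : ℚ
    g = ((+ 1) ℚ./ (k !)) {{k ℕₚ.!≢0}}
    lemma : ∀ f g c d → f * g * (c * d) ≡ f * c * (g * d)
    lemma = RingSolver.solve-∀ ℚ-ring

  ∏-fourth : ∀ k f → ∏ k (fourthℤ ∘ f) ≡ fourthℤ (∏ k f)
  ∏-fourth k f = trans (∏-* k _ f) (cong (ℤ._* ∏ k f) (trans (∏-* k _ f) (cong (ℤ._* ∏ k f) (∏-* k f f))))

  -- The signs of (-4)^k, which come from the falling factorial of -1/4, disappear in the fourth
  -- power.
  ∏ys : ∀ k → fourthℤ (∏ k ys) ≡ fourthℤ ((ℤ.- + 4) ℤ.^ k ℤ.* + (k !))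
  ∏ys zero    = refl
  ∏ys (suc k) = trans (lemma₁ (∏ k ys) (+ k)) (trans (cong (ℤ._* fourthℤ (ys k)) (∏ys k))
    (trans (lemma₂ ((ℤ.- + 4) ℤ.^ k) (+ (k !)) (+ k)) (cong (λ x → fourthℤ (ℤ.- + 4 ℤ.* (ℤ.- + 4) ℤ.^ k ℤ.* x)) (sym (ℤₚ.pos-* (suc k) (k !))))))
    where
    lemma₁ : ∀ a k → (a ℤ.* (+ 4 ℤ.* k ℤ.+ + 4)) ℤ.* (a ℤ.* (+ 4 ℤ.* k ℤ.+ + 4)) ℤ.* (a ℤ.* (+ 4 ℤ.* k ℤ.+ + 4)) ℤ.* (a ℤ.* (+ 4 ℤ.* k ℤ.+ + 4))
      ≡ a ℤ.* a ℤ.* a ℤ.* a ℤ.* ((+ 4 ℤ.* k ℤ.+ + 4) ℤ.* (+ 4 ℤ.* k ℤ.+ + 4) ℤ.* (+ 4 ℤ.* k ℤ.+ + 4) ℤ.* (+ 4 ℤ.* k ℤ.+ + 4))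
    lemma₁ = solve-∀
    lemma₂ : ∀ v f k → (v ℤ.* f) ℤ.* (v ℤ.* f) ℤ.* (v ℤ.* f) ℤ.* (v ℤ.* f) ℤ.* ((+ 4 ℤ.* k ℤ.+ + 4) ℤ.* (+ 4 ℤ.* k ℤ.+ + 4) ℤ.* (+ 4 ℤ.* k ℤ.+ + 4) ℤ.* (+ 4 ℤ.* k ℤ.+ + 4))
      ≡ (ℤ.- + 4 ℤ.* v ℤ.* ((+ 1 ℤ.+ k) ℤ.* f)) ℤ.* (ℤ.- + 4 ℤ.* v ℤ.* ((+ 1 ℤ.+ k) ℤ.* f)) ℤ.* (ℤ.- + 4 ℤ.* v ℤ.* ((+ 1 ℤ.+ k) ℤ.* f)) ℤ.* (ℤ.- + 4 ℤ.* v ℤ.* ((+ 1 ℤ.+ k) ℤ.* f))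
    lemma₂ = solve-∀

  integer-sum : ℕ → ℤ
  integer-sum L = ∑ (suc L) (λ k → (+ 8 ℤ.* + k ℤ.+ + 1) ℤ.* (∏ k (fourthℤ ∘ zs) ℤ.* tail L (fourthℤ ∘ ys) k))

  Σ<-scaled : ∀ n c {f} {g : ℕ → ℤ} → (∀ k → k ℕ.< n → f k * c ≡ ℤ→ℚ (g k)) → Σ< n f * c ≡ ℤ→ℚ (∑ n g)
  Σ<-scaled zero    c h = ℚₚ.*-zeroˡ c
  Σ<-scaled (suc n) c {f} {g} h = trans (ℚₚ.*-distribʳ-+ c (Σ< n f) (f n))
    (trans (cong₂ _+_ (Σ<-scaled n c {f} {g} (λ k k<n → h k (ℕₚ.m<n⇒m<1+n k<n))) (h n ℕₚ.≤-refl)) (sym (ℤ→ℚ-+ (∑ n g) (g n))))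

  S-as-quotient : ∀ L → S (suc L) * ℤ→ℚ (∏ L (fourthℤ ∘ ys)) ≡ ℤ→ℚ (integer-sum L)
  S-as-quotient L = Σ<-scaled (suc L) (ℤ→ℚ (∏ L (fourthℤ ∘ ys))) (λ k k≤L → step k (ℕ.s≤s⁻¹ k≤L))
    where
    open ≡-Reasoning
    step : ∀ k → k ℕ.≤ L → ℕ→ℚ (8 ℕ.* k ℕ.+ 1) * (binomℚ ¼ k ^ℚ 4) * ℤ→ℚ (∏ L (fourthℤ ∘ ys))
      ≡ ℤ→ℚ ((+ 8 ℤ.* + k ℤ.+ + 1) ℤ.* (∏ k (fourthℤ ∘ zs) ℤ.* tail L (fourthℤ ∘ ys) k))
    step k k≤L = begin
      ℕ→ℚ (8 ℕ.* k ℕ.+ 1) * (b ^ℚ 4) * ℤ→ℚ (∏ L (fourthℤ ∘ ys))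
        ≡⟨ cong₂ (λ x y → ℤ→ℚ (x ℤ.+ + 1) * (b ^ℚ 4) * ℤ→ℚ y) (ℤₚ.pos-* 8 k) split ⟩
      ℤ→ℚ c * (b ^ℚ 4) * ℤ→ℚ (fourthℤ d ℤ.* rest)
        ≡⟨ cong (ℤ→ℚ c * (b ^ℚ 4) *_) (trans (ℤ→ℚ-* (fourthℤ d) rest) (cong (_* ℤ→ℚ rest) (ℤ→ℚ-fourth d))) ⟩
      ℤ→ℚ c * (b ^ℚ 4) * (ℤ→ℚ d * ℤ→ℚ d * ℤ→ℚ d * ℤ→ℚ d * ℤ→ℚ rest)
        ≡⟨ lemma (ℤ→ℚ c) b (ℤ→ℚ d) (ℤ→ℚ rest) ⟩
      ℤ→ℚ c * ((b * ℤ→ℚ d) * (b * ℤ→ℚ d) * (b * ℤ→ℚ d) * (b * ℤ→ℚ d) * ℤ→ℚ rest)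
        ≡⟨ cong (λ x → ℤ→ℚ c * (x * x * x * x * ℤ→ℚ rest)) (binom-¼ k) ⟩
      ℤ→ℚ c * (ℤ→ℚ (∏ k zs) * ℤ→ℚ (∏ k zs) * ℤ→ℚ (∏ k zs) * ℤ→ℚ (∏ k zs) * ℤ→ℚ rest)
        ≡⟨ cong (λ x → ℤ→ℚ c * (x * ℤ→ℚ rest)) (sym (trans (cong ℤ→ℚ (∏-fourth k zs)) (ℤ→ℚ-fourth (∏ k zs)))) ⟩
      ℤ→ℚ c * (ℤ→ℚ (∏ k (fourthℤ ∘ zs)) * ℤ→ℚ rest)
        ≡⟨ trans (cong (ℤ→ℚ c *_) (sym (ℤ→ℚ-* (∏ k (fourthℤ ∘ zs)) rest))) (sym (ℤ→ℚ-* c (∏ k (fourthℤ ∘ zs) ℤ.* rest))) ⟩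
      ℤ→ℚ (c ℤ.* (∏ k (fourthℤ ∘ zs) ℤ.* rest)) ∎
      where
      b : ℚ
      b = binomℚ ¼ k
      c d rest : ℤ
      c = + 8 ℤ.* + k ℤ.+ + 1
      d = (ℤ.- + 4) ℤ.^ k ℤ.* + (k !)
      rest = tail L (fourthℤ ∘ ys) k
      split : ∏ L (fourthℤ ∘ ys) ≡ fourthℤ d ℤ.* rest
      split = trans (sym (tail-full L (fourthℤ ∘ ys))) (trans (tail-split k (fourthℤ ∘ ys) z≤n k≤L)
        (cong (ℤ._* rest) (trans (tail-full k (fourthℤ ∘ ys)) (trans (∏-fourth k ys) (∏ys k)))))
      ℤ→ℚ-fourth : ∀ a → ℤ→ℚ (fourthℤ a) ≡ ℤ→ℚ a * ℤ→ℚ a * ℤ→ℚ a * ℤ→ℚ a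
      ℤ→ℚ-fourth a = trans (ℤ→ℚ-* (a ℤ.* a ℤ.* a) a) (cong (_* ℤ→ℚ a) (trans (ℤ→ℚ-* (a ℤ.* a) a) (cong (_* ℤ→ℚ a) (ℤ→ℚ-* a a))))
      lemma : ∀ c b d r → c * (b * (b * (b * (b * 1ℚ)))) * (d * d * d * d * r) ≡ c * ((b * d) * (b * d) * (b * d) * (b * d) * r)
      lemma = RingSolver.solve-∀ ℚ-ring

-- Sums over residues and the Legendre symbol

module LegendreSums where

  open IntegerCongruences
  open import Data.Integer using (_+_; _*_; _-_; -_; _^_)

  +-cancelˡ-≤ : ∀ a {b c} → a + b ℤ.≤ a + c → b ℤ.≤ c
  +-cancelˡ-≤ a {b} {c} h = subst₂ ℤ._≤_ (lemma a b) (lemma a c) (ℤₚ.+-monoʳ-≤ (- a) h)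
    where
    lemma : ∀ a b → - a + (a + b) ≡ b
    lemma = solve-∀

  +-cancelʳ-≤ : ∀ a {b c} → b + a ℤ.≤ c + a → b ℤ.≤ c
  +-cancelʳ-≤ a {b} {c} h = +-cancelˡ-≤ a (subst₂ ℤ._≤_ (ℤₚ.+-comm b a) (ℤₚ.+-comm c a) h)

  ∑-equal : ∀ n {f g} → (∀ i → i ℕ.< n → f i ℤ.≤ g i) → ∑ n f ≡ ∑ n g → ∀ i → i ℕ.< n → f i ≡ g i
  ∑-equal (suc n) {f} {g} f≤g e i i<1+n with i ℕ.≟ n
  ... | yes refl = ℤₚ.≤-antisym (f≤g n ℕₚ.≤-refl) (+-cancelˡ-≤ (∑ n f)
          (ℤₚ.≤-trans (ℤₚ.+-monoˡ-≤ (g n) (∑-mono n (λ j j<n → f≤g j (ℕₚ.m<n⇒m<1+n j<n)))) (ℤₚ.≤-reflexive (sym e))))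
  ... | no i≢n = ∑-equal n (λ j j<n → f≤g j (ℕₚ.m<n⇒m<1+n j<n)) (ℤₚ.≤-antisym
          (∑-mono n (λ j j<n → f≤g j (ℕₚ.m<n⇒m<1+n j<n)))
          (+-cancelʳ-≤ (f n) (ℤₚ.≤-trans (ℤₚ.+-monoʳ-≤ (∑ n g) (f≤g n ℕₚ.≤-refl)) (ℤₚ.≤-reflexive (sym e)))))
          i (ℕₚ.≤∧≢⇒< (ℕ.s≤s⁻¹ i<1+n) i≢n)

  data Sign : ℤ → Set where
    null     : Sign (+ 0)
    positive : Sign (+ 1)
    negative : Sign (- + 1)

  sign-* : ∀ {a b} → Sign a → Sign b → Sign (a * b)
  sign-* null     null     = null
  sign-* null     positive = null
  sign-* null     negative = null
  sign-* positive null     = null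
  sign-* positive positive = positive
  sign-* positive negative = negative
  sign-* negative null     = null
  sign-* negative positive = negative
  sign-* negative negative = positive

  module Residues {p : ℕ} (pr : Prime p) where
    open ModPrime pr

    residues-distinct : ∀ {i j} → i ℕ.< p → j ℕ.< p → + i ≈ + j [ P ] → i ≡ j
    residues-distinct {i} {j} i<p j<p e with ℕₚ.<-cmp i j
    ... | tri≈ _ i≡j _ = i≡j
    ... | tri< i<j _ _ = ⊥-elim (nz-small (ℕₚ.m<n⇒0<n∸m i<j) (ℕₚ.≤-<-trans (ℕₚ.m∸n≤m j i) j<p)
            (≈-trans (≡⇒≈ (pos-∸ (ℕₚ.<⇒≤ i<j))) (difference-≈0 (≈-sym e))))
    ... | tri> _ _ j<i = ⊥-elim (nz-small (ℕₚ.m<n⇒0<n∸m j<i) (ℕₚ.≤-<-trans (ℕₚ.m∸n≤m i j) i<p)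
            (≈-trans (≡⇒≈ (pos-∸ (ℕₚ.<⇒≤ j<i))) (difference-≈0 e)))

    Periodic : (ℤ → ℤ) → Set
    Periodic F = ∀ {a b} → a ≈ b [ P ] → F a ≡ F b

    indicator : ∀ {a} → Dec (a ≈ + 0 [ P ]) → ℤ
    indicator (yes _) = + 1
    indicator (no _)  = + 0

    δ : ℤ → ℤ → ℤ
    δ a b = indicator (≈0? (a - b))

    δ-yes : ∀ {a b} → a ≈ b [ P ] → δ a b ≡ + 1
    δ-yes {a} {b} e with ≈0? (a - b)
    ... | yes _ = refl
    ... | no ne = contradiction (difference-≈0 e) ne

    δ-no : ∀ {a b} → ¬ (a ≈ b [ P ]) → δ a b ≡ + 0
    δ-no {a} {b} ne with ≈0? (a - b)
    ... | yes e = contradiction (≈-from-difference e) ne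
    ... | no _  = refl

    ≈? : ∀ a b → Dec (a ≈ b [ P ])
    ≈? a b with ≈0? (a - b)
    ... | yes e = yes (≈-from-difference e)
    ... | no ne = no (ne ∘ difference-≈0)

    δ-⇔ : ∀ {a b c d} → (a ≈ b [ P ] → c ≈ d [ P ]) → (c ≈ d [ P ] → a ≈ b [ P ]) → δ a b ≡ δ c d
    δ-⇔ {a} {b} {c} {d} f g with ≈? a b
    ... | yes e = trans (δ-yes e) (sym (δ-yes (f e)))
    ... | no ne = trans (δ-no ne) (sym (δ-no (ne ∘ g)))

    δ-congʳ : ∀ {a b c} → a ≈ b [ P ] → δ c a ≡ δ c b
    δ-congʳ {a} {b} {c} e = δ-⇔ {c} {a} {c} {b} (λ x → ≈-trans x e) (λ x → ≈-trans x (≈-sym e))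

    ∑ₚ : (ℤ → ℤ) → ℤ
    ∑ₚ F = ∑ p (λ t → F (+ t))

    ∑ₚ-cong : ∀ {F G : ℤ → ℤ} → (∀ t → F t ≡ G t) → ∑ₚ F ≡ ∑ₚ G
    ∑ₚ-cong h = ∑-cong p (λ t _ → h (+ t))

    ∑ₚ-+ : ∀ F G → ∑ₚ (λ t → F t + G t) ≡ ∑ₚ F + ∑ₚ G
    ∑ₚ-+ F G = ∑-+ p (λ t → F (+ t)) (λ t → G (+ t))

    ∑ₚ-*ˡ : ∀ c F → ∑ₚ (λ t → c * F t) ≡ c * ∑ₚ F
    ∑ₚ-*ˡ c F = ∑-*ˡ p c (λ t → F (+ t))

    ∑ₚ-*ʳ : ∀ c F → ∑ₚ (λ t → F t * c) ≡ ∑ₚ F * c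
    ∑ₚ-*ʳ c F = ∑-*ʳ p c (λ t → F (+ t))

    ∑ₚ-swap : ∀ (F : ℤ → ℤ → ℤ) → ∑ₚ (λ s → ∑ₚ (F s)) ≡ ∑ₚ (λ t → ∑ₚ (λ s → F s t))
    ∑ₚ-swap F = ∑-swap p p (λ s t → F (+ s) (+ t))

    ∑ₚ-const : ∀ c → ∑ₚ (λ _ → c) ≡ P * c
    ∑ₚ-const c = ∑-const p c

    ∑ₚ-δ : ∀ a {F} → Periodic F → ∑ₚ (λ t → δ a t * F t) ≡ F a
    ∑ₚ-δ a {F} per with residue a
    ... | r , r<p , a≈r = trans (≈-exact (∑-single p r r<p (λ i i<p i≢r → ≡⇒≈ (off i i<p i≢r)))) at
      where
      off : ∀ i → i ℕ.< p → i ≢ r → δ a (+ i) * F (+ i) ≡ + 0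
      off i i<p i≢r = trans (cong (_* F (+ i)) (δ-no (λ e → i≢r (residues-distinct i<p r<p (≈-trans (≈-sym e) a≈r))))) (ℤₚ.*-zeroˡ (F (+ i)))
      at : δ a (+ r) * F (+ r) ≡ F a
      at = trans (cong₂ _*_ (δ-yes a≈r) (per (≈-sym a≈r))) (ℤₚ.*-identityˡ (F a))

    ∑ₚ-δ₁ : ∀ a → ∑ₚ (δ a) ≡ + 1
    ∑ₚ-δ₁ a = trans (∑ₚ-cong (λ t → sym (ℤₚ.*-identityʳ (δ a t)))) (∑ₚ-δ a {λ _ → + 1} (λ _ → refl))

    ∑ₚ-fibres : ∀ (σ : ℤ → ℤ) {F} → Periodic F → ∑ₚ (λ t → F (σ t)) ≡ ∑ₚ (λ u → ∑ₚ (λ t → δ (σ t) u) * F u)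
    ∑ₚ-fibres σ {F} per = begin
      ∑ₚ (λ t → F (σ t))
        ≡⟨ ∑ₚ-cong (λ t → sym (∑ₚ-δ (σ t) per)) ⟩
      ∑ₚ (λ t → ∑ₚ (λ u → δ (σ t) u * F u))
        ≡⟨ ∑ₚ-swap (λ t u → δ (σ t) u * F u) ⟩
      ∑ₚ (λ u → ∑ₚ (λ t → δ (σ t) u * F u))
        ≡⟨ ∑ₚ-cong (λ u → ∑ₚ-*ʳ (F u) (λ t → δ (σ t) u)) ⟩
      ∑ₚ (λ u → ∑ₚ (λ t → δ (σ t) u) * F u) ∎
      where open ≡-Reasoning

    -- σ and τ need be inverse on residues only: the two implications identify δ (σ t) u with δ (τ
    -- u) t, so each fibre of σ has total weight 1.
    reindex : ∀ (σ τ : ℤ → ℤ) → (∀ a b → σ a ≈ b [ P ] → τ b ≈ a [ P ]) → (∀ a b → τ b ≈ a [ P ] → σ a ≈ b [ P ]) →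
      ∀ {F} → Periodic F → ∑ₚ (λ t → F (σ t)) ≡ ∑ₚ F
    reindex σ τ f g {F} per = trans (∑ₚ-fibres σ per) (∑ₚ-cong (λ u → trans
      (cong (_* F u) (trans (∑ₚ-cong (λ t → δ-⇔ (f t u) (g t u))) (∑ₚ-δ₁ (τ u)))) (ℤₚ.*-identityˡ (F u))))

    shift : ∀ c {F} → Periodic F → ∑ₚ (λ t → F (t + c)) ≡ ∑ₚ F
    shift c = reindex (_+ c) (_- c)
      (λ a b e → ≈-trans (-‿≈ (≈-sym e) (≈-refl {a = c})) (≡⇒≈ (lemma₁ a c)))
      (λ a b e → ≈-trans (+-≈ (≈-sym e) (≈-refl {a = c})) (≡⇒≈ (lemma₂ b c)))
      where
      lemma₁ : ∀ a c → a + c - c ≡ a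
      lemma₁ = solve-∀
      lemma₂ : ∀ a c → a - c + c ≡ a
      lemma₂ = solve-∀

    scale : ∀ {u} → Nz u → ∀ {F} → Periodic F → ∑ₚ (λ t → F (u * t)) ≡ ∑ₚ F
    scale {u} nu = reindex (u *_) (v *_)
      (λ a b e → ≈-trans (*-≈ˡ v (≈-sym e)) (≈-trans (≡⇒≈ (lemma v u a)) (≈-trans (*-≈ʳ a uv) (≡⇒≈ (ℤₚ.*-identityˡ a)))))
      (λ a b e → ≈-trans (*-≈ˡ u (≈-sym e)) (≈-trans (≡⇒≈ (sym (ℤₚ.*-assoc u v b))) (≈-trans (*-≈ʳ b uv) (≡⇒≈ (ℤₚ.*-identityˡ b)))))
      where
      v : ℤ
      v = proj₁ (inverse₁ nu)
      uv : u * v ≈ + 1 [ P ]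
      uv = proj₂ (inverse₁ nu)
      lemma : ∀ v u a → v * (u * a) ≡ u * v * a
      lemma = solve-∀

    0<p-2 : 2 ℕ.< p → 0 ℕ.< p ℕ.∸ 2
    0<p-2 = ℕₚ.m<n⇒0<n∸m

    ^-≈0 : ∀ {k a} → 0 ℕ.< k → a ≈ + 0 [ P ] → a ^ k ≈ + 0 [ P ]
    ^-≈0 {suc k} {a} _ e = ≈-trans (*-≈ʳ (a ^ k) e) (≡⇒≈ (ℤₚ.*-zeroˡ (a ^ k)))

    -- As a power it inverts units and fixes 0, hence permutes all residues and needs no case
    -- distinction under a sum.
    recip : ℤ → ℤ
    recip a = a ^ (p ℕ.∸ 2)

    recip-inverse : ∀ {a} → Nz a → a * recip a ≈ + 1 [ P ]
    recip-inverse na = proj₂ (inverse₁ na)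

    recip-involutive : 2 ℕ.< p → ∀ {a} → recip (recip a) ≈ a [ P ]
    recip-involutive 2<p {a} with ≈0? a
    ... | yes e = ≈-trans (^-≈0 (0<p-2 2<p) (^-≈0 (0<p-2 2<p) e)) (≈-sym e)
    ... | no na = ≈-cancel₁ {recip a} n-recip (≈-trans (recip-inverse n-recip) (≈-trans (≈-sym (recip-inverse na)) (≡⇒≈ (ℤₚ.*-comm a (recip a)))))
      where
      n-recip : Nz (recip a)
      n-recip = nz-^ (p ℕ.∸ 2) na

    invert : 2 ℕ.< p → ∀ {F} → Periodic F → ∑ₚ (λ t → F (recip t)) ≡ ∑ₚ F
    invert 2<p = reindex recip recip
      (λ a b e → ≈-trans (^-≈ (p ℕ.∸ 2) (≈-sym e)) (recip-involutive 2<p))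
      (λ a b e → ≈-trans (^-≈ (p ℕ.∸ 2) (≈-sym e)) (recip-involutive 2<p))

  module Legendre {p : ℕ} (pr : Prime p) (n : ℕ) (p≡ : p ≡ suc ((n ℕ.+ n) ℕ.+ (n ℕ.+ n))) where
    open ModPrime pr
    open Residues pr

    h : ℕ
    h = n ℕ.+ n

    0<h : 0 ℕ.< h
    0<h = positive-h h p≡
      where
      positive-h : ∀ h → p ≡ suc (h ℕ.+ h) → 0 ℕ.< h
      positive-h zero    e = ⊥-elim (ℕₚ.<-irrefl (sym e) 1<p)
      positive-h (suc h) _ = s≤s z≤n

    1+h<p : suc h ℕ.< p
    1+h<p = subst (suc h ℕ.<_) (sym p≡) (s≤s (ℕₚ.m<m+n h 0<h))

    2<p : 2 ℕ.< p
    2<p = ℕₚ.≤-<-trans (s≤s 0<h) 1+h<p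

    nz-2 : Nz (+ 2)
    nz-2 = nz-small (s≤s z≤n) 2<p

    p-1 : p ℕ.∸ 1 ≡ h ℕ.+ h
    p-1 = cong (ℕ._∸ 1) p≡

    -- The Legendre symbol through Euler's criterion: by Fermat, a^h is a root of x(x - 1)(x + 1)
    -- modulo P.
    character : ∀ a → ∃ λ e → Sign e × a ^ h ≈ e [ P ]
    character a with ≈0? a
    ... | yes e = + 0 , null , ^-≈0 0<h e
    ... | no na with ≈0? (a ^ h - + 1)
    ...   | yes e = + 1 , positive , ≈-from-difference e
    ...   | no ne = - + 1 , negative , ≈-from-difference (≈-trans (≡⇒≈ (lemma₁ (a ^ h))) (≈0-cancel ne (≈-trans (≡⇒≈ (trans (lemma₂ (a ^ h))
              (cong (_- + 1) (trans (sym (ℤₚ.^-distribˡ-+-* a h h)) (cong (a ^_) (sym p-1)))))) (difference-≈0 (fermat-1 na)))))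
      where
      lemma₁ : ∀ x → x - - + 1 ≡ x + + 1
      lemma₁ = solve-∀
      lemma₂ : ∀ x → (x - + 1) * (x + + 1) ≡ x * x - + 1
      lemma₂ = solve-∀

    φ : ℤ → ℤ
    φ a = proj₁ (character a)

    φ-sign : ∀ a → Sign (φ a)
    φ-sign a = proj₁ (proj₂ (character a))

    euler : ∀ a → a ^ h ≈ φ a [ P ]
    euler a = proj₂ (proj₂ (character a))

    sign-unique : ∀ {e f} → Sign e → Sign f → e ≈ f [ P ] → e ≡ f
    sign-unique null     null     _ = refl
    sign-unique null     positive x = ⊥-elim (nz-1 (≈-sym x))
    sign-unique null     negative x = ⊥-elim (nz-neg nz-1 (≈-sym x))
    sign-unique positive null     x = ⊥-elim (nz-1 x)
    sign-unique positive positive _ = refl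
    sign-unique positive negative x = ⊥-elim (nz-2 (difference-≈0 x))
    sign-unique negative null     x = ⊥-elim (nz-neg nz-1 x)
    sign-unique negative positive x = ⊥-elim (nz-neg nz-2 (difference-≈0 x))
    sign-unique negative negative _ = refl

    φ-unique : ∀ {a e} → Sign e → a ^ h ≈ e [ P ] → φ a ≡ e
    φ-unique {a} s e = sign-unique (φ-sign a) s (≈-trans (≈-sym (euler a)) e)

    φ-periodic : Periodic φ
    φ-periodic {a} {b} e = φ-unique (φ-sign b) (≈-trans (^-≈ h e) (euler b))

    φ-* : ∀ a b → φ (a * b) ≡ φ a * φ b
    φ-* a b = φ-unique (sign-* (φ-sign a) (φ-sign b)) (≈-trans (≡⇒≈ (^-distrib-* a b h)) (*-≈ (euler a) (euler b)))

    φ-0 : ∀ {a} → a ≈ + 0 [ P ] → φ a ≡ + 0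
    φ-0 e = φ-unique null (^-≈0 0<h e)

    φ-1 : φ (+ 1) ≡ + 1
    φ-1 = φ-unique positive (≡⇒≈ (ℤₚ.^-zeroˡ h))

    φ-neg1 : φ (- + 1) ≡ + 1
    φ-neg1 = φ-unique positive (≡⇒≈ (trans (ℤₚ.^-distribˡ-+-* (- + 1) n n) (sign-square n)))

    φ-neg : ∀ a → φ (- a) ≡ φ a
    φ-neg a = trans (cong φ (lemma a)) (trans (φ-* (- + 1) a) (trans (cong (_* φ a) φ-neg1) (ℤₚ.*-identityˡ (φ a))))
      where
      lemma : ∀ a → - a ≡ - + 1 * a
      lemma = solve-∀

    φ² : ∀ {a} → Nz a → φ a * φ a ≡ + 1
    φ² {a} na with φ a | φ-sign a | euler a
    ... | _ | null     | e = ⊥-elim (nz-^ h na e)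
    ... | _ | positive | _ = refl
    ... | _ | negative | _ = refl

    φ²-δ : ∀ a → φ a * φ a ≡ + 1 - δ (+ 0) a
    φ²-δ a = cases (≈0? a)
      where
      cases : Dec (a ≈ + 0 [ P ]) → φ a * φ a ≡ + 1 - δ (+ 0) a
      cases (yes e) = trans (cong₂ _*_ (φ-0 e) (φ-0 e)) (cong (λ d → + 1 - d) (sym (δ-yes (≈-sym e))))
      cases (no na) = trans (φ² na) (cong (λ d → + 1 - d) (sym (δ-no (λ e → na (≈-sym e)))))

    ∑ₚ-1-δ : ∑ₚ (λ t → + 1 - δ (+ 0) t) ≡ P - + 1
    ∑ₚ-1-δ = trans (∑ₚ-+ (λ _ → + 1) (λ t → - δ (+ 0) t)) (cong₂ _+_ (trans (∑ₚ-const (+ 1)) (ℤₚ.*-identityʳ P))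
      (trans (∑-neg p (λ t → δ (+ 0) (+ t))) (cong -_ (∑ₚ-δ₁ (+ 0)))))

    -- Without a nonresidue φ would be 1 on all units, so that ∑ t^h ≈ p - 1 ≈ -1, whereas the power
    -- sum of exponent h < p - 1 vanishes.
    nonresidue : ∃ λ g → φ g ≡ - + 1
    nonresidue with ℕₚ.anyUpTo? (λ t → φ (+ t) ℤ.≟ - + 1) p
    ... | yes (g , _ , e) = + g , e
    ... | no none = ⊥-elim (nz-neg nz-1 (≈-trans (≈-trans (≡⇒≈ (sym (ℤₚ.+-identityˡ (- + 1)))) (+-≈ (≈-sym P≈0) (≈-refl {a = - + 1})))
          (≈-trans (≡⇒≈ (sym ∑ₚ-1-δ)) (≈-trans (≈-sym (∑-≈ p (λ t t<p → ≈-trans (euler (+ t)) (≡⇒≈ (all t t<p))))) (power-sum≈0 h 1+h<p)))))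
      where
      only : ∀ {e} → Sign e → e ≢ - + 1 → e ≡ e * e
      only null     _ = refl
      only positive _ = refl
      only negative n = ⊥-elim (n refl)
      all : ∀ t → t ℕ.< p → φ (+ t) ≡ + 1 - δ (+ 0) (+ t)
      all t t<p = trans (only (φ-sign (+ t)) (λ e → none (t , t<p , e))) (φ²-δ (+ t))

    φ⇒nz : ∀ {a} → φ a ≡ - + 1 → Nz a
    φ⇒nz {a} e a0 with trans (sym e) (φ-0 a0)
    ... | ()

    ∑φ : ∑ₚ φ ≡ + 0
    ∑φ = flip-sign (begin
      ∑ₚ φ                      ≡⟨ sym (scale (φ⇒nz eg) φ-periodic) ⟩
      ∑ₚ (λ t → φ (g * t))      ≡⟨ ∑ₚ-cong (λ t → trans (φ-* g t) (cong (_* φ t) eg)) ⟩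
      ∑ₚ (λ t → - + 1 * φ t)    ≡⟨ ∑ₚ-*ˡ (- + 1) φ ⟩
      - + 1 * ∑ₚ φ              ∎)
      where
      open ≡-Reasoning
      g = proj₁ nonresidue
      eg = proj₂ nonresidue
      flip-sign : ∀ {s} → s ≡ - + 1 * s → s ≡ + 0
      flip-sign {s} e = ℤₚ.*-cancelˡ-≡ (+ 2) s (+ 0) (trans (lemma₁ s) (trans (cong (λ x → s + x) e) (lemma₂ s)))
        where
        lemma₁ : ∀ s → + 2 * s ≡ s + s
        lemma₁ = solve-∀
        lemma₂ : ∀ s → s + - + 1 * s ≡ + 2 * + 0
        lemma₂ = solve-∀

-- Jacobsthal sums

module JacobsthalSums where

  open IntegerCongruences
  open LegendreSums
  open import Data.Integer using (_+_; _*_; _-_; -_; _^_)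

  module Jacobsthal {p : ℕ} (pr : Prime p) (n : ℕ) (p≡ : p ≡ suc ((n ℕ.+ n) ℕ.+ (n ℕ.+ n))) where
    open ModPrime pr
    open Residues pr
    open Legendre pr n p≡

    δ-sym : ∀ a b → δ a b ≡ δ b a
    δ-sym a b = δ-⇔ {a} {b} {b} {a} ≈-sym ≈-sym

    ±-distinct : ∀ {s} → Nz s → ¬ (s ≈ - s [ P ])
    ±-distinct {s} ns e = nz-* nz-2 ns (≈-trans (≡⇒≈ (lemma s)) (difference-≈0 e))
      where
      lemma : ∀ s → + 2 * s ≡ s - - s
      lemma = solve-∀

    square-roots : ∀ {s u} → s * s ≈ u * u [ P ] → s ≈ u [ P ] ⊎ s ≈ - u [ P ]
    square-roots {s} {u} e with euclid {s - u} {s + u} (≈-trans (≡⇒≈ (lemma s u)) (difference-≈0 e))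
      where
      lemma : ∀ s u → (s - u) * (s + u) ≡ s * s - u * u
      lemma = solve-∀
    ... | inj₁ x = inj₁ (≈-from-difference x)
    ... | inj₂ x = inj₂ (≈-from-difference (≈-trans (≡⇒≈ (cong (λ z → s + z) (ℤₚ.neg-involutive u))) x))

    δ-squares : ∀ {s} → Nz s → ∀ u → δ (u * u) (s * s) ≡ δ s u + δ (- s) u
    δ-squares {s} ns u with ≈? s u | ≈? (- s) u
    ... | yes a | yes b = ⊥-elim (±-distinct ns (≈-trans a (≈-sym b)))
    ... | yes a | no nb = trans (δ-yes (*-≈ (≈-sym a) (≈-sym a))) (sym (cong₂ _+_ (δ-yes a) (δ-no nb)))
    ... | no na | yes b = trans (δ-yes (≈-trans (*-≈ (≈-sym b) (≈-sym b)) (≡⇒≈ (lemma s)))) (sym (cong₂ _+_ (δ-no na) (δ-yes b)))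
      where
      lemma : ∀ s → - s * - s ≡ s * s
      lemma = solve-∀
    ... | no na | no nb = trans (δ-no (λ e → none (square-roots e))) (sym (cong₂ _+_ (δ-no na) (δ-no nb)))
      where
      none : ¬ (u ≈ s [ P ] ⊎ u ≈ - s [ P ])
      none (inj₁ x) = na (≈-sym x)
      none (inj₂ x) = nb (≈-sym x)

    roots : ℤ → ℤ
    roots t = ∑ₚ (λ s → δ (s * s) t)

    roots-periodic : Periodic roots
    roots-periodic {a} {b} e = ∑ₚ-cong (λ s → δ-congʳ {a} {b} {s * s} e)

    -- With a root s at hand the roots are exactly ±s, or 0 alone when t is 0; with none the bound
    -- is trivial. Only an inequality is claimed, which avoids having to find a root for every
    -- residue with φ t = 1.
    roots≤ : ∀ t → roots t ℤ.≤ + 1 + φ t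
    roots≤ t = zero-case (≈0? t)
      where
      lower : ∀ {e} → Sign e → + 0 ℤ.≤ + 1 + e
      lower null     = ℤ.+≤+ z≤n
      lower positive = ℤ.+≤+ z≤n
      lower negative = ℤ.+≤+ z≤n
      root-case : Nz t → Dec (∃ λ s → s ℕ.< p × (+ s * + s ≈ t [ P ])) → roots t ℤ.≤ + 1 + φ t
      root-case nt (yes (s , _ , e)) = ℤₚ.≤-reflexive (begin
        ∑ₚ (λ u → δ (u * u) t)
          ≡⟨ ∑ₚ-cong (λ u → trans (δ-congʳ {t} {+ s * + s} {u * u} (≈-sym e)) (δ-squares ns u)) ⟩
        ∑ₚ (λ u → δ (+ s) u + δ (- + s) u)
          ≡⟨ trans (∑ₚ-+ (δ (+ s)) (δ (- + s))) (cong₂ _+_ (∑ₚ-δ₁ (+ s)) (∑ₚ-δ₁ (- + s))) ⟩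
        + 1 + + 1
          ≡⟨ cong (λ x → + 1 + x) (sym (trans (φ-periodic (≈-sym e)) (trans (φ-* (+ s) (+ s)) (φ² ns)))) ⟩
        + 1 + φ t ∎)
        where
        open ≡-Reasoning
        ns : Nz (+ s)
        ns s0 = nt (≈-trans (≈-sym e) (≈-trans (*-≈ʳ (+ s) s0) (≡⇒≈ (ℤₚ.*-zeroˡ (+ s)))))
      root-case nt (no none) = ℤₚ.≤-trans (ℤₚ.≤-reflexive (≈-exact (∑-zero p (λ s s<p → ≡⇒≈ (δ-no (λ e → none (s , s<p , e)))))))
        (lower (φ-sign t))
      zero-case : Dec (t ≈ + 0 [ P ]) → roots t ℤ.≤ + 1 + φ t
      zero-case (no nt) = root-case nt (ℕₚ.anyUpTo? (λ s → ≈? (+ s * + s) t) p)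
      zero-case (yes t0) = ℤₚ.≤-reflexive (trans (∑ₚ-cong (λ s → δ-⇔ {s * s} {t} {+ 0} {s} (to s) (from s)))
        (trans (∑ₚ-δ₁ (+ 0)) (cong (λ x → + 1 + x) (sym (φ-0 t0)))))
        where
        to : ∀ s → s * s ≈ t [ P ] → + 0 ≈ s [ P ]
        to s e with euclid {s} {s} (≈-trans e t0)
        ... | inj₁ x = ≈-sym x
        ... | inj₂ x = ≈-sym x
        from : ∀ s → + 0 ≈ s [ P ] → s * s ≈ t [ P ]
        from s e = ≈-trans (*-≈ (≈-sym e) (≈-sym e)) (≈-sym t0)

    ∑roots : ∑ₚ roots ≡ ∑ₚ (λ t → + 1 + φ t)
    ∑roots = begin
      ∑ₚ (λ t → ∑ₚ (λ s → δ (s * s) t))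
        ≡⟨ ∑ₚ-swap (λ t s → δ (s * s) t) ⟩
      ∑ₚ (λ s → ∑ₚ (δ (s * s)))
        ≡⟨ ∑ₚ-cong (λ s → ∑ₚ-δ₁ (s * s)) ⟩
      ∑ₚ (λ _ → + 1)
        ≡⟨ sym (ℤₚ.+-identityʳ _) ⟩
      ∑ₚ (λ _ → + 1) + + 0
        ≡⟨ cong (λ x → ∑ₚ (λ _ → + 1) + x) (sym ∑φ) ⟩
      ∑ₚ (λ _ → + 1) + ∑ₚ φ
        ≡⟨ sym (∑ₚ-+ (λ _ → + 1) φ) ⟩
      ∑ₚ (λ t → + 1 + φ t) ∎
      where open ≡-Reasoning

    -- Termwise roots t ≤ 1 + φ t, and the totals over all residues agree.
    roots≡ : ∀ t → roots t ≡ + 1 + φ t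
    roots≡ t with residue t
    ... | r , r<p , e = trans (roots-periodic e) (trans (∑-equal p (λ i _ → roots≤ (+ i)) ∑roots r r<p) (cong (λ x → + 1 + x) (φ-periodic (≈-sym e))))

    ∑-squares : ∀ {F} → Periodic F → ∑ₚ (λ s → F (s * s)) ≡ ∑ₚ (λ t → (+ 1 + φ t) * F t)
    ∑-squares {F} per = trans (∑ₚ-fibres (λ s → s * s) per) (∑ₚ-cong (λ t → cong (_* F t) (roots≡ t)))

    -- The values s² and κs² together run through every residue exactly twice.
    ∑-halves : ∀ {κ F} → φ κ ≡ - + 1 → Periodic F → ∑ₚ (λ s → F (s * s)) + ∑ₚ (λ s → F (κ * (s * s))) ≡ + 2 * ∑ₚ F
    ∑-halves {κ} {F} eκ per = begin
      ∑ₚ (λ s → F (s * s)) + ∑ₚ (λ s → F (κ * (s * s)))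
        ≡⟨ cong₂ _+_ (∑-squares per) second ⟩
      ∑ₚ (λ t → (+ 1 + φ t) * F t) + ∑ₚ (λ t → (+ 1 - φ t) * F t)
        ≡⟨ sym (∑ₚ-+ (λ t → (+ 1 + φ t) * F t) (λ t → (+ 1 - φ t) * F t)) ⟩
      ∑ₚ (λ t → (+ 1 + φ t) * F t + (+ 1 - φ t) * F t)
        ≡⟨ ∑ₚ-cong (λ t → lemma (φ t) (F t)) ⟩
      ∑ₚ (λ t → + 2 * F t)
        ≡⟨ ∑ₚ-*ˡ (+ 2) F ⟩
      + 2 * ∑ₚ F ∎
      where
      open ≡-Reasoning
      lemma : ∀ a f → (+ 1 + a) * f + (+ 1 - a) * f ≡ + 2 * f
      lemma = solve-∀
      lemma₂ : ∀ a → + 1 + a ≡ + 1 - (- + 1 * a)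
      lemma₂ = solve-∀
      second : ∑ₚ (λ s → F (κ * (s * s))) ≡ ∑ₚ (λ t → (+ 1 - φ t) * F t)
      second = begin
        ∑ₚ (λ s → F (κ * (s * s)))
          ≡⟨ ∑-squares {λ t → F (κ * t)} (λ e → per (*-≈ˡ κ e)) ⟩
        ∑ₚ (λ t → (+ 1 + φ t) * F (κ * t))
          ≡⟨ ∑ₚ-cong (λ t → cong (_* F (κ * t)) (trans (lemma₂ (φ t)) (cong (λ x → + 1 - x) (sym (trans (φ-* κ t) (cong (_* φ t) eκ)))))) ⟩
        ∑ₚ (λ t → (+ 1 - φ (κ * t)) * F (κ * t))
          ≡⟨ scale (φ⇒nz eκ) {λ t → (+ 1 - φ t) * F t} (λ e → cong₂ (λ x y → (+ 1 - x) * y) (φ-periodic e) (per e)) ⟩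
        ∑ₚ (λ t → (+ 1 - φ t) * F t) ∎

    -- For a unit t, φ(t)φ(t + c) = φ(1 + c/t), and 1 + c/t runs through a linear image of all
    -- residues. Since `recip` sends 0 to 0, the term t = 0 adds φ(1) = 1, which δ takes away.
    ∑φφ-shift : ∀ {c} → Nz c → ∑ₚ (λ t → φ t * φ (t + c)) ≡ - + 1
    ∑φφ-shift {c} nc = begin
      ∑ₚ (λ t → φ t * φ (t + c))
        ≡⟨ ∑ₚ-cong pointwise ⟩
      ∑ₚ (λ t → φ (+ 1 + c * recip t) - δ (+ 0) t)
        ≡⟨ trans (∑ₚ-+ (λ t → φ (+ 1 + c * recip t)) (λ t → - δ (+ 0) t)) (cong₂ _+_ (invert 2<p {λ t → φ (+ 1 + c * t)} (λ e → φ-periodic (+-≈ (≈-refl {a = + 1}) (*-≈ˡ c e)))) (∑-neg p (λ t → δ (+ 0) (+ t)))) ⟩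
      ∑ₚ (λ t → φ (+ 1 + c * t)) - ∑ₚ (δ (+ 0))
        ≡⟨ cong₂ _-_ (trans (scale nc {λ t → φ (+ 1 + t)} (λ e → φ-periodic (+-≈ (≈-refl {a = + 1}) e)))
             (trans (∑ₚ-cong (λ t → cong φ (ℤₚ.+-comm (+ 1) t))) (trans (shift (+ 1) φ-periodic) ∑φ))) (∑ₚ-δ₁ (+ 0)) ⟩
      - + 1 ∎
      where
      open ≡-Reasoning
      pointwise : ∀ t → φ t * φ (t + c) ≡ φ (+ 1 + c * recip t) - δ (+ 0) t
      pointwise t = cases (≈0? t)
        where
        cases : Dec (t ≈ + 0 [ P ]) → φ t * φ (t + c) ≡ φ (+ 1 + c * recip t) - δ (+ 0) t
        cases (yes t0) = trans (trans (cong (_* φ (t + c)) (φ-0 t0)) (ℤₚ.*-zeroˡ (φ (t + c)))) (sym (cong₂ _-_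
          (trans (φ-periodic {b = + 1} (≈-trans (+-≈ (≈-refl {a = + 1}) (*-≈ˡ c (^-≈0 (0<p-2 2<p) t0))) (≡⇒≈ (lemma c)))) φ-1) (δ-yes (≈-sym t0))))
          where
          lemma : ∀ c → + 1 + c * + 0 ≡ + 1
          lemma = solve-∀
        cases (no nt) = begin
          φ t * φ (t + c)
            ≡⟨ cong (φ t *_) (trans (φ-periodic {b = t * (+ 1 + c * recip t)} (≈-sym (≈-trans (≡⇒≈ (lemma t c (recip t))) (≈-trans (+-≈ (≈-refl {a = t}) (*-≈ˡ c (recip-inverse nt))) (≡⇒≈ (cong (λ x → t + x) (ℤₚ.*-identityʳ c))))))) (φ-* t _)) ⟩
          φ t * (φ t * φ (+ 1 + c * recip t))
            ≡⟨ sym (ℤₚ.*-assoc (φ t) (φ t) _) ⟩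
          φ t * φ t * φ (+ 1 + c * recip t)
            ≡⟨ trans (cong (_* φ (+ 1 + c * recip t)) (φ² nt)) (trans (lemma₂ (φ (+ 1 + c * recip t))) (cong (λ x → φ (+ 1 + c * recip t) - x) (sym (δ-no (λ e → nt (≈-sym e)))))) ⟩
          φ (+ 1 + c * recip t) - δ (+ 0) t ∎
          where
          lemma : ∀ t c i → t * (+ 1 + c * i) ≡ t + c * (t * i)
          lemma = solve-∀
          lemma₂ : ∀ x → + 1 * x ≡ x - + 0
          lemma₂ = solve-∀

    ∑φφ : ∀ a b → ∑ₚ (λ l → φ (l - a) * φ (l - b)) ≡ P * δ a b - + 1
    ∑φφ a b = trans (sym (shift a {λ l → φ (l - a) * φ (l - b)} (λ e → cong₂ _*_ (φ-periodic (-‿≈ e (≈-refl {a = a}))) (φ-periodic (-‿≈ e (≈-refl {a = b}))))))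
      (trans (∑ₚ-cong (λ t → cong₂ (λ x y → φ x * φ y) (lemma₁ t a) (lemma₂ t a b))) (cases (≈? a b)))
      where
      lemma₁ : ∀ t a → t + a - a ≡ t
      lemma₁ = solve-∀
      lemma₂ : ∀ t a b → t + a - b ≡ t + (a - b)
      lemma₂ = solve-∀
      lemma₃ : ∀ p → p - + 1 ≡ p * + 1 - + 1
      lemma₃ = solve-∀
      lemma₄ : ∀ p → - + 1 ≡ p * + 0 - + 1
      lemma₄ = solve-∀
      cases : Dec (a ≈ b [ P ]) → ∑ₚ (λ t → φ t * φ (t + (a - b))) ≡ P * δ a b - + 1
      cases (yes e) = trans (trans (∑ₚ-cong (λ t → trans (cong (φ t *_) (φ-periodic (≈-trans (+-≈ (≈-refl {a = t}) (difference-≈0 e)) (≡⇒≈ (ℤₚ.+-identityʳ t))))) (φ²-δ t))) ∑ₚ-1-δ)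
        (trans (lemma₃ P) (cong (λ d → P * d - + 1) (sym (δ-yes e))))
      cases (no ne) = trans (∑φφ-shift (λ e → ne (≈-from-difference e))) (trans (lemma₄ P) (cong (λ d → P * d - + 1) (sym (δ-no ne))))

    -- Two normalisations of the Jacobsthal sum: T l has a second moment in l that can be computed,
    -- T̃ κ is the form in which the Jacobi sum decomposes. They agree at 1.
    T T̃ : ℤ → ℤ
    T l = ∑ₚ (λ s → φ s * φ (l - s * s))
    T̃ κ = ∑ₚ (λ s → φ s * φ (+ 1 - κ * (s * s)))

    T-periodic : Periodic T
    T-periodic e = ∑ₚ-cong (λ s → cong (φ s *_) (φ-periodic (-‿≈ e (≈-refl {a = s * s}))))

    -- After expanding the square, the sum over l is P on the diagonal s² = u² minus a constant that
    -- ∑φ = 0 kills. Each unit s meets u = ±s, and φ(-1) = 1.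
    ∑T² : ∑ₚ (λ l → T l * T l) ≡ + 2 * (P * (P - + 1))
    ∑T² = begin
      ∑ₚ (λ l → T l * T l)
        ≡⟨ ∑ₚ-cong (λ l → trans (sym (∑ₚ-*ʳ (T l) (λ s → φ s * φ (l - s * s)))) (∑ₚ-cong (λ s → sym (∑ₚ-*ˡ (φ s * φ (l - s * s)) (λ u → φ u * φ (l - u * u)))))) ⟩
      ∑ₚ (λ l → ∑ₚ (λ s → ∑ₚ (λ u → φ s * φ (l - s * s) * (φ u * φ (l - u * u)))))
        ≡⟨ ∑ₚ-swap (λ l s → ∑ₚ (λ u → φ s * φ (l - s * s) * (φ u * φ (l - u * u)))) ⟩
      ∑ₚ (λ s → ∑ₚ (λ l → ∑ₚ (λ u → φ s * φ (l - s * s) * (φ u * φ (l - u * u)))))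
        ≡⟨ ∑ₚ-cong (λ s → ∑ₚ-swap (λ l u → φ s * φ (l - s * s) * (φ u * φ (l - u * u)))) ⟩
      ∑ₚ (λ s → ∑ₚ (λ u → ∑ₚ (λ l → φ s * φ (l - s * s) * (φ u * φ (l - u * u)))))
        ≡⟨ ∑ₚ-cong (λ s → ∑ₚ-cong (λ u → trans (∑ₚ-cong (λ l → lemma₁ (φ s) (φ (l - s * s)) (φ u) (φ (l - u * u))))
             (trans (∑ₚ-*ˡ (φ s * φ u) (λ l → φ (l - s * s) * φ (l - u * u))) (cong (φ s * φ u *_) (∑φφ (s * s) (u * u)))))) ⟩
      ∑ₚ (λ s → ∑ₚ (λ u → φ s * φ u * (P * δ (s * s) (u * u) - + 1)))
        ≡⟨ ∑ₚ-cong inner ⟩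
      ∑ₚ (λ s → (+ 2 * P) * (+ 1 - δ (+ 0) s))
        ≡⟨ trans (∑ₚ-*ˡ (+ 2 * P) (λ s → + 1 - δ (+ 0) s)) (cong (+ 2 * P *_) ∑ₚ-1-δ) ⟩
      + 2 * P * (P - + 1)
        ≡⟨ ℤₚ.*-assoc (+ 2) P (P - + 1) ⟩
      + 2 * (P * (P - + 1)) ∎
      where
      open ≡-Reasoning
      lemma₁ : ∀ a b c d → a * b * (c * d) ≡ a * c * (b * d)
      lemma₁ = solve-∀
      lemma₂ : ∀ a b p d → a * b * (p * d - + 1) ≡ a * (p * (d * b) - b)
      lemma₂ = solve-∀
      near : ∀ s → φ s * ∑ₚ (λ u → δ (s * s) (u * u) * φ u) ≡ + 2 * (φ s * φ s)
      near s = cases (≈0? s)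
        where
        lemma₃ : ∀ a b c → (a + b) * c ≡ a * c + b * c
        lemma₃ = solve-∀
        lemma₄ : ∀ a → a * (a + a) ≡ + 2 * (a * a)
        lemma₄ = solve-∀
        cases : Dec (s ≈ + 0 [ P ]) → φ s * ∑ₚ (λ u → δ (s * s) (u * u) * φ u) ≡ + 2 * (φ s * φ s)
        cases (yes s0) = trans (cong (_* ∑ₚ (λ u → δ (s * s) (u * u) * φ u)) (φ-0 s0)) (trans (ℤₚ.*-zeroˡ (∑ₚ (λ u → δ (s * s) (u * u) * φ u)))
          (sym (cong (λ x → + 2 * (x * x)) (φ-0 s0))))
        cases (no ns) = trans (cong (φ s *_) (begin
          ∑ₚ (λ u → δ (s * s) (u * u) * φ u)
            ≡⟨ ∑ₚ-cong (λ u → trans (cong (_* φ u) (trans (δ-sym (s * s) (u * u)) (δ-squares ns u))) (lemma₃ (δ s u) (δ (- s) u) (φ u))) ⟩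
          ∑ₚ (λ u → δ s u * φ u + δ (- s) u * φ u)
            ≡⟨ trans (∑ₚ-+ (λ u → δ s u * φ u) (λ u → δ (- s) u * φ u)) (cong₂ _+_ (∑ₚ-δ s φ-periodic) (trans (∑ₚ-δ (- s) φ-periodic) (φ-neg s))) ⟩
          φ s + φ s ∎)) (lemma₄ (φ s))
      inner : ∀ s → ∑ₚ (λ u → φ s * φ u * (P * δ (s * s) (u * u) - + 1)) ≡ (+ 2 * P) * (+ 1 - δ (+ 0) s)
      inner s = begin
        ∑ₚ (λ u → φ s * φ u * (P * δ (s * s) (u * u) - + 1))
          ≡⟨ ∑ₚ-cong (λ u → lemma₂ (φ s) (φ u) P (δ (s * s) (u * u))) ⟩
        ∑ₚ (λ u → φ s * (P * (δ (s * s) (u * u) * φ u) - φ u))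
          ≡⟨ trans (∑ₚ-*ˡ (φ s) (λ u → P * (δ (s * s) (u * u) * φ u) - φ u)) (cong (φ s *_) (trans (∑ₚ-+ (λ u → P * (δ (s * s) (u * u) * φ u)) (λ u → - φ u))
               (cong₂ _+_ (∑ₚ-*ˡ P (λ u → δ (s * s) (u * u) * φ u)) (trans (∑-neg p (λ u → φ (+ u))) (cong -_ ∑φ))))) ⟩
        φ s * (P * ∑ₚ (λ u → δ (s * s) (u * u) * φ u) + - + 0)
          ≡⟨ lemma₅ (φ s) P (∑ₚ (λ u → δ (s * s) (u * u) * φ u)) ⟩
        P * (φ s * ∑ₚ (λ u → δ (s * s) (u * u) * φ u))
          ≡⟨ cong (P *_) (near s) ⟩
        P * (+ 2 * (φ s * φ s))
          ≡⟨ trans (lemma₆ P (φ s * φ s)) (cong (+ 2 * P *_) (φ²-δ s)) ⟩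
        (+ 2 * P) * (+ 1 - δ (+ 0) s) ∎
        where
        lemma₅ : ∀ a p x → a * (p * x + - + 0) ≡ p * (a * x)
        lemma₅ = solve-∀
        lemma₆ : ∀ p x → p * (+ 2 * x) ≡ + 2 * p * x
        lemma₆ = solve-∀

    T-scale : ∀ {s} → Nz s → ∀ l → T (l * (s * s)) ≡ φ s * T l
    T-scale {s} ns l = begin
      ∑ₚ (λ u → φ u * φ (l * (s * s) - u * u))
        ≡⟨ sym (scale ns {λ u → φ u * φ (l * (s * s) - u * u)} (λ e → cong₂ _*_ (φ-periodic e) (φ-periodic (-‿≈ (≈-refl {a = l * (s * s)}) (*-≈ e e))))) ⟩
      ∑ₚ (λ u → φ (s * u) * φ (l * (s * s) - (s * u) * (s * u)))
        ≡⟨ ∑ₚ-cong (λ u → trans (cong₂ _*_ (φ-* s u) (trans (cong φ (lemma₁ l s u)) (trans (φ-* (s * s) (l - u * u)) (cong (_* φ (l - u * u)) (trans (φ-* s s) (φ² ns)))))) (lemma₂ (φ s) (φ u) (φ (l - u * u)))) ⟩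
      ∑ₚ (λ u → φ s * (φ u * φ (l - u * u)))
        ≡⟨ ∑ₚ-*ˡ (φ s) (λ u → φ u * φ (l - u * u)) ⟩
      φ s * T l ∎
      where
      open ≡-Reasoning
      lemma₁ : ∀ l s u → l * (s * s) - (s * u) * (s * u) ≡ s * s * (l - u * u)
      lemma₁ = solve-∀
      lemma₂ : ∀ a b c → a * b * (+ 1 * c) ≡ a * (b * c)
      lemma₂ = solve-∀

    T-0 : ∀ {l} → l ≈ + 0 [ P ] → T l ≡ + 0
    T-0 {l} l0 = trans (∑ₚ-cong (λ s → trans (cong (φ s *_) (trans (φ-periodic (≈-trans (-‿≈ l0 (≈-refl {a = s * s})) (≡⇒≈ (lemma s)))) (trans (φ-neg (s * s)) (φ-* s s))))
        (cube (φ-sign s)))) ∑φ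
      where
      lemma : ∀ s → + 0 - s * s ≡ - (s * s)
      lemma = solve-∀
      cube : ∀ {e} → Sign e → e * (e * e) ≡ e
      cube null     = refl
      cube positive = refl
      cube negative = refl

    ∑T²-class : ∀ l → ∑ₚ (λ s → T (l * (s * s)) * T (l * (s * s))) ≡ (P - + 1) * (T l * T l)
    ∑T²-class l = begin
      ∑ₚ (λ s → T (l * (s * s)) * T (l * (s * s)))
        ≡⟨ ∑ₚ-cong (λ s → cases s (≈0? s)) ⟩
      ∑ₚ (λ s → (+ 1 - δ (+ 0) s) * (T l * T l))
        ≡⟨ ∑ₚ-*ʳ (T l * T l) (λ s → + 1 - δ (+ 0) s) ⟩
      ∑ₚ (λ s → + 1 - δ (+ 0) s) * (T l * T l)
        ≡⟨ cong (_* (T l * T l)) ∑ₚ-1-δ ⟩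
      (P - + 1) * (T l * T l) ∎
      where
      open ≡-Reasoning
      lemma₁ : ∀ l → l * (+ 0 * + 0) ≡ + 0
      lemma₁ = solve-∀
      lemma₂ : ∀ a t → a * t * (a * t) ≡ a * a * (t * t)
      lemma₂ = solve-∀
      lemma₃ : ∀ x → + 0 * + 0 ≡ (+ 1 - + 1) * x
      lemma₃ = solve-∀
      cases : ∀ s → Dec (s ≈ + 0 [ P ]) → T (l * (s * s)) * T (l * (s * s)) ≡ (+ 1 - δ (+ 0) s) * (T l * T l)
      cases s (yes s0) = trans (cong₂ _*_ t0 t0) (trans (lemma₃ (T l * T l)) (cong (λ d → (+ 1 - d) * (T l * T l)) (sym (δ-yes (≈-sym s0)))))
        where
        t0 : T (l * (s * s)) ≡ + 0
        t0 = T-0 (≈-trans (*-≈ˡ l (*-≈ s0 s0)) (≡⇒≈ (lemma₁ l)))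
      cases s (no ns) = trans (cong₂ _*_ (T-scale ns l) (T-scale ns l)) (trans (lemma₂ (φ s) (T l)) (cong (_* (T l * T l)) (φ²-δ s)))

    -- By `T-scale`, T² is constant on the nonzero squares and on the nonsquares, so the second
    -- moment is a multiple of T(1)² + T(κ)².
    T-sum-of-squares : ∀ {κ} → φ κ ≡ - + 1 → T (+ 1) * T (+ 1) + T κ * T κ ≡ + 4 * P
    T-sum-of-squares {κ} eκ = ℤₚ.*-cancelˡ-≡ (P - + 1) _ _ {{p-1≢0}} (begin
      (P - + 1) * (T (+ 1) * T (+ 1) + T κ * T κ)
        ≡⟨ trans (ℤₚ.*-distribˡ-+ (P - + 1) _ _) (sym (cong₂ _+_ (∑T²-class (+ 1)) (∑T²-class κ))) ⟩
      ∑ₚ (λ s → T (+ 1 * (s * s)) * T (+ 1 * (s * s))) + ∑ₚ (λ s → T (κ * (s * s)) * T (κ * (s * s)))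
        ≡⟨ cong (_+ ∑ₚ (λ s → T (κ * (s * s)) * T (κ * (s * s)))) (∑ₚ-cong (λ s → cong (λ x → T x * T x) (ℤₚ.*-identityˡ (s * s)))) ⟩
      ∑ₚ (λ s → T (s * s) * T (s * s)) + ∑ₚ (λ s → T (κ * (s * s)) * T (κ * (s * s)))
        ≡⟨ ∑-halves {κ} {λ l → T l * T l} eκ (λ e → cong₂ _*_ (T-periodic e) (T-periodic e)) ⟩
      + 2 * ∑ₚ (λ l → T l * T l)
        ≡⟨ cong (+ 2 *_) ∑T² ⟩
      + 2 * (+ 2 * (P * (P - + 1)))
        ≡⟨ lemma P ⟩
      (P - + 1) * (+ 4 * P) ∎)
      where
      open ≡-Reasoning
      lemma : ∀ p → + 2 * (+ 2 * (p * (p - + 1))) ≡ (p - + 1) * (+ 4 * p)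
      lemma = solve-∀
      p-1≢0 : ℤ.NonZero (P - + 1)
      p-1≢0 = ℤ.≢-nonZero (λ e → ℕₚ.<⇒≢ 1<p (sym (ℤₚ.+-injective (ℤₚ.i-j≡0⇒i≡j P (+ 1) e))))

    T̃-1 : T̃ (+ 1) ≡ T (+ 1)
    T̃-1 = ∑ₚ-cong (λ s → cong (λ x → φ s * φ (+ 1 - x)) (ℤₚ.*-identityˡ (s * s)))

    sum-of-squares : ∀ {κ} → φ κ ≡ - + 1 → T̃ (+ 1) * T̃ (+ 1) + T̃ κ * T̃ κ ≡ + 4 * P
    sum-of-squares {κ} eκ = trans (cong₂ _+_ (cong₂ _*_ T̃-1 T̃-1) (sym squares)) (T-sum-of-squares eι)
      where
      -- T is taken at 1/κ, again a nonresidue, because 1/κ - s² = (1/κ)(1 - κs²).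
      ι : ℤ
      ι = recip κ
      κι : κ * ι ≈ + 1 [ P ]
      κι = recip-inverse (φ⇒nz eκ)
      eι : φ ι ≡ - + 1
      eι = solve-sign (trans (sym (φ-* κ ι)) (trans (φ-periodic κι) φ-1)) eκ
        where
        solve-sign : ∀ {a b} → a * b ≡ + 1 → a ≡ - + 1 → b ≡ - + 1
        solve-sign {b = b} h refl = trans (sym (trans (cong -_ (ℤₚ.-1*i≡-i b)) (ℤₚ.neg-involutive b))) (cong -_ h)
      T≡ : T ι ≡ - + 1 * T̃ κ
      T≡ = begin
        ∑ₚ (λ s → φ s * φ (ι - s * s))
          ≡⟨ ∑ₚ-cong (λ s → trans (cong (φ s *_) (trans (φ-periodic {b = ι * (+ 1 - κ * (s * s))} (≈-sym (≈-trans (≡⇒≈ (lemma₁ ι κ (s * s))) (≈-trans (-‿≈ (≈-refl {a = ι}) (*-≈ʳ (s * s) κι)) (≡⇒≈ (cong (λ x → ι - x) (ℤₚ.*-identityˡ (s * s)))))))) (trans (φ-* ι _) (cong (_* φ (+ 1 - κ * (s * s))) eι))))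
               (lemma₂ (φ s) (φ (+ 1 - κ * (s * s))))) ⟩
        ∑ₚ (λ s → - + 1 * (φ s * φ (+ 1 - κ * (s * s))))
          ≡⟨ ∑ₚ-*ˡ (- + 1) (λ s → φ s * φ (+ 1 - κ * (s * s))) ⟩
        - + 1 * T̃ κ ∎
        where
        open ≡-Reasoning
        lemma₁ : ∀ i k s → i * (+ 1 - k * s) ≡ i - k * i * s
        lemma₁ = solve-∀
        lemma₂ : ∀ a b → a * (- + 1 * b) ≡ - + 1 * (a * b)
        lemma₂ = solve-∀
      squares : T ι * T ι ≡ T̃ κ * T̃ κ
      squares = trans (cong₂ _*_ T≡ T≡) (lemma (T̃ κ))
        where
        lemma : ∀ x → - + 1 * x * (- + 1 * x) ≡ x * x
        lemma = solve-∀

    private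
      even : ∀ {a} → Nz a → + 1 + φ a ≈ + 0 [ + 2 ]
      even {a} na = cases (φ-sign a) (φ² na)
        where
        cases : ∀ {e} → Sign e → e * e ≡ + 1 → + 1 + e ≈ + 0 [ + 2 ]
        cases null     ()
        cases positive _ = mod-by (+ 1) refl
        cases negative _ = mod-by (+ 0) refl

      -- Divisible by 8 unless s is 0, 1 or −1.
      triple : ℤ → ℤ
      triple s = (+ 1 + φ s) * (+ 1 + φ (s + - + 1)) * (+ 1 + φ (s + + 1))

      -- Of the eight products, 1 contributes P, the three single characters 0, and the three pairs
      -- -1 each; the triple product is the Jacobsthal sum.
      ∑triple : ∑ₚ triple ≡ P - + 3 + T̃ (+ 1)
      ∑triple = begin
        ∑ₚ triple
          ≡⟨ ∑ₚ-cong (λ s → trans (lemma₁ (φ s) (φ (s + - + 1)) (φ (s + + 1)))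
               (cong (λ x → + 1 + (φ s + (φ (s + - + 1) + (φ (s + + 1) + (φ s * φ (s + - + 1) + (φ s * φ (s + + 1) + (φ (s + - + 1) * φ (s + + 1) + φ s * x))))))) (difference-of-squares s))) ⟩
        ∑ₚ (λ s → + 1 + (φ s + (φ (s + - + 1) + (φ (s + + 1) + (φ s * φ (s + - + 1) + (φ s * φ (s + + 1) + (φ (s + - + 1) * φ (s + + 1) + φ s * φ (+ 1 - + 1 * (s * s)))))))))
          ≡⟨ split (λ _ → + 1) (λ s → (φ s + (φ (s + - + 1) + (φ (s + + 1) + (φ s * φ (s + - + 1) + (φ s * φ (s + + 1) + (φ (s + - + 1) * φ (s + + 1) + φ s * φ (+ 1 - + 1 * (s * s)))))))))
               (trans (∑ₚ-const (+ 1)) (ℤₚ.*-identityʳ P))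
            (split φ (λ s → (φ (s + - + 1) + (φ (s + + 1) + (φ s * φ (s + - + 1) + (φ s * φ (s + + 1) + (φ (s + - + 1) * φ (s + + 1) + φ s * φ (+ 1 - + 1 * (s * s))))))))
               ∑φ
            (split (λ s → φ (s + - + 1)) (λ s → (φ (s + + 1) + (φ s * φ (s + - + 1) + (φ s * φ (s + + 1) + (φ (s + - + 1) * φ (s + + 1) + φ s * φ (+ 1 - + 1 * (s * s)))))))
               (trans (shift (- + 1) φ-periodic) ∑φ)
            (split (λ s → φ (s + + 1)) (λ s → (φ s * φ (s + - + 1) + (φ s * φ (s + + 1) + (φ (s + - + 1) * φ (s + + 1) + φ s * φ (+ 1 - + 1 * (s * s))))))
               (trans (shift (+ 1) φ-periodic) ∑φ)
            (split (λ s → φ s * φ (s + - + 1)) (λ s → (φ s * φ (s + + 1) + (φ (s + - + 1) * φ (s + + 1) + φ s * φ (+ 1 - + 1 * (s * s)))))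
               (∑φφ-shift (nz-neg nz-1))
            (split (λ s → φ s * φ (s + + 1)) (λ s → (φ (s + - + 1) * φ (s + + 1) + φ s * φ (+ 1 - + 1 * (s * s))))
               (∑φφ-shift nz-1)
            (split (λ s → φ (s + - + 1) * φ (s + + 1)) (λ s → φ s * φ (+ 1 - + 1 * (s * s)))
               outer refl)))))) ⟩
        P + (+ 0 + (+ 0 + (+ 0 + (- + 1 + (- + 1 + (- + 1 + T̃ (+ 1)))))))
          ≡⟨ lemma₂ P (T̃ (+ 1)) ⟩
        P - + 3 + T̃ (+ 1) ∎
        where
        open ≡-Reasoning
        lemma₁ : ∀ a b c → (+ 1 + a) * (+ 1 + b) * (+ 1 + c) ≡ + 1 + (a + (b + (c + (a * b + (a * c + (b * c + a * (b * c)))))))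
        lemma₁ = solve-∀
        lemma₂ : ∀ p x → p + (+ 0 + (+ 0 + (+ 0 + (- + 1 + (- + 1 + (- + 1 + x)))))) ≡ p - + 3 + x
        lemma₂ = solve-∀
        split : ∀ (F G : ℤ → ℤ) {a b} → ∑ₚ F ≡ a → ∑ₚ G ≡ b → ∑ₚ (λ s → F s + G s) ≡ a + b
        split F G refl refl = ∑ₚ-+ F G
        difference-of-squares : ∀ s → φ (s + - + 1) * φ (s + + 1) ≡ φ (+ 1 - + 1 * (s * s))
        difference-of-squares s = trans (sym (φ-* (s + - + 1) (s + + 1))) (trans (sym (φ-neg _)) (cong φ (factor s)))
          where
          factor : ∀ s → - ((s + - + 1) * (s + + 1)) ≡ + 1 - + 1 * (s * s)
          factor = solve-∀
        outer : ∑ₚ (λ s → φ (s + - + 1) * φ (s + + 1)) ≡ - + 1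
        outer = trans (∑ₚ-cong (λ s → cong (λ x → φ (s + - + 1) * φ x) (move s)))
          (trans (shift (- + 1) {λ t → φ t * φ (t + + 2)} (λ e → cong₂ _*_ (φ-periodic e) (φ-periodic (+-≈ e (≈-refl {a = + 2}))))) (∑φφ-shift nz-2))
          where
          move : ∀ s → s + + 1 ≡ s + - + 1 + + 2
          move = solve-∀

      triple≈ : ∀ s → triple s ≈ + 4 * δ (+ 0) s + + 2 * (+ 1 + φ (+ 2)) * (δ (+ 1) s + δ (- + 1) s) [ + 8 ]
      triple≈ s = cases (≈? (+ 0) s) (≈? (+ 1) s) (≈? (- + 1) s)
        where
        value : ∀ {a b c d e f} → φ s ≡ a → φ (s + - + 1) ≡ b → φ (s + + 1) ≡ c → δ (+ 0) s ≡ d → δ (+ 1) s ≡ e → δ (- + 1) s ≡ f →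
          (+ 1 + a) * (+ 1 + b) * (+ 1 + c) ≡ + 4 * d + + 2 * (+ 1 + φ (+ 2)) * (e + f) →
          triple s ≈ + 4 * δ (+ 0) s + + 2 * (+ 1 + φ (+ 2)) * (δ (+ 1) s + δ (- + 1) s) [ + 8 ]
        value refl refl refl refl refl refl e = ≡⇒≈ e
        at : ∀ {a} c → a ≈ s [ P ] → s + c ≈ a + c [ P ]
        at c e = +-≈ (≈-sym e) (≈-refl {a = c})
        lemma₀ : ∀ x → + 4 ≡ + 4 * + 1 + + 2 * x * (+ 0 + + 0)
        lemma₀ = solve-∀
        lemma₁ : ∀ x → (+ 1 + + 1) * (+ 1 + + 0) * (+ 1 + x) ≡ + 4 * + 0 + + 2 * (+ 1 + x) * (+ 1 + + 0)
        lemma₁ = solve-∀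
        lemma₂ : ∀ x → (+ 1 + + 1) * (+ 1 + x) * (+ 1 + + 0) ≡ + 4 * + 0 + + 2 * (+ 1 + x) * (+ 0 + + 1)
        lemma₂ = solve-∀
        lemma₃ : ∀ x → + 0 ≡ + 4 * + 0 + + 2 * x * (+ 0 + + 0)
        lemma₃ = solve-∀
        cases : Dec (+ 0 ≈ s [ P ]) → Dec (+ 1 ≈ s [ P ]) → Dec (- + 1 ≈ s [ P ]) →
          triple s ≈ + 4 * δ (+ 0) s + + 2 * (+ 1 + φ (+ 2)) * (δ (+ 1) s + δ (- + 1) s) [ + 8 ]
        cases (yes z) _ _ = value (φ-0 (≈-sym z)) (trans (φ-periodic (at (- + 1) z)) φ-neg1) (trans (φ-periodic (at (+ 1) z)) φ-1)
          (δ-yes z) (δ-no (λ e → nz-1 (≈-trans e (≈-sym z)))) (δ-no (λ e → nz-neg nz-1 (≈-trans e (≈-sym z)))) (lemma₀ (+ 1 + φ (+ 2)))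
        cases (no nz) (yes o) _ = value (trans (φ-periodic (≈-sym o)) φ-1) (φ-0 (at (- + 1) o)) (φ-periodic (at (+ 1) o))
          (δ-no nz) (δ-yes o) (δ-no { - + 1} {s} (λ e → nz-neg nz-2 (difference-≈0 { a = - + 1} {b = + 1} (≈-trans e (≈-sym o))))) (lemma₁ (φ (+ 2)))
        cases (no nz) (no no₁) (yes m) = value (trans (φ-periodic (≈-sym m)) φ-neg1) (trans (φ-periodic (at (- + 1) m)) (φ-neg (+ 2))) (φ-0 (at (+ 1) m))
          (δ-no nz) (δ-no no₁) (δ-yes m) (lemma₂ (φ (+ 2)))
        cases (no nz) (no no₁) (no no₂) = ≈-trans
          (≈-zero-* {+ 4} {+ 2} (≈-zero-* {+ 2} {+ 2} (even (λ e → nz (≈-sym e))) (even (λ e → no₁ (≈-sym (≈-from-difference e))))) (even (λ e → no₂ (≈-sym (≈-from-difference {a = s} {b = - + 1} e)))))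
          (≡⇒≈ (trans (lemma₃ (+ 1 + φ (+ 2))) (sym (cong₂ (λ x y → + 4 * x + + 2 * (+ 1 + φ (+ 2)) * y) (δ-no nz) (cong₂ _+_ (δ-no no₁) (δ-no no₂))))))

    -- The exceptional residues contribute 4 + 4(1 + φ(2)) to the sum of `triple`, and 1 + φ(2) is
    -- even.
    T̃-mod-8 : T̃ (+ 1) ≈ + 7 - P [ + 8 ]
    T̃-mod-8 = begin
      T̃ (+ 1)
        ≡⟨ lemma₁ P (T̃ (+ 1)) ⟩
      (P - + 3 + T̃ (+ 1)) + (+ 3 - P)
        ≡⟨ cong (_+ (+ 3 - P)) (sym ∑triple) ⟩
      ∑ₚ triple + (+ 3 - P)
        ≈⟨ +-≈ (∑-≈ p (λ s _ → triple≈ (+ s))) (≈-refl {a = + 3 - P}) ⟩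
      ∑ₚ (λ s → + 4 * δ (+ 0) s + + 2 * (+ 1 + φ (+ 2)) * (δ (+ 1) s + δ (- + 1) s)) + (+ 3 - P)
        ≡⟨ cong (_+ (+ 3 - P)) total ⟩
      + 4 * + 1 + + 2 * (+ 1 + φ (+ 2)) * (+ 1 + + 1) + (+ 3 - P)
        ≡⟨ lemma₂ (+ 1 + φ (+ 2)) P ⟩
      + 4 * (+ 1 + φ (+ 2)) + (+ 7 - P)
        ≈⟨ +-≈ (≈-zero-* {+ 4} {+ 2} {+ 4} (mod-by (+ 1) refl) (even nz-2)) (≈-refl {a = + 7 - P}) ⟩
      + 0 + (+ 7 - P)
        ≡⟨ ℤₚ.+-identityˡ (+ 7 - P) ⟩
      + 7 - P ∎
      where
      open ≈-Reasoning (+ 8)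
      lemma₁ : ∀ p x → x ≡ (p - + 3 + x) + (+ 3 - p)
      lemma₁ = solve-∀
      lemma₂ : ∀ x p → + 4 * + 1 + + 2 * x * (+ 1 + + 1) + (+ 3 - p) ≡ + 4 * x + (+ 7 - p)
      lemma₂ = solve-∀
      total : ∑ₚ (λ s → + 4 * δ (+ 0) s + + 2 * (+ 1 + φ (+ 2)) * (δ (+ 1) s + δ (- + 1) s)) ≡ + 4 * + 1 + + 2 * (+ 1 + φ (+ 2)) * (+ 1 + + 1)
      total = trans (∑ₚ-+ (λ s → + 4 * δ (+ 0) s) (λ s → + 2 * (+ 1 + φ (+ 2)) * (δ (+ 1) s + δ (- + 1) s)))
        (cong₂ _+_ (trans (∑ₚ-*ˡ (+ 4) (δ (+ 0))) (cong (+ 4 *_) (∑ₚ-δ₁ (+ 0))))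
          (trans (∑ₚ-*ˡ (+ 2 * (+ 1 + φ (+ 2))) (λ s → δ (+ 1) s + δ (- + 1) s)) (cong (+ 2 * (+ 1 + φ (+ 2)) *_) (trans (∑ₚ-+ (δ (+ 1)) (δ (- + 1))) (cong₂ _+_ (∑ₚ-δ₁ (+ 1)) (∑ₚ-δ₁ (- + 1)))))))

-- A Jacobi sum modulo p³

module JacobiSums where

  open IntegerCongruences
  open LegendreSums
  open JacobsthalSums
  open import Data.Integer using (_+_; _*_; _-_; -_; _^_)

  module Jacobi {p : ℕ} (pr : Prime p) (n : ℕ) (p≡ : p ≡ suc ((n ℕ.+ n) ℕ.+ (n ℕ.+ n))) where
    open ModPrime pr
    open Residues pr
    open Legendre pr n p≡
    open Jacobsthal pr n p≡

    representative : ℤ → ℤ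
    representative a = + proj₁ (residue a)

    representative≈ : ∀ a → representative a ≈ a [ P ]
    representative≈ a = ≈-sym (proj₂ (proj₂ (residue a)))

    lift : ∀ {a b} → a ≈ b [ P ] → (a ^ p) ^ p ≈ (b ^ p) ^ p [ P³ ]
    lift e = ^p-lift (≈-lower (^p-lift e e)) (^p-lift e e)

    -- The Teichmüller character modulo p³.
    ζ : ℤ → ℤ
    ζ a = (representative a ^ p) ^ p

    ζ-periodic : Periodic ζ
    ζ-periodic {a} {b} e = cong (λ r → ((+ r) ^ p) ^ p) (residues-distinct (proj₁ (proj₂ (residue a))) (proj₁ (proj₂ (residue b)))
      (≈-trans (representative≈ a) (≈-trans e (≈-sym (representative≈ b)))))

    ζ≈ : ∀ a → ζ a ≈ a [ P ]
    ζ≈ a = ≈-trans (fermat (representative a ^ p)) (≈-trans (fermat (representative a)) (representative≈ a))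

    ζ-lift : ∀ {a b} → a ≈ b [ P ] → ζ a ≈ (b ^ p) ^ p [ P³ ]
    ζ-lift {a} e = lift (≈-trans (representative≈ a) e)

    ζ-* : ∀ a b → ζ (a * b) ≈ ζ a * ζ b [ P³ ]
    ζ-* a b = ≈-trans (ζ-lift {b = representative a * representative b} (*-≈ (≈-sym (representative≈ a)) (≈-sym (representative≈ b))))
      (≡⇒≈ (trans (cong (_^ p) (^-distrib-* (representative a) (representative b) p)) (^-distrib-* (representative a ^ p) (representative b ^ p) p)))

    ^-^-comm : ∀ a j k → (a ^ j) ^ k ≡ (a ^ k) ^ j
    ^-^-comm a j k = trans (ℤₚ.^-*-assoc a j k) (trans (cong (a ^_) (ℕₚ.*-comm j k)) (sym (ℤₚ.^-*-assoc a k j)))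

    ζ-^ : ∀ a k → ζ a ^ k ≈ ζ (a ^ k) [ P³ ]
    ζ-^ a k = ≈-trans (≡⇒≈ (trans (^-^-comm (representative a ^ p) p k) (cong (_^ p) (^-^-comm (representative a) p k))))
      (≈-sym (ζ-lift {b = representative a ^ k} (^-≈ k (≈-sym (representative≈ a)))))

    sign-^p : ∀ {e} → Sign e → e ^ p ≡ e
    sign-^p {e} s = trans (cong (e ^_) p≡) (trans (cong (e *_) (ℤₚ.^-distribˡ-+-* e h h)) (go s))
      where
      go : ∀ {e} → Sign e → e * (e ^ h * e ^ h) ≡ e
      go null     = ℤₚ.*-zeroˡ ((+ 0) ^ h * (+ 0) ^ h)
      go positive = cong (λ x → + 1 * (x * x)) (ℤₚ.^-zeroˡ h)
      go negative = cong (- + 1 *_) (sign-square h)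

    ζ-sign : ∀ {a e} → Sign e → a ≈ e [ P ] → ζ a ≈ e [ P³ ]
    ζ-sign s a≈e = ≈-trans (ζ-lift a≈e) (≡⇒≈ (trans (cong (_^ p) (sign-^p s)) (sign-^p s)))

    ζ-euler : ∀ a → ζ a ^ h ≈ φ a [ P³ ]
    ζ-euler a = ≈-trans (ζ-^ a h) (ζ-sign (φ-sign a) (euler a))

    ^-≈0₃ : ∀ {k a} → 0 ℕ.< k → a ≈ + 0 [ P³ ] → a ^ k ≈ + 0 [ P³ ]
    ^-≈0₃ {suc k} {a} _ e = ≈-trans (*-≈ʳ (a ^ k) e) (≡⇒≈ (ℤₚ.*-zeroˡ (a ^ k)))

    ζ-fermat : ∀ a → ζ a ^ (h ℕ.+ h) ≈ + 1 - δ (+ 0) a [ P³ ]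
    ζ-fermat a = ≈-trans (≡⇒≈ (ℤₚ.^-distribˡ-+-* (ζ a) h h)) (≈-trans (*-≈ (ζ-euler a) (ζ-euler a)) (≡⇒≈ (φ²-δ a)))

    z : ℕ → ℤ
    z k = ∑ₚ (λ t → ζ t ^ k)

    ζ-shift : ∀ {k} → 0 ℕ.< k → ∀ a → (+ 1 - δ (+ 0) a) * ζ a ^ k ≈ ζ a ^ k [ P³ ]
    ζ-shift {k} 0<k a = cases (≈0? a)
      where
      cases : Dec (a ≈ + 0 [ P ]) → (+ 1 - δ (+ 0) a) * ζ a ^ k ≈ ζ a ^ k [ P³ ]
      cases (yes e) = ≈-trans (*-≈ˡ (+ 1 - δ (+ 0) a) ζ0) (≈-trans (≡⇒≈ (ℤₚ.*-zeroʳ (+ 1 - δ (+ 0) a))) (≈-sym ζ0))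
        where
        ζ0 : ζ a ^ k ≈ + 0 [ P³ ]
        ζ0 = ^-≈0₃ 0<k (ζ-sign null e)
      cases (no ne) = ≡⇒≈ (trans (cong (λ d → (+ 1 - d) * ζ a ^ k) (δ-no (λ e → ne (≈-sym e)))) (ℤₚ.*-identityˡ (ζ a ^ k)))

    z-periodic : ∀ {k} → 0 ℕ.< k → z (h ℕ.+ h ℕ.+ k) ≈ z k [ P³ ]
    z-periodic {k} 0<k = ∑-≈ p (λ t _ → ≈-trans (≡⇒≈ (ℤₚ.^-distribˡ-+-* (ζ (+ t)) (h ℕ.+ h) k))
      (≈-trans (*-≈ʳ (ζ (+ t) ^ k) (ζ-fermat (+ t))) (ζ-shift 0<k (+ t))))

    z-top : z (h ℕ.+ h) ≈ P - + 1 [ P³ ]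
    z-top = ≈-trans (∑-≈ p (λ t _ → ζ-fermat (+ t))) (≡⇒≈ ∑ₚ-1-δ)

    -- Summing ζ(u)^k z = z over the units u gives z² = (p − 1) z, and z vanishes modulo p.
    z-low : ∀ {k} → 0 ℕ.< k → k ℕ.< h ℕ.+ h → z k ≈ + 0 [ P³ ]
    z-low {k} 0<k k<2h = ≈-cancel₃ {z k - (P - + 1)} nz-u (begin
      (z k - (P - + 1)) * z k
        ≡⟨ lemma (z k) (P - + 1) ⟩
      z k * z k - (P - + 1) * z k
        ≈⟨ difference-≈0 square ⟩
      + 0
        ≡⟨ sym (ℤₚ.*-zeroʳ (z k - (P - + 1))) ⟩
      (z k - (P - + 1)) * + 0 ∎)
      where
      open ≈-Reasoning P³
      lemma : ∀ z c → (z - c) * z ≡ z * z - c * z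
      lemma = solve-∀
      z≈0 : z k ≈ + 0 [ P ]
      z≈0 = ≈-trans (∑-≈ p (λ t _ → ^-≈ k (ζ≈ (+ t)))) (power-sum≈0 k (subst (suc k ℕ.<_) (sym p≡) (s≤s k<2h)))
      nz-u : Nz (z k - (P - + 1))
      nz-u = nz-≈ (≈-sym (-‿≈ z≈0 (-‿≈ P≈0 (≈-refl {a = + 1})))) nz-1
      invariant : ∀ u → ζ u ^ k * z k ≈ (+ 1 - δ (+ 0) u) * z k [ P³ ]
      invariant u = cases (≈0? u)
        where
        cases : Dec (u ≈ + 0 [ P ]) → ζ u ^ k * z k ≈ (+ 1 - δ (+ 0) u) * z k [ P³ ]
        cases (yes e) = *-≈ʳ (z k) (≈-trans (^-≈0₃ 0<k (ζ-sign null e)) (≡⇒≈ (cong (λ d → + 1 - d) (sym (δ-yes (≈-sym e))))))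
        cases (no nu) = begin
          ζ u ^ k * z k
            ≡⟨ sym (∑ₚ-*ˡ (ζ u ^ k) (λ t → ζ t ^ k)) ⟩
          ∑ₚ (λ t → ζ u ^ k * ζ t ^ k)
            ≈⟨ ∑-≈ p (λ t _ → ≈-trans (≡⇒≈ (sym (^-distrib-* (ζ u) (ζ (+ t)) k))) (^-≈ k (≈-sym (ζ-* u (+ t))))) ⟩
          ∑ₚ (λ t → ζ (u * t) ^ k)
            ≡⟨ scale nu {λ t → ζ t ^ k} (λ e → cong (_^ k) (ζ-periodic e)) ⟩
          z k
            ≡⟨ sym (ℤₚ.*-identityˡ (z k)) ⟩
          (+ 1 - + 0) * z k
            ≡⟨ cong (λ d → (+ 1 - d) * z k) (sym (δ-no (λ e → nu (≈-sym e)))) ⟩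
          (+ 1 - δ (+ 0) u) * z k ∎
      square : z k * z k ≈ (P - + 1) * z k [ P³ ]
      square = begin
        z k * z k
          ≡⟨ sym (∑ₚ-*ʳ (z k) (λ u → ζ u ^ k)) ⟩
        ∑ₚ (λ u → ζ u ^ k * z k)
          ≈⟨ ∑-≈ p (λ u _ → invariant (+ u)) ⟩
        ∑ₚ (λ u → (+ 1 - δ (+ 0) u) * z k)
          ≡⟨ trans (∑ₚ-*ʳ (z k) (λ u → + 1 - δ (+ 0) u)) (cong (_* z k) ∑ₚ-1-δ) ⟩
        (P - + 1) * z k ∎

    z-reduce : ∀ l {k} → 0 ℕ.< k → z (l ℕ.* (h ℕ.+ h) ℕ.+ k) ≈ z k [ P³ ]
    z-reduce zero    _ = ≈-refl
    z-reduce (suc l) {k} 0<k = ≈-trans (≡⇒≈ (cong z (ℕₚ.+-assoc (h ℕ.+ h) (l ℕ.* (h ℕ.+ h)) k)))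
      (≈-trans (z-periodic (ℕₚ.<-≤-trans 0<k (ℕₚ.m≤n+m k (l ℕ.* (h ℕ.+ h))))) (z-reduce l 0<k))

    -- The exponent of ζ s in the i-th binomial term. Since p - 1 = 2h and h = 2n, it is a multiple
    -- of p - 1 exactly when i ≡ n modulo h.
    index : ℕ → ℕ
    index i = h ℕ.+ (i ℕ.+ i)

    index-split : ∀ l j → index (l ℕ.* h ℕ.+ j) ≡ l ℕ.* (h ℕ.+ h) ℕ.+ index j
    index-split l j = ℤₚ.+-injective (trans (cong (λ x → + h + (x + + j + (x + + j))) (ℤₚ.pos-* l h))
      (trans (lemma (+ h) (+ l) (+ j)) (cong (λ x → x + (+ h + (+ j + + j))) (sym (ℤₚ.pos-* l (h ℕ.+ h))))))
      where
      lemma : ∀ h l j → h + (l * h + j + (l * h + j)) ≡ l * (h + h) + (h + (j + j))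
      lemma = solve-∀

    0<index : ∀ j → 0 ℕ.< index j
    0<index j = ℕₚ.<-≤-trans 0<h (ℕₚ.m≤m+n h (j ℕ.+ j))

    z-index-n : ∀ l → z (index (l ℕ.* h ℕ.+ n)) ≈ P - + 1 [ P³ ]
    z-index-n l = ≈-trans (≡⇒≈ (cong z (index-split l n))) (≈-trans (z-reduce l (0<index n)) z-top)

    z-index : ∀ l {j} → j ℕ.< h → j ≢ n → z (index (l ℕ.* h ℕ.+ j)) ≈ + 0 [ P³ ]
    z-index l {j} j<h j≢n = ≈-trans (≡⇒≈ (cong z (index-split l j))) (≈-trans (z-reduce l (0<index j)) (cases (ℕₚ.≤-total j n)))
      where
      cases : j ℕ.≤ n ⊎ n ℕ.≤ j → z (index j) ≈ + 0 [ P³ ]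
      cases (inj₁ j≤n) = z-low (0<index j) (ℕₚ.+-monoʳ-< h (ℕₚ.+-mono-< (ℕₚ.≤∧≢⇒< j≤n j≢n) (ℕₚ.≤∧≢⇒< j≤n j≢n)))
      cases (inj₂ n≤j) = ≈-trans (≡⇒≈ (cong z split)) (≈-trans (z-periodic 0<d+d) (z-low 0<d+d (ℕₚ.+-mono-< d<h d<h)))
        where
        d : ℕ
        d = j ℕ.∸ n
        0<d : 0 ℕ.< d
        0<d = ℕₚ.m<n⇒0<n∸m (ℕₚ.≤∧≢⇒< n≤j (j≢n ∘ sym))
        0<d+d : 0 ℕ.< d ℕ.+ d
        0<d+d = ℕₚ.<-≤-trans 0<d (ℕₚ.m≤m+n d d)
        d<h : d ℕ.< h
        d<h = ℕₚ.≤-<-trans (ℕₚ.m∸n≤m j n) j<h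
        split : index j ≡ h ℕ.+ h ℕ.+ (d ℕ.+ d)
        split = trans (cong (λ x → h ℕ.+ (x ℕ.+ x)) (sym (ℕₚ.m+[n∸m]≡n n≤j))) (ℤₚ.+-injective (lemma (+ n) (+ d)))
          where
          lemma : ∀ n d → (n + n) + ((n + d) + (n + d)) ≡ (n + n) + (n + n) + (d + d)
          lemma = solve-∀

    0<n : 0 ℕ.< n
    0<n = go n 0<h
      where
      go : ∀ n → 0 ℕ.< n ℕ.+ n → 0 ℕ.< n
      go (suc n) _ = s≤s z≤n

    n<h : n ℕ.< h
    n<h = ℕₚ.m<m+n n 0<n

    sieve : ∀ L (f : ℕ → ℤ) → (∀ l j → j ℕ.< h → j ≢ n → f (l ℕ.* h ℕ.+ j) ≈ + 0 [ P³ ]) →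
      ∑ (L ℕ.* h) f ≈ ∑ L (λ l → f (l ℕ.* h ℕ.+ n)) [ P³ ]
    sieve zero    f _ = ≈-refl
    sieve (suc L) f v = ≈-trans (≡⇒≈ (trans (cong (λ k → ∑ k f) (ℕₚ.+-comm h (L ℕ.* h))) (∑-split (L ℕ.* h) h f)))
      (+-≈ (sieve L f v) (∑-single h n n<h (λ j j<h j≢n → v L j j<h j≢n)))

    -- The Jacobsthal sum with its second character replaced by an N-th power; N will be h, 3h and
    -- 5h, for the three powers of c in the quintic.
    K : ℤ → ℕ → ℤ
    K κ N = ∑ₚ (λ s → ζ s ^ h * (+ 1 - κ * (ζ s * ζ s)) ^ N)

    K-expand : ∀ κ N → K κ N ≡ ∑ (suc N) (λ i → + (N C i) * (- κ) ^ i * z (index i))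
    K-expand κ N = begin
      ∑ₚ (λ s → ζ s ^ h * (+ 1 - κ * (ζ s * ζ s)) ^ N)
        ≡⟨ ∑ₚ-cong (λ s → trans (cong (λ x → ζ s ^ h * x ^ N) (lemma₁ κ (ζ s * ζ s))) (trans (cong (ζ s ^ h *_) (binomial-theorem (- κ * (ζ s * ζ s)) N))
             (sym (∑-*ˡ (suc N) (ζ s ^ h) (λ i → + (N C i) * (- κ * (ζ s * ζ s)) ^ i))))) ⟩
      ∑ₚ (λ s → ∑ (suc N) (λ i → ζ s ^ h * (+ (N C i) * (- κ * (ζ s * ζ s)) ^ i)))
        ≡⟨ ∑-swap p (suc N) (λ s i → ζ (+ s) ^ h * (+ (N C i) * (- κ * (ζ (+ s) * ζ (+ s))) ^ i)) ⟩
      ∑ (suc N) (λ i → ∑ₚ (λ s → ζ s ^ h * (+ (N C i) * (- κ * (ζ s * ζ s)) ^ i)))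
        ≡⟨ ∑-cong (suc N) (λ i _ → trans (∑ₚ-cong (λ s → power s i)) (∑ₚ-*ˡ (+ (N C i) * (- κ) ^ i) (λ s → ζ s ^ index i))) ⟩
      ∑ (suc N) (λ i → + (N C i) * (- κ) ^ i * z (index i)) ∎
      where
      open ≡-Reasoning
      lemma₁ : ∀ k x → + 1 - k * x ≡ + 1 + - k * x
      lemma₁ = solve-∀
      lemma₂ : ∀ a c x y → a * (c * (x * (y * y))) ≡ c * x * (a * (y * y))
      lemma₂ = solve-∀
      power : ∀ s i → ζ s ^ h * (+ (N C i) * (- κ * (ζ s * ζ s)) ^ i) ≡ + (N C i) * (- κ) ^ i * ζ s ^ index i
      power s i = begin
        ζ s ^ h * (+ (N C i) * (- κ * (ζ s * ζ s)) ^ i)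
          ≡⟨ cong (λ x → ζ s ^ h * (+ (N C i) * x)) (trans (^-distrib-* (- κ) (ζ s * ζ s) i) (cong ((- κ) ^ i *_) (^-distrib-* (ζ s) (ζ s) i))) ⟩
        ζ s ^ h * (+ (N C i) * ((- κ) ^ i * (ζ s ^ i * ζ s ^ i)))
          ≡⟨ lemma₂ (ζ s ^ h) (+ (N C i)) ((- κ) ^ i) (ζ s ^ i) ⟩
        + (N C i) * (- κ) ^ i * (ζ s ^ h * (ζ s ^ i * ζ s ^ i))
          ≡⟨ cong (+ (N C i) * (- κ) ^ i *_) (sym (trans (ℤₚ.^-distribˡ-+-* (ζ s) h (i ℕ.+ i)) (cong (ζ s ^ h *_) (ℤₚ.^-distribˡ-+-* (ζ s) i i)))) ⟩
        + (N C i) * (- κ) ^ i * ζ s ^ index i ∎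

    a : ℕ → ℤ → ℤ
    a L σ = ∑ L (λ l → + ((L ℕ.* h) C (l ℕ.* h ℕ.+ n)) * σ ^ l)

    -- Only the indices i = lh + n survive, each with the power sum P - 1; there (-κ)^i splits into
    -- σ^l and (-κ)^n.
    K≈ : ∀ κ {σ} L → (- κ) ^ h ≈ σ [ P³ ] → K κ (L ℕ.* h) ≈ (P - + 1) * (- κ) ^ n * a L σ [ P³ ]
    K≈ κ {σ} L e = begin
      K κ N
        ≡⟨ K-expand κ N ⟩
      ∑ N f + f N
        ≈⟨ +-≈ (sieve L f (λ l j j<h j≢n → vanish (l ℕ.* h ℕ.+ j) (z-index l j<h j≢n)))
               (subst (λ i → f i ≈ + 0 [ P³ ]) (ℕₚ.+-identityʳ N) (vanish (L ℕ.* h ℕ.+ 0) (z-index L 0<h (ℕₚ.<⇒≢ 0<n)))) ⟩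
      ∑ L (λ l → f (l ℕ.* h ℕ.+ n)) + + 0
        ≡⟨ ℤₚ.+-identityʳ _ ⟩
      ∑ L (λ l → f (l ℕ.* h ℕ.+ n))
        ≈⟨ ∑-≈ L (λ l _ → surviving l) ⟩
      ∑ L (λ l → (P - + 1) * (- κ) ^ n * (+ (N C (l ℕ.* h ℕ.+ n)) * σ ^ l))
        ≡⟨ ∑-*ˡ L ((P - + 1) * (- κ) ^ n) (λ l → + (N C (l ℕ.* h ℕ.+ n)) * σ ^ l) ⟩
      (P - + 1) * (- κ) ^ n * a L σ ∎
      where
      open ≈-Reasoning P³
      N : ℕ
      N = L ℕ.* h
      f : ℕ → ℤ
      f i = + (N C i) * (- κ) ^ i * z (index i)
      vanish : ∀ i → z (index i) ≈ + 0 [ P³ ] → f i ≈ + 0 [ P³ ]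
      vanish i e = ≈-trans (*-≈ˡ (+ (N C i) * (- κ) ^ i) e) (≡⇒≈ (ℤₚ.*-zeroʳ (+ (N C i) * (- κ) ^ i)))
      lemma : ∀ c x y q → c * (x * y) * q ≡ q * y * (c * x)
      lemma = solve-∀
      surviving : ∀ l → f (l ℕ.* h ℕ.+ n) ≈ (P - + 1) * (- κ) ^ n * (+ (N C (l ℕ.* h ℕ.+ n)) * σ ^ l) [ P³ ]
      surviving l = begin
        + (N C i) * (- κ) ^ i * z (index i)
          ≈⟨ *-≈ (*-≈ˡ (+ (N C i)) (≈-trans (≡⇒≈ (trans (ℤₚ.^-distribˡ-+-* (- κ) (l ℕ.* h) n)
               (cong (_* (- κ) ^ n) (trans (cong ((- κ) ^_) (ℕₚ.*-comm l h)) (sym (ℤₚ.^-*-assoc (- κ) h l)))))) (*-≈ʳ ((- κ) ^ n) (^-≈ l e)))) (z-index-n l) ⟩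
        + (N C i) * (σ ^ l * (- κ) ^ n) * (P - + 1)
          ≡⟨ lemma (+ (N C i)) (σ ^ l) ((- κ) ^ n) (P - + 1) ⟩
        (P - + 1) * (- κ) ^ n * (+ (N C i) * σ ^ l) ∎
        where
        i : ℕ
        i = l ℕ.* h ℕ.+ n

    -- 15c − 10c³ + 3c⁵ agrees to third order with 8e at each of the signs e = ±1.
    quintic : ∀ {c e} → Sign e → c ≈ e [ P ] → (e ≡ + 0 → c ≈ + 0 [ P³ ]) →
      + 15 * c - + 10 * (c * c * c) + + 3 * (c * c * c * c * c) ≈ + 8 * e [ P³ ]
    quintic {c} null _ h = ≈-trans (+-≈ (-‿≈ (*-≈ˡ (+ 15) c0) (*-≈ˡ (+ 10) (*-≈ (*-≈ c0 c0) c0))) (*-≈ˡ (+ 3) (*-≈ (*-≈ (*-≈ (*-≈ c0 c0) c0) c0) c0))) (≡⇒≈ refl)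
      where
      c0 = h refl
    quintic {c} positive e _ = ≈-from-difference (≈-trans (≡⇒≈ (lemma c)) (≈-trans (*-≈ʳ (+ 3 * c * c + + 9 * c + + 8) (≈-zero-* (≈-zero-* d d) d)) (≡⇒≈ (ℤₚ.*-zeroˡ (+ 3 * c * c + + 9 * c + + 8)))))
      where
      d : c - + 1 ≈ + 0 [ P ]
      d = difference-≈0 e
      lemma : ∀ c → + 15 * c - + 10 * (c * c * c) + + 3 * (c * c * c * c * c) - + 8 * + 1 ≡ (c - + 1) * (c - + 1) * (c - + 1) * (+ 3 * c * c + + 9 * c + + 8)
      lemma = solve-∀
    quintic {c} negative e _ = ≈-from-difference (≈-trans (≡⇒≈ (lemma c)) (≈-trans (*-≈ʳ (+ 3 * c * c - + 9 * c + + 8) (≈-zero-* (≈-zero-* d d) d)) (≡⇒≈ (ℤₚ.*-zeroˡ (+ 3 * c * c - + 9 * c + + 8)))))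
      where
      d : c + + 1 ≈ + 0 [ P ]
      d = difference-≈0 e
      lemma : ∀ c → + 15 * c - + 10 * (c * c * c) + + 3 * (c * c * c * c * c) - + 8 * (- + 1) ≡ (c + + 1) * (c + + 1) * (c + + 1) * (+ 3 * c * c - + 9 * c + + 8)
      lemma = solve-∀

    quintic-φ : ∀ κ s → let w = + 1 - ζ κ * (ζ s * ζ s) in
      + 15 * w ^ (1 ℕ.* h) - + 10 * w ^ (3 ℕ.* h) + + 3 * w ^ (5 ℕ.* h) ≈ + 8 * φ (+ 1 - κ * (s * s)) [ P³ ]
    quintic-φ κ s = ≈-trans (≡⇒≈ powers) (quintic (φ-sign (+ 1 - κ * (s * s))) (≈-trans (^-≈ h w≈) (euler (+ 1 - κ * (s * s)))) degenerate)
      where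
      w c : ℤ
      w = + 1 - ζ κ * (ζ s * ζ s)
      c = w ^ h
      split : ∀ L → w ^ (L ℕ.* h) ≡ c ^ L
      split L = trans (cong (w ^_) (ℕₚ.*-comm L h)) (sym (ℤₚ.^-*-assoc w h L))
      flatten : ∀ c → + 15 * (c * + 1) - + 10 * (c * (c * (c * + 1))) + + 3 * (c * (c * (c * (c * (c * + 1))))) ≡ + 15 * c - + 10 * (c * c * c) + + 3 * (c * c * c * c * c)
      flatten = solve-∀
      powers : + 15 * w ^ (1 ℕ.* h) - + 10 * w ^ (3 ℕ.* h) + + 3 * w ^ (5 ℕ.* h) ≡ + 15 * c - + 10 * (c * c * c) + + 3 * (c * c * c * c * c)
      powers = trans (cong₂ _+_ (cong₂ (λ x y → + 15 * x - + 10 * y) (split 1) (split 3)) (cong (+ 3 *_) (split 5))) (flatten c)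
      w≈ : w ≈ + 1 - κ * (s * s) [ P ]
      w≈ = -‿≈ (≈-refl {a = + 1}) (*-≈ (ζ≈ κ) (*-≈ (ζ≈ s) (ζ≈ s)))
      degenerate : φ (+ 1 - κ * (s * s)) ≡ + 0 → c ≈ + 0 [ P³ ]
      -- Multiplicativity of the Teichmüller lift is essential here: κs² ≈ 1 modulo P gives
      -- ζ(κ)ζ(s)² ≈ 1 modulo P³, so w itself vanishes to third order, whatever the size of h.
      degenerate e = ^-≈0₃ 0<h (difference-≈0 (≈-trans (≈-sym (ζ-sign positive unit)) (≈-trans (ζ-* κ (s * s)) (*-≈ˡ (ζ κ) (ζ-* s s)))))
        where
        root : + 1 - κ * (s * s) ≈ + 0 [ P ]
        root = go (≈0? (+ 1 - κ * (s * s)))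
          where
          go : Dec (+ 1 - κ * (s * s) ≈ + 0 [ P ]) → + 1 - κ * (s * s) ≈ + 0 [ P ]
          go (yes r) = r
          go (no nr) with trans (sym (φ² nr)) (cong₂ _*_ e e)
          ... | ()
        unit : κ * (s * s) ≈ + 1 [ P ]
        unit = ≈-sym (≈-from-difference root)

    A : ℤ → ℤ
    A σ = + 15 * a 1 σ - + 10 * a 3 σ + + 3 * a 5 σ

    8T̃≈ : ∀ κ → + 8 * T̃ κ ≈ (P - + 1) * (- ζ κ) ^ n * A (φ κ) [ P³ ]
    8T̃≈ κ = begin
      + 8 * T̃ κ
        ≡⟨ sym (∑ₚ-*ˡ (+ 8) (λ s → φ s * φ (+ 1 - κ * (s * s)))) ⟩
      ∑ₚ (λ s → + 8 * (φ s * φ (+ 1 - κ * (s * s))))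
        ≡⟨ ∑ₚ-cong (λ s → lemma₁ (φ s) (φ (+ 1 - κ * (s * s)))) ⟩
      ∑ₚ (λ s → φ s * (+ 8 * φ (+ 1 - κ * (s * s))))
        ≈⟨ ∑-≈ p (λ s _ → *-≈ (ζ-euler (+ s)) (quintic-φ κ (+ s))) ⟨
      ∑ₚ (λ s → ζ s ^ h * (+ 15 * w s ^ (1 ℕ.* h) - + 10 * w s ^ (3 ℕ.* h) + + 3 * w s ^ (5 ℕ.* h)))
        ≡⟨ ∑ₚ-cong (λ s → lemma₂ (ζ s ^ h) (w s ^ (1 ℕ.* h)) (w s ^ (3 ℕ.* h)) (w s ^ (5 ℕ.* h))) ⟩
      ∑ₚ (λ s → + 15 * (ζ s ^ h * w s ^ (1 ℕ.* h)) + (- + 10 * (ζ s ^ h * w s ^ (3 ℕ.* h)) + + 3 * (ζ s ^ h * w s ^ (5 ℕ.* h))))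
        ≡⟨ trans (∑ₚ-+ (λ s → + 15 * (ζ s ^ h * w s ^ (1 ℕ.* h))) (λ s → - + 10 * (ζ s ^ h * w s ^ (3 ℕ.* h)) + + 3 * (ζ s ^ h * w s ^ (5 ℕ.* h))))
             (cong₂ _+_ (∑ₚ-*ˡ (+ 15) (λ s → ζ s ^ h * w s ^ (1 ℕ.* h))) (trans (∑ₚ-+ (λ s → - + 10 * (ζ s ^ h * w s ^ (3 ℕ.* h))) (λ s → + 3 * (ζ s ^ h * w s ^ (5 ℕ.* h))))
               (cong₂ _+_ (∑ₚ-*ˡ (- + 10) (λ s → ζ s ^ h * w s ^ (3 ℕ.* h))) (∑ₚ-*ˡ (+ 3) (λ s → ζ s ^ h * w s ^ (5 ℕ.* h)))))) ⟩
      + 15 * K (ζ κ) (1 ℕ.* h) + (- + 10 * K (ζ κ) (3 ℕ.* h) + + 3 * K (ζ κ) (5 ℕ.* h))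
        ≈⟨ +-≈ (*-≈ˡ (+ 15) (K≈ (ζ κ) 1 e)) (+-≈ (*-≈ˡ (- + 10) (K≈ (ζ κ) 3 e)) (*-≈ˡ (+ 3) (K≈ (ζ κ) 5 e))) ⟩
      + 15 * (q * a 1 σ) + (- + 10 * (q * a 3 σ) + + 3 * (q * a 5 σ))
        ≡⟨ lemma₃ q (a 1 σ) (a 3 σ) (a 5 σ) ⟩
      q * A σ ∎
      where
      open ≈-Reasoning P³
      w : ℤ → ℤ
      w s = + 1 - ζ κ * (ζ s * ζ s)
      σ q : ℤ
      σ = φ κ
      q = (P - + 1) * (- ζ κ) ^ n
      e : (- ζ κ) ^ h ≈ σ [ P³ ]
      e = ≈-trans (≡⇒≈ (trans (ℤₚ.^-distribˡ-+-* (- ζ κ) n n) (trans (sym (^-distrib-* (- ζ κ) (- ζ κ) n)) (trans (cong (_^ n) (signs (ζ κ))) (trans (^-distrib-* (ζ κ) (ζ κ) n) (sym (ℤₚ.^-distribˡ-+-* (ζ κ) n n))))))) (ζ-euler κ)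
        where
        signs : ∀ x → - x * - x ≡ x * x
        signs = solve-∀
      lemma₁ : ∀ a b → + 8 * (a * b) ≡ a * (+ 8 * b)
      lemma₁ = solve-∀
      lemma₂ : ∀ z a b c → z * (+ 15 * a - + 10 * b + + 3 * c) ≡ + 15 * (z * a) + (- + 10 * (z * b) + + 3 * (z * c))
      lemma₂ = solve-∀
      lemma₃ : ∀ q a b c → + 15 * (q * a) + (- + 10 * (q * b) + + 3 * (q * c)) ≡ q * (+ 15 * a - + 10 * b + + 3 * c)
      lemma₃ = solve-∀

    -- In A(1) + A(-1) only even l remain, and the symmetry of binomial coefficients merges the
    -- outer ones: 20 = 2 · 10 and 6 = 2 · 3.
    Br : ℤ
    Br = + 15 * + (h C n) - + 20 * + ((3 ℕ.* h) C n) + + 6 * + ((5 ℕ.* h) C n) + + 3 * + ((5 ℕ.* h) C (2 ℕ.* h ℕ.+ n))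

    A-symmetric : A (+ 1) + A (- + 1) ≡ + 2 * Br
    A-symmetric = begin
      A (+ 1) + A (- + 1)
        ≡⟨ lemma (c 1 0) (c 3 0) (c 3 1) (c 3 2) (c 5 0) (c 5 1) (c 5 2) (c 5 3) (c 5 4) ⟩
      + 2 * (+ 15 * c 1 0 - + 10 * (c 3 0 + c 3 2) + + 3 * (c 5 0 + c 5 2 + c 5 4))
        ≡⟨ cong₂ (λ x y → + 2 * (x - + 10 * (c 3 0 + y) + + 3 * (c 5 0 + c 5 2 + c 5 4))) (cong (λ k → + 15 * + (k C n)) (ℕₚ.+-identityʳ h)) (cong +_ sym₃) ⟩
      + 2 * (+ 15 * + (h C n) - + 10 * (c 3 0 + c 3 0) + + 3 * (c 5 0 + c 5 2 + c 5 4))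
        ≡⟨ cong (λ y → + 2 * (+ 15 * + (h C n) - + 10 * (c 3 0 + c 3 0) + + 3 * (c 5 0 + c 5 2 + y))) (cong +_ sym₅) ⟩
      + 2 * (+ 15 * + (h C n) - + 10 * (c 3 0 + c 3 0) + + 3 * (c 5 0 + c 5 2 + c 5 0))
        ≡⟨ lemma₂ (+ (h C n)) (c 3 0) (c 5 0) (c 5 2) ⟩
      + 2 * Br ∎
      where
      open ≡-Reasoning
      c : ℕ → ℕ → ℤ
      c L l = + ((L ℕ.* h) C (l ℕ.* h ℕ.+ n))
      lemma : ∀ a b₀ b₁ b₂ d₀ d₁ d₂ d₃ d₄ →
        + 15 * (+ 0 + a * + 1) - + 10 * (+ 0 + b₀ * + 1 + b₁ * + 1 + b₂ * + 1) + + 3 * (+ 0 + d₀ * + 1 + d₁ * + 1 + d₂ * + 1 + d₃ * + 1 + d₄ * + 1)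
        + (+ 15 * (+ 0 + a * + 1) - + 10 * (+ 0 + b₀ * + 1 + b₁ * - + 1 + b₂ * + 1) + + 3 * (+ 0 + d₀ * + 1 + d₁ * - + 1 + d₂ * + 1 + d₃ * - + 1 + d₄ * + 1))
        ≡ + 2 * (+ 15 * a - + 10 * (b₀ + b₂) + + 3 * (d₀ + d₂ + d₄))
      lemma = solve-∀
      lemma₂ : ∀ a b c d → + 2 * (+ 15 * a - + 10 * (b + b) + + 3 * (c + d + c)) ≡ + 2 * (+ 15 * a - + 20 * b + + 6 * c + + 3 * d)
      lemma₂ = solve-∀
      reflected : ∀ N k → N ≡ k ℕ.+ n → N C k ≡ N C n
      reflected N k refl = trans (nCk≡nC[n∸k] (ℕₚ.m≤m+n k n)) (cong (N C_) (ℕₚ.m+n∸m≡n k n))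
      sym₃ : (3 ℕ.* h) C (2 ℕ.* h ℕ.+ n) ≡ (3 ℕ.* h) C n
      sym₃ = reflected (3 ℕ.* h) (2 ℕ.* h ℕ.+ n) (ℤₚ.+-injective (split (+ n)))
        where
        split : ∀ n → (n + n) + ((n + n) + ((n + n) + + 0)) ≡ (n + n) + ((n + n) + + 0) + n + n
        split = solve-∀
      sym₅ : (5 ℕ.* h) C (4 ℕ.* h ℕ.+ n) ≡ (5 ℕ.* h) C n
      sym₅ = reflected (5 ℕ.* h) (4 ℕ.* h ℕ.+ n) (ℤₚ.+-injective (split (+ n)))
        where
        split : ∀ n → (n + n) + ((n + n) + ((n + n) + ((n + n) + ((n + n) + + 0)))) ≡ (n + n) + ((n + n) + ((n + n) + ((n + n) + + 0))) + n + n
        split = solve-∀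

    -- W is -(-1)ⁿ(X + ιY) with ι² ≈ -1 modulo P³, up to sign twice the Jacobi sum; 2ξ - W is its
    -- conjugate, so their product is the norm X² + Y² = 4p. The sign is chosen so that ξ is
    -- congruent to 2 modulo 8, as 2x is.
    jacobi-sum : ∃ λ ξ → ∃ λ Y → ∃ λ W → (ξ * ξ + Y * Y ≡ + 4 * P) × (ξ ≈ - (- + 1) ^ n * (+ 7 - P) [ + 8 ]) ×
      (+ 4 * W ≈ (+ 1 - P) * Br [ P³ ]) × (W * (+ 2 * ξ - W) ≈ + 4 * P [ P³ ])
    jacobi-sum = - s * X , Y , W ,
      trans (trans (lemma₁ s X Y) (cong (λ x → x * (X * X) + Y * Y) s²)) (trans (cong (_+ Y * Y) (ℤₚ.*-identityˡ (X * X))) (sum-of-squares eg)) ,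
      *-≈ˡ (- s) T̃-mod-8 ,
      ≈-cancel₃ {+ 2} nz-2 main ,
      ≈-trans (≡⇒≈ (lemma₂ s X ι Y)) (≈-trans (*-≈ (≡⇒≈ s²) (-‿≈ (≈-refl {a = X * X}) (*-≈ʳ (Y * Y) ι²))) (≡⇒≈ (trans (lemma₃ (X * X) (Y * Y)) (sum-of-squares eg))))
      where
      open ≈-Reasoning P³
      g s r ι X Y W : ℤ
      g = proj₁ nonresidue
      s = (- + 1) ^ n
      r = ζ g ^ n
      ι = - r
      X = T̃ (+ 1)
      Y = T̃ g
      W = - s * (X + ι * Y)
      eg : φ g ≡ - + 1
      eg = proj₂ nonresidue
      s² : s * s ≡ + 1
      s² = sign-square n
      r² : r * r ≈ - + 1 [ P³ ]
      r² = ≈-trans (≡⇒≈ (sym (ℤₚ.^-distribˡ-+-* (ζ g) n n))) (≈-trans (ζ-euler g) (≡⇒≈ eg))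
      ι² : ι * ι ≈ - + 1 [ P³ ]
      ι² = ≈-trans (≡⇒≈ (lemma r)) r²
        where
        lemma : ∀ x → - x * - x ≡ x * x
        lemma = solve-∀
      lemma₁ : ∀ s x y → - s * x * (- s * x) + y * y ≡ s * s * (x * x) + y * y
      lemma₁ = solve-∀
      lemma₂ : ∀ s x i y → - s * (x + i * y) * (+ 2 * (- s * x) - - s * (x + i * y)) ≡ s * s * (x * x - i * i * (y * y))
      lemma₂ = solve-∀
      lemma₃ : ∀ x y → + 1 * (x - - + 1 * y) ≡ x + y
      lemma₃ = solve-∀
      lemma₄ : ∀ s x r y → + 2 * (+ 4 * (- s * (x + - r * y))) ≡ - s * (+ 8 * x) + s * r * (+ 8 * y)
      lemma₄ = solve-∀
      lemma₅ : ∀ s p r a b → - s * ((p - + 1) * s * a) + s * r * ((p - + 1) * (s * r) * b) ≡ s * s * ((+ 1 - p) * (a - r * r * b))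
      lemma₅ = solve-∀
      lemma₆ : ∀ p a b → + 1 * ((+ 1 - p) * (a - - + 1 * b)) ≡ (+ 1 - p) * (a + b)
      lemma₆ = solve-∀
      lemma₇ : ∀ p b → (+ 1 - p) * (+ 2 * b) ≡ + 2 * ((+ 1 - p) * b)
      lemma₇ = solve-∀
      8X : + 8 * X ≈ (P - + 1) * s * A (+ 1) [ P³ ]
      8X = ≈-trans (8T̃≈ (+ 1)) (*-≈ (*-≈ˡ (P - + 1) (^-≈ n (neg-≈ (ζ-sign positive ≈-refl)))) (≡⇒≈ (cong A φ-1)))
      8Y : + 8 * Y ≈ (P - + 1) * (s * r) * A (- + 1) [ P³ ]
      8Y = ≈-trans (8T̃≈ g) (≡⇒≈ (cong₂ (λ x y → (P - + 1) * x * A y) (trans (cong (_^ n) (sym (ℤₚ.-1*i≡-i (ζ g)))) (^-distrib-* (- + 1) (ζ g) n)) eg))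
      main : + 2 * (+ 4 * W) ≈ + 2 * ((+ 1 - P) * Br) [ P³ ]
      main = begin
        + 2 * (+ 4 * W)
          ≡⟨ lemma₄ s X r Y ⟩
        - s * (+ 8 * X) + s * r * (+ 8 * Y)
          ≈⟨ +-≈ (*-≈ˡ (- s) 8X) (*-≈ˡ (s * r) 8Y) ⟩
        - s * ((P - + 1) * s * A (+ 1)) + s * r * ((P - + 1) * (s * r) * A (- + 1))
          ≡⟨ lemma₅ s P r (A (+ 1)) (A (- + 1)) ⟩
        s * s * ((+ 1 - P) * (A (+ 1) - r * r * A (- + 1)))
          ≈⟨ *-≈ (≡⇒≈ s²) (*-≈ˡ (+ 1 - P) (-‿≈ (≈-refl {a = A (+ 1)}) (*-≈ʳ (A (- + 1)) r²))) ⟩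
        + 1 * ((+ 1 - P) * (A (+ 1) - - + 1 * A (- + 1)))
          ≡⟨ lemma₆ P (A (+ 1)) (A (- + 1)) ⟩
        (+ 1 - P) * (A (+ 1) + A (- + 1))
          ≡⟨ cong ((+ 1 - P) *_) A-symmetric ⟩
        (+ 1 - P) * (+ 2 * Br)
          ≡⟨ lemma₇ P Br ⟩
        + 2 * ((+ 1 - P) * Br) ∎

-- Harmonic expansions of half and quarter factorials modulo p³

module QuarterFactorialExpansions where

  open IntegerCongruences
  open ShiftedProducts
  open import Data.Integer using (_+_; _*_; _-_; -_; _^_)

  -- The elementary symmetric functions of 1, ..., k of degrees k - 1 and k - 2. Divided by k! they
  -- are H and (H² - H⁽²⁾)/2, with H the harmonic number and H⁽²⁾ the sum of inverse squares.
  e₁ e₂ : ℕ → ℤ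
  e₁ zero    = + 0
  e₁ (suc k) = e₁ k * + suc k + ∏ k (λ i → + suc i)
  e₂ zero    = + 0
  e₂ (suc k) = e₂ k * + suc k + e₁ k

  -- The expansion of the product in powers of w/u, cut off at w³; the factor u² keeps it integral.
  rising-expansion : ∀ {m} u {w} → w * w * w ≈ + 0 [ m ] → ∀ k →
    u * u * ∏ k (λ i → u * + suc i + w) ≈ u ^ k * (u * u * ∏ k (λ i → + suc i) + u * w * e₁ k + w * w * e₂ k) [ m ]
  rising-expansion u {w} _ zero = ≡⇒≈ (lemma u w)
    where
    lemma : ∀ u w → u * u * + 1 ≡ + 1 * (u * u * + 1 + u * w * + 0 + w * w * + 0)
    lemma = solve-∀
  rising-expansion {m} u {w} w³ (suc k) = begin
    u * u * (∏ k f * (u * + suc k + w))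
      ≡⟨ sym (ℤₚ.*-assoc (u * u) (∏ k f) _) ⟩
    u * u * ∏ k f * (u * + suc k + w)
      ≈⟨ *-≈ʳ (u * + suc k + w) (rising-expansion u w³ k) ⟩
    u ^ k * (u * u * e + u * w * e₁ k + w * w * e₂ k) * (u * + suc k + w)
      ≡⟨ lemma (u ^ k) u w e (e₁ k) (e₂ k) (+ suc k) ⟩
    u * u ^ k * (u * u * (e * + suc k) + u * w * (e₁ k * + suc k + e) + w * w * (e₂ k * + suc k + e₁ k)) + u ^ k * e₂ k * (w * w * w)
      ≈⟨ +-≈ (≈-refl {a = u * u ^ k * (u * u * (e * + suc k) + u * w * (e₁ k * + suc k + e) + w * w * (e₂ k * + suc k + e₁ k))}) (*-≈ˡ (u ^ k * e₂ k) w³) ⟩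
    u * u ^ k * (u * u * (e * + suc k) + u * w * e₁ (suc k) + w * w * e₂ (suc k)) + u ^ k * e₂ k * + 0
      ≡⟨ trans (cong (λ x → u * u ^ k * (u * u * (e * + suc k) + u * w * e₁ (suc k) + w * w * e₂ (suc k)) + x) (ℤₚ.*-zeroʳ (u ^ k * e₂ k))) (ℤₚ.+-identityʳ _) ⟩
    u * u ^ k * (u * u * (e * + suc k) + u * w * e₁ (suc k) + w * w * e₂ (suc k)) ∎
    where
    open ≈-Reasoning m
    e : ℤ
    e = ∏ k (λ i → + suc i)
    f : ℕ → ℤ
    f i = u * + suc i + w
    lemma : ∀ v u w e a b s → v * (u * u * e + u * w * a + w * w * b) * (u * s + w)
      ≡ u * v * (u * u * (e * s) + u * w * (a * s + e) + w * w * (b * s + a)) + v * b * (w * w * w)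
    lemma = solve-∀

  even-power : ∀ x k → (- x) ^ (k ℕ.+ k) ≡ x ^ (k ℕ.+ k)
  even-power x k = trans (split (- x)) (trans (cong (_^ k) (square x)) (sym (split x)))
    where
    split : ∀ y → y ^ (k ℕ.+ k) ≡ (y * y) ^ k
    split y = trans (ℤₚ.^-distribˡ-+-* y k k) (sym (^-distrib-* y y k))
    square : ∀ x → - x * - x ≡ x * x
    square = solve-∀

  module QuarterFactorials {p : ℕ} (pr : Prime p) (3<p : 3 ℕ.< p) (n : ℕ) (p≡ : p ≡ suc ((n ℕ.+ n) ℕ.+ (n ℕ.+ n))) where
    open ModPrime pr

    h : ℕ
    h = n ℕ.+ n

    P≡ : P ≡ + 4 * + n + + 1
    P≡ = trans (cong +_ p≡) (lemma (+ n))
      where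
      lemma : ∀ n → + 1 + ((n + n) + (n + n)) ≡ + 4 * n + + 1
      lemma = solve-∀

    h<p : h ℕ.< p
    h<p = subst (h ℕ.<_) (sym p≡) (s≤s (ℕₚ.m≤m+n h h))

    n<p : n ℕ.< p
    n<p = ℕₚ.≤-<-trans (ℕₚ.m≤m+n n n) h<p

    nz-2 : Nz (+ 2)
    nz-2 = nz-small (s≤s z≤n) (ℕₚ.<-trans (s≤s (s≤s (s≤s z≤n))) 3<p)

    nz-3 : Nz (+ 3)
    nz-3 = nz-small (s≤s z≤n) 3<p

    a₀ b₀ : ℤ
    a₀ = + (n !)
    b₀ = + (h !)

    nz-a₀ : Nz a₀
    nz-a₀ = nz-! n<p

    nz-b₀ : Nz b₀
    nz-b₀ = nz-! h<p

    -- The exponent p - 3 is even, so i ↦ p - i makes twice the half sum a full power sum, of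
    -- exponent below p - 1.
    ∑-inverse-squares : ∑ h (λ i → (+ suc i) ^ (p ℕ.∸ 3)) ≈ + 0 [ P ]
    ∑-inverse-squares = go h p≡
      where
      go : ∀ h → p ≡ suc (h ℕ.+ h) → ∑ h (λ i → (+ suc i) ^ (p ℕ.∸ 3)) ≈ + 0 [ P ]
      go zero          _ = ≈-refl
      go (suc zero)    e = ⊥-elim (ℕₚ.<-irrefl (sym e) 3<p)
      go (suc (suc m)) e = ≈-trans (≡⇒≈ (cong (λ k → ∑ H (λ i → (+ suc i) ^ k)) p-3)) (≈0-cancel nz-2 (begin
        + 2 * s
          ≡⟨ double s ⟩
        s + s
          ≈⟨ +-≈ (≈-refl {a = s}) reflected ⟩
        s + ∑ H (λ i → (+ suc (H ℕ.+ i)) ^ K)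
          ≡⟨ sym (∑-split H H (λ i → (+ suc i) ^ K)) ⟩
        ∑ (H ℕ.+ H) (λ i → (+ suc i) ^ K)
          ≡⟨ sym (trans (∑-head (H ℕ.+ H) (λ t → (+ t) ^ K)) (trans (cong (_+ ∑ (H ℕ.+ H) (λ i → (+ suc i) ^ K)) (ℤₚ.*-zeroˡ ((+ 0) ^ (m ℕ.+ suc m)))) (ℤₚ.+-identityˡ _))) ⟩
        ∑ (suc (H ℕ.+ H)) (λ t → (+ t) ^ K)
          ≡⟨ cong (λ k → ∑ k (λ t → (+ t) ^ K)) (sym e) ⟩
        power-sum K
          ≈⟨ power-sum≈0 K (subst (suc K ℕ.<_) (sym e) (s≤s (s≤s (ℕₚ.+-monoʳ-≤ (suc m) (ℕₚ.n≤1+n (suc m)))))) ⟩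
        + 0 ∎))
        where
        open ≈-Reasoning P
        H K : ℕ
        H = suc (suc m)
        K = suc m ℕ.+ suc m
        s : ℤ
        s = ∑ H (λ i → (+ suc i) ^ K)
        p-3 : p ℕ.∸ 3 ≡ K
        p-3 = trans (cong (ℕ._∸ 3) e) (cong (ℕ._∸ 1) (ℕₚ.+-suc (suc m) (suc m)))
        double : ∀ s → + 2 * s ≡ s + s
        double = solve-∀
        reflected : s ≈ ∑ H (λ i → (+ suc (H ℕ.+ i)) ^ K) [ P ]
        reflected = ≈-trans (∑-≈ H (λ i i<H → ≈-sym (≈-trans (^-≈ K (negate i i<H)) (≡⇒≈ (even-power (+ suc i) (suc m))))))
          (≡⇒≈ (sym (∑-reverse H (λ i → (+ suc (H ℕ.+ i)) ^ K))))
          where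
          negate : ∀ i → i ℕ.< H → + suc (H ℕ.+ (H ℕ.∸ suc i)) ≈ - + suc i [ P ]
          negate i i<H = mod-by (+ 1) (trans (cong (λ x → + 1 + (+ H + x)) (pos-∸ i<H)) (trans (lemma (+ H) (+ i)) (cong (λ x → - + suc i + x * + 1) (sym (cong +_ e)))))
            where
            lemma : ∀ h i → + 1 + (h + (h - (+ 1 + i))) ≡ - (+ 1 + i) + (+ 1 + (h + h)) * + 1
            lemma = solve-∀

    -- By Fermat, the power p − 3 stands for the inverse square.
    newton-identity : ∀ k → k ℕ.< p → let e = ∏ k (λ i → + suc i) in
      e₁ k * e₁ k - + 2 * (e * e₂ k) ≈ e * e * ∑ k (λ i → (+ suc i) ^ (p ℕ.∸ 3)) [ P ]
    newton-identity zero    _   = ≈-refl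
    newton-identity (suc k) k<p = begin
      e₁ (suc k) * e₁ (suc k) - + 2 * (e * f * e₂ (suc k))
        ≡⟨ lemma₁ (e₁ k) (e₂ k) e f ⟩
      f * f * (e₁ k * e₁ k - + 2 * (e * e₂ k)) + e * e * + 1
        ≈⟨ +-≈ (*-≈ˡ (f * f) (newton-identity k (ℕₚ.<⇒≤ k<p))) (*-≈ˡ (e * e) (≈-sym unit)) ⟩
      f * f * (e * e * s) + e * e * (f * (f * f ^ (p ℕ.∸ 3)))
        ≡⟨ lemma₂ f e s (f ^ (p ℕ.∸ 3)) ⟩
      e * f * (e * f) * (s + f ^ (p ℕ.∸ 3)) ∎
      where
      open ≈-Reasoning P
      e f s : ℤ
      e = ∏ k (λ i → + suc i)
      f = + suc k
      s = ∑ k (λ i → (+ suc i) ^ (p ℕ.∸ 3))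
      lemma₁ : ∀ a b e f → (a * f + e) * (a * f + e) - + 2 * (e * f * (b * f + a)) ≡ f * f * (a * a - + 2 * (e * b)) + e * e * + 1
      lemma₁ = solve-∀
      lemma₂ : ∀ f e s x → f * f * (e * e * s) + e * e * (f * (f * x)) ≡ e * f * (e * f) * (s + x)
      lemma₂ = solve-∀
      unit : f * (f * f ^ (p ℕ.∸ 3)) ≈ + 1 [ P ]
      unit = ≈-trans (≡⇒≈ (cong (f ^_) (trans (cong suc (sym (ℕₚ.+-∸-assoc 1 {p} {3} (ℕₚ.<⇒≤ 3<p)))) (sym (ℕₚ.+-∸-assoc 1 {p} {2} (ℕₚ.≤-trans (s≤s (s≤s z≤n)) (ℕₚ.<⇒≤ 3<p)))))))
        (fermat-1 (nz-small (s≤s z≤n) k<p))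

    quotient : ∀ {u} → Nz u → ℤ → ℤ
    quotient nu a = proj₁ (inverse nu) * a

    quotient-* : ∀ {u} (nu : Nz u) a → u * quotient nu a ≈ a [ P³ ]
    quotient-* {u} nu a = ≈-trans (≡⇒≈ (sym (ℤₚ.*-assoc u _ a))) (≈-trans (*-≈ʳ a (≈-lower (proj₂ (inverse nu)))) (≡⇒≈ (ℤₚ.*-identityˡ a)))

    -- `λ′` is an eighth of the harmonic number H_h. Since H_n turns out to be 12 `λ′` modulo P
    -- (`α₁≈`), subtracting 72 `λ′`² = (12 `λ′`)²/2 isolates the inverse squares: modulo P, `ω` is
    -- -1/16 of the sum of 1/i² over i ≤ n. The scalings keep the later coefficients integral.
    λ′ α₂ ω : ℤ
    λ′ = quotient (nz-* (nz-* nz-2 (nz-* nz-2 nz-2)) nz-b₀) (e₁ h)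
    α₂ = quotient nz-a₀ (e₂ n)
    ω  = quotient (nz-* nz-2 (nz-* nz-2 nz-2)) (α₂ - + 72 * λ′ * λ′)

    b₁≈ : e₁ h ≈ b₀ * (+ 8 * λ′) [ P³ ]
    b₁≈ = ≈-trans (≈-sym (quotient-* (nz-* (nz-* nz-2 (nz-* nz-2 nz-2)) nz-b₀) (e₁ h))) (≡⇒≈ (lemma b₀ λ′))
      where
      lemma : ∀ b l → + 8 * b * l ≡ b * (+ 8 * l)
      lemma = solve-∀

    -- With the inverse squares gone, Newton's identity makes e₂ half the square of e₁, up to h!.
    -- Hence h!⁻¹ ∏ (i + Pc) is exp(8`λ′`Pc) to second order.
    b₂≈ : e₂ h ≈ b₀ * (+ 32 * λ′ * λ′) [ P ]
    b₂≈ = ≈-cancel₁ {+ 2 * b₀} (nz-* nz-2 nz-b₀) (begin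
      + 2 * b₀ * e₂ h
        ≡⟨ lemma₁ b₀ (e₁ h) (e₂ h) ⟩
      e₁ h * e₁ h - (e₁ h * e₁ h - + 2 * (b₀ * e₂ h))
        ≈⟨ -‿≈ (*-≈ b₁ b₁) newton ⟩
      b₀ * (+ 8 * λ′) * (b₀ * (+ 8 * λ′)) - + 0
        ≡⟨ lemma₂ b₀ λ′ ⟩
      + 2 * b₀ * (b₀ * (+ 32 * λ′ * λ′)) ∎)
      where
      open ≈-Reasoning P
      b₁ : e₁ h ≈ b₀ * (+ 8 * λ′) [ P ]
      b₁ = ≈-lower (≈-lower b₁≈)
      lemma₁ : ∀ b x y → + 2 * b * y ≡ x * x - (x * x - + 2 * (b * y))
      lemma₁ = solve-∀
      lemma₂ : ∀ b l → b * (+ 8 * l) * (b * (+ 8 * l)) - + 0 ≡ + 2 * b * (b * (+ 32 * l * l))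
      lemma₂ = solve-∀
      newton : e₁ h * e₁ h - + 2 * (b₀ * e₂ h) ≈ + 0 [ P ]
      newton = ≈-trans (≡⇒≈ (cong (λ e → e₁ h * e₁ h - + 2 * (e * e₂ h)) (sym (!-as-∏ h)))) (≈-trans (newton-identity h h<p)
        (≈-trans (*-≈ˡ (∏ h (λ i → + suc i) * ∏ h (λ i → + suc i)) ∑-inverse-squares) (≡⇒≈ (ℤₚ.*-zeroʳ (∏ h (λ i → + suc i) * ∏ h (λ i → + suc i))))))

    -- The hypotheses have precisions P² and P because e₁ enters multiplied by P and e₂ multiplied
    -- by P².
    quadratic : ∀ u c k {β₁ β₂} → e₁ k ≈ + (k !) * β₁ [ P² ] → e₂ k ≈ + (k !) * β₂ [ P ] →
      u * u * ∏ k (λ i → u * + suc i + P * c) ≈ u ^ k * (+ (k !) * (u * u + u * (P * c) * β₁ + P * c * (P * c) * β₂)) [ P³ ]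
    quadratic u c k {β₁} {β₂} h₁ h₂ = begin
      u * u * ∏ k (λ i → u * + suc i + P * c)
        ≈⟨ rising-expansion u cube k ⟩
      u ^ k * (u * u * ∏ k (λ i → + suc i) + u * (P * c) * e₁ k + P * c * (P * c) * e₂ k)
        ≡⟨ cong (u ^ k *_) (trans (cong (λ e → u * u * e + u * (P * c) * e₁ k + P * c * (P * c) * e₂ k) (!-as-∏ k)) (lemma₁ u P c (+ (k !)) (e₁ k) (e₂ k))) ⟩
      u ^ k * (u * u * + (k !) + u * c * (P * e₁ k) + c * c * (P * (P * e₂ k)))
        ≈⟨ *-≈ˡ (u ^ k) (+-≈ (+-≈ (≈-refl {a = u * u * + (k !)}) (*-≈ˡ (u * c) (P*-≈ h₁))) (*-≈ˡ (c * c) (P*-≈ (P*-≈ h₂)))) ⟩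
      u ^ k * (u * u * + (k !) + u * c * (P * (+ (k !) * β₁)) + c * c * (P * (P * (+ (k !) * β₂))))
        ≡⟨ lemma₂ (u ^ k) u P c (+ (k !)) β₁ β₂ ⟩
      u ^ k * (+ (k !) * (u * u + u * (P * c) * β₁ + P * c * (P * c) * β₂)) ∎
      where
      open ≈-Reasoning P³
      cube : P * c * (P * c) * (P * c) ≈ + 0 [ P³ ]
      cube = mod-by (c * c * c) (lemma P c)
        where
        lemma : ∀ p c → p * c * (p * c) * (p * c) ≡ + 0 + p * p * p * (c * c * c)
        lemma = solve-∀
      lemma₁ : ∀ u p c e a b → u * u * e + u * (p * c) * a + p * c * (p * c) * b ≡ u * u * e + u * c * (p * a) + c * c * (p * (p * b))
      lemma₁ = solve-∀
      lemma₂ : ∀ v u p c e a b → v * (u * u * e + u * c * (p * (e * a)) + c * c * (p * (p * (e * b)))) ≡ v * (e * (u * u + u * (p * c) * a + p * c * (p * c) * b))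
      lemma₂ = solve-∀

    quadratic-b : ∀ u c → u * u * ∏ h (λ i → u * + suc i + P * c) ≈ u ^ h * (b₀ * (u * u + u * (P * c) * (+ 8 * λ′) + P * c * (P * c) * (+ 32 * λ′ * λ′))) [ P³ ]
    quadratic-b u c = quadratic u c h (≈-lower b₁≈) b₂≈

    α₁ : ℤ
    α₁ = quotient nz-a₀ (e₁ n)

    quadratic-a′ : ∀ u c → u * u * ∏ n (λ i → u * + suc i + P * c) ≈ u ^ n * (a₀ * (u * u + u * (P * c) * α₁ + P * c * (P * c) * α₂)) [ P³ ]
    quadratic-a′ u c = quadratic u c n (≈-lower (≈-sym (quotient-* nz-a₀ (e₁ n)))) (≈-lower (≈-lower (≈-sym (quotient-* nz-a₀ (e₂ n)))))

    half : ∀ k → half-shifted P k ≡ ∏ k (λ i → + 2 * + suc i + P * (- + 1))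
    half k = ∏-cong k (λ i _ → lemma (+ 2 * + suc i) P)
      where
      lemma : ∀ x p → x - p ≡ x + p * (- + 1)
      lemma = solve-∀

    -- q is (-1)ⁿ 2^((p-1)/2), and G is exp(-2P`λ′`) cut off after the second order.
    s q G : ℤ
    s = (- + 1) ^ n
    q = s * (+ 4) ^ n
    G = + 1 - + 2 * P * λ′ + + 2 * P * P * λ′ * λ′

    4^n : (+ 4) ^ n ≡ (+ 2) ^ h
    4^n = trans (^-distrib-* (+ 2) (+ 2) n) (sym (ℤₚ.^-distribˡ-+-* (+ 2) n n))

    4half : + 4 * half-shifted P h ≈ (+ 2) ^ h * (b₀ * (+ 4 - + 16 * P * λ′ + + 32 * P * P * λ′ * λ′)) [ P³ ]
    4half = ≈-trans (≡⇒≈ (cong (+ 4 *_) (half h))) (≈-trans (quadratic-b (+ 2) (- + 1)) (≡⇒≈ (cong (λ x → (+ 2) ^ h * (b₀ * x)) (lemma P λ′))))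
      where
      lemma : ∀ p l → + 2 * + 2 + + 2 * (p * (- + 1)) * (+ 8 * l) + p * (- + 1) * (p * (- + 1)) * (+ 32 * l * l) ≡ + 4 - + 16 * p * l + + 32 * p * p * l * l
      lemma = solve-∀

    -- `half-shifted≡shifted` with both products expanded: q² exp(-4P`λ′`) ≈ exp(-8P`λ′`) in
    -- truncated form.
    first-relation : q * q * (+ 1 - + 4 * P * λ′ + + 8 * P * P * λ′ * λ′) ≈ + 1 - + 8 * P * λ′ + + 32 * P * P * λ′ * λ′ [ P³ ]
    first-relation = ≈-cancel₃ {+ 4 * b₀} (nz-* (nz-* nz-2 nz-2) nz-b₀) (begin
      + 4 * b₀ * (q * q * (+ 1 - + 4 * P * λ′ + + 8 * P * P * λ′ * λ′))
        ≡⟨ lemma₁ b₀ s ((+ 4) ^ n) P λ′ ⟩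
      s * s * ((+ 4) ^ n * ((+ 4) ^ n * (b₀ * (+ 4 - + 16 * P * λ′ + + 32 * P * P * λ′ * λ′))))
        ≡⟨ cong₂ (λ x y → x * (y * (y * (b₀ * (+ 4 - + 16 * P * λ′ + + 32 * P * P * λ′ * λ′))))) (sign-square n) 4^n ⟩
      + 1 * ((+ 2) ^ h * ((+ 2) ^ h * (b₀ * (+ 4 - + 16 * P * λ′ + + 32 * P * P * λ′ * λ′))))
        ≈⟨ *-≈ˡ (+ 1) (*-≈ˡ ((+ 2) ^ h) 4half) ⟨
      + 1 * ((+ 2) ^ h * (+ 4 * half-shifted P h))
        ≡⟨ lemma₂ ((+ 2) ^ h) (half-shifted P h) ⟩
      + 4 * ((+ 2) ^ h * half-shifted P h)
        ≡⟨ cong (+ 4 *_) (half-shifted≡shifted h P≡h) ⟩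
      + 4 * shifted (- P) h
        ≡⟨ cong (+ 4 *_) (trans (∏-cong h (λ i _ → lemma₃ (+ suc i) P)) (sym (ℤₚ.*-identityˡ _))) ⟩
      + 4 * (+ 1 * + 1 * ∏ h (λ i → + 1 * + suc i + P * (- + 1)))
        ≈⟨ *-≈ˡ (+ 4) (quadratic-b (+ 1) (- + 1)) ⟩
      + 4 * ((+ 1) ^ h * (b₀ * (+ 1 * + 1 + + 1 * (P * (- + 1)) * (+ 8 * λ′) + P * (- + 1) * (P * (- + 1)) * (+ 32 * λ′ * λ′))))
        ≡⟨ trans (cong (λ x → + 4 * (x * (b₀ * (+ 1 * + 1 + + 1 * (P * (- + 1)) * (+ 8 * λ′) + P * (- + 1) * (P * (- + 1)) * (+ 32 * λ′ * λ′))))) (ℤₚ.^-zeroˡ h)) (lemma₄ b₀ P λ′) ⟩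
      + 4 * b₀ * (+ 1 - + 8 * P * λ′ + + 32 * P * P * λ′ * λ′) ∎)
      where
      open ≈-Reasoning P³
      P≡h : P ≡ + 2 * + h + + 1
      P≡h = trans P≡ (lemma (+ n))
        where
        lemma : ∀ n → + 4 * n + + 1 ≡ + 2 * (n + n) + + 1
        lemma = solve-∀
      lemma₁ : ∀ b s v p l → + 4 * b * (s * v * (s * v) * (+ 1 - + 4 * p * l + + 8 * p * p * l * l)) ≡ s * s * (v * (v * (b * (+ 4 - + 16 * p * l + + 32 * p * p * l * l))))
      lemma₁ = solve-∀
      lemma₂ : ∀ v x → + 1 * (v * (+ 4 * x)) ≡ + 4 * (v * x)
      lemma₂ = solve-∀
      lemma₃ : ∀ x p → x + - p ≡ + 1 * x + p * (- + 1)
      lemma₃ = solve-∀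
      lemma₄ : ∀ b p l → + 4 * (+ 1 * (b * (+ 1 * + 1 + + 1 * (p * (- + 1)) * (+ 8 * l) + p * (- + 1) * (p * (- + 1)) * (+ 32 * l * l)))) ≡ + 4 * b * (+ 1 - + 8 * p * l + + 32 * p * p * l * l)
      lemma₄ = solve-∀

    -- `half-shifted-split` at the midpoint n, expanded on the half range on the left and on the
    -- quarter range on the right; (2n - 1)!! combines with 2ⁿ n! to (2n)!.
    second-relation : q * (+ 4 - + 16 * P * λ′ + + 32 * P * P * λ′ * λ′) ≈ + 4 - + 2 * P * α₁ + P * P * α₂ [ P³ ]
    second-relation = ≈-cancel₃ {(+ 2) ^ n * a₀ * b₀} (nz-* (nz-* (nz-^ n nz-2) nz-a₀) nz-b₀) (begin
      v * a₀ * b₀ * (q * (+ 4 - + 16 * P * λ′ + + 32 * P * P * λ′ * λ′))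
        ≡⟨ lemma₁ v a₀ b₀ s ((+ 4) ^ n) (+ 4 - + 16 * P * λ′ + + 32 * P * P * λ′ * λ′) ⟩
      s * (v * a₀) * ((+ 4) ^ n * (b₀ * (+ 4 - + 16 * P * λ′ + + 32 * P * P * λ′ * λ′)))
        ≡⟨ cong (λ y → s * (v * a₀) * (y * (b₀ * (+ 4 - + 16 * P * λ′ + + 32 * P * P * λ′ * λ′)))) 4^n ⟩
      s * (v * a₀) * ((+ 2) ^ h * (b₀ * (+ 4 - + 16 * P * λ′ + + 32 * P * P * λ′ * λ′)))
        ≈⟨ *-≈ˡ (s * (v * a₀)) 4half ⟨
      s * (v * a₀) * (+ 4 * half-shifted P h)
        ≡⟨ cong (λ x → s * (v * a₀) * (+ 4 * x)) (half-shifted-split n n P≡n) ⟩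
      s * (v * a₀) * (+ 4 * (half-shifted P n * (s * O n)))
        ≡⟨ lemma₂ s v a₀ (half-shifted P n) (O n) ⟩
      s * s * (v * a₀ * O n) * (+ 4 * half-shifted P n)
        ≡⟨ cong₂ (λ x y → x * y * (+ 4 * half-shifted P n)) (sign-square n) (trans (sym (double-factorial n)) (cong (λ k → + ((n ℕ.+ k) !)) (ℕₚ.+-identityʳ n))) ⟩
      + 1 * b₀ * (+ 4 * half-shifted P n)
        ≈⟨ *-≈ˡ (+ 1 * b₀) (≈-trans (≡⇒≈ (cong (+ 4 *_) (half n))) (quadratic-a′ (+ 2) (- + 1))) ⟩
      + 1 * b₀ * (v * (a₀ * (+ 2 * + 2 + + 2 * (P * (- + 1)) * α₁ + P * (- + 1) * (P * (- + 1)) * α₂)))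
        ≡⟨ lemma₃ b₀ v a₀ P α₁ α₂ ⟩
      v * a₀ * b₀ * (+ 4 - + 2 * P * α₁ + P * P * α₂) ∎)
      where
      open ≈-Reasoning P³
      v : ℤ
      v = (+ 2) ^ n
      P≡n : P ≡ + 2 * (+ n + + n) + + 1
      P≡n = trans P≡ (lemma (+ n))
        where
        lemma : ∀ n → + 4 * n + + 1 ≡ + 2 * (n + n) + + 1
        lemma = solve-∀
      lemma₁ : ∀ v a b s w x → v * a * b * (s * w * x) ≡ s * (v * a) * (w * (b * x))
      lemma₁ = solve-∀
      lemma₂ : ∀ s v a x o → s * (v * a) * (+ 4 * (x * (s * o))) ≡ s * s * (v * a * o) * (+ 4 * x)
      lemma₂ = solve-∀
      lemma₃ : ∀ b v a p x y → + 1 * b * (v * (a * (+ 2 * + 2 + + 2 * (p * (- + 1)) * x + p * (- + 1) * (p * (- + 1)) * y))) ≡ v * a * b * (+ 4 - + 2 * p * x + p * p * y)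
      lemma₃ = solve-∀

    q≈1 : q ≈ + 1 [ P ]
    q≈1 = ≈-cancel₁ {+ 4} (nz-* nz-2 nz-2) (begin
      + 4 * q
        ≡⟨ lemma₁ q P λ′ ⟩
      q * (+ 4 - + 16 * P * λ′ + + 32 * P * P * λ′ * λ′) + P * (q * (+ 16 * λ′ - + 32 * P * λ′ * λ′))
        ≈⟨ +-≈ (≈-lower (≈-lower second-relation)) (multiple-≈0 (q * (+ 16 * λ′ - + 32 * P * λ′ * λ′))) ⟩
      + 4 - + 2 * P * α₁ + P * P * α₂ + + 0
        ≡⟨ lemma₂ P α₁ α₂ ⟩
      + 4 * + 1 + P * (P * α₂ - + 2 * α₁)
        ≈⟨ +-≈ (≈-refl {a = + 4 * + 1}) (multiple-≈0 (P * α₂ - + 2 * α₁)) ⟩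
      + 4 * + 1 + + 0
        ≡⟨ refl ⟩
      + 4 * + 1 ∎)
      where
      open ≈-Reasoning P
      lemma₁ : ∀ q p l → + 4 * q ≡ q * (+ 4 - + 16 * p * l + + 32 * p * p * l * l) + p * (q * (+ 16 * l - + 32 * p * l * l))
      lemma₁ = solve-∀
      lemma₂ : ∀ p a b → + 4 - + 2 * p * a + p * p * b + + 0 ≡ + 4 * + 1 + p * (p * b - + 2 * a)
      lemma₂ = solve-∀

    1+P≈1 : ∀ c → + 1 + P * c ≈ + 1 [ P ]
    1+P≈1 c = mod-by c refl

    nz-1+P : ∀ c → Nz (+ 1 + P * c)
    nz-1+P c = nz-≈ (≈-sym (1+P≈1 c)) nz-1

    -- `first-relation` gives only q² ≈ G². As q and G are both 1 modulo P, q + G is a unit and the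
    -- sign is settled.
    q≈G : q ≈ G [ P³ ]
    q≈G = ≈-from-difference (≈-cancel₃ {q + G} nz-q+G (begin
      (q + G) * (q - G)
        ≡⟨ lemma₁ q G ⟩
      q * q - G * G
        ≈⟨ difference-≈0 q² ⟩
      + 0
        ≡⟨ sym (ℤₚ.*-zeroʳ (q + G)) ⟩
      (q + G) * + 0 ∎))
      where
      open ≈-Reasoning P³
      lemma₁ : ∀ q g → (q + g) * (q - g) ≡ q * q - g * g
      lemma₁ = solve-∀
      G≡ : G ≡ + 1 + P * (- + 2 * λ′ + + 2 * P * λ′ * λ′)
      G≡ = lemma P λ′
        where
        lemma : ∀ p l → + 1 - + 2 * p * l + + 2 * p * p * l * l ≡ + 1 + p * (- + 2 * l + + 2 * p * l * l)
        lemma = solve-∀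
      nz-q+G : Nz (q + G)
      nz-q+G = nz-≈ (≈-sym (+-≈ q≈1 (≈-trans (≡⇒≈ G≡) (1+P≈1 _)))) nz-2
      g₂ : ℤ
      g₂ = + 1 - + 4 * P * λ′ + + 8 * P * P * λ′ * λ′
      nz-g₂ : Nz g₂
      nz-g₂ = subst Nz (lemma P λ′) (nz-1+P (- + 4 * λ′ + + 8 * P * λ′ * λ′))
        where
        lemma : ∀ p l → + 1 + p * (- + 4 * l + + 8 * p * l * l) ≡ + 1 - + 4 * p * l + + 8 * p * p * l * l
        lemma = solve-∀
      q² : q * q ≈ G * G [ P³ ]
      q² = ≈-cancel₃ {g₂} nz-g₂ (≈-trans (≡⇒≈ (ℤₚ.*-comm g₂ (q * q))) (≈-trans first-relation (mod-by (+ 72 * λ′ * λ′ * λ′ + - + 100 * P * λ′ * λ′ * λ′ * λ′ + + 80 * P * P * λ′ * λ′ * λ′ * λ′ * λ′ + - + 32 * P * P * P * λ′ * λ′ * λ′ * λ′ * λ′ * λ′) (lemma P λ′))))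
        where
        lemma : ∀ P λ′ → + 1 - + 8 * P * λ′ + + 32 * P * P * λ′ * λ′
          ≡ (+ 1 - + 4 * P * λ′ + + 8 * P * P * λ′ * λ′) * ((+ 1 - + 2 * P * λ′ + + 2 * P * P * λ′ * λ′) * (+ 1 - + 2 * P * λ′ + + 2 * P * P * λ′ * λ′)) + P * P * P * ((+ 72 * λ′ * λ′ * λ′ + - + 100 * P * λ′ * λ′ * λ′ * λ′ + + 80 * P * P * λ′ * λ′ * λ′ * λ′ * λ′ + - + 32 * P * P * P * λ′ * λ′ * λ′ * λ′ * λ′ * λ′))
        lemma = solve-∀

    8ω≈ : + 8 * ω ≈ α₂ - + 72 * λ′ * λ′ [ P³ ]
    8ω≈ = quotient-* (nz-* nz-2 (nz-* nz-2 nz-2)) (α₂ - + 72 * λ′ * λ′)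

    α₂≈ : α₂ ≈ + 72 * λ′ * λ′ + + 8 * ω [ P³ ]
    α₂≈ = ≈-trans (≡⇒≈ (lemma α₂ (+ 72 * λ′ * λ′))) (+-≈ (≈-refl {a = + 72 * λ′ * λ′}) (≈-sym 8ω≈))
      where
      lemma : ∀ a b → a ≡ b + (a - b)
      lemma = solve-∀

    -- `second-relation` solved for α₁, which occurs there with a factor P; dividing by it lowers
    -- the precision to P².
    α₁≈ : α₁ ≈ + 12 * λ′ + + 4 * P * ω [ P² ]
    α₁≈ = ≈-cancel₂ {+ 2} nz-2 (≈-unraise (begin
      + 2 * α₁ * P
        ≡⟨ lemma₁ P α₁ α₂ ⟩
      + 4 + P * P * α₂ - (+ 4 - + 2 * P * α₁ + P * P * α₂)
        ≈⟨ -‿≈ (+-≈ (≈-refl {a = + 4}) (*-≈ˡ (P * P) α₂≈)) (≈-trans (≈-sym second-relation) (*-≈ʳ (+ 4 - + 16 * P * λ′ + + 32 * P * P * λ′ * λ′) q≈G)) ⟩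
      + 4 + P * P * (+ 72 * λ′ * λ′ + + 8 * ω) - G * (+ 4 - + 16 * P * λ′ + + 32 * P * P * λ′ * λ′)
        ≈⟨ mod-by (+ 96 * λ′ * λ′ * λ′ + - + 64 * P * λ′ * λ′ * λ′ * λ′) (lemma₂ P λ′ ω) ⟩
      + 2 * (+ 12 * λ′ + + 4 * P * ω) * P ∎))
      where
      open ≈-Reasoning P³
      lemma₁ : ∀ p a b → + 2 * a * p ≡ + 4 + p * p * b - (+ 4 - + 2 * p * a + p * p * b)
      lemma₁ = solve-∀
      lemma₂ : ∀ P λ′ ω → + 4 + P * P * (+ 72 * λ′ * λ′ + + 8 * ω) - (+ 1 - + 2 * P * λ′ + + 2 * P * P * λ′ * λ′) * (+ 4 - + 16 * P * λ′ + + 32 * P * P * λ′ * λ′)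
        ≡ + 2 * (+ 12 * λ′ + + 4 * P * ω) * P + P * P * P * ((+ 96 * λ′ * λ′ * λ′ + - + 64 * P * λ′ * λ′ * λ′ * λ′))
      lemma₂ = solve-∀

    quadratic-a : ∀ u c → u * u * ∏ n (λ i → u * + suc i + P * c) ≈ u ^ n * (a₀ * (u * u + u * (P * c) * (+ 12 * λ′ + + 4 * P * ω) + P * c * (P * c) * (+ 72 * λ′ * λ′ + + 8 * ω))) [ P³ ]
    quadratic-a u c = quadratic u c n
      (≈-trans (≈-lower (≈-sym (quotient-* nz-a₀ (e₁ n)))) (*-≈ˡ a₀ α₁≈))
      (≈-trans (≈-lower (≈-lower (≈-sym (quotient-* nz-a₀ (e₂ n))))) (*-≈ˡ a₀ (≈-lower (≈-lower α₂≈))))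

-- The four binomial coefficients modulo p³

module QuarterBinomialCoefficients where

  open IntegerCongruences
  open ShiftedProducts
  open JacobiSums
  open QuarterFactorialExpansions
  open import Data.Integer using (_+_; _*_; _-_; -_; _^_)

  C-product : ∀ {N} k l → N ≡ k ℕ.+ l → + (N C k) * (+ (k !) * + (l !)) ≡ + (N !)
  C-product k l refl = trans (cong (+ ((k ℕ.+ l) C k) *_) (sym (ℤₚ.pos-* (k !) (l !)))) (trans (sym (ℤₚ.pos-* ((k ℕ.+ l) C k) _))
    (cong +_ (trans (cong (λ m → ((k ℕ.+ l) C k) ℕ.* (k ! ℕ.* m !)) (sym (ℕₚ.m+n∸m≡n k l))) (C-factorial (ℕₚ.m≤m+n k l)))))

  module QuarterBinomials {p : ℕ} (pr : Prime p) (3<p : 3 ℕ.< p) (n : ℕ) (p≡ : p ≡ suc ((n ℕ.+ n) ℕ.+ (n ℕ.+ n))) where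
    open ModPrime pr
    open QuarterFactorials pr 3<p n p≡

    -- The ratios of ∏ (i + kP) to n! and to h!, expanded to second order in P.
    Â B̂ : ℤ → ℤ
    Â k = + 1 + P * k * (+ 12 * λ′ + + 4 * P * ω) + P * k * (P * k) * (+ 72 * λ′ * λ′ + + 8 * ω)
    B̂ k = + 1 + P * k * (+ 8 * λ′) + P * k * (P * k) * (+ 32 * λ′ * λ′)

    normalise : ∀ k c → + 1 * + 1 * ∏ k (λ i → + 1 * + suc i + P * c) ≡ shifted (P * c) k
    normalise k c = trans (ℤₚ.*-identityˡ _) (∏-cong k (λ i _ → cong (_+ P * c) (ℤₚ.*-identityˡ (+ suc i))))

    shifted-a : ∀ c → shifted (P * c) n ≈ a₀ * Â c [ P³ ]
    shifted-a c = ≈-trans (≡⇒≈ (sym (normalise n c))) (≈-trans (quadratic-a (+ 1) c) (≡⇒≈ (trans (cong (λ x → x * (a₀ * (+ 1 * + 1 + + 1 * (P * c) * x₁ + P * c * (P * c) * x₂))) (ℤₚ.^-zeroˡ n)) (lemma a₀ (P * c) x₁ x₂))))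
      where
      x₁ x₂ : ℤ
      x₁ = + 12 * λ′ + + 4 * P * ω
      x₂ = + 72 * λ′ * λ′ + + 8 * ω
      lemma : ∀ a w x y → + 1 * (a * (+ 1 * + 1 + + 1 * w * x + w * w * y)) ≡ a * (+ 1 + w * x + w * w * y)
      lemma = solve-∀

    shifted-b : ∀ c → shifted (P * c) h ≈ b₀ * B̂ c [ P³ ]
    shifted-b c = ≈-trans (≡⇒≈ (sym (normalise h c))) (≈-trans (quadratic-b (+ 1) c) (≡⇒≈ (trans (cong (λ x → x * (b₀ * (+ 1 * + 1 + + 1 * (P * c) * x₁ + P * c * (P * c) * x₂))) (ℤₚ.^-zeroˡ h)) (lemma b₀ (P * c) x₁ x₂))))
      where
      x₁ x₂ : ℤ
      x₁ = + 8 * λ′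
      x₂ = + 32 * λ′ * λ′
      lemma : ∀ a w x y → + 1 * (a * (+ 1 * + 1 + + 1 * w * x + w * w * y)) ≡ a * (+ 1 + w * x + w * w * y)
      lemma = solve-∀

    nz-Â : ∀ k → Nz (Â k)
    nz-Â k = subst Nz (lemma P k (+ 12 * λ′ + + 4 * P * ω) (+ 72 * λ′ * λ′ + + 8 * ω)) (nz-1+P (k * (+ 12 * λ′ + + 4 * P * ω) + k * (P * k) * (+ 72 * λ′ * λ′ + + 8 * ω)))
      where
      lemma : ∀ p k x y → + 1 + p * (k * x + k * (p * k) * y) ≡ + 1 + p * k * x + p * k * (p * k) * y
      lemma = solve-∀

    nz-B̂ : ∀ k → Nz (B̂ k)
    nz-B̂ k = subst Nz (lemma P k (+ 8 * λ′) (+ 32 * λ′ * λ′)) (nz-1+P (k * (+ 8 * λ′) + k * (P * k) * (+ 32 * λ′ * λ′)))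
      where
      lemma : ∀ p k x y → + 1 + p * (k * x + k * (p * k) * y) ≡ + 1 + p * k * x + p * k * (p * k) * y
      lemma = solve-∀

    c C₃ C₅ C₅′ : ℤ
    c   = + (h C n)
    C₃  = + ((3 ℕ.* h) C n)
    C₅  = + ((5 ℕ.* h) C n)
    C₅′ = + ((5 ℕ.* h) C (2 ℕ.* h ℕ.+ n))

    -- X₃, X₅ and X₅′ expand B̂ 1 / Â 1, B̂ 2 / Â 2 and B̂ 2 / (Â 1)² to third order in P, and Z₃, U, V do the
    -- same for the rational functions of P that come with them.
    X₃ X₅ X₅′ Z₃ U V D₂ : ℤ
    X₃  = + 1 - + 4 * P * λ′ + P * P * (+ 8 * λ′ * λ′ - + 12 * ω)
    X₅  = + 1 - + 8 * P * λ′ + P * P * (+ 32 * λ′ * λ′ - + 40 * ω)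
    X₅′ = + 1 - + 8 * P * λ′ + P * P * (+ 32 * λ′ * λ′ - + 24 * ω)
    Z₃  = + 1 + P * (- + 2 - + 4 * λ′) + P * P * (- + 6 + + 8 * λ′ + + 8 * λ′ * λ′ - + 12 * ω)
    U   = + 45 - + 186 * P - + 886 * P * P
    V   = + 9 - + 30 * P - + 50 * P * P
    D₂  = (+ 10 * P - + 6) * (+ 10 * P - + 2)

    I1 : B̂ (+ 1) ≈ Â (+ 1) * X₃ [ P³ ]
    -- The witness, here and in the identities below, collects what the polynomial expansion leaves
    -- beyond P².
    I1 = mod-by (+ 192 * λ′ * ω + + 192 * λ′ * λ′ * λ′ + + 144 * P * ω * ω + + 768 * P * λ′ * λ′ * ω + - + 576 * P * λ′ * λ′ * λ′ * λ′) (lemma P λ′ ω)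
      where
      lemma : ∀ P λ′ ω → (+ 1 + P * (+ 1) * (+ 8 * λ′) + P * (+ 1) * (P * (+ 1)) * (+ 32 * λ′ * λ′)) ≡ (+ 1 + P * (+ 1) * (+ 12 * λ′ + + 4 * P * ω) + P * (+ 1) * (P * (+ 1)) * (+ 72 * λ′ * λ′ + + 8 * ω)) * (+ 1 - + 4 * P * λ′ + P * P * (+ 8 * λ′ * λ′ - + 12 * ω)) + P * P * P * (+ 192 * λ′ * ω + + 192 * λ′ * λ′ * λ′ + + 144 * P * ω * ω + + 768 * P * λ′ * λ′ * ω + - + 576 * P * λ′ * λ′ * λ′ * λ′)
      lemma = solve-∀

    I2 : B̂ (+ 2) ≈ Â (+ 2) * X₅ [ P³ ]
    I2 = mod-by (+ 1280 * λ′ * ω + + 1536 * λ′ * λ′ * λ′ + + 1600 * P * ω * ω + + 10240 * P * λ′ * λ′ * ω + - + 9216 * P * λ′ * λ′ * λ′ * λ′) (lemma P λ′ ω)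
      where
      lemma : ∀ P λ′ ω → (+ 1 + P * (+ 2) * (+ 8 * λ′) + P * (+ 2) * (P * (+ 2)) * (+ 32 * λ′ * λ′)) ≡ (+ 1 + P * (+ 2) * (+ 12 * λ′ + + 4 * P * ω) + P * (+ 2) * (P * (+ 2)) * (+ 72 * λ′ * λ′ + + 8 * ω)) * (+ 1 - + 8 * P * λ′ + P * P * (+ 32 * λ′ * λ′ - + 40 * ω)) + P * P * P * (+ 1280 * λ′ * ω + + 1536 * λ′ * λ′ * λ′ + + 1600 * P * ω * ω + + 10240 * P * λ′ * λ′ * ω + - + 9216 * P * λ′ * λ′ * λ′ * λ′)
      lemma = solve-∀

    I3 : B̂ (+ 2) ≈ Â (+ 1) * Â (+ 1) * X₅′ [ P³ ]
    I3 = mod-by (+ 480 * λ′ * ω + - + 192 * λ′ * λ′ * λ′ + + 432 * P * ω * ω + + 6720 * P * λ′ * λ′ * ω + - + 576 * P * λ′ * λ′ * λ′ * λ′ + + 8064 * P * P * λ′ * ω * ω + + 46080 * P * P * λ′ * λ′ * λ′ * ω + - + 13824 * P * P * λ′ * λ′ * λ′ * λ′ * λ′ + + 3456 * P * P * P * ω * ω * ω + + 36864 * P * P * P * λ′ * λ′ * ω * ω + + 69120 * P * P * P * λ′ * λ′ * λ′ * λ′ * ω + - + 165888 * P * P * P * λ′ * λ′ * λ′ * λ′ * λ′ * λ′) (lemma P λ′ ω)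
      where
      lemma : ∀ P λ′ ω → (+ 1 + P * (+ 2) * (+ 8 * λ′) + P * (+ 2) * (P * (+ 2)) * (+ 32 * λ′ * λ′)) ≡ (+ 1 + P * (+ 1) * (+ 12 * λ′ + + 4 * P * ω) + P * (+ 1) * (P * (+ 1)) * (+ 72 * λ′ * λ′ + + 8 * ω)) * (+ 1 + P * (+ 1) * (+ 12 * λ′ + + 4 * P * ω) + P * (+ 1) * (P * (+ 1)) * (+ 72 * λ′ * λ′ + + 8 * ω)) * (+ 1 - + 8 * P * λ′ + P * P * (+ 32 * λ′ * λ′ - + 24 * ω)) + P * P * P * (+ 480 * λ′ * ω + - + 192 * λ′ * λ′ * λ′ + + 432 * P * ω * ω + + 6720 * P * λ′ * λ′ * ω + - + 576 * P * λ′ * λ′ * λ′ * λ′ + + 8064 * P * P * λ′ * ω * ω + + 46080 * P * P * λ′ * λ′ * λ′ * ω + - + 13824 * P * P * λ′ * λ′ * λ′ * λ′ * λ′ + + 3456 * P * P * P * ω * ω * ω + + 36864 * P * P * P * λ′ * λ′ * ω * ω + + 69120 * P * P * P * λ′ * λ′ * λ′ * λ′ * ω + - + 165888 * P * P * P * λ′ * λ′ * λ′ * λ′ * λ′ * λ′)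
      lemma = solve-∀

    I4 : B̂ (+ 1) ≈ B̂ (- + 1) * B̂ (+ 2) [ P³ ]
    I4 = mod-by (+ 512 * λ′ * λ′ * λ′ + - + 4096 * P * λ′ * λ′ * λ′ * λ′) (lemma P λ′)
      where
      lemma : ∀ P λ′ → (+ 1 + P * (+ 1) * (+ 8 * λ′) + P * (+ 1) * (P * (+ 1)) * (+ 32 * λ′ * λ′)) ≡ (+ 1 + P * (- + 1) * (+ 8 * λ′) + P * (- + 1) * (P * (- + 1)) * (+ 32 * λ′ * λ′)) * (+ 1 + P * (+ 2) * (+ 8 * λ′) + P * (+ 2) * (P * (+ 2)) * (+ 32 * λ′ * λ′)) + P * P * P * (+ 512 * λ′ * λ′ * λ′ + - + 4096 * P * λ′ * λ′ * λ′ * λ′)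
      lemma = solve-∀

    I5 : B̂ (+ 2) * B̂ (- + 2) ≈ + 1 [ P³ ]
    I5 = mod-by (+ 16384 * P * λ′ * λ′ * λ′ * λ′) (lemma P λ′)
      where
      lemma : ∀ P λ′ → (+ 1 + P * (+ 2) * (+ 8 * λ′) + P * (+ 2) * (P * (+ 2)) * (+ 32 * λ′ * λ′)) * (+ 1 + P * (- + 2) * (+ 8 * λ′) + P * (- + 2) * (P * (- + 2)) * (+ 32 * λ′ * λ′)) ≡ + 1 + P * P * P * (+ 16384 * P * λ′ * λ′ * λ′ * λ′)
      lemma = solve-∀

    I6 : (+ 6 * P - + 2) * Z₃ ≈ + 2 * (+ 5 * P - + 1) * X₃ [ P³ ]
    I6 = mod-by (- + 36 + + 48 * ω + + 48 * λ′ + - + 32 * λ′ * λ′) (lemma P λ′ ω)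
      where
      lemma : ∀ P λ′ ω → (+ 6 * P - + 2) * (+ 1 + P * (- + 2 - + 4 * λ′) + P * P * (- + 6 + + 8 * λ′ + + 8 * λ′ * λ′ - + 12 * ω)) ≡ + 2 * (+ 5 * P - + 1) * (+ 1 - + 4 * P * λ′ + P * P * (+ 8 * λ′ * λ′ - + 12 * ω)) + P * P * P * (- + 36 + + 48 * ω + + 48 * λ′ + - + 32 * λ′ * λ′)
      lemma = solve-∀

    -- D₂ = 12 - 80P + 100P², and 1/D₂ has denominators dividing 108 up to second order; this
    -- explains the constant here and in `I8`.
    I7 : D₂ * U ≈ + 108 * ((+ 9 * P - + 5) * (+ 9 * P - + 1)) [ P³ ]
    I7 = mod-by (+ 52280 + - + 88600 * P) (lemma P)
      where
      lemma : ∀ P → ((+ 10 * P - + 6) * (+ 10 * P - + 2)) * (+ 45 - + 186 * P - + 886 * P * P) ≡ + 108 * ((+ 9 * P - + 5) * (+ 9 * P - + 1)) + P * P * P * (+ 52280 + - + 88600 * P)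
      lemma = solve-∀

    I8 : D₂ * V ≈ + 108 * ((+ 5 * P - + 1) * (+ 5 * P - + 1)) [ P³ ]
    I8 = mod-by (+ 1000 + - + 5000 * P) (lemma P)
      where
      lemma : ∀ P → ((+ 10 * P - + 6) * (+ 10 * P - + 2)) * (+ 9 - + 30 * P - + 50 * P * P) ≡ + 108 * ((+ 5 * P - + 1) * (+ 5 * P - + 1)) + P * P * P * (+ 1000 + - + 5000 * P)
      lemma = solve-∀

    -- The constant term is 270 - 180 + 45 + 9 = 144. To the order considered, the factors 1 - P and
    -- G absorb every other term in P and every `λ′`; only `ω` survives.
    I9 : (+ 1 - P) * (+ 270 - + 180 * Z₃ + U * X₅ + V * X₅′) * G ≈ + 144 * (+ 1 + P * P * ω) [ P³ ]
    I9 = mod-by (- + 144 + + 8016 * ω + + 7200 * λ′ + - + 288 * λ′ * ω + - + 7200 * λ′ * λ′ + + 28480 * P * ω + - + 7200 * P * λ′ + - + 16032 * P * λ′ * ω + - + 37440 * P * λ′ * λ′ + + 288 * P * λ′ * λ′ * ω + + 14400 * P * λ′ * λ′ * λ′ + + 576 * P * λ′ * λ′ * λ′ * λ′ + - + 36640 * P * P * ω + - + 56960 * P * P * λ′ * ω + + 44640 * P * P * λ′ * λ′ + + 16032 * P * P * λ′ * λ′ * ω + + 60480 * P * P * λ′ * λ′ * λ′ + - + 14400 * P * P * λ′ * λ′ * λ′ * λ′ + + 73280 * P * P * P * λ′ * ω + + 56960 * P * P * P * λ′ * λ′ * ω + - + 74880 * P * P * P * λ′ * λ′ * λ′ + - +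 46080 * P * P * P * λ′ * λ′ * λ′ * λ′ + - + 73280 * P * P * P * P * λ′ * λ′ * ω + + 59904 * P * P * P * P * λ′ * λ′ * λ′ * λ′) (lemma P λ′ ω)
      where
      lemma : ∀ P λ′ ω → (+ 1 - P) * (+ 270 - + 180 * (+ 1 + P * (- + 2 - + 4 * λ′) + P * P * (- + 6 + + 8 * λ′ + + 8 * λ′ * λ′ - + 12 * ω)) + (+ 45 - + 186 * P - + 886 * P * P) * (+ 1 - + 8 * P * λ′ + P * P * (+ 32 * λ′ * λ′ - + 40 * ω)) + (+ 9 - + 30 * P - + 50 * P * P) * (+ 1 - + 8 * P * λ′ + P * P * (+ 32 * λ′ * λ′ - + 24 * ω))) * (+ 1 - + 2 * P * λ′ + + 2 * P * P * λ′ * λ′) ≡ + 144 * (+ 1 + P * P * ω) + P * P * P * (- + 144 + + 8016 * ω + + 7200 * λ′ + - + 288 * λ′ * ω + - + 7200 * λ′ * λ′ + + 28480 * P * ω + - + 7200 * P * λ′ + - + 16032 * P * λ′ * ω + - + 37440 * P * λ′ * λ′ + + 288 * P * λ′ * λ′ * ω + + 14400 * P * λ′ * λ′ * λ′ + + 576 * P * λ′ * λ′ * λ′ * λ′ + - + 36640 * P * P * ω + - + 56960 * P * P * λ′ * ω + + 44640 * P * P * λ′ * λ′ + + 16032 * P * P * λ′ * λ′ * ω + + 60480 * P * P * λ′ * λ′ * λ′ + - + 14400 * P * P * λ′ * λ′ * λ′ * λ′ + + 73280 * P * P * P * λ′ * ω + + 56960 * P * P * P * λ′ * λ′ * ω +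 - + 74880 * P * P * P * λ′ * λ′ * λ′ + - + 46080 * P * P * P * λ′ * λ′ * λ′ * λ′ + - + 73280 * P * P * P * P * λ′ * λ′ * ω + + 59904 * P * P * P * P * λ′ * λ′ * λ′ * λ′)
      lemma = solve-∀

    c-relation : c * (a₀ * a₀) ≡ b₀
    c-relation = C-product n n refl

    p! : ℤ
    p! = + (p !)

    nonzero-p! : ℤ.NonZero p!
    nonzero-p! = factorial-nonzero p

    p!≡ : p! ≡ P * (b₀ * shifted (P * - + 1) h)
    p!≡ = begin
      + (p !)
        ≡⟨ cong (λ k → + (k !)) p≡ ⟩
      + (suc (h ℕ.+ h) !)
        ≡⟨ trans (ℤₚ.pos-* (suc (h ℕ.+ h)) _) (cong₂ _*_ (sym (cong +_ p≡)) (sym (!-reflect h h P≡h))) ⟩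
      P * (b₀ * ((- + 1) ^ h * shifted (- P) h))
        ≡⟨ cong₂ (λ x y → P * (b₀ * (x * shifted y h))) even (lemma P) ⟩
      P * (b₀ * (+ 1 * shifted (P * - + 1) h))
        ≡⟨ cong (λ x → P * (b₀ * x)) (ℤₚ.*-identityˡ _) ⟩
      P * (b₀ * shifted (P * - + 1) h) ∎
      where
      open ≡-Reasoning
      lemma : ∀ p → - p ≡ p * - + 1
      lemma = solve-∀
      even : (- + 1) ^ h ≡ + 1
      even = trans (even-power (+ 1) n) (ℤₚ.^-zeroˡ h)
      P≡h : P ≡ + h + + h + + 1
      P≡h = trans (cong +_ p≡) (ℤₚ.+-comm (+ 1) (+ h + + h))

    2p!≡ : + ((p ℕ.+ p) !) ≡ p! * (+ 2 * P * (shifted (P * + 1) h * shifted (P * - + 2) h))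
    2p!≡ = trans (shifted-! p p) (cong (p! *_) (begin
      shifted P p
        ≡⟨ cong (shifted P) p≡ ⟩
      shifted P (h ℕ.+ h) * (+ suc (h ℕ.+ h) + P)
        ≡⟨ cong₂ _*_ (trans (∏-split h h (λ i → + suc i + P)) (cong₂ _*_ (cong (λ x → shifted x h) (sym (ℤₚ.*-identityʳ P))) upper)) (trans (cong (λ x → + x + P) (sym p≡)) (double P)) ⟩
      shifted (P * + 1) h * shifted (P * - + 2) h * (+ 2 * P)
        ≡⟨ ℤₚ.*-comm _ (+ 2 * P) ⟩
      + 2 * P * (shifted (P * + 1) h * shifted (P * - + 2) h) ∎))
      where
      open ≡-Reasoning
      double : ∀ p → p + p ≡ + 2 * p
      double = solve-∀
      upper : ∏ h (λ i → + suc (h ℕ.+ i) + P) ≡ shifted (P * - + 2) h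
      upper = begin
        ∏ h (λ i → + suc (h ℕ.+ i) + P)
          ≡⟨ ∏-reverse h _ ⟩
        ∏ h (λ i → + suc (h ℕ.+ (h ℕ.∸ suc i)) + P)
          ≡⟨ ∏-cong h (λ i i<h → trans (cong (λ k → + 1 + (+ h + k) + P) (pos-∸ i<h)) (trans (lemma₁ (+ h) (+ i) P) (trans (cong (λ x → x - (+ 1 + + i) + P) (sym (cong +_ p≡))) (lemma₂ (+ i) P)))) ⟩
        ∏ h (λ i → - + 1 * (+ suc i + P * - + 2))
          ≡⟨ trans (∏-scale h (- + 1) _) (trans (cong (_* shifted (P * - + 2) h) (trans (even-power (+ 1) n) (ℤₚ.^-zeroˡ h))) (ℤₚ.*-identityˡ _)) ⟩
        shifted (P * - + 2) h ∎
        where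
        lemma₁ : ∀ h i p → + 1 + (h + (h - (+ 1 + i))) + p ≡ (+ 1 + (h + h)) - (+ 1 + i) + p
        lemma₁ = solve-∀
        lemma₂ : ∀ i p → p - (+ 1 + i) + p ≡ - + 1 * (+ 1 + i + p * - + 2)
        lemma₂ = solve-∀

    -- From 2h = p - 1 one has 2h + n = p + n - 1, 3h = p + h - 1, 4h + n = 2p + n - 2 and 5h = 2p +
    -- h - 2. These factorials thus lack one or two top factors of those that `shifted-!` describes.
    M₅ M₉ : ℕ
    M₅ = 2 ℕ.* h ℕ.+ n
    M₉ = 4 ℕ.* h ℕ.+ n

    f₅ f₆ f₉ f₁₀ A₁ B₁ A₂ B₂ : ℤ
    f₅  = + (M₅ !)
    f₆  = + ((3 ℕ.* h) !)
    f₉  = + (M₉ !)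
    f₁₀ = + ((5 ℕ.* h) !)
    A₁  = shifted (P * + 1) n
    B₁  = shifted (P * + 1) h
    A₂  = shifted (P * + 2) n
    B₂  = shifted (P * + 2) h

    4n : + 4 * + n ≡ P - + 1
    4n = trans (lemma (+ 4 * + n)) (cong (_- + 1) (sym P≡))
      where
      lemma : ∀ x → x ≡ x + + 1 - + 1
      lemma = solve-∀

    factorial₁ : ∀ k m → p ℕ.+ k ≡ suc m → (P + + k) * + (m !) ≡ p! * shifted (P * + 1) k
    factorial₁ k m e = begin
      (+ (p ℕ.+ k)) * + (m !)
        ≡⟨ cong (λ x → + x * + (m !)) e ⟩
      + suc m * + (m !)
        ≡⟨ sym (ℤₚ.pos-* (suc m) (m !)) ⟩
      + (suc m !)
        ≡⟨ cong (λ x → + (x !)) (sym e) ⟩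
      + ((p ℕ.+ k) !)
        ≡⟨ trans (shifted-! p k) (cong (λ x → p! * shifted x k) (sym (ℤₚ.*-identityʳ P))) ⟩
      p! * shifted (P * + 1) k ∎
      where open ≡-Reasoning

    factorial₂ : ∀ k m → p ℕ.+ p ℕ.+ k ≡ suc (suc m) → (+ 2 * P + + k) * (+ 2 * P + + k - + 1) * + (m !) ≡ + ((p ℕ.+ p) !) * shifted (P * + 2) k
    factorial₂ k m e = begin
      (+ 2 * P + + k) * (+ 2 * P + + k - + 1) * + (m !)
        ≡⟨ cong (λ x → x * (x - + 1) * + (m !)) (trans (lemma₁ P (+ k)) (cong +_ e)) ⟩
      + suc (suc m) * (+ suc (suc m) - + 1) * + (m !)
        ≡⟨ lemma₂ (+ m) (+ (m !)) ⟩
      + suc (suc m) * (+ suc m * + (m !))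
        ≡⟨ trans (cong (+ suc (suc m) *_) (sym (ℤₚ.pos-* (suc m) (m !)))) (sym (ℤₚ.pos-* (suc (suc m)) (suc m !))) ⟩
      + (suc (suc m) !)
        ≡⟨ cong (λ x → + (x !)) (sym e) ⟩
      + ((p ℕ.+ p ℕ.+ k) !)
        ≡⟨ trans (shifted-! (p ℕ.+ p) k) (cong (λ x → + ((p ℕ.+ p) !) * shifted x k) (lemma₃ P)) ⟩
      + ((p ℕ.+ p) !) * shifted (P * + 2) k ∎
      where
      open ≡-Reasoning
      lemma₁ : ∀ p k → + 2 * p + k ≡ p + p + k
      lemma₁ = solve-∀
      lemma₂ : ∀ m f → (+ 1 + (+ 1 + m)) * ((+ 1 + (+ 1 + m)) - + 1) * f ≡ (+ 1 + (+ 1 + m)) * ((+ 1 + m) * f)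
      lemma₂ = solve-∀
      lemma₃ : ∀ p → p + p ≡ p * + 2
      lemma₃ = solve-∀

    F₅ : (P + + n) * f₅ ≡ p! * A₁
    F₅ = factorial₁ n M₅ (trans (cong (ℕ._+ n) p≡) (ℤₚ.+-injective (lemma (+ n))))
      where
      lemma : ∀ n → + 1 + ((n + n) + (n + n)) + n ≡ + 1 + ((n + n) + ((n + n) + + 0) + n)
      lemma = solve-∀

    F₆ : (P + + h) * f₆ ≡ p! * B₁
    F₆ = factorial₁ h (3 ℕ.* h) (trans (cong (ℕ._+ h) p≡) (ℤₚ.+-injective (lemma (+ n))))
      where
      lemma : ∀ n → + 1 + ((n + n) + (n + n)) + (n + n) ≡ + 1 + ((n + n) + ((n + n) + ((n + n) + + 0)))
      lemma = solve-∀

    F₉ : (+ 2 * P + + n) * (+ 2 * P + + n - + 1) * f₉ ≡ + ((p ℕ.+ p) !) * A₂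
    F₉ = factorial₂ n M₉ (trans (cong (λ x → x ℕ.+ x ℕ.+ n) p≡) (ℤₚ.+-injective (lemma (+ n))))
      where
      lemma : ∀ n → (+ 1 + ((n + n) + (n + n))) + (+ 1 + ((n + n) + (n + n))) + n ≡ + 1 + (+ 1 + ((n + n) + ((n + n) + ((n + n) + ((n + n) + + 0))) + n))
      lemma = solve-∀

    F₁₀ : (+ 2 * P + + h) * (+ 2 * P + + h - + 1) * f₁₀ ≡ + ((p ℕ.+ p) !) * B₂
    F₁₀ = factorial₂ h (5 ℕ.* h) (trans (cong (λ x → x ℕ.+ x ℕ.+ h) p≡) (ℤₚ.+-injective (lemma (+ n))))
      where
      lemma : ∀ n → (+ 1 + ((n + n) + (n + n))) + (+ 1 + ((n + n) + (n + n))) + (n + n) ≡ + 1 + (+ 1 + ((n + n) + ((n + n) + ((n + n) + ((n + n) + ((n + n) + + 0))))))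
      lemma = solve-∀

    -- The linear factors are the missing top factors times 4: 4(P + h) = 6P - 2 and 4(P + n) = 5P -
    -- 1.
    exact₃ : C₃ * a₀ * (+ 6 * P - + 2) * A₁ ≡ (+ 5 * P - + 1) * B₁
    exact₃ = ℤₚ.*-cancelˡ-≡ p! _ _ {{nonzero-p!}} (begin
      p! * (C₃ * a₀ * (+ 6 * P - + 2) * A₁)
        ≡⟨ lemma₁ p! C₃ a₀ (+ 6 * P - + 2) A₁ ⟩
      C₃ * a₀ * (+ 6 * P - + 2) * (p! * A₁)
        ≡⟨ cong₂ (λ x y → C₃ * a₀ * x * y) (trans (lemma₂ P (P - + 1) refl) (cong (λ x → + 4 * P + + 2 * x) (sym 4n))) (sym F₅) ⟩
      C₃ * a₀ * (+ 4 * P + + 2 * (+ 4 * + n)) * ((P + + n) * f₅)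
        ≡⟨ lemma₃ C₃ a₀ P (+ n) f₅ ⟩
      + 4 * (P + + n) * (P + (+ n + + n)) * (C₃ * (a₀ * f₅))
        ≡⟨ cong (+ 4 * (P + + n) * (P + + h) *_) (C-product n M₅ (ℤₚ.+-injective (lemma₄ (+ n)))) ⟩
      + 4 * (P + + n) * (P + + h) * f₆
        ≡⟨ trans (ℤₚ.*-assoc (+ 4 * (P + + n)) (P + + h) f₆) (cong (+ 4 * (P + + n) *_) F₆) ⟩
      + 4 * (P + + n) * (p! * B₁)
        ≡⟨ cong (_* (p! * B₁)) (trans (lemma₅ P (+ n)) (trans (cong (λ x → + 4 * P + x) 4n) (lemma₆ P))) ⟩
      (+ 5 * P - + 1) * (p! * B₁)
        ≡⟨ lemma₇ (+ 5 * P - + 1) p! B₁ ⟩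
      p! * ((+ 5 * P - + 1) * B₁) ∎)
      where
      open ≡-Reasoning
      lemma₁ : ∀ f c a x y → f * (c * a * x * y) ≡ c * a * x * (f * y)
      lemma₁ = solve-∀
      lemma₂ : ∀ p x → x ≡ p - + 1 → + 6 * p - + 2 ≡ + 4 * p + + 2 * x
      lemma₂ p _ refl = go p
        where
        go : ∀ p → + 6 * p - + 2 ≡ + 4 * p + + 2 * (p - + 1)
        go = solve-∀
      lemma₃ : ∀ c a p n f → c * a * (+ 4 * p + + 2 * (+ 4 * n)) * ((p + n) * f) ≡ + 4 * (p + n) * (p + (n + n)) * (c * (a * f))
      lemma₃ = solve-∀
      lemma₄ : ∀ n → (n + n) + ((n + n) + ((n + n) + + 0)) ≡ n + ((n + n) + ((n + n) + + 0) + n)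
      lemma₄ = solve-∀
      lemma₅ : ∀ p n → + 4 * (p + n) ≡ + 4 * p + + 4 * n
      lemma₅ = solve-∀
      lemma₆ : ∀ p → + 4 * p + (p - + 1) ≡ + 5 * p - + 1
      lemma₆ = solve-∀
      lemma₇ : ∀ x f b → x * (f * b) ≡ f * (x * b)
      lemma₇ = solve-∀

    private
      top-h : + 16 * ((+ 2 * P + + h) * (+ 2 * P + + h - + 1)) ≡ D₂
      top-h = trans (lemma₁ P (+ n)) (trans (cong (λ x → (+ 8 * P + + 2 * x) * (+ 8 * P + + 2 * x - + 4)) 4n) (lemma₂ P))
        where
        lemma₁ : ∀ p n → + 16 * ((+ 2 * p + (n + n)) * (+ 2 * p + (n + n) - + 1)) ≡ (+ 8 * p + + 2 * (+ 4 * n)) * (+ 8 * p + + 2 * (+ 4 * n) - + 4)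
        lemma₁ = solve-∀
        lemma₂ : ∀ p → (+ 8 * p + + 2 * (p - + 1)) * (+ 8 * p + + 2 * (p - + 1) - + 4) ≡ (+ 10 * p - + 6) * (+ 10 * p - + 2)
        lemma₂ = solve-∀

      top-n : + 16 * ((+ 2 * P + + n) * (+ 2 * P + + n - + 1)) ≡ (+ 9 * P - + 5) * (+ 9 * P - + 1)
      top-n = trans (lemma₁ P (+ n)) (trans (cong (λ x → (+ 8 * P + x) * (+ 8 * P + x - + 4)) 4n) (lemma₂ P))
        where
        lemma₁ : ∀ p n → + 16 * ((+ 2 * p + n) * (+ 2 * p + n - + 1)) ≡ (+ 8 * p + + 4 * n) * (+ 8 * p + + 4 * n - + 4)
        lemma₁ = solve-∀
        lemma₂ : ∀ p → (+ 8 * p + (p - + 1)) * (+ 8 * p + (p - + 1) - + 4) ≡ (+ 9 * p - + 5) * (+ 9 * p - + 1)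
        lemma₂ = solve-∀

      top-5 : + 16 * ((P + + n) * (P + + n)) ≡ (+ 5 * P - + 1) * (+ 5 * P - + 1)
      top-5 = trans (lemma₁ P (+ n)) (trans (cong (λ x → (+ 4 * P + x) * (+ 4 * P + x)) 4n) (lemma₂ P))
        where
        lemma₁ : ∀ p n → + 16 * ((p + n) * (p + n)) ≡ (+ 4 * p + + 4 * n) * (+ 4 * p + + 4 * n)
        lemma₁ = solve-∀
        lemma₂ : ∀ p → (+ 4 * p + (p - + 1)) * (+ 4 * p + (p - + 1)) ≡ (+ 5 * p - + 1) * (+ 5 * p - + 1)
        lemma₂ = solve-∀

    exact₅ : C₅ * a₀ * D₂ * A₂ ≡ (+ 9 * P - + 5) * (+ 9 * P - + 1) * B₂
    exact₅ = ℤₚ.*-cancelˡ-≡ (+ ((p ℕ.+ p) !)) _ _ {{factorial-nonzero (p ℕ.+ p)}} (begin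
      g * (C₅ * a₀ * D₂ * A₂)
        ≡⟨ lemma₁ g C₅ a₀ D₂ A₂ ⟩
      C₅ * a₀ * D₂ * (g * A₂)
        ≡⟨ cong₂ (λ x y → C₅ * a₀ * x * y) (sym top-h) (sym F₉) ⟩
      C₅ * a₀ * (+ 16 * th) * (tn * f₉)
        ≡⟨ lemma₂ C₅ a₀ th tn f₉ ⟩
      + 16 * tn * (th * (C₅ * (a₀ * f₉)))
        ≡⟨ cong (λ x → + 16 * tn * (th * x)) (C-product n M₉ (ℤₚ.+-injective (lemma₃ (+ n)))) ⟩
      + 16 * tn * (th * f₁₀)
        ≡⟨ cong₂ _*_ top-n F₁₀ ⟩
      (+ 9 * P - + 5) * (+ 9 * P - + 1) * (g * B₂)
        ≡⟨ lemma₄ ((+ 9 * P - + 5) * (+ 9 * P - + 1)) g B₂ ⟩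
      g * ((+ 9 * P - + 5) * (+ 9 * P - + 1) * B₂) ∎)
      where
      open ≡-Reasoning
      g th tn : ℤ
      g = + ((p ℕ.+ p) !)
      th = (+ 2 * P + + h) * (+ 2 * P + + h - + 1)
      tn = (+ 2 * P + + n) * (+ 2 * P + + n - + 1)
      lemma₁ : ∀ f c a x y → f * (c * a * x * y) ≡ c * a * x * (f * y)
      lemma₁ = solve-∀
      lemma₂ : ∀ c a x y f → c * a * (+ 16 * x) * (y * f) ≡ + 16 * y * (x * (c * (a * f)))
      lemma₂ = solve-∀
      lemma₃ : ∀ n → (n + n) + ((n + n) + ((n + n) + ((n + n) + ((n + n) + + 0)))) ≡ n + ((n + n) + ((n + n) + ((n + n) + ((n + n) + + 0))) + n)
      lemma₃ = solve-∀
      lemma₄ : ∀ x f b → x * (f * b) ≡ f * (x * b)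
      lemma₄ = solve-∀

    -- Here (2p)! stands against (p!)². The powers of p balance exactly, so p! P is cancelled over
    -- the integers before anything is reduced.
    exact₅′ : C₅′ * D₂ * b₀ * shifted (P * - + 1) h * (A₁ * A₁) ≡ + 2 * ((+ 5 * P - + 1) * (+ 5 * P - + 1)) * (B₁ * shifted (P * - + 2) h * B₂)
    exact₅′ = ℤₚ.*-cancelˡ-≡ (p! * P) _ _ {{nonzero}} (begin
      p! * P * (C₅′ * D₂ * b₀ * m₁ * (A₁ * A₁))
        ≡⟨ lemma₁ p! P C₅′ D₂ b₀ m₁ A₁ ⟩
      C₅′ * D₂ * (P * (b₀ * m₁)) * p! * (A₁ * A₁)
        ≡⟨ cong (λ x → C₅′ * D₂ * x * p! * (A₁ * A₁)) (sym p!≡) ⟩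
      C₅′ * D₂ * p! * p! * (A₁ * A₁)
        ≡⟨ lemma₂ C₅′ D₂ p! A₁ ⟩
      C₅′ * D₂ * (p! * A₁ * (p! * A₁))
        ≡⟨ cong₂ (λ x y → C₅′ * x * (y * y)) (sym top-h) (sym F₅) ⟩
      C₅′ * (+ 16 * th) * ((P + + n) * f₅ * ((P + + n) * f₅))
        ≡⟨ lemma₃ C₅′ th (P + + n) f₅ ⟩
      + 16 * ((P + + n) * (P + + n)) * (th * (C₅′ * (f₅ * f₅)))
        ≡⟨ cong₂ (λ x y → x * (th * y)) top-5 (C-product M₅ M₅ (ℤₚ.+-injective (lemma₄ (+ n)))) ⟩
      (+ 5 * P - + 1) * (+ 5 * P - + 1) * (th * f₁₀)
        ≡⟨ cong ((+ 5 * P - + 1) * (+ 5 * P - + 1) *_) (trans F₁₀ (cong (_* B₂) 2p!≡)) ⟩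
      (+ 5 * P - + 1) * (+ 5 * P - + 1) * (p! * (+ 2 * P * (B₁ * m₂)) * B₂)
        ≡⟨ lemma₅ ((+ 5 * P - + 1) * (+ 5 * P - + 1)) p! P B₁ m₂ B₂ ⟩
      p! * P * (+ 2 * ((+ 5 * P - + 1) * (+ 5 * P - + 1)) * (B₁ * m₂ * B₂)) ∎)
      where
      open ≡-Reasoning
      m₁ m₂ th : ℤ
      m₁ = shifted (P * - + 1) h
      m₂ = shifted (P * - + 2) h
      th = (+ 2 * P + + h) * (+ 2 * P + + h - + 1)
      nonzero : ℤ.NonZero (p! * P)
      nonzero = ℤₚ.i*j≢0 p! P {{nonzero-p!}} {{prime⇒nonZero pr}}
      lemma₁ : ∀ f p c d b m a → f * p * (c * d * b * m * (a * a)) ≡ c * d * (p * (b * m)) * f * (a * a)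
      lemma₁ = solve-∀
      lemma₂ : ∀ c d f a → c * d * f * f * (a * a) ≡ c * d * (f * a * (f * a))
      lemma₂ = solve-∀
      lemma₃ : ∀ c t x f → c * (+ 16 * t) * (x * f * (x * f)) ≡ + 16 * (x * x) * (t * (c * (f * f)))
      lemma₃ = solve-∀
      lemma₄ : ∀ n → (n + n) + ((n + n) + ((n + n) + ((n + n) + ((n + n) + + 0)))) ≡ ((n + n) + ((n + n) + + 0) + n) + ((n + n) + ((n + n) + + 0) + n)
      lemma₄ = solve-∀
      lemma₅ : ∀ x f p b m c → x * (f * (+ 2 * p * (b * m)) * c) ≡ f * p * (+ 2 * x * (b * m * c))
      lemma₅ = solve-∀

    nz-6P-2 : Nz (+ 6 * P - + 2)
    nz-6P-2 = nz-≈ (mod-by (- + 6) (lemma P)) (nz-neg nz-2)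
      where
      lemma : ∀ p → - + 2 ≡ + 6 * p - + 2 + p * - + 6
      lemma = solve-∀

    nz-D₂ : Nz D₂
    nz-D₂ = nz-* {+ 10 * P - + 6} {+ 10 * P - + 2} (nz-≈ (mod-by (- + 10) (lemma₁ P)) (nz-neg (nz-* nz-2 nz-3))) (nz-≈ (mod-by (- + 10) (lemma₂ P)) (nz-neg nz-2))
      where
      lemma₁ : ∀ p → - + 6 ≡ + 10 * p - + 6 + p * - + 10
      lemma₁ = solve-∀
      lemma₂ : ∀ p → - + 2 ≡ + 10 * p - + 2 + p * - + 10
      lemma₂ = solve-∀

    2C₃≈ : + 2 * C₃ ≈ c * Z₃ [ P³ ]
    2C₃≈ = ≈-cancel₃ {a₀ * a₀ * Â (+ 1) * (+ 6 * P - + 2)} (nz-* (nz-* (nz-* nz-a₀ nz-a₀) (nz-Â (+ 1))) nz-6P-2) (begin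
      a₀ * a₀ * Â (+ 1) * (+ 6 * P - + 2) * (+ 2 * C₃)
        ≡⟨ lemma₁ a₀ (Â (+ 1)) (+ 6 * P - + 2) C₃ ⟩
      + 2 * (C₃ * a₀ * (+ 6 * P - + 2) * (a₀ * Â (+ 1)))
        ≈⟨ *-≈ˡ (+ 2) (*-≈ˡ (C₃ * a₀ * (+ 6 * P - + 2)) (shifted-a (+ 1))) ⟨
      + 2 * (C₃ * a₀ * (+ 6 * P - + 2) * A₁)
        ≡⟨ cong (+ 2 *_) exact₃ ⟩
      + 2 * ((+ 5 * P - + 1) * B₁)
        ≈⟨ *-≈ˡ (+ 2) (*-≈ˡ (+ 5 * P - + 1) (≈-trans (shifted-b (+ 1)) (*-≈ (≡⇒≈ (sym c-relation)) I1))) ⟩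
      + 2 * ((+ 5 * P - + 1) * (c * (a₀ * a₀) * (Â (+ 1) * X₃)))
        ≡⟨ lemma₂ (+ 5 * P - + 1) c a₀ (Â (+ 1)) X₃ ⟩
      a₀ * a₀ * Â (+ 1) * c * (+ 2 * (+ 5 * P - + 1) * X₃)
        ≈⟨ *-≈ˡ (a₀ * a₀ * Â (+ 1) * c) I6 ⟨
      a₀ * a₀ * Â (+ 1) * c * ((+ 6 * P - + 2) * Z₃)
        ≡⟨ lemma₃ (a₀ * a₀ * Â (+ 1)) c (+ 6 * P - + 2) Z₃ ⟩
      a₀ * a₀ * Â (+ 1) * (+ 6 * P - + 2) * (c * Z₃) ∎)
      where
      open ≈-Reasoning P³
      lemma₁ : ∀ a x y c → a * a * x * y * (+ 2 * c) ≡ + 2 * (c * a * y * (a * x))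
      lemma₁ = solve-∀
      lemma₂ : ∀ y c a x z → + 2 * (y * (c * (a * a) * (x * z))) ≡ a * a * x * c * (+ 2 * y * z)
      lemma₂ = solve-∀
      lemma₃ : ∀ a c y z → a * c * (y * z) ≡ a * y * (c * z)
      lemma₃ = solve-∀

    108C₅≈ : + 108 * C₅ ≈ c * (U * X₅) [ P³ ]
    108C₅≈ = ≈-cancel₃ {a₀ * a₀ * Â (+ 2) * D₂} (nz-* (nz-* (nz-* nz-a₀ nz-a₀) (nz-Â (+ 2))) nz-D₂) (begin
      a₀ * a₀ * Â (+ 2) * D₂ * (+ 108 * C₅)
        ≡⟨ lemma₁ a₀ (Â (+ 2)) D₂ C₅ ⟩
      + 108 * (C₅ * a₀ * D₂ * (a₀ * Â (+ 2)))
        ≈⟨ *-≈ˡ (+ 108) (*-≈ˡ (C₅ * a₀ * D₂) (shifted-a (+ 2))) ⟨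
      + 108 * (C₅ * a₀ * D₂ * A₂)
        ≡⟨ cong (+ 108 *_) exact₅ ⟩
      + 108 * (E * B₂)
        ≈⟨ *-≈ˡ (+ 108) (*-≈ˡ E (≈-trans (shifted-b (+ 2)) (*-≈ (≡⇒≈ (sym c-relation)) I2))) ⟩
      + 108 * (E * (c * (a₀ * a₀) * (Â (+ 2) * X₅)))
        ≡⟨ lemma₂ E c a₀ (Â (+ 2)) X₅ ⟩
      a₀ * a₀ * Â (+ 2) * c * (+ 108 * E * X₅)
        ≈⟨ *-≈ˡ (a₀ * a₀ * Â (+ 2) * c) (*-≈ʳ X₅ I7) ⟨
      a₀ * a₀ * Â (+ 2) * c * (D₂ * U * X₅)
        ≡⟨ lemma₃ (a₀ * a₀ * Â (+ 2)) c D₂ U X₅ ⟩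
      a₀ * a₀ * Â (+ 2) * D₂ * (c * (U * X₅)) ∎)
      where
      open ≈-Reasoning P³
      E : ℤ
      E = (+ 9 * P - + 5) * (+ 9 * P - + 1)
      lemma₁ : ∀ a x y c → a * a * x * y * (+ 108 * c) ≡ + 108 * (c * a * y * (a * x))
      lemma₁ = solve-∀
      lemma₂ : ∀ y c a x z → + 108 * (y * (c * (a * a) * (x * z))) ≡ a * a * x * c * (+ 108 * y * z)
      lemma₂ = solve-∀
      lemma₃ : ∀ a c y u z → a * c * (y * u * z) ≡ a * y * (c * (u * z))
      lemma₃ = solve-∀

    54C₅′≈ : + 54 * C₅′ ≈ c * (V * X₅′) [ P³ ]
    54C₅′≈ = ≈-cancel₃ {b₀ * b₀ * (a₀ * a₀) * B̂ (- + 1) * (Â (+ 1) * Â (+ 1)) * D₂}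
      (nz-* (nz-* (nz-* (nz-* (nz-* nz-b₀ nz-b₀) (nz-* nz-a₀ nz-a₀)) (nz-B̂ (- + 1))) (nz-* (nz-Â (+ 1)) (nz-Â (+ 1)))) nz-D₂) (begin
      b₀ * b₀ * (a₀ * a₀) * B̂ (- + 1) * (Â (+ 1) * Â (+ 1)) * D₂ * (+ 54 * C₅′)
        ≡⟨ lemma₁ b₀ a₀ (B̂ (- + 1)) (Â (+ 1)) D₂ C₅′ ⟩
      + 54 * (C₅′ * D₂ * b₀ * (b₀ * B̂ (- + 1)) * (a₀ * Â (+ 1) * (a₀ * Â (+ 1))))
        ≈⟨ *-≈ˡ (+ 54) (*-≈ (*-≈ˡ (C₅′ * D₂ * b₀) (shifted-b (- + 1))) (*-≈ (shifted-a (+ 1)) (shifted-a (+ 1)))) ⟨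
      + 54 * (C₅′ * D₂ * b₀ * shifted (P * - + 1) h * (A₁ * A₁))
        ≡⟨ cong (+ 54 *_) exact₅′ ⟩
      + 54 * (+ 2 * E * (B₁ * shifted (P * - + 2) h * B₂))
        ≈⟨ *-≈ˡ (+ 54) (*-≈ˡ (+ 2 * E) (*-≈ (*-≈ (≈-trans (shifted-b (+ 1)) (*-≈ˡ b₀ I4)) (shifted-b (- + 2))) (shifted-b (+ 2)))) ⟩
      + 54 * (+ 2 * E * (b₀ * (B̂ (- + 1) * B̂ (+ 2)) * (b₀ * B̂ (- + 2)) * (b₀ * B̂ (+ 2))))
        ≡⟨ lemma₂ E b₀ (B̂ (- + 1)) (B̂ (+ 2)) (B̂ (- + 2)) ⟩
      b₀ * b₀ * B̂ (- + 1) * (+ 108 * E) * (b₀ * B̂ (+ 2) * (B̂ (+ 2) * B̂ (- + 2)))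
        ≈⟨ *-≈ (*-≈ˡ (b₀ * b₀ * B̂ (- + 1)) (≈-sym I8)) (*-≈ (*-≈ (≡⇒≈ (sym c-relation)) I3) I5) ⟩
      b₀ * b₀ * B̂ (- + 1) * (D₂ * V) * (c * (a₀ * a₀) * (Â (+ 1) * Â (+ 1) * X₅′) * + 1)
        ≡⟨ lemma₃ b₀ (B̂ (- + 1)) D₂ V c a₀ (Â (+ 1)) X₅′ ⟩
      b₀ * b₀ * (a₀ * a₀) * B̂ (- + 1) * (Â (+ 1) * Â (+ 1)) * D₂ * (c * (V * X₅′)) ∎)
      where
      open ≈-Reasoning P³
      E : ℤ
      E = (+ 5 * P - + 1) * (+ 5 * P - + 1)
      lemma₁ : ∀ b a x y d c → b * b * (a * a) * x * (y * y) * d * (+ 54 * c) ≡ + 54 * (c * d * b * (b * x) * (a * y * (a * y)))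
      lemma₁ = solve-∀
      lemma₂ : ∀ e b x y z → + 54 * (+ 2 * e * (b * (x * y) * (b * z) * (b * y))) ≡ b * b * x * (+ 108 * e) * (b * y * (y * z))
      lemma₂ = solve-∀
      lemma₃ : ∀ b x d v c a y z → b * b * x * (d * v) * (c * (a * a) * (y * y * z) * + 1) ≡ b * b * (a * a) * x * (y * y) * d * (c * (v * z))
      lemma₃ = solve-∀

    open Jacobi pr n p≡ using (Br; jacobi-sum)

    -- The factor 18 turns the coefficients 20, 6, 3 of `Br` into 180 · 2, 108 and 54, as the three
    -- preceding congruences require; `I9` then sums them.
    Br≈ : (+ 1 - P) * Br * q ≈ + 8 * (c * (+ 1 + P * P * ω)) [ P³ ]
    Br≈ = ≈-cancel₃ {+ 18} (nz-* nz-2 (nz-* nz-3 nz-3)) (begin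
      + 18 * ((+ 1 - P) * Br * q)
        ≡⟨ lemma₁ (+ 1 - P) c C₃ C₅ C₅′ q ⟩
      (+ 1 - P) * (+ 270 * c - + 180 * (+ 2 * C₃) + + 108 * C₅ + + 54 * C₅′) * q
        ≈⟨ *-≈ (*-≈ˡ (+ 1 - P) (+-≈ (+-≈ (-‿≈ (≈-refl {a = + 270 * c}) (*-≈ˡ (+ 180) 2C₃≈)) 108C₅≈) 54C₅′≈)) q≈G ⟩
      (+ 1 - P) * (+ 270 * c - + 180 * (c * Z₃) + c * (U * X₅) + c * (V * X₅′)) * G
        ≡⟨ lemma₂ (+ 1 - P) c Z₃ (U * X₅) (V * X₅′) G ⟩
      c * ((+ 1 - P) * (+ 270 - + 180 * Z₃ + U * X₅ + V * X₅′) * G)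
        ≈⟨ *-≈ˡ c I9 ⟩
      c * (+ 144 * (+ 1 + P * P * ω))
        ≡⟨ lemma₃ c (+ 1 + P * P * ω) ⟩
      + 18 * (+ 8 * (c * (+ 1 + P * P * ω))) ∎)
      where
      open ≈-Reasoning P³
      lemma₁ : ∀ x c d e f q → + 18 * (x * (+ 15 * c - + 20 * d + + 6 * e + + 3 * f) * q) ≡ x * (+ 270 * c - + 180 * (+ 2 * d) + + 108 * e + + 54 * f) * q
      lemma₁ = solve-∀
      lemma₂ : ∀ x c z u v g → x * (+ 270 * c - + 180 * (c * z) + c * u + c * v) * g ≡ c * (x * (+ 270 - + 180 * z + u + v) * g)
      lemma₂ = solve-∀
      lemma₃ : ∀ c x → c * (+ 144 * x) ≡ + 18 * (+ 8 * (c * x))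
      lemma₃ = solve-∀

-- Primes congruent to 1 modulo 4

module FirstCase where

  open IntegerCongruences
  open LegendreSums
  open JacobiSums
  open QuarterFactorialExpansions
  open QuarterBinomialCoefficients
  open import Data.Integer using (_+_; _*_; _-_; -_; _^_)

  square-nonneg : ∀ a → + 0 ℤ.≤ a * a
  square-nonneg (+ n)    = subst (+ 0 ℤ.≤_) (ℤₚ.pos-* n n) (ℤ.+≤+ z≤n)
  square-nonneg -[1+ n ] = ℤ.+≤+ z≤n

  square-pos : ∀ {a} → a ≢ + 0 → + 1 ℤ.≤ a * a
  square-pos {+ zero}   a≢0 = ⊥-elim (a≢0 refl)
  square-pos {+ suc n}  _   = ℤ.+≤+ (s≤s z≤n)
  square-pos { -[1+ n ]} _  = ℤ.+≤+ (s≤s z≤n)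

  square-zero : ∀ {a} → a * a ≡ + 0 → a ≡ + 0
  square-zero {a} e with ℤₚ.i*j≡0⇒i≡0∨j≡0 a e
  ... | inj₁ x = x
  ... | inj₂ x = x

  ≈0⇒multiple : ∀ {a m} → a ≈ + 0 [ m ] → ∃ λ k → a ≡ m * k
  ≈0⇒multiple {a} {m} (mod-by k e) = k , trans e (ℤₚ.+-identityˡ (m * k))

  odd-nonzero : ∀ {a} → a ≈ + 1 [ + 2 ] → a ≢ + 0
  odd-nonzero (mod-by (+ n) e) refl with trans e (cong (λ x → + 1 + x) (sym (ℤₚ.pos-* 2 n)))
  ... | ()
  odd-nonzero (mod-by -[1+ n ] e) refl = lemma n e
    where
    lemma : ∀ n → + 0 ≡ + 1 + + 2 * -[1+ n ] → ⊥
    lemma zero    ()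
    lemma (suc n) ()

  parity : ∀ a → a ≈ + 0 [ + 2 ] ⊎ a ≈ + 1 [ + 2 ]
  parity (+ zero)        = inj₁ ≈-refl
  parity (+ suc n) with parity (+ n)
  ... | inj₁ e = inj₂ (+-≈ (≈-refl {a = + 1}) e)
  ... | inj₂ e = inj₁ (≈-trans (+-≈ (≈-refl {a = + 1}) e) (mod-by (+ 1) refl))
  parity -[1+ zero ] = inj₂ (mod-by (- + 1) refl)
  parity -[1+ suc n ] with parity -[1+ n ]
  ... | inj₁ e = inj₂ (≈-trans (+-≈ (≈-refl {a = - + 1}) e) (mod-by (- + 1) refl))
  ... | inj₂ e = inj₁ (+-≈ (≈-refl {a = - + 1}) e)

  even-if-square-even : ∀ {a} → a * a ≈ + 0 [ + 2 ] → a ≈ + 0 [ + 2 ]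
  even-if-square-even {a} e with parity a
  ... | inj₁ x = x
  ... | inj₂ x = ⊥-elim (odd-nonzero {+ 0} (≈-trans (≈-sym e) (*-≈ x x)) refl)

  -- Modulo 8 the expression has period two in n.
  alternating-mod-8 : ∀ n → - (- + 1) ^ n * (+ 7 - (+ 4 * + n + + 1)) ≈ + 2 [ + 8 ]
  alternating-mod-8 = go
    where
    value : ℤ → ℤ → ℤ
    value s m = - s * (+ 7 - (+ 4 * m + + 1))
    abstract
      step : ∀ s m → value (- + 1 * (- + 1 * s)) (+ 1 + (+ 1 + m)) ≈ value s m [ + 8 ]
      step s m = mod-by (- + 1 * (- + 1 * s)) (lemma s m)
        where
        lemma : ∀ s n → - (- + 1 * (- + 1 * s)) * (+ 7 - (+ 4 * (+ 1 + (+ 1 + n)) + + 1)) ≡ - s * (+ 7 - (+ 4 * n + + 1)) + + 8 * (- + 1 * (- + 1 * s))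
        lemma = solve-∀
    go : ∀ n → value ((- + 1) ^ n) (+ n) ≈ + 2 [ + 8 ]
    go zero          = mod-by (- + 1) refl
    go (suc zero)    = mod-by (+ 0) refl
    go (suc (suc n)) = ≈-trans (step ((- + 1) ^ n) (+ n)) (go n)

  module _ {p : ℕ} (pr : Prime p) where
    open ModPrime pr

    private
      nonzero-P : ℤ.NonZero P
      nonzero-P = prime⇒nonZero pr

    -- Lagrange's identity gives (ac + bd)² + (ad - bc)² = P². If ad - bc is a nonzero multiple of
    -- P, then ac + bd = 0, but it is odd. So ad = bc, whence a² = c², and the residue 1 modulo 4
    -- fixes the sign.
    aligned : ∀ {a b c d} → P ≡ a * a + b * b → P ≡ c * c + d * d → a ≈ + 1 [ + 4 ] → c ≈ + 1 [ + 4 ] → b ≈ + 0 [ + 2 ] →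
      a * d - b * c ≈ + 0 [ P ] → a ≡ c
    aligned {a} {b} {c} {d} e f a≈1 c≈1 b≈0 h with ≈0⇒multiple h
    ... | k , ek = cases (k ℤ.≟ + 0)
      where
      D : ℤ
      D = a * c + b * d
      D-odd : D ≈ + 1 [ + 2 ]
      D-odd = ≈-trans (+-≈ (*-≈ (≈-lower {+ 2} {+ 2} a≈1) (≈-lower {+ 2} {+ 2} c≈1)) (*-≈ʳ d b≈0)) (≡⇒≈ (lemma d))
        where
        lemma : ∀ d → + 1 * + 1 + + 0 * d ≡ + 1
        lemma = solve-∀
      lagrange : D * D + P * P * (k * k) ≡ P * P
      lagrange = begin
        D * D + P * P * (k * k)                              ≡⟨ lemma₁ (D * D) P k ⟩
        D * D + P * k * (P * k)                              ≡⟨ cong (λ x → D * D + x * x) (sym ek) ⟩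
        D * D + (a * d - b * c) * (a * d - b * c)            ≡⟨ lemma₂ a b c d ⟩
        (a * a + b * b) * (c * c + d * d)                    ≡⟨ sym (cong₂ _*_ e f) ⟩
        P * P                                                ∎
        where
        open ≡-Reasoning
        lemma₁ : ∀ x p k → x + p * p * (k * k) ≡ x + p * k * (p * k)
        lemma₁ = solve-∀
        lemma₂ : ∀ a b c d → (a * c + b * d) * (a * c + b * d) + (a * d - b * c) * (a * d - b * c) ≡ (a * a + b * b) * (c * c + d * d)
        lemma₂ = solve-∀
      cases : Dec (k ≡ + 0) → a ≡ c
      cases (no k≢0) = ⊥-elim (odd-nonzero D-odd (square-zero (ℤₚ.≤-antisym upper (square-nonneg D))))
        where
        upper : D * D ℤ.≤ + 0
        upper = +-cancelʳ-≤ (P * P) (subst₂ ℤ._≤_ refl (sym (ℤₚ.+-identityˡ (P * P))) (ℤₚ.≤-trans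
          (ℤₚ.+-monoʳ-≤ (D * D) (subst (ℤ._≤ P * P * (k * k)) (ℤₚ.*-identityʳ (P * P)) (ℤₚ.*-monoˡ-≤-nonNeg (P * P) {{ℤ.nonNegative (square-nonneg P)}} (square-pos k≢0)))) (ℤₚ.≤-reflexive lagrange)))
      cases (yes refl) = signs (ℤₚ.i*j≡0⇒i≡0∨j≡0 (a - c) (trans (lemma₃ a c) (≡-difference squares)))
        where
        lemma₃ : ∀ a c → (a - c) * (a + c) ≡ a * a - c * c
        lemma₃ = solve-∀
        ≡-difference : ∀ {x y} → x ≡ y → x - y ≡ + 0
        ≡-difference {x} refl = ℤₚ.+-inverseʳ x
        squares : a * a ≡ c * c
        squares = ℤₚ.*-cancelˡ-≡ P (a * a) (c * c) {{nonzero-P}} (ℤₚ.i-j≡0⇒i≡j (P * (a * a)) (P * (c * c)) (begin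
          P * (a * a) - P * (c * c)                                            ≡⟨ cong₂ (λ x y → x * (a * a) - y * (c * c)) f e ⟩
          (c * c + d * d) * (a * a) - (a * a + b * b) * (c * c)                ≡⟨ lemma₄ a b c d ⟩
          (a * d - b * c) * (a * d + b * c)                                    ≡⟨ cong (_* (a * d + b * c)) (trans ek (ℤₚ.*-zeroʳ P)) ⟩
          + 0 * (a * d + b * c)                                                ≡⟨ ℤₚ.*-zeroˡ (a * d + b * c) ⟩
          + 0                                                                  ∎))
          where
          open ≡-Reasoning
          lemma₄ : ∀ a b c d → (c * c + d * d) * (a * a) - (a * a + b * b) * (c * c) ≡ (a * d - b * c) * (a * d + b * c)
          lemma₄ = solve-∀
        signs : a - c ≡ + 0 ⊎ a + c ≡ + 0 → a ≡ c
        signs (inj₁ x) = ℤₚ.i-j≡0⇒i≡j a c x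
        signs (inj₂ x) = impossible (≈-trans (≡⇒≈ (sym x)) (+-≈ a≈1 c≈1))
          where
          halve : ∀ t → + 2 + + 4 * t ≡ + 2 * (+ 1 + + 2 * t)
          halve = solve-∀
          impossible : + 0 ≈ + 2 [ + 4 ] → a ≡ c
          impossible (mod-by t y) = ⊥-elim (odd-nonzero {+ 1 + + 2 * t} (mod-by t refl)
            (ℤₚ.*-cancelˡ-≡ (+ 2) (+ 1 + + 2 * t) (+ 0) (sym (trans y (halve t)))))

    -- P divides (ad - bc)(ad + bc) = P(a² - c²); replacing b by -b brings the second factor to the
    -- first.
    two-squares-unique : ∀ {a b c d} → P ≡ a * a + b * b → P ≡ c * c + d * d → a ≈ + 1 [ + 4 ] → c ≈ + 1 [ + 4 ] → b ≈ + 0 [ + 2 ] → a ≡ c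
    two-squares-unique {a} {b} {c} {d} e f a≈1 c≈1 b≈0 = cases (euclid product)
      where
      open ≡-Reasoning
      lemma₁ : ∀ a b c d → (a * d - b * c) * (a * d + b * c) ≡ (c * c + d * d) * (a * a) - (a * a + b * b) * (c * c)
      lemma₁ = solve-∀
      lemma₂ : ∀ p x y → p * x - p * y ≡ + 0 + p * (x - y)
      lemma₂ = solve-∀
      lemma₃ : ∀ b → b * b ≡ - b * - b
      lemma₃ = solve-∀
      lemma₄ : ∀ x b c → x - - b * c ≡ x + b * c
      lemma₄ = solve-∀
      product : (a * d - b * c) * (a * d + b * c) ≈ + 0 [ P ]
      product = mod-by (a * a - c * c) (begin
        (a * d - b * c) * (a * d + b * c)                                ≡⟨ lemma₁ a b c d ⟩
        (c * c + d * d) * (a * a) - (a * a + b * b) * (c * c)            ≡⟨ cong₂ (λ x y → x * (a * a) - y * (c * c)) (sym f) (sym e) ⟩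
        P * (a * a) - P * (c * c)                                        ≡⟨ lemma₂ P (a * a) (c * c) ⟩
        + 0 + P * (a * a - c * c)                                        ∎)
      cases : a * d - b * c ≈ + 0 [ P ] ⊎ a * d + b * c ≈ + 0 [ P ] → a ≡ c
      cases (inj₁ x) = aligned {a} {b} {c} {d} e f a≈1 c≈1 b≈0 x
      cases (inj₂ x) = aligned {a} { - b} {c} {d} (trans e (cong (λ z → a * a + z) (lemma₃ b))) f a≈1 c≈1 (neg-≈ b≈0) (≈-trans (≡⇒≈ (lemma₄ (a * d) b c)) x)

    -- The expansion W = 2 (2x − P/(2x) − P²/(8x³)) + O(P³) of the unit root, cleared of denominators.
    unit-root : ∀ {W x} → Nz (+ 4) → Nz W → W * (+ 4 * x - W) ≈ + 4 * P [ P³ ] →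
      Nz x × (+ 8 * (x * x * x) * W ≈ + 2 * (+ 16 * (x * x * x * x) - + 4 * (x * x) * P - P * P) [ P³ ])
    unit-root {W} {x} n4 nW h with ≈0⇒multiple (≈0-cancel nW (≈-trans (≈-lower (≈-lower h)) (≈-trans (*-≈ˡ (+ 4) P≈0) (≡⇒≈ refl))))
    ... | e , ee = nx , (begin
        + 8 * (x * x * x) * W
          ≡⟨ cong (+ 8 * (x * x * x) *_) W≡ ⟩
        + 8 * (x * x * x) * (+ 4 * x - P * e)
          ≡⟨ lemma₃ x P e ⟩
        + 32 * (x * x * x * x) - P * (+ 2 * (x * x) * (+ 4 * (x * e)))
          ≈⟨ -‿≈ (≈-refl {a = + 32 * (x * x * x * x)}) (P*-≈ (≈-trans (*-≈ˡ (+ 2 * (x * x)) 4xe≈) (≈-trans (≡⇒≈ (lemma₄ x P e)) (+-≈ (≈-refl {a = + 8 * (x * x)}) (*-≈ˡ (+ 2) (P*-≈ (*-≈ xe≈1 xe≈1))))))) ⟩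
        + 32 * (x * x * x * x) - P * (+ 8 * (x * x) + + 2 * (P * (+ 1 * + 1)))
          ≡⟨ lemma₅ x P ⟩
        + 2 * (+ 16 * (x * x * x * x) - + 4 * (x * x) * P - P * P) ∎)
      where
      open ≈-Reasoning P³
      lemma₁ : ∀ w y → w ≡ y - (y - w)
      lemma₁ = solve-∀
      W≡ : W ≡ + 4 * x - P * e
      W≡ = trans (lemma₁ W (+ 4 * x)) (cong (λ z → + 4 * x - z) ee)
      We≈4 : W * e ≈ + 4 [ P² ]
      We≈4 = ≈-unraise (≈-trans (≡⇒≈ (trans (lemma₂ W e P) (cong (W *_) (sym ee)))) h)
        where
        lemma₂ : ∀ w e p → w * e * p ≡ w * (p * e)
        lemma₂ = solve-∀
      4xe≈ : + 4 * (x * e) ≈ + 4 + P * (e * e) [ P² ]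
      4xe≈ = ≈-trans (≡⇒≈ (trans (lemma₂ x e P) (cong (λ w → w * e + P * (e * e)) (sym W≡)))) (+-≈ We≈4 (≈-refl {a = P * (e * e)}))
        where
        lemma₂ : ∀ x e p → + 4 * (x * e) ≡ (+ 4 * x - p * e) * e + p * (e * e)
        lemma₂ = solve-∀
      xe≈1 : x * e ≈ + 1 [ P ]
      xe≈1 = ≈-cancel₁ n4 (≈-trans (≈-lower 4xe≈) (≈-trans (+-≈ (≈-refl {a = + 4}) (multiple-≈0 (e * e))) (≡⇒≈ refl)))
      nx : Nz x
      nx = nz-factorˡ {x} {e} (nz-≈ (≈-sym xe≈1) nz-1)
      lemma₃ : ∀ x p e → + 8 * (x * x * x) * (+ 4 * x - p * e) ≡ + 32 * (x * x * x * x) - p * (+ 2 * (x * x) * (+ 4 * (x * e)))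
      lemma₃ = solve-∀
      lemma₄ : ∀ x p e → + 2 * (x * x) * (+ 4 + p * (e * e)) ≡ + 8 * (x * x) + + 2 * (p * (x * e * (x * e)))
      lemma₄ = solve-∀
      lemma₅ : ∀ x p → + 32 * (x * x * x * x) - p * (+ 8 * (x * x) + + 2 * (p * (+ 1 * + 1))) ≡ + 2 * (+ 16 * (x * x * x * x) - + 4 * (x * x) * p - p * p)
      lemma₅ = solve-∀

  module Prime≡1 {p : ℕ} (pr : Prime p) (3<p : 3 ℕ.< p) (n : ℕ) (p≡ : p ≡ suc ((n ℕ.+ n) ℕ.+ (n ℕ.+ n)))
                 (x y : ℤ) (two-squares : + p ≡ x * x + y * y) (x≈1 : x ≈ + 1 [ + 4 ]) where
    open ModPrime pr
    open QuarterFactorials pr 3<p n p≡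
    open QuarterBinomials pr 3<p n p≡
    open Jacobi pr n p≡ using (Br; jacobi-sum)

    y-even : y ≈ + 0 [ + 2 ]
    y-even = even-if-square-even (begin
      y * y
        ≡⟨ lemma₁ (x * x) (y * y) ⟩
      x * x + y * y - x * x
        ≡⟨ cong (_- x * x) (trans (sym two-squares) P≡) ⟩
      + 4 * + n + + 1 - x * x
        ≈⟨ -‿≈ (+-≈ (*-≈ʳ (+ n) (mod-by {+ 4} {+ 0} (+ 2) refl)) (≈-refl {a = + 1})) (*-≈ x₂ x₂) ⟩
      + 0 * + n + + 1 - + 1 * + 1
        ≡⟨ lemma₂ (+ n) ⟩
      + 0 ∎)
      where
      open ≈-Reasoning (+ 2)
      x₂ : x ≈ + 1 [ + 2 ]
      x₂ = ≈-lower {+ 2} {+ 2} x≈1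
      lemma₁ : ∀ a b → b ≡ a + b - a
      lemma₁ = solve-∀
      lemma₂ : ∀ n → + 0 * n + + 1 - + 1 * + 1 ≡ + 0
      lemma₂ = solve-∀

    sign-mod-8 : - s * (+ 7 - P) ≈ + 2 [ + 8 ]
    sign-mod-8 = ≈-trans (≡⇒≈ (cong (λ z → - s * (+ 7 - z)) P≡)) (alternating-mod-8 n)

    -- ξ is 2 modulo 8, which makes ξ/2 congruent to 1 modulo 4 and Y even; dividing by 4 leaves a
    -- second representation of p as a sum of two squares.
    trace : ∀ {ξ Y} → ξ * ξ + Y * Y ≡ + 4 * P → ξ ≈ - s * (+ 7 - P) [ + 8 ] → ξ ≡ + 2 * x
    trace {ξ} {Y} e h = lifted (≈-trans h sign-mod-8)
      where
      lemma₁ : ∀ a b → b * b ≡ a * a + b * b - a * a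
      lemma₁ = solve-∀
      lemma₂ : ∀ p t → + 4 * p - (+ 2 + + 8 * t) * (+ 2 + + 8 * t) ≡ + 0 + + 2 * (+ 2 * p - + 2 * ((+ 1 + + 4 * t) * (+ 1 + + 4 * t)))
      lemma₂ = solve-∀
      lemma₃ : ∀ t → + 2 + + 8 * t ≡ + 2 * (+ 1 + + 4 * t)
      lemma₃ = solve-∀
      lemma₄ : ∀ t y → (+ 2 + + 8 * t) * (+ 2 + + 8 * t) + + 2 * y * (+ 2 * y) ≡ + 4 * ((+ 1 + + 4 * t) * (+ 1 + + 4 * t) + y * y)
      lemma₄ = solve-∀
      lifted : ξ ≈ + 2 [ + 8 ] → ξ ≡ + 2 * x
      lifted (mod-by t et) = halved (≈0⇒multiple (even-if-square-even Y-even))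
        where
        Y-even : Y * Y ≈ + 0 [ + 2 ]
        Y-even = mod-by (+ 2 * P - + 2 * ((+ 1 + + 4 * t) * (+ 1 + + 4 * t)))
          (trans (lemma₁ ξ Y) (trans (cong₂ _-_ e (cong (λ z → z * z) et)) (lemma₂ P t)))
        halved : (∃ λ Y₁ → Y ≡ + 2 * Y₁) → ξ ≡ + 2 * x
        halved (Y₁ , eY) = trans et (trans (lemma₃ t) (cong (+ 2 *_) (sym
          (two-squares-unique pr {x} {y} {+ 1 + + 4 * t} {Y₁} two-squares P≡ξ² x≈1 (mod-by t refl) y-even))))
          where
          P≡ξ² : P ≡ (+ 1 + + 4 * t) * (+ 1 + + 4 * t) + Y₁ * Y₁
          P≡ξ² = ℤₚ.*-cancelˡ-≡ (+ 4) P _ (trans (sym e) (trans (cong₂ (λ a b → a * a + b * b) et eY) (lemma₄ t Y₁)))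

    R≈0 : + 4 * + n + + 1 ≈ + 0 [ P ]
    R≈0 = ≈-trans (≡⇒≈ (sym P≡)) P≈0

    open TruncatedSum pr 3<p n n<p R≈0 using (R; closed; full-sum; full-sum≈; full-denominator; ∏[16i²-R²]; fourth; ∏y) renaming (y to y′)

    v : ℤ
    v = (+ 4) ^ n

    -- 16i² - P² = (4i + P)(4i - P), so the expansions at P and -P are multiplied; the terms linear
    -- in P cancel, and (48`λ′`)² cancels 2 · 16 · 72`λ′`².
    ∏≈ : + 16 * ∏[16i²-R²] ≈ + 16 * (v * v * (a₀ * a₀) * (+ 1 + P * P * ω)) [ P³ ]
    ∏≈ = ≈-cancel₃ {+ 16} (nz-* nz-4 nz-4) (begin
      + 16 * (+ 16 * ∏[16i²-R²])
        ≡⟨ cong (λ z → + 16 * (+ 16 * z)) (trans (∏-cong n (λ i _ → trans (cong (λ r → + 16 * (+ suc i * + suc i) - r * r) (sym P≡)) (lemma₁ (+ suc i) P))) (∏-* n (λ i → + 4 * + suc i + P * + 1) (λ i → + 4 * + suc i + P * - + 1))) ⟩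
      + 16 * (+ 16 * (∏ n (λ i → + 4 * + suc i + P * + 1) * ∏ n (λ i → + 4 * + suc i + P * - + 1)))
        ≡⟨ lemma₂ (∏ n (λ i → + 4 * + suc i + P * + 1)) (∏ n (λ i → + 4 * + suc i + P * - + 1)) ⟩
      (+ 4 * + 4 * ∏ n (λ i → + 4 * + suc i + P * + 1)) * (+ 4 * + 4 * ∏ n (λ i → + 4 * + suc i + P * - + 1))
        ≈⟨ *-≈ (quadratic-a (+ 4) (+ 1)) (quadratic-a (+ 4) (- + 1)) ⟩
      v * (a₀ * (+ 4 * + 4 + + 4 * (P * + 1) * (+ 12 * λ′ + + 4 * P * ω) + P * + 1 * (P * + 1) * (+ 72 * λ′ * λ′ + + 8 * ω)))
        * (v * (a₀ * (+ 4 * + 4 + + 4 * (P * - + 1) * (+ 12 * λ′ + + 4 * P * ω) + P * - + 1 * (P * - + 1) * (+ 72 * λ′ * λ′ + + 8 * ω))))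
        ≡⟨ lemma₃ v a₀ (+ 4 * + 4 + + 4 * (P * + 1) * (+ 12 * λ′ + + 4 * P * ω) + P * + 1 * (P * + 1) * (+ 72 * λ′ * λ′ + + 8 * ω)) (+ 4 * + 4 + + 4 * (P * - + 1) * (+ 12 * λ′ + + 4 * P * ω) + P * - + 1 * (P * - + 1) * (+ 72 * λ′ * λ′ + + 8 * ω)) ⟩
      v * v * (a₀ * a₀) * ((+ 4 * + 4 + + 4 * (P * + 1) * (+ 12 * λ′ + + 4 * P * ω) + P * + 1 * (P * + 1) * (+ 72 * λ′ * λ′ + + 8 * ω)) * (+ 4 * + 4 + + 4 * (P * - + 1) * (+ 12 * λ′ + + 4 * P * ω) + P * - + 1 * (P * - + 1) * (+ 72 * λ′ * λ′ + + 8 * ω)))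
        ≈⟨ *-≈ˡ (v * v * (a₀ * a₀)) (mod-by (- + 1536 * λ′ * ω + P * ((+ 72 * λ′ * λ′ + + 8 * ω) * (+ 72 * λ′ * λ′ + + 8 * ω) - + 256 * ω * ω)) (lemma₄ P λ′ ω)) ⟩
      v * v * (a₀ * a₀) * (+ 256 * (+ 1 + P * P * ω))
        ≡⟨ lemma₅ (v * v * (a₀ * a₀)) (+ 1 + P * P * ω) ⟩
      + 16 * (+ 16 * (v * v * (a₀ * a₀) * (+ 1 + P * P * ω))) ∎)
      where
      open ≈-Reasoning P³
      nz-4 : Nz (+ 4)
      nz-4 = nz-* nz-2 nz-2
      lemma₁ : ∀ i p → + 16 * (i * i) - p * p ≡ (+ 4 * i + p * + 1) * (+ 4 * i + p * - + 1)
      lemma₁ = solve-∀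
      lemma₂ : ∀ a b → + 16 * (+ 16 * (a * b)) ≡ + 4 * + 4 * a * (+ 4 * + 4 * b)
      lemma₂ = solve-∀
      lemma₃ : ∀ v a x y → v * (a * x) * (v * (a * y)) ≡ v * v * (a * a) * (x * y)
      lemma₃ = solve-∀
      lemma₄ : ∀ p l w → (+ 4 * + 4 + + 4 * (p * + 1) * (+ 12 * l + + 4 * p * w) + p * + 1 * (p * + 1) * (+ 72 * l * l + + 8 * w)) * (+ 4 * + 4 + + 4 * (p * - + 1) * (+ 12 * l + + 4 * p * w) + p * - + 1 * (p * - + 1) * (+ 72 * l * l + + 8 * w))
        ≡ + 256 * (+ 1 + p * p * w) + p * p * p * (- + 1536 * l * w + p * ((+ 72 * l * l + + 8 * w) * (+ 72 * l * l + + 8 * w) - + 256 * w * w))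
      lemma₄ = solve-∀
      lemma₅ : ∀ a b → a * (+ 256 * b) ≡ + 16 * (+ 16 * (a * b))
      lemma₅ = solve-∀

    K : ℤ
    K = v * ∏[16i²-R²] * b₀

    closed≡ : closed ≡ P * K
    closed≡ = begin
      v * (R * ∏[16i²-R²] * + ((2 ℕ.* n) !))
        ≡⟨ cong₂ (λ r k → v * (r * ∏[16i²-R²] * + ((n ℕ.+ k) !))) (sym P≡) (ℕₚ.+-identityʳ n) ⟩
      v * (P * ∏[16i²-R²] * b₀)
        ≡⟨ lemma v P ∏[16i²-R²] b₀ ⟩
      P * K ∎
      where
      open ≡-Reasoning
      lemma : ∀ v p g b → v * (p * g * b) ≡ p * (v * g * b)
      lemma = solve-∀

    fourth-root : ℤ
    fourth-root = v * a₀

    ∏fourth : ∏ n (fourth ∘ y′) ≡ fourth fourth-root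
    ∏fourth = trans (∏-* n _ y′) (cong₂ _*_ (trans (∏-* n _ y′) (cong₂ _*_ (trans (∏-* n y′ y′) (cong₂ _*_ (∏y n) (∏y n))) (∏y n))) (∏y n))

    -- The unit 1 + P²`ω` occurs both in `∏≈` and in `Br≈`, so 2K is (-1)ⁿ W times the fourth power
    -- of v n!. `unit-root` then expresses W through x, and yields that x is a unit.
    main-congruence : Nz x × (K * (+ 8 * (x * x * x)) ≈ s * (+ 16 * (x * x * x * x) - + 4 * (x * x) * P - P * P) * fourth fourth-root [ P³ ])
    main-congruence = nx , ≈-cancel₃ {+ 2} nz-2 (begin
      + 2 * (K * (+ 8 * (x * x * x)))
        ≡⟨ lemma₁ K (+ 8 * (x * x * x)) ⟩
      + 8 * (x * x * x) * (+ 2 * K)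
        ≈⟨ *-≈ˡ (+ 8 * (x * x * x)) 2K≈ ⟩
      + 8 * (x * x * x) * (s * W * fourth fourth-root)
        ≡⟨ lemma₂ (+ 8 * (x * x * x)) s W (fourth fourth-root) ⟩
      s * fourth fourth-root * (+ 8 * (x * x * x) * W)
        ≈⟨ *-≈ˡ (s * fourth fourth-root) root ⟩
      s * fourth fourth-root * (+ 2 * (+ 16 * (x * x * x * x) - + 4 * (x * x) * P - P * P))
        ≡⟨ lemma₃ s (fourth fourth-root) (+ 16 * (x * x * x * x) - + 4 * (x * x) * P - P * P) ⟩
      + 2 * (s * (+ 16 * (x * x * x * x) - + 4 * (x * x) * P - P * P) * fourth fourth-root) ∎)
      where
      open ≈-Reasoning P³
      ξ Y W : ℤ
      ξ = proj₁ jacobi-sum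
      Y = proj₁ (proj₂ jacobi-sum)
      W = proj₁ (proj₂ (proj₂ jacobi-sum))
      properties = proj₂ (proj₂ (proj₂ jacobi-sum))
      nz-4 : Nz (+ 4)
      nz-4 = nz-* nz-2 nz-2
      ξ≡ : ξ ≡ + 2 * x
      ξ≡ = trace {ξ} {Y} (proj₁ properties) (proj₁ (proj₂ properties))
      -- Multiplying by q = (-1)ⁿ 4ⁿ rids W of `λ′` and supplies the fourth factor v needed for the
      -- fourth power.
      Wq : W * q ≈ + 2 * (c * (+ 1 + P * P * ω)) [ P³ ]
      Wq = ≈-cancel₃ {+ 4} nz-4 (≈-trans (≡⇒≈ (sym (ℤₚ.*-assoc (+ 4) W q))) (≈-trans (*-≈ʳ q (proj₁ (proj₂ (proj₂ properties)))) (≈-trans Br≈ (≡⇒≈ (lemma (c * (+ 1 + P * P * ω)))))))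
        where
        lemma : ∀ z → + 8 * z ≡ + 4 * (+ 2 * z)
        lemma = solve-∀
      nz-c : Nz c
      nz-c = nz-factorˡ {c} {a₀ * a₀} (subst Nz (sym c-relation) nz-b₀)
      nz-W : Nz W
      nz-W = nz-factorˡ {W} {q} (nz-≈ (≈-sym (≈-lower (≈-lower Wq))) (nz-* nz-2 (nz-* nz-c (subst Nz (cong (λ z → + 1 + z) (sym (ℤₚ.*-assoc P P ω))) (nz-1+P (P * ω))))))
      roots : Nz x × (+ 8 * (x * x * x) * W ≈ + 2 * (+ 16 * (x * x * x * x) - + 4 * (x * x) * P - P * P) [ P³ ])
      roots = unit-root pr {W} {x} nz-4 nz-W (≈-trans (≡⇒≈ (cong (λ z → W * (z - W)) (trans (lemma x) (cong (+ 2 *_) (sym ξ≡))))) (proj₂ (proj₂ (proj₂ properties))))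
        where
        lemma : ∀ x → + 4 * x ≡ + 2 * (+ 2 * x)
        lemma = solve-∀
      nx = proj₁ roots
      root = proj₂ roots
      ∏≈′ : ∏[16i²-R²] ≈ v * v * (a₀ * a₀) * (+ 1 + P * P * ω) [ P³ ]
      ∏≈′ = ≈-cancel₃ {+ 16} (nz-* nz-4 nz-4) ∏≈
      lemma₄ : ∀ v a w c → + 2 * (v * (v * v * (a * a) * w) * (c * (a * a))) ≡ v * v * v * (a * a * a * a) * (+ 2 * (c * w))
      lemma₄ = solve-∀
      lemma₅ : ∀ v a w s → v * v * v * (a * a * a * a) * (w * (s * v)) ≡ s * w * (v * a * (v * a) * (v * a) * (v * a))
      lemma₅ = solve-∀
      2K≈ : + 2 * K ≈ s * W * fourth fourth-root [ P³ ]
      2K≈ = begin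
        + 2 * (v * ∏[16i²-R²] * b₀)
          ≈⟨ *-≈ˡ (+ 2) (*-≈ (*-≈ˡ v ∏≈′) (≡⇒≈ (sym c-relation))) ⟩
        + 2 * (v * (v * v * (a₀ * a₀) * (+ 1 + P * P * ω)) * (c * (a₀ * a₀)))
          ≡⟨ lemma₄ v a₀ (+ 1 + P * P * ω) c ⟩
        v * v * v * (a₀ * a₀ * a₀ * a₀) * (+ 2 * (c * (+ 1 + P * P * ω)))
          ≈⟨ *-≈ˡ (v * v * v * (a₀ * a₀ * a₀ * a₀)) Wq ⟨
        v * v * v * (a₀ * a₀ * a₀ * a₀) * (W * (s * v))
          ≡⟨ lemma₅ v a₀ W s ⟩
        s * W * fourth fourth-root ∎
      lemma₁ : ∀ k z → + 2 * (k * z) ≡ z * (+ 2 * k)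
      lemma₁ = solve-∀
      lemma₂ : ∀ z s w f → z * (s * w * f) ≡ s * f * (z * w)
      lemma₂ = solve-∀
      lemma₃ : ∀ s f z → s * f * (+ 2 * z) ≡ + 2 * (s * z * f)
      lemma₃ = solve-∀

    full-sum-≈ : full-sum * (+ 8 * (x * x * x)) ≈ s * (+ 16 * (x * x * x * x) * P - + 4 * (x * x) * (P * P) - P * P * P) * ∏ (p ℕ.∸ 1) (fourth ∘ y′) [ P⁴ ]
    full-sum-≈ = begin
      full-sum * (+ 8 * (x * x * x))
        ≈⟨ *-≈ʳ (+ 8 * (x * x * x)) full-sum≈ ⟩
      closed * rest * (+ 8 * (x * x * x))
        ≡⟨ trans (cong (λ z → z * rest * (+ 8 * (x * x * x))) closed≡) (lemma₁ P K rest (+ 8 * (x * x * x))) ⟩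
      P * (K * (+ 8 * (x * x * x))) * rest
        ≈⟨ *-≈ʳ rest (P*-≈ (proj₂ main-congruence)) ⟩
      P * (s * (+ 16 * (x * x * x * x) - + 4 * (x * x) * P - P * P) * fourth fourth-root) * rest
        ≡⟨ lemma₂ P s (x * x * x * x) (x * x) (fourth fourth-root) rest ⟩
      s * (+ 16 * (x * x * x * x) * P - + 4 * (x * x) * (P * P) - P * P * P) * (fourth fourth-root * rest)
        ≡⟨ cong (s * (+ 16 * (x * x * x * x) * P - + 4 * (x * x) * (P * P) - P * P * P) *_) (trans (cong (_* rest) (sym ∏fourth)) (sym full-denominator)) ⟩
      s * (+ 16 * (x * x * x * x) * P - + 4 * (x * x) * (P * P) - P * P * P) * ∏ (p ℕ.∸ 1) (fourth ∘ y′) ∎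
      where
      open ≈-Reasoning P⁴
      rest = tail (p ℕ.∸ 1) (fourth ∘ y′) n
      lemma₁ : ∀ p k r z → p * k * r * z ≡ p * (k * z) * r
      lemma₁ = solve-∀
      lemma₂ : ∀ p s x y f r → p * (s * (+ 16 * x - + 4 * y * p - p * p) * f) * r ≡ s * (+ 16 * x * p - + 4 * y * (p * p) - p * p * p) * (f * r)
      lemma₂ = solve-∀

-- The two cases over the rationals

module Conclusion where

  open IntegerCongruences
  open SecondCase
  open RationalTransfer
  open FirstCase
  open import Data.Rational using (_+_; _*_; _-_; -_)

  pos-^ : ∀ a k → + (a ℕ.^ k) ≡ (+ a) ℤ.^ k
  pos-^ a zero    = refl
  pos-^ a (suc k) = trans (ℤₚ.pos-* a (a ℕ.^ k)) (cong (+ a ℤ.*_) (pos-^ a k))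

  ℤ→ℚ-sign : ∀ k → (- 1ℚ) ^ℚ k ≡ ℤ→ℚ ((ℤ.- + 1) ℤ.^ k)
  ℤ→ℚ-sign k = sym (ℤ→ℚ-^ (ℤ.- + 1) k)

  module _ {p : ℕ} (pr : Prime p) (3<p : 3 ℕ.< p) where
    open ModPrime pr

    private
      suc-p-1 : suc (p ℕ.∸ 1) ≡ p
      suc-p-1 = sym (ℕₚ.+-∸-assoc 1 {p} {1} (ℕₚ.<⇒≤ 1<p))

      nz-2 : Nz (+ 2)
      nz-2 = nz-small (s≤s z≤n) (ℕₚ.<-trans (s≤s (s≤s (s≤s z≤n))) 3<p)

      nz-ys : ∀ j → j ℕ.< p ℕ.∸ 1 → Nz (ys j)
      nz-ys j j<p-1 = subst Nz (lemma (+ j)) (nz-* (nz-* nz-2 nz-2) (nz-small {suc j} (s≤s z≤n) (subst (suc (suc j) ℕ.≤_) suc-p-1 (s≤s j<p-1))))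
        where
        lemma : ∀ j → + 4 ℤ.* (+ 1 ℤ.+ j) ≡ + 4 ℤ.* j ℤ.+ + 4
        lemma = solve-∀

      D : ℤ
      D = ∏ (p ℕ.∸ 1) (fourthℤ ∘ ys)

      nz-D : Nz D
      nz-D = nz-∏ (p ℕ.∸ 1) (λ j j<p-1 → nz-* (nz-* (nz-* (nz-ys j j<p-1) (nz-ys j j<p-1)) (nz-ys j j<p-1)) (nz-ys j j<p-1))

    -- Clears both denominators at once: D is a product of fourth powers of 4(j + 1) with j + 1 < p,
    -- hence prime to p.
    S-congruence : ∀ {r E Y} → Nz E → r * ℤ→ℚ E ≡ ℤ→ℚ Y →
      ∑ p (λ k → (+ 8 ℤ.* + k ℤ.+ + 1) ℤ.* (∏ k (fourthℤ ∘ zs) ℤ.* tail (p ℕ.∸ 1) (fourthℤ ∘ ys) k)) ℤ.* E ≈ Y ℤ.* D [ P⁴ ] →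
      Congr p (S p) r (ℕ→ℚ p ^ℚ 4)
    S-congruence {r} {E} {Y} nE rE h = congruence-of-quotients pr {S p} {r} {D} {integer-sum (p ℕ.∸ 1)} {E} {Y} nz-D nE
      (trans (cong (λ m → S m * ℤ→ℚ D) (sym suc-p-1)) (S-as-quotient (p ℕ.∸ 1))) rE
      (subst (λ m → ∑ m (λ k → (+ 8 ℤ.* + k ℤ.+ + 1) ℤ.* (∏ k (fourthℤ ∘ zs) ℤ.* tail (p ℕ.∸ 1) (fourthℤ ∘ ys) k)) ℤ.* E ≈ Y ℤ.* D [ P⁴ ]) (sym suc-p-1) h)

    first-case : p ℕ.% 4 ≡ 1 → (x y : ℤ) → + p ≡ x ℤ.* x ℤ.+ y ℤ.* y → (+ 4) ℤD.∣ (x ℤ.- + 1) →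
      Congr p (S p)
        (((- 1ℚ) ^ℚ ((p ℕ.∸ 1) ℕ./ 4)) *
          ((ℕ→ℚ 2 * ℤ→ℚ x * ℕ→ℚ p)
            - (ℕ→ℚ p ^ℚ 2) * inv (ℕ→ℚ 2 * ℤ→ℚ x)
            - (ℕ→ℚ p ^ℚ 3) * inv (ℕ→ℚ 8 * (ℤ→ℚ x ^ℚ 3))))
        (ℕ→ℚ p ^ℚ 4)
    first-case p%4 x y squares 4∣x-1 = S-congruence {E = E} {Y} nz-E quotient full-sum-≈
      where
      open ≡-Reasoning
      n : ℕ
      n = p ℕ./ 4
      p≡1+4n : p ≡ suc (n ℕ.* 4)
      p≡1+4n = trans (ℕDM.m≡m%n+[m/n]*n p 4) (cong (ℕ._+ n ℕ.* 4) p%4)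
      p≡ : p ≡ suc ((n ℕ.+ n) ℕ.+ (n ℕ.+ n))
      p≡ = trans p≡1+4n (cong suc (ℤₚ.+-injective (trans (ℤₚ.pos-* n 4) (lemma (+ n)))))
        where
        lemma : ∀ n → n ℤ.* + 4 ≡ (n ℤ.+ n) ℤ.+ (n ℤ.+ n)
        lemma = solve-∀
      exponent : (p ℕ.∸ 1) ℕ./ 4 ≡ n
      exponent = trans (cong (λ m → (m ℕ.∸ 1) ℕ./ 4) p≡1+4n) (ℕDM.m*n/n≡m n 4)
      x≈1 : x ≈ + 1 [ + 4 ]
      x≈1 with ℤDˢ.∣ᵤ⇒∣ {+ 4} {x ℤ.- + 1} 4∣x-1
      ... | ℤDˢ.divides q e = ≈-from-difference (mod-by q (trans e (trans (ℤₚ.*-comm q (+ 4)) (sym (ℤₚ.+-identityˡ (+ 4 ℤ.* q))))))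
      open Prime≡1 pr 3<p n p≡ x y squares x≈1 using (full-sum-≈; main-congruence)
      s E Y : ℤ
      s = (ℤ.- + 1) ℤ.^ n
      E = + 8 ℤ.* (x ℤ.* x ℤ.* x)
      Y = s ℤ.* (+ 16 ℤ.* (x ℤ.* x ℤ.* x ℤ.* x) ℤ.* P ℤ.- + 4 ℤ.* (x ℤ.* x) ℤ.* (P ℤ.* P) ℤ.- P ℤ.* P ℤ.* P)
      nz-x : Nz x
      nz-x = proj₁ main-congruence
      nz-E : Nz E
      nz-E = nz-* (nz-* nz-2 (nz-* nz-2 nz-2)) (nz-* (nz-* nz-x nz-x) nz-x)
      X Π σ t i₁ i₂ : ℚ
      X = ℤ→ℚ x
      Π = ℕ→ℚ p
      σ = ℤ→ℚ s
      t = ℕ→ℚ 2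
      i₁ = inv (t * X)
      i₂ = inv (ℕ→ℚ 8 * (X ^ℚ 3))
      i₁-inverse : i₁ * (t * X) ≡ 1ℚ
      i₁-inverse = inv-inverse (subst (_≢ 0ℚ) (ℤ→ℚ-* (+ 2) x) (nz⇒≢0 pr (nz-* nz-2 nz-x)))
      X³ : ℤ→ℚ (x ℤ.* x ℤ.* x) ≡ X * X * X
      X³ = trans (ℤ→ℚ-* (x ℤ.* x) x) (cong (_* X) (ℤ→ℚ-* x x))
      -- 8 is written as a power of t = 2 (and 16 likewise below), so that the ring identity `clear`
      -- sees how 2x and 8x³ are related.
      E≡ : ℤ→ℚ E ≡ t * t * t * (X * X * X)
      E≡ = trans (ℤ→ℚ-* (+ 8) (x ℤ.* x ℤ.* x)) (cong (ℕ→ℚ 8 *_) X³)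
      flatten : ∀ t X → t * t * t * (X * X * X) ≡ t * t * t * (X * (X * (X * 1ℚ)))
      flatten = RingSolver.solve-∀ ℚ-ring
      i₂-inverse : i₂ * (t * t * t * (X * (X * (X * 1ℚ)))) ≡ 1ℚ
      i₂-inverse = inv-inverse (subst (_≢ 0ℚ) (trans E≡ (flatten t X)) (nz⇒≢0 pr nz-E))
      Y≡ : ℤ→ℚ Y ≡ σ * (t * t * t * t * (X * X * X * X) * Π - t * t * (X * X) * (Π * Π) - Π * Π * Π)
      Y≡ = trans (ℤ→ℚ-* s (y₁ ℤ.- y₂ ℤ.- P ℤ.* P ℤ.* P)) (cong (σ *_) (trans (ℤ→ℚ-- (y₁ ℤ.- y₂) (P ℤ.* P ℤ.* P)) (cong₂ _-_ (trans (ℤ→ℚ-- y₁ y₂) (cong₂ _-_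
        (trans (ℤ→ℚ-* (+ 16 ℤ.* (x ℤ.* x ℤ.* x ℤ.* x)) P) (cong (_* Π) (trans (ℤ→ℚ-* (+ 16) (x ℤ.* x ℤ.* x ℤ.* x)) (cong (ℕ→ℚ 16 *_) (trans (ℤ→ℚ-* (x ℤ.* x ℤ.* x) x) (cong (_* X) X³))))))
        (trans (ℤ→ℚ-* (+ 4 ℤ.* (x ℤ.* x)) (P ℤ.* P)) (cong₂ _*_ (trans (ℤ→ℚ-* (+ 4) (x ℤ.* x)) (cong (ℕ→ℚ 4 *_) (ℤ→ℚ-* x x))) (ℤ→ℚ-* P P)))))
        (trans (ℤ→ℚ-* (P ℤ.* P) P) (cong (_* Π) (ℤ→ℚ-* P P))))))
        where
        y₁ y₂ : ℤ
        y₁ = + 16 ℤ.* (x ℤ.* x ℤ.* x ℤ.* x) ℤ.* P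
        y₂ = + 4 ℤ.* (x ℤ.* x) ℤ.* (P ℤ.* P)
      clear : ∀ σ t X Π i j → σ * (t * X * Π - Π * (Π * 1ℚ) * i - Π * (Π * (Π * 1ℚ)) * j) * (t * t * t * (X * X * X))
        ≡ σ * (t * t * t * t * (X * X * X * X) * Π - t * t * (X * X) * (Π * Π) * (i * (t * X)) - Π * Π * Π * (j * (t * t * t * (X * (X * (X * 1ℚ))))))
      clear = RingSolver.solve-∀ ℚ-ring
      quotient : ((- 1ℚ) ^ℚ ((p ℕ.∸ 1) ℕ./ 4)) * ((t * X * Π) - (Π ^ℚ 2) * i₁ - (Π ^ℚ 3) * i₂) * ℤ→ℚ E ≡ ℤ→ℚ Y
      quotient = begin
        ((- 1ℚ) ^ℚ ((p ℕ.∸ 1) ℕ./ 4)) * ((t * X * Π) - (Π ^ℚ 2) * i₁ - (Π ^ℚ 3) * i₂) * ℤ→ℚ E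
          ≡⟨ cong₂ (λ a b → a * ((t * X * Π) - (Π ^ℚ 2) * i₁ - (Π ^ℚ 3) * i₂) * b) (trans (cong ((- 1ℚ) ^ℚ_) exponent) (ℤ→ℚ-sign n)) E≡ ⟩
        σ * ((t * X * Π) - (Π ^ℚ 2) * i₁ - (Π ^ℚ 3) * i₂) * (t * t * t * (X * X * X))
          ≡⟨ clear σ t X Π i₁ i₂ ⟩
        σ * (t * t * t * t * (X * X * X * X) * Π - t * t * (X * X) * (Π * Π) * (i₁ * (t * X)) - Π * Π * Π * (i₂ * (t * t * t * (X * (X * (X * 1ℚ))))))
          ≡⟨ cong₂ (λ a b → σ * (t * t * t * t * (X * X * X * X) * Π - a - b)) (trans (cong (t * t * (X * X) * (Π * Π) *_) i₁-inverse) (ℚₚ.*-identityʳ (t * t * (X * X) * (Π * Π)))) (trans (cong (Π * Π * Π *_) i₂-inverse) (ℚₚ.*-identityʳ (Π * Π * Π))) ⟩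
        σ * (t * t * t * t * (X * X * X * X) * Π - t * t * (X * X) * (Π * Π) - Π * Π * Π)
          ≡⟨ sym Y≡ ⟩
        ℤ→ℚ Y ∎

    second-case : p ℕ.% 4 ≡ 3 →
      Congr p (S p)
        (ℕ→ℚ 3 * ((- 1ℚ) ^ℚ ((p ℕ.+ 1) ℕ./ 4))
          * ((ℕ→ℚ 2 * ℕ→ℚ p - 1ℚ - ℕ→ℚ (2 ℕ.^ (p ℕ.∸ 1))) * (ℕ→ℚ p ^ℚ 2))
          * inv (ℕ→ℚ (((p ℕ.∸ 1) ℕ./ 2) C ((p ℕ.∸ 3) ℕ./ 4))))
        (ℕ→ℚ p ^ℚ 4)
    second-case p%4 = S-congruence {E = Γ} {Y} nz-Γ quotient full-sum-≈
      where
      open ≡-Reasoning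
      m : ℕ
      m = p ℕ./ 4
      p≡3+4m : p ≡ 3 ℕ.+ m ℕ.* 4
      p≡3+4m = trans (ℕDM.m≡m%n+[m/n]*n p 4) (cong (ℕ._+ m ℕ.* 4) p%4)
      p≡ : p ≡ suc ((m ℕ.+ suc m) ℕ.+ (m ℕ.+ suc m))
      p≡ = trans p≡3+4m (cong suc (ℤₚ.+-injective (trans (cong (λ z → + 2 ℤ.+ z) (ℤₚ.pos-* m 4)) (lemma (+ m)))))
        where
        lemma : ∀ m → + 2 ℤ.+ m ℤ.* + 4 ≡ (m ℤ.+ (+ 1 ℤ.+ m)) ℤ.+ (m ℤ.+ (+ 1 ℤ.+ m))
        lemma = solve-∀
      open Prime≡3 pr 3<p m p≡ using (M; ε; w; Γ; Γ-relation; nz-b₀; full-sum-≈; a₀; s) renaming (X to Ω)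
      exponent : (p ℕ.+ 1) ℕ./ 4 ≡ suc m
      exponent = trans (cong (ℕ._/ 4) (trans (ℕₚ.+-comm p 1) (cong suc p≡3+4m))) (ℕDM.m*n/n≡m (suc m) 4)
      upper : (p ℕ.∸ 1) ℕ./ 2 ≡ M
      upper = trans (cong (λ k → (k ℕ.∸ 1) ℕ./ 2) p≡) (trans (cong (ℕ._/ 2) (trans (cong (M ℕ.+_) (sym (ℕₚ.+-identityʳ M))) (ℕₚ.*-comm 2 M))) (ℕDM.m*n/n≡m M 2))
      lower : (p ℕ.∸ 3) ℕ./ 4 ≡ m
      lower = trans (cong (λ k → (k ℕ.∸ 3) ℕ./ 4) p≡3+4m) (ℕDM.m*n/n≡m m 4)
      power : + (2 ℕ.^ (p ℕ.∸ 1)) ≡ w ℤ.* w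
      power = trans (pos-^ 2 (p ℕ.∸ 1)) (trans (cong (λ k → (+ 2) ℤ.^ (k ℕ.∸ 1)) p≡) (ℤₚ.^-distribˡ-+-* (+ 2) M M))
      nz-Γ : Nz Γ
      nz-Γ = nz-factorˡ {Γ} {a₀ ℤ.* (s ℤ.* a₀)} (subst Nz (sym Γ-relation) nz-b₀)
      Y : ℤ
      Y = + 3 ℤ.* (ε ℤ.* Ω) ℤ.* (P ℤ.* P)
      Π σ : ℚ
      Π = ℕ→ℚ p
      σ = ℤ→ℚ ε
      Y≡ : ℤ→ℚ Y ≡ ℕ→ℚ 3 * (σ * ℤ→ℚ Ω) * (Π * Π)
      Y≡ = trans (ℤ→ℚ-* (+ 3 ℤ.* (ε ℤ.* Ω)) (P ℤ.* P)) (cong₂ _*_ (trans (ℤ→ℚ-* (+ 3) (ε ℤ.* Ω)) (cong (ℕ→ℚ 3 *_) (ℤ→ℚ-* ε Ω))) (ℤ→ℚ-* P P))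
      Ω≡ : ℕ→ℚ 2 * Π - 1ℚ - ℕ→ℚ (2 ℕ.^ (p ℕ.∸ 1)) ≡ ℤ→ℚ Ω
      Ω≡ = sym (trans (ℤ→ℚ-- (+ 2 ℤ.* P ℤ.- + 1) (w ℤ.* w)) (cong₂ _-_ (trans (ℤ→ℚ-- (+ 2 ℤ.* P) (+ 1)) (cong (_- 1ℚ) (ℤ→ℚ-* (+ 2) P))) (cong ℤ→ℚ (sym power))))
      regroup : ∀ a b c p i g → a * b * (c * (p * (p * 1ℚ))) * i * g ≡ a * (b * c) * (p * p) * (i * g)
      regroup = RingSolver.solve-∀ ℚ-ring
      quotient : ℕ→ℚ 3 * ((- 1ℚ) ^ℚ ((p ℕ.+ 1) ℕ./ 4)) * ((ℕ→ℚ 2 * Π - 1ℚ - ℕ→ℚ (2 ℕ.^ (p ℕ.∸ 1))) * (Π ^ℚ 2))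
        * inv (ℕ→ℚ (((p ℕ.∸ 1) ℕ./ 2) C ((p ℕ.∸ 3) ℕ./ 4))) * ℤ→ℚ Γ ≡ ℤ→ℚ Y
      quotient = begin
        ℕ→ℚ 3 * ((- 1ℚ) ^ℚ ((p ℕ.+ 1) ℕ./ 4)) * ((ℕ→ℚ 2 * Π - 1ℚ - ℕ→ℚ (2 ℕ.^ (p ℕ.∸ 1))) * (Π ^ℚ 2)) * inv (ℕ→ℚ (((p ℕ.∸ 1) ℕ./ 2) C ((p ℕ.∸ 3) ℕ./ 4))) * ℤ→ℚ Γ
          ≡⟨ cong₂ (λ a b → ℕ→ℚ 3 * a * (b * (Π ^ℚ 2)) * inv (ℕ→ℚ (((p ℕ.∸ 1) ℕ./ 2) C ((p ℕ.∸ 3) ℕ./ 4))) * ℤ→ℚ Γ) (trans (cong ((- 1ℚ) ^ℚ_) exponent) (ℤ→ℚ-sign (suc m))) Ω≡ ⟩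
        ℕ→ℚ 3 * σ * (ℤ→ℚ Ω * (Π ^ℚ 2)) * inv (ℕ→ℚ (((p ℕ.∸ 1) ℕ./ 2) C ((p ℕ.∸ 3) ℕ./ 4))) * ℤ→ℚ Γ
          ≡⟨ cong₂ (λ a b → ℕ→ℚ 3 * σ * (ℤ→ℚ Ω * (Π ^ℚ 2)) * inv (ℕ→ℚ (a C b)) * ℤ→ℚ Γ) upper lower ⟩
        ℕ→ℚ 3 * σ * (ℤ→ℚ Ω * (Π ^ℚ 2)) * inv (ℤ→ℚ Γ) * ℤ→ℚ Γ
          ≡⟨ regroup (ℕ→ℚ 3) σ (ℤ→ℚ Ω) Π (inv (ℤ→ℚ Γ)) (ℤ→ℚ Γ) ⟩
        ℕ→ℚ 3 * (σ * ℤ→ℚ Ω) * (Π * Π) * (inv (ℤ→ℚ Γ) * ℤ→ℚ Γ)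
          ≡⟨ trans (cong (ℕ→ℚ 3 * (σ * ℤ→ℚ Ω) * (Π * Π) *_) (inv-inverse (nz⇒≢0 pr nz-Γ))) (ℚₚ.*-identityʳ (ℕ→ℚ 3 * (σ * ℤ→ℚ Ω) * (Π * Π))) ⟩
        ℕ→ℚ 3 * (σ * ℤ→ℚ Ω) * (Π * Π)
          ≡⟨ sym Y≡ ⟩
        ℤ→ℚ Y ∎

open import Data.Rational using (_+_; _*_; _-_; -_)

theorem5p3 : (p : ℕ) → Prime p → p > 3 →
    ((p % 4 ≡ 1) → (x y : ℤ) → + p ≡ x ℤ.* x ℤ.+ y ℤ.* y → (+ 4) ℤD.∣ (x ℤ.- + 1) →
      Congr p (S p)
        (((- ℚ.1ℚ) ^ℚ ((p ∸ 1) / 4)) *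
          ((ℕ→ℚ 2 * ℤ→ℚ x * ℕ→ℚ p)
            - (ℕ→ℚ p ^ℚ 2) * inv (ℕ→ℚ 2 * ℤ→ℚ x)
            - (ℕ→ℚ p ^ℚ 3) * inv (ℕ→ℚ 8 * (ℤ→ℚ x ^ℚ 3))))
        (ℕ→ℚ p ^ℚ 4))
    ×
    ((p % 4 ≡ 3) →
      Congr p (S p)
        (ℕ→ℚ 3 * ((- ℚ.1ℚ) ^ℚ ((p ℕ.+ 1) / 4))
          * ((ℕ→ℚ 2 * ℕ→ℚ p - ℚ.1ℚ - ℕ→ℚ (2 ℕ.^ (p ∸ 1))) * (ℕ→ℚ p ^ℚ 2))
          * inv (ℕ→ℚ (((p ∸ 1) / 2) C ((p ∸ 3) / 4))))
        (ℕ→ℚ p ^ℚ 4))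
theorem5p3 p pr 3<p = Conclusion.first-case pr 3<p , Conclusion.second-case pr 3<p
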